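{- Let $q\ge 7$ be an odd prime power, $\Sigma_\infty$ a hyperplane of $\mathrm{PG}(4,q)$, and let $\mathcal C$ be a set of $q^2$ affine points together with a set of affine planes ($\mathcal C$-planes) satisfying: (A1) each $\mathcal C$-plane meets $\mathcal C$ in a $q$-arc, and every plane meeting $\mathcal C$ in more than four points is a $\mathcal C$-plane; (A2) any two distinct points of $\mathcal C$ lie in exactly one $\mathcal C$-plane; (A3) each affine point is either in $\mathcal C$, or on no $\mathcal C$-plane, or on exactly two $\mathcal C$-planes. Let $\mathcal S=\{t_A: A\in\mathcal C\}\cup\{t_\infty\}$ and let $\mathcal S'$ be any spread of $\Sigma_\infty$ with $\mathcal S'\neq\mathcal S$. Then in the Bruck–Bose plane $\mathcal P(\mathcal S')$, the set of points corresponding to $\mathcal C$ is not an arc.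
   Context: Affine points/lines/planes are those not contained in $\Sigma_\infty$. A $k$-arc (arc) is a set of points of a plane, no three collinear. For a $\mathcal C$-plane $\pi$, the $q$-arc $\pi\cap\mathcal C$ lies ($q$ odd) in a unique conic $(\pi\cap\mathcal C)\cup\{\pi_\infty\}$ of $\pi$; $\pi_\infty$ is the $\infty$-point of $\pi$, and an $\infty$-point is the $\infty$-point of some $\mathcal C$-plane. The $\mathcal C$-line of $\pi$ is $\pi\cap\Sigma_\infty$; a $0$-point is a point of $\Sigma_\infty$ on no $\mathcal C$-line. The set of all $\infty$-points and $0$-points is a line $t_\infty$ of $\Sigma_\infty$. For $A\in\mathcal C$ and a $\mathcal C$-plane $\pi\ni A$, $A_\pi$ is the point where the tangent at $A$ in $\pi$ to the conic $(\pi\cap\mathcal C)\cup\{\pi_\infty\}$ meets $\Sigma_\infty$; $t_A$ is the set of the $q+1$ points $A_\pi$ over the $q+1$ $\mathcal C$-planes $\pi\ni A$; each $t_A$ is a line and $\mathcal S$ is a spread of $\Sigma_\infty$. A spread of $\Sigma_\infty\cong\mathrm{PG}(3,q)$ is a set of $q^2+1$ pairwise disjoint lines covering all points. For a spread $\mathcal S'$, the Bruck–Bose plane $\mathcal P(\mathcal S')$ has as affine points the affine points of $\mathrm{PG}(4,q)$, as affine lines the affine planes meeting $\Sigma_\infty$ in a line of $\mathcal S'$, and a line at infinity whose points are the elements of $\mathcal S'$. -}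

module Defs where

open import Level using (0ℓ)
open import Algebra.Bundles using (CommutativeRing)
open import Data.Nat as ℕ using (ℕ; suc; _^_)
open import Data.Nat.Primality using (Prime)
open import Data.Fin using (Fin; zero; suc)
open import Data.Product using (Σ; ∃; ∃₂; _×_; _,_)
open import Data.Sum using (_⊎_)
open import Relation.Nullary using (¬_)
open import Relation.Binary.PropositionalEquality as ≡ using (_≡_; _≢_)
open import Function.Bundles using (Inverse)
open import Function.Definitions using (Injective)

IsPrimePower : ℕ → Set
IsPrimePower q = ∃₂ λ p k → Prime p × q ≡ p ^ suc k

record IsFiniteField (R : CommutativeRing 0ℓ 0ℓ) (q : ℕ) : Set where
  open CommutativeRing R
  field
    0≉1     : ¬ (0# ≈ 1#)
    inverse : ∀ x → ¬ (x ≈ 0#) → ∃ λ y → x * y ≈ 1#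
    size    : Inverse setoid (≡.setoid (Fin q))

_⇔_ : Set → Set → Set
A ⇔ B = (A → B) × (B → A)

-- PG(4,q) over the field R (vectors of F^5, points = nonzero vectors up to
-- nonzero scalars); Σ∞ is the hyperplane { x | h·x = 0 }.
module Geometry (R : CommutativeRing 0ℓ 0ℓ) (q : ℕ) (h : Fin 5 → CommutativeRing.Carrier R) where
  open CommutativeRing R renaming (Carrier to K) hiding (zero)

  Vec5 : Set
  Vec5 = Fin 5 → K

  _≈v_ : Vec5 → Vec5 → Set
  u ≈v v = ∀ i → u i ≈ v i

  _·_ : K → Vec5 → Vec5
  (a · v) i = a * v i

  _⊕_ : Vec5 → Vec5 → Vec5
  (u ⊕ v) i = u i + v i

  0v : Vec5
  0v i = 0#

  NonZero : Vec5 → Set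
  NonZero v = ¬ (v ≈v 0v)

  _∼_ : Vec5 → Vec5 → Set
  u ∼ v = ∃ λ a → ¬ (a ≈ 0#) × (u ≈v (a · v))

  dot : Vec5 → Vec5 → K
  dot a v = a zero * v zero + a (suc zero) * v (suc zero) + a (suc (suc zero)) * v (suc (suc zero))
          + a (suc (suc (suc zero))) * v (suc (suc (suc zero)))
          + a (suc (suc (suc (suc zero)))) * v (suc (suc (suc (suc zero))))

  AtInf : Vec5 → Set
  AtInf x = dot h x ≈ 0#

  Affine : Vec5 → Set
  Affine x = ¬ AtInf x

  InSpan2 : Vec5 → Vec5 → Vec5 → Set
  InSpan2 x u v = ∃₂ λ a b → x ≈v ((a · u) ⊕ (b · v))

  InSpan3 : Vec5 → Vec5 → Vec5 → Vec5 → Set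
  InSpan3 x u v w = ∃₂ λ a b → ∃ λ c → x ≈v (((a · u) ⊕ (b · v)) ⊕ (c · w))

  Independent2 : Vec5 → Vec5 → Set
  Independent2 u v = ∀ a b → ((a · u) ⊕ (b · v)) ≈v 0v → a ≈ 0# × b ≈ 0#

  Independent3 : Vec5 → Vec5 → Vec5 → Set
  Independent3 u v w = ∀ a b c → (((a · u) ⊕ (b · v)) ⊕ (c · w)) ≈v 0v → a ≈ 0# × b ≈ 0# × c ≈ 0#

  Collinear3 : Vec5 → Vec5 → Vec5 → Set
  Collinear3 x y z = ∃₂ λ a b → ∃ λ c → ¬ (a ≈ 0# × b ≈ 0# × c ≈ 0#)
                       × (((a · x) ⊕ (b · y)) ⊕ (c · z)) ≈v 0v

  record Line : Set where
    field
      l₁ l₂ : Vec5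
      indep : Independent2 l₁ l₂

  OnLine : Line → Vec5 → Set
  OnLine ℓ x = NonZero x × InSpan2 x (Line.l₁ ℓ) (Line.l₂ ℓ)

  record Plane : Set where
    field
      p₁ p₂ p₃ : Vec5
      indep : Independent3 p₁ p₂ p₃

  OnPlane : Plane → Vec5 → Set
  OnPlane π x = NonZero x × InSpan3 x (Plane.p₁ π) (Plane.p₂ π) (Plane.p₃ π)

  SameSet : (Vec5 → Set) → (Vec5 → Set) → Set
  SameSet S T = ∀ x → NonZero x → S x ⇔ T x

  SamePlane : Plane → Plane → Set
  SamePlane π ρ = SameSet (OnPlane π) (OnPlane ρ)

  AffinePlane : Plane → Set
  AffinePlane π = ∃ λ x → OnPlane π x × Affine x

  HasExactly : {m : ℕ} → ℕ → (Fin m → Set) → Set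
  HasExactly {m} n P = ∃ λ (f : Fin n → Fin m) → Injective _≡_ _≡_ f × (∀ i → P i ⇔ (∃ λ k → f k ≡ i))

  -- nondegenerate conics of a plane π = ⟨u,v,w⟩ :
  -- Q(x,y,z) = a x² + b y² + c z² + d xy + e xz + f yz with nonzero
  -- determinant of the symmetric matrix [[2a,d,e],[d,2b,f],[e,f,2c]].
  record TernaryForm : Set where
    field
      a b c d e f : K

  evalForm : TernaryForm → K → K → K → K
  evalForm Q x y z = a * (x * x) + b * (y * y) + c * (z * z) + d * (x * y) + e * (x * z) + f * (y * z)
    where open TernaryForm Q

  two : K
  two = 1# + 1#

  discriminant : TernaryForm → K
  discriminant Q = (two * a) * ((two * b) * (two * c) - f * f)
                 - d * (d * (two * c) - f * e)
                 + e * (d * f - (two * b) * e)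
    where open TernaryForm Q

  OnConic : Plane → TernaryForm → Vec5 → Set
  OnConic π Q X = ∃₂ λ x y → ∃ λ z →
    X ∼ (((x · Plane.p₁ π) ⊕ (y · Plane.p₂ π)) ⊕ (z · Plane.p₃ π)) × evalForm Q x y z ≈ 0#

  IsConicOf : Plane → (Vec5 → Set) → Set
  IsConicOf π S = ∃ λ Q → ¬ (discriminant Q ≈ 0#) × SameSet S (OnConic π Q)

  module Config (C : Fin (q ℕ.* q) → Vec5) (CPlane : Plane → Set) where

    InPlaneC : Plane → Fin (q ℕ.* q) → Set
    InPlaneC π i = OnPlane π (C i)

    ArcPlus : Plane → Vec5 → Vec5 → Set
    ArcPlus π X Y = (∃ λ i → InPlaneC π i × Y ∼ C i) ⊎ Y ∼ X

    IsInfPointOf : Plane → Vec5 → Set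
    IsInfPointOf π X = NonZero X × OnPlane π X × (∀ i → InPlaneC π i → ¬ (X ∼ C i))
                       × IsConicOf π (ArcPlus π X)

    -- Y = A_π for A = C i : the tangent at A in π to the conic
    -- (π∩𝒞) ∪ {π∞} meets Σ∞ in Y
    IsAπ : Fin (q ℕ.* q) → Plane → Vec5 → Set
    IsAπ i π Y = CPlane π × InPlaneC π i × OnPlane π Y × AtInf Y
                 × ∃ λ X → IsInfPointOf π X
                   × (∀ Z → NonZero Z → InSpan2 Z (C i) Y → ArcPlus π X Z → Z ∼ C i)

    tA : Fin (q ℕ.* q) → Vec5 → Set
    tA i Y = ∃ λ π → IsAπ i π Y

    InfinityPoint : Vec5 → Set
    InfinityPoint Y = ∃ λ π → CPlane π × IsInfPointOf π Y

    ZeroPoint : Vec5 → Set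
    ZeroPoint Y = AtInf Y × (∀ π → CPlane π → ¬ OnPlane π Y)

    t∞ : Vec5 → Set
    t∞ Y = InfinityPoint Y ⊎ ZeroPoint Y

    In𝒮 : (Vec5 → Set) → Set
    In𝒮 T = (∃ λ i → SameSet T (tA i)) ⊎ SameSet T t∞

    record Hypotheses : Set where
      field
        C-nonzero  : ∀ i → NonZero (C i)
        C-affine   : ∀ i → Affine (C i)
        C-distinct : ∀ i j → C i ∼ C j → i ≡ j
        CPlane-affine : ∀ π → CPlane π → AffinePlane π
        CPlane-resp   : ∀ π ρ → SamePlane π ρ → CPlane π → CPlane ρ
        A1-arc   : ∀ π → CPlane π → HasExactly q (InPlaneC π)
                   × (∀ i j k → i ≢ j → i ≢ k → j ≢ k → InPlaneC π i → InPlaneC π j → InPlaneC π k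
                      → ¬ Collinear3 (C i) (C j) (C k))
        A1-five  : ∀ π → (∃ λ (f : Fin 5 → Fin (q ℕ.* q)) → Injective _≡_ _≡_ f × (∀ k → InPlaneC π (f k)))
                   → CPlane π
        A2       : ∀ i j → i ≢ j → ∃ λ π → CPlane π × InPlaneC π i × InPlaneC π j
                   × (∀ ρ → CPlane ρ → InPlaneC ρ i → InPlaneC ρ j → SamePlane ρ π)
        A3       : ∀ x → NonZero x → Affine x →
                   (∃ λ i → x ∼ C i)
                   ⊎ (∀ π → CPlane π → ¬ OnPlane π x)
                   ⊎ (∃₂ λ π₁ π₂ → CPlane π₁ × CPlane π₂ × ¬ SamePlane π₁ π₂
                        × OnPlane π₁ x × OnPlane π₂ x
                        × (∀ ρ → CPlane ρ → OnPlane ρ x → SamePlane ρ π₁ ⊎ SamePlane ρ π₂))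

  record Spread : Set where
    field
      line     : Fin (suc (q ℕ.* q)) → Line
      inΣ∞     : ∀ k x → OnLine (line k) x → AtInf x
      disjoint : ∀ k l → k ≢ l → ∀ x → OnLine (line k) x → ¬ OnLine (line l) x
      cover    : ∀ x → NonZero x → AtInf x → ∃ λ k → OnLine (line k) x

  module _ (C : Fin (q ℕ.* q) → Vec5) (CPlane : Plane → Set) (S' : Spread) where
    open Config C CPlane
    open Spread S'

    SpreadEq𝒮 : Set
    SpreadEq𝒮 = (∀ k → In𝒮 (OnLine (line k)))
              × (∀ i → ∃ λ k → SameSet (OnLine (line k)) (tA i))
              × (∃ λ k → SameSet (OnLine (line k)) t∞)

    BBLine : Plane → Set
    BBLine π = AffinePlane π × ∃ λ k → SameSet (λ x → OnPlane π x × AtInf x) (OnLine (line k))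

    -- the points of 𝒞 form an arc of 𝒫(𝒮') (𝒞 is affine, so only affine
    -- lines of 𝒫(𝒮') can contain points of 𝒞)
    IsArcBB : Set
    IsArcBB = ∀ i j k → i ≢ j → i ≢ k → j ≢ k →
              ¬ (∃ λ π → BBLine π × InPlaneC π i × InPlaneC π j × InPlaneC π k)

module Submission where

-- Any two 𝒞-planes through a point of 𝒞 lie in no common solid and counting shows that
-- every 𝒞-plane π has one direction N at infinity such that each affine point y of π off 𝒞
-- lies, together with y + N, in a second 𝒞-plane. This splits the 𝒞-planes into parallel
-- classes, two of which coordinatise 𝒞 as P + x e₁ + y e₂ + x y f + φ(x , y) N; comparing with
-- a third class makes φ quadratic, so that 𝒞 = { P + x e₁ + y e₂ + x y f + (α x² + γ y²) N }.
-- In these coordinates t∞ is spanned by f and N, and t_A is spanned by the tangent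
-- directions at A. If 𝒞 is an arc of 𝒫(𝒮′), a line of 𝒮′ disjoint from t∞ carries the
-- midpoints of the chords with direction on it; three such chords through a common point
-- would put three points of 𝒞 on one line of 𝒫(𝒮′), so all these midpoints coincide and the
-- line is some t_A. A pigeonhole argument at two points then forces t∞ ∈ 𝒮′, whence 𝒮′ = 𝒮.

open import Defs
open import Level using (0ℓ)
open import Algebra.Bundles using (CommutativeRing)
import Algebra.Properties.AbelianGroup as AbelianGroupProps
import Algebra.Properties.CommutativeMonoid.Sum as Sum
import Algebra.Properties.CommutativeSemigroup as CommSemigroupProps
import Algebra.Properties.Ring as RingProps
import Algebra.Properties.Semiring.Mult as SemiringMult
import Algebra.Properties.Semiring.Sum as SemiringSum
open import Data.Bool using (Bool; true; false; T; if_then_else_; _∧_)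
open import Data.Empty using (⊥; ⊥-elim)
open import Data.Fin as Fin using (Fin; zero; suc; punchIn; punchOut; combine; remQuot)
open import Data.Fin.Permutation using (Permutation′; permutation; _⟨$⟩ʳ_)
import Data.Fin.Properties as Finₚ
open import Data.List using (List; []; _∷_; foldr)
open import Data.List.Properties using (≡-dec)
open import Data.Nat as ℕ using (ℕ; suc; zero; _≡ᵇ_; _<ᵇ_)
open import Data.Nat.Divisibility using (_∣_; divides)
import Data.Nat.Properties as ℕₚ
open import Data.Product using (Σ; ∃; ∃₂; _×_; _,_; proj₁; proj₂)
open import Data.Sum using (_⊎_; inj₁; inj₂)
open import Data.Sum.Function.Propositional using (_⊎-↔_)
open import Data.Unit using (⊤; tt)
open import Data.Vec using (Vec; []; _∷_; lookup)
open import Data.Vec.Functional using (insertAt)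
open import Data.Vec.Functional.Properties using (insertAt-lookup; insertAt-punchIn)
open import Data.Vec.Relation.Unary.All using (All; []; _∷_)
open import Function using (_∘_; id; _↔_; Inverse; Injective)
open import Function.Construct.Composition using (_↔-∘_)
open import Function.Construct.Identity using (↔-id)
open import Relation.Binary.Definitions using (tri<; tri≈; tri>)
open import Relation.Binary.PropositionalEquality as ≡ using (_≡_; _≢_)
import Relation.Binary.Reasoning.Setoid as SetoidReasoning
open import Relation.Nullary using (¬_; Dec; yes; no)
import Relation.Nullary.Decidable as Dec
open import Relation.Nullary.Decidable using (_×-dec_; _⊎-dec_; ¬?)

data Expr : Set where
  zeroᵉ oneᵉ : Expr
  varᵉ : ℕ → Expr
  addᵉ mulᵉ : Expr → Expr → Expr
  negᵉ : Expr → Expr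

module RingTactic (R : CommutativeRing 0ℓ 0ℓ) where
  open CommutativeRing R renaming (Carrier to K) hiding (zero)
  open SemiringMult semiring using (×-homo-+; ×1-homo-*) renaming (_×_ to _×′_)
  open RingProps ring using (-‿distribˡ-*; -‿distribʳ-*; -‿involutive; -0#≈0#)
  open AbelianGroupProps +-abelianGroup using (⁻¹-∙-comm)
  open CommSemigroupProps +-commutativeSemigroup using (interchange; x∙yz≈y∙xz)
  open CommSemigroupProps *-commutativeSemigroup using () renaming (interchange to *-interchange; x∙yz≈y∙xz to *-swap)
  open SetoidReasoning setoid

  -- Integer coefficients are formal differences of naturals, monomials are
  -- sorted lists of variables, and polynomials are sorted lists of terms.
  Monomial = List ℕ
  Poly = List ((ℕ × ℕ) × Monomial)

  difference : ℕ × ℕ → K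
  difference (m , n) = m ×′ 1# + - (n ×′ 1#)

  difference-+ : ∀ x y z w → (x + y) + - (z + w) ≈ (x + - z) + (y + - w)
  difference-+ x y z w = trans (+-congˡ (sym (⁻¹-∙-comm z w))) (interchange x y (- z) (- w))

  difference-* : ∀ x y z w → (x * y + z * w) + - (x * w + z * y) ≈ (x + - z) * (y + - w)
  difference-* x y z w = begin
    (x * y + z * w) + - (x * w + z * y)       ≈⟨ difference-+ _ _ _ _ ⟩
    (x * y + - (x * w)) + (z * w + - (z * y)) ≈⟨ +-cong (+-congˡ (-‿distribʳ-* x w)) (+-comm _ _) ⟩
    (x * y + x * - w) + (- (z * y) + z * w)   ≈⟨ +-cong (sym (distribˡ x y (- w))) (+-cong (-‿distribˡ-* z y) (sym (-‿involutive _))) ⟩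
    x * (y + - w) + (- z * y + - - (z * w))   ≈⟨ +-congˡ (+-congˡ (-‿cong (-‿distribˡ-* z w))) ⟩
    x * (y + - w) + (- z * y + - (- z * w))   ≈⟨ +-congˡ (+-congˡ (-‿distribʳ-* (- z) w)) ⟩
    x * (y + - w) + (- z * y + - z * - w)     ≈⟨ +-congˡ (sym (distribˡ (- z) y (- w))) ⟩
    x * (y + - w) + - z * (y + - w)           ≈⟨ sym (distribʳ (y + - w) x (- z)) ⟩
    (x + - z) * (y + - w) ∎

  _+c_ _*c_ : ℕ × ℕ → ℕ × ℕ → ℕ × ℕ
  (a , b) +c (c , d) = a ℕ.+ c , b ℕ.+ d
  (a , b) *c (c , d) = a ℕ.* c ℕ.+ b ℕ.* d , a ℕ.* d ℕ.+ b ℕ.* c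

  -c_ : ℕ × ℕ → ℕ × ℕ
  -c (a , b) = b , a

  +c-homo : ∀ c d → difference (c +c d) ≈ difference c + difference d
  +c-homo (a , b) (c , d) = trans
    (+-cong (×-homo-+ 1# a c) (-‿cong (×-homo-+ 1# b d))) (difference-+ _ _ _ _)

  *c-homo : ∀ c d → difference (c *c d) ≈ difference c * difference d
  *c-homo (a , b) (c , d) = trans
    (+-cong (trans (×-homo-+ 1# (a ℕ.* c) (b ℕ.* d)) (+-cong (×1-homo-* a c) (×1-homo-* b d)))
            (-‿cong (trans (×-homo-+ 1# (a ℕ.* d) (b ℕ.* c)) (+-cong (×1-homo-* a d) (×1-homo-* b c)))))
    (difference-* _ _ _ _)

  -c-homo : ∀ c → difference (-c c) ≈ - difference c
  -c-homo (a , b) = trans (+-comm _ _)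
    (trans (+-congˡ (sym (-‿involutive _))) (⁻¹-∙-comm (a ×′ 1#) (- (b ×′ 1#))))

  insert : ℕ → Monomial → Monomial
  insert i [] = i ∷ []
  insert i (j ∷ m) = if i <ᵇ j then i ∷ j ∷ m else j ∷ insert i m

  _≺_ : Monomial → Monomial → Bool
  [] ≺ _ = true
  (_ ∷ _) ≺ [] = false
  (i ∷ m) ≺ (j ∷ n) = if i <ᵇ j then true else (if i ≡ᵇ j then m ≺ n else false)

  addTerm : (ℕ × ℕ) × Monomial → Poly → Poly
  addTerm t [] = t ∷ []
  addTerm (c , m) ((d , n) ∷ p) with ≡-dec ℕ._≟_ m n
  ... | yes _ = (c +c d , n) ∷ p
  ... | no _ = if m ≺ n then (c , m) ∷ (d , n) ∷ p else (d , n) ∷ addTerm (c , m) p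

  addPoly : Poly → Poly → Poly
  addPoly p r = foldr addTerm r p

  mulTerm : (ℕ × ℕ) × Monomial → Poly → Poly → Poly
  mulTerm t [] acc = acc
  mulTerm (c , m) ((d , n) ∷ p) acc = addTerm (c *c d , foldr insert n m) (mulTerm (c , m) p acc)

  mulPoly : Poly → Poly → Poly
  mulPoly [] r = []
  mulPoly (t ∷ p) r = mulTerm t r (mulPoly p r)

  negPoly : Poly → Poly
  negPoly [] = []
  negPoly ((c , m) ∷ p) = (-c c , m) ∷ negPoly p

  normalise : Expr → Poly
  normalise zeroᵉ = []
  normalise oneᵉ = ((1 , 0) , []) ∷ []
  normalise (varᵉ i) = ((1 , 0) , i ∷ []) ∷ []
  normalise (addᵉ e f) = addPoly (normalise e) (normalise f)
  normalise (mulᵉ e f) = mulPoly (normalise e) (normalise f)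
  normalise (negᵉ e) = negPoly (normalise e)

  vanishes : Poly → Bool
  vanishes [] = true
  vanishes (((a , b) , m) ∷ p) = (a ≡ᵇ b) ∧ vanishes p

  nth : List K → ℕ → K
  nth [] _ = 0#
  nth (x ∷ ρ) zero = x
  nth (x ∷ ρ) (suc i) = nth ρ i

  ⟦_⟧ : Expr → List K → K
  ⟦ zeroᵉ ⟧ ρ = 0#
  ⟦ oneᵉ ⟧ ρ = 1#
  ⟦ varᵉ i ⟧ ρ = nth ρ i
  ⟦ addᵉ e f ⟧ ρ = ⟦ e ⟧ ρ + ⟦ f ⟧ ρ
  ⟦ mulᵉ e f ⟧ ρ = ⟦ e ⟧ ρ * ⟦ f ⟧ ρ
  ⟦ negᵉ e ⟧ ρ = - ⟦ e ⟧ ρ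

  module Soundness (ρ : List K) where
    ⟦_⟧m : Monomial → K
    ⟦ [] ⟧m = 1#
    ⟦ i ∷ m ⟧m = nth ρ i * ⟦ m ⟧m

    ⟦_⟧t : (ℕ × ℕ) × Monomial → K
    ⟦ c , m ⟧t = difference c * ⟦ m ⟧m

    ⟦_⟧p : Poly → K
    ⟦ [] ⟧p = 0#
    ⟦ t ∷ p ⟧p = ⟦ t ⟧t + ⟦ p ⟧p

    insert-sound : ∀ i m → ⟦ insert i m ⟧m ≈ nth ρ i * ⟦ m ⟧m
    insert-sound i [] = refl
    insert-sound i (j ∷ m) with i <ᵇ j
    ... | true = refl
    ... | false = trans (*-congˡ (insert-sound i m)) (*-swap _ _ _)

    merge-sound : ∀ m n → ⟦ foldr insert n m ⟧m ≈ ⟦ m ⟧m * ⟦ n ⟧m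
    merge-sound [] n = sym (*-identityˡ _)
    merge-sound (i ∷ m) n = trans (insert-sound i (foldr insert n m))
      (trans (*-congˡ (merge-sound m n)) (sym (*-assoc _ _ _)))

    addTerm-sound : ∀ t p → ⟦ addTerm t p ⟧p ≈ ⟦ t ⟧t + ⟦ p ⟧p
    addTerm-sound t [] = refl
    addTerm-sound (c , m) ((d , n) ∷ p) with ≡-dec ℕ._≟_ m n
    ... | yes ≡.refl = trans (+-congʳ (trans (*-congʳ (+c-homo c d)) (distribʳ _ _ _))) (+-assoc _ _ _)
    ... | no _ with m ≺ n
    ... | true = refl
    ... | false = trans (+-congˡ (addTerm-sound (c , m) p)) (x∙yz≈y∙xz _ _ _)

    addPoly-sound : ∀ p r → ⟦ addPoly p r ⟧p ≈ ⟦ p ⟧p + ⟦ r ⟧p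
    addPoly-sound [] r = sym (+-identityˡ _)
    addPoly-sound (t ∷ p) r = trans (addTerm-sound t (addPoly p r))
      (trans (+-congˡ (addPoly-sound p r)) (sym (+-assoc _ _ _)))

    mulTerm-sound : ∀ t p acc → ⟦ mulTerm t p acc ⟧p ≈ ⟦ t ⟧t * ⟦ p ⟧p + ⟦ acc ⟧p
    mulTerm-sound t [] acc = sym (trans (+-congʳ (zeroʳ _)) (+-identityˡ _))
    mulTerm-sound (c , m) ((d , n) ∷ p) acc = begin
      ⟦ addTerm (c *c d , foldr insert n m) (mulTerm (c , m) p acc) ⟧p
        ≈⟨ addTerm-sound (c *c d , foldr insert n m) (mulTerm (c , m) p acc) ⟩
      ⟦ c *c d , foldr insert n m ⟧t + ⟦ mulTerm (c , m) p acc ⟧p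
        ≈⟨ +-cong (trans (*-cong (*c-homo c d) (merge-sound m n)) (*-interchange _ _ _ _)) (mulTerm-sound (c , m) p acc) ⟩
      ⟦ c , m ⟧t * ⟦ d , n ⟧t + (⟦ c , m ⟧t * ⟦ p ⟧p + ⟦ acc ⟧p)
        ≈⟨ sym (+-assoc _ _ _) ⟩
      (⟦ c , m ⟧t * ⟦ d , n ⟧t + ⟦ c , m ⟧t * ⟦ p ⟧p) + ⟦ acc ⟧p
        ≈⟨ +-congʳ (sym (distribˡ _ _ _)) ⟩
      ⟦ c , m ⟧t * (⟦ d , n ⟧t + ⟦ p ⟧p) + ⟦ acc ⟧p ∎

    mulPoly-sound : ∀ p r → ⟦ mulPoly p r ⟧p ≈ ⟦ p ⟧p * ⟦ r ⟧p
    mulPoly-sound [] r = sym (zeroˡ _)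
    mulPoly-sound (t ∷ p) r = trans (mulTerm-sound t r (mulPoly p r))
      (trans (+-congˡ (mulPoly-sound p r)) (sym (distribʳ _ _ _)))

    negPoly-sound : ∀ p → ⟦ negPoly p ⟧p ≈ - ⟦ p ⟧p
    negPoly-sound [] = sym -0#≈0#
    negPoly-sound ((c , m) ∷ p) = trans
      (+-cong (trans (*-congʳ (-c-homo c)) (sym (-‿distribˡ-* _ _))) (negPoly-sound p)) (⁻¹-∙-comm _ _)

    one-sound : difference (1 , 0) ≈ 1#
    one-sound = trans (+-congˡ -0#≈0#) (trans (+-identityʳ _) (+-identityʳ _))

    normalise-sound : ∀ e → ⟦ normalise e ⟧p ≈ ⟦ e ⟧ ρ
    normalise-sound zeroᵉ = refl
    normalise-sound oneᵉ = trans (+-identityʳ _) (trans (*-identityʳ _) one-sound)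
    normalise-sound (varᵉ i) = trans (+-identityʳ _) (trans (*-cong one-sound (*-identityʳ _)) (*-identityˡ _))
    normalise-sound (addᵉ e f) = trans (addPoly-sound (normalise e) (normalise f)) (+-cong (normalise-sound e) (normalise-sound f))
    normalise-sound (mulᵉ e f) = trans (mulPoly-sound (normalise e) (normalise f)) (*-cong (normalise-sound e) (normalise-sound f))
    normalise-sound (negᵉ e) = trans (negPoly-sound (normalise e)) (-‿cong (normalise-sound e))

    vanishes-sound : ∀ p → T (vanishes p) → ⟦ p ⟧p ≈ 0#
    vanishes-sound [] _ = refl
    vanishes-sound (((a , b) , m) ∷ p) t with a ≡ᵇ b in eq
    ... | true with ≡.refl ← ℕₚ.≡ᵇ⇒≡ a b (≡.subst T (≡.sym eq) tt) =
      trans (+-cong (trans (*-congʳ (-‿inverseʳ _)) (zeroˡ _)) (vanishes-sound p t)) (+-identityˡ _)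

    identity : ∀ e f → T (vanishes (normalise (addᵉ e (negᵉ f)))) → ⟦ e ⟧ ρ ≈ ⟦ f ⟧ ρ
    identity e f t = begin
      ⟦ e ⟧ ρ                              ≈⟨ sym (+-identityʳ _) ⟩
      ⟦ e ⟧ ρ + 0#                         ≈⟨ +-congˡ (sym (-‿inverseˡ _)) ⟩
      ⟦ e ⟧ ρ + (- ⟦ f ⟧ ρ + ⟦ f ⟧ ρ)      ≈⟨ sym (+-assoc _ _ _) ⟩
      (⟦ e ⟧ ρ + - ⟦ f ⟧ ρ) + ⟦ f ⟧ ρ      ≈⟨ +-congʳ (trans (sym (normalise-sound (addᵉ e (negᵉ f)))) (vanishes-sound (normalise (addᵉ e (negᵉ f))) t)) ⟩
      0# + ⟦ f ⟧ ρ                         ≈⟨ +-identityˡ _ ⟩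
      ⟦ f ⟧ ρ ∎

  -- Instance search over Reify reads an expression off a ring element whose
  -- atoms are the entries of ρ.
  record Reify (ρ : List K) (x : K) : Set where
    constructor reified
    field
      expr  : Expr
      sound : ⟦ expr ⟧ ρ ≈ x

  open Reify

  instance
    reify-+ : ∀ {ρ x y} {{_ : Reify ρ x}} {{_ : Reify ρ y}} → Reify ρ (x + y)
    reify-+ {{rx}} {{ry}} = reified (addᵉ (expr rx) (expr ry)) (+-cong (sound rx) (sound ry))

    reify-* : ∀ {ρ x y} {{_ : Reify ρ x}} {{_ : Reify ρ y}} → Reify ρ (x * y)
    reify-* {{rx}} {{ry}} = reified (mulᵉ (expr rx) (expr ry)) (*-cong (sound rx) (sound ry))

    reify-neg : ∀ {ρ x} {{_ : Reify ρ x}} → Reify ρ (- x)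
    reify-neg {{rx}} = reified (negᵉ (expr rx)) (-‿cong (sound rx))

    reify-0 : ∀ {ρ} → Reify ρ 0#
    reify-0 = reified zeroᵉ refl

    reify-1 : ∀ {ρ} → Reify ρ 1#
    reify-1 = reified oneᵉ refl

  -- Under f : Atoms ρ ρ T, instance search sees the entries of ρ as local instances.
  Atoms : List K → List K → Set → Set
  Atoms ρ [] T = T
  Atoms ρ (x ∷ xs) T = {{_ : Reify ρ x}} → Atoms ρ xs T

  supply : ∀ {T} ρ xs n → (∀ i → nth ρ (n ℕ.+ i) ≡ nth xs i) → Atoms ρ xs T → T
  supply ρ [] n e f = f
  supply ρ (x ∷ xs) n e f = supply ρ xs (suc n) (λ i → ≡.trans (≡.cong (nth ρ) (≡.sym (ℕₚ.+-suc n i))) (e (suc i)))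
    (f {{reified (varᵉ n) (reflexive (≡.trans (≡.cong (nth ρ) (≡.sym (ℕₚ.+-identityʳ n))) (e 0)))}})

  reify : ∀ {x} ρ → Atoms ρ ρ (Reify ρ x) → Reify ρ x
  reify ρ = supply ρ ρ 0 (λ _ → ≡.refl)

  ring! : ∀ ρ {x y} {{f : Atoms ρ ρ (Reify ρ x)}} {{g : Atoms ρ ρ (Reify ρ y)}} →
          {T (vanishes (normalise (addᵉ (expr (reify ρ f)) (negᵉ (expr (reify ρ g))))))} → x ≈ y
  ring! ρ {{f}} {{g}} {t} = trans (sym (sound (reify ρ f)))
    (trans (Soundness.identity ρ (expr (reify ρ f)) (expr (reify ρ g)) t) (sound (reify ρ g)))

  cancel : ∀ {a b c d} → a + c ≈ b + d → c ≈ d → a ≈ b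
  cancel {a} {b} {c} {d} e f = begin
    a             ≈⟨ ring! (a ∷ c ∷ []) ⟩
    (a + c) + - c ≈⟨ +-cong e (-‿cong f) ⟩
    (b + d) + - d ≈⟨ ring! (b ∷ d ∷ []) ⟩
    b ∎

  -- a ≈ b from a linear combination of the hypotheses lᵢ ≈ rᵢ, with the
  -- combination moved to both sides so that what remains is a ring identity.
  lc₁ : ∀ {a b l₁ r₁} c₁ → l₁ ≈ r₁ → a + c₁ * r₁ ≈ b + c₁ * l₁ → a ≈ b
  lc₁ c₁ e₁ f = cancel f (*-congˡ (sym e₁))

  lc₂ : ∀ {a b l₁ r₁ l₂ r₂} c₁ → l₁ ≈ r₁ → ∀ c₂ → l₂ ≈ r₂ →
        a + (c₁ * r₁ + c₂ * r₂) ≈ b + (c₁ * l₁ + c₂ * l₂) → a ≈ b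
  lc₂ c₁ e₁ c₂ e₂ f = cancel f (+-cong (*-congˡ (sym e₁)) (*-congˡ (sym e₂)))

  lc₃ : ∀ {a b l₁ r₁ l₂ r₂ l₃ r₃} c₁ → l₁ ≈ r₁ → ∀ c₂ → l₂ ≈ r₂ → ∀ c₃ → l₃ ≈ r₃ →
        a + (c₁ * r₁ + (c₂ * r₂ + c₃ * r₃)) ≈ b + (c₁ * l₁ + (c₂ * l₂ + c₃ * l₃)) → a ≈ b
  lc₃ c₁ e₁ c₂ e₂ c₃ e₃ f =
    cancel f (+-cong (*-congˡ (sym e₁)) (+-cong (*-congˡ (sym e₂)) (*-congˡ (sym e₃))))

  lc₄ : ∀ {a b l₁ r₁ l₂ r₂ l₃ r₃ l₄ r₄} c₁ → l₁ ≈ r₁ → ∀ c₂ → l₂ ≈ r₂ → ∀ c₃ → l₃ ≈ r₃ → ∀ c₄ → l₄ ≈ r₄ →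
        a + (c₁ * r₁ + (c₂ * r₂ + (c₃ * r₃ + c₄ * r₄))) ≈ b + (c₁ * l₁ + (c₂ * l₂ + (c₃ * l₃ + c₄ * l₄))) → a ≈ b
  lc₄ c₁ e₁ c₂ e₂ c₃ e₃ c₄ e₄ f =
    cancel f (+-cong (*-congˡ (sym e₁)) (+-cong (*-congˡ (sym e₂)) (+-cong (*-congˡ (sym e₃)) (*-congˡ (sym e₄)))))

to-injective : ∀ {A B : Set} (e : A ↔ B) {x y} → Inverse.to e x ≡ Inverse.to e y → x ≡ y
to-injective e p = ≡.trans (≡.sym (Inverse.strictlyInverseʳ e _))
                           (≡.trans (≡.cong (Inverse.from e) p) (Inverse.strictlyInverseʳ e _))

from-injective : ∀ {A B : Set} (e : A ↔ B) {x y} → Inverse.from e x ≡ Inverse.from e y → x ≡ y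
from-injective e p = ≡.trans (≡.sym (Inverse.strictlyInverseˡ e _))
                             (≡.trans (≡.cong (Inverse.to e) p) (Inverse.strictlyInverseˡ e _))

abstract
  cover : ∀ {n m} {X Y : Set} → Fin n ↔ X → Fin m ↔ Y → (B : X → Y → Set) →
          (∀ x → ∃ (B x)) → (∀ {x x′} y → B x y → B x′ y → x ≡ x′) → n ℕ.≤ m
  cover {n} {m} eX eY B total unique = Finₚ.injective⇒≤ {f = f} f-injective
    where
    f : Fin n → Fin m
    f = λ t → Inverse.from eY (proj₁ (total (Inverse.to eX t)))
    f-injective : Injective _≡_ _≡_ f
    f-injective {s} {t} p = to-injective eX (unique _ (proj₂ (total _))
      (≡.subst (B _) (≡.sym (from-injective eY p)) (proj₂ (total _))))

  search : ∀ {n} {X : Set} → Fin n ↔ X → {P : X → Set} → (∀ x → Dec (P x)) → Dec (∃ P)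
  search e {P} P? with Finₚ.any? (λ t → P? (Inverse.to e t))
  ... | yes (t , p) = yes (_ , p)
  ... | no ¬p = no λ (x , p) → ¬p (Inverse.from e x , ≡.subst P (≡.sym (Inverse.strictlyInverseˡ e x)) p)

  avoid : ∀ {n m} {X Y : Set} → Fin n ↔ X → Fin m ↔ Y → (B : X → Y → Set) → (∀ x y → Dec (B x y)) →
          (∀ {x x′} y → B x y → B x′ y → x ≡ x′) → m ℕ.< n → ∃ λ x → ∀ y → ¬ B x y
  avoid eX eY B B? unique m<n with search eX (λ x → ¬? (search eY (B? x)))
  ... | yes (x , ¬b) = x , λ y b → ¬b (y , b)
  ... | no all = ⊥-elim (ℕₚ.<⇒≱ m<n (cover eX eY B (λ x → Dec.decidable-stable (search eY (B? x)) (λ ¬b → all (x , ¬b))) unique))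

  injective⇒surjective : ∀ {n} (f : Fin n → Fin n) → Injective _≡_ _≡_ f → ∀ y → ∃ λ x → f x ≡ y
  injective⇒surjective {n} f inj y with Finₚ.any? (λ x → f x Fin.≟ y)
  ... | yes p = p
  ... | no ¬p = ⊥-elim (ℕₚ.<-irrefl ≡.refl (Finₚ.injective⇒≤ {f = extended} (λ {i} {j} → extended-injective i j)))
    where
    extended : Fin (suc n) → Fin n
    extended zero = y
    extended (suc x) = f x
    extended-injective : ∀ i j → extended i ≡ extended j → i ≡ j
    extended-injective zero zero _ = ≡.refl
    extended-injective zero (suc j) e = ⊥-elim (¬p (j , ≡.sym e))
    extended-injective (suc i) zero e = ⊥-elim (¬p (i , e))
    extended-injective (suc i) (suc j) e = ≡.cong suc (inj e)

private
  indicator : ∀ {n} → Fin n → Fin n → ℕ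
  indicator i j with i Fin.<? j
  ... | yes _ = 1
  ... | no _ = 0

  indicator-sum : ∀ {n} (i j : Fin n) → i ≢ j → 1 ≡ indicator i j ℕ.+ indicator j i
  indicator-sum i j i≢j with i Fin.<? j | j Fin.<? i
  ... | yes a | yes b = ⊥-elim (ℕₚ.<-asym a b)
  ... | yes a | no _ = ≡.refl
  ... | no _ | yes b = ≡.refl
  ... | no a | no b with Finₚ.<-cmp i j
  ... | tri< c _ _ = ⊥-elim (a c)
  ... | tri≈ _ c _ = ⊥-elim (i≢j c)
  ... | tri> _ _ c = ⊥-elim (b c)

-- The points with i < f i and those with f i < i are equinumerous.
fixpointfree-involution : ∀ {n} (f : Fin n → Fin n) → (∀ i → f (f i) ≡ i) → (∀ i → f i ≢ i) → 2 ∣ n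
fixpointfree-involution {n} f invol free = divides (sum up) (begin
  n                                      ≡⟨ count n ⟩
  sum {n} (λ _ → 1)                      ≡⟨ sum-cong-≗ {n} (λ i → indicator-sum i (f i) (free i ∘ ≡.sym)) ⟩
  sum (λ i → up i ℕ.+ down i)            ≡⟨ ∑-distrib-+ up down ⟩
  sum up ℕ.+ sum down                    ≡⟨ ≡.cong (sum up ℕ.+_) (sum-permute down π) ⟩
  sum up ℕ.+ sum (λ i → indicator (f (f i)) (f i)) ≡⟨ ≡.cong (sum up ℕ.+_) (sum-cong-≗ {n} (λ i → ≡.cong (λ j → indicator j (f i)) (invol i))) ⟩
  sum up ℕ.+ sum up                      ≡⟨ ≡.cong (sum up ℕ.+_) (ℕₚ.+-identityʳ _) ⟨
  2 ℕ.* sum up                           ≡⟨ ℕₚ.*-comm 2 (sum up) ⟩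
  sum up ℕ.* 2 ∎)
  where
  open Sum ℕₚ.+-0-commutativeMonoid using (sum; sum-cong-≗; ∑-distrib-+; sum-permute)
  open ≡.≡-Reasoning
  up down : Fin n → ℕ
  up i = indicator i (f i)
  down i = indicator (f i) i
  π : Permutation′ n
  π = permutation f f invol invol
  count : ∀ m → m ≡ sum {m} (λ _ → 1)
  count zero = ≡.refl
  count (suc m) = ≡.cong suc (count m)

module FiniteField (R : CommutativeRing 0ℓ 0ℓ) (q : ℕ) (isField : IsFiniteField R q) where
  open CommutativeRing R renaming (Carrier to K) hiding (zero)
  open IsFiniteField isField
  open RingTactic R
  open SetoidReasoning setoid
  open SemiringSum semiring using (sum; sum-remove; sum-cong-≋; *-distribˡ-sum; ∑-distrib-+)

  private module Size = Inverse size

  ix : K → Fin q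
  ix = Size.to

  el : Fin q → K
  el = Size.from

  ix-cong : ∀ {x y} → x ≈ y → ix x ≡ ix y
  ix-cong = Size.to-cong

  el-ix : ∀ x → el (ix x) ≈ x
  el-ix x = Size.inverseʳ ≡.refl

  ix-el : ∀ t → ix (el t) ≡ t
  ix-el t = Size.inverseˡ refl

  ix-injective : ∀ {x y} → ix x ≡ ix y → x ≈ y
  ix-injective {x} {y} e = trans (sym (el-ix x)) (trans (reflexive (≡.cong el e)) (el-ix y))

  el-injective : ∀ {s t} → el s ≈ el t → s ≡ t
  el-injective {s} {t} e = ≡.trans (≡.sym (ix-el s)) (≡.trans (ix-cong e) (ix-el t))

  infix 4 _≟_
  _≟_ : ∀ x y → Dec (x ≈ y)
  x ≟ y = Dec.map′ ix-injective ix-cong (ix x Fin.≟ ix y)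

  search-K : {P : K → Set} → (∀ {x y} → x ≈ y → P x → P y) → (∀ x → Dec (P x)) → Dec (∃ P)
  search-K resp P? with Finₚ.any? (P? ∘ el)
  ... | yes (t , p) = yes (el t , p)
  ... | no ¬p = no λ (x , p) → ¬p (ix x , resp (sym (el-ix x)) p)

  1≉0 : ¬ 1# ≈ 0#
  1≉0 e = 0≉1 (sym e)

  inv : ∀ x → ¬ x ≈ 0# → K
  inv x x≉0 = proj₁ (inverse x x≉0)

  inv-right : ∀ x (x≉0 : ¬ x ≈ 0#) → x * inv x x≉0 ≈ 1#
  inv-right x x≉0 = proj₂ (inverse x x≉0)

  *-cancel-0 : ∀ {x y} → ¬ x ≈ 0# → x * y ≈ 0# → y ≈ 0#
  *-cancel-0 {x} {y} x≉0 e =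
    lc₂ (inv x x≉0) e (- y) (inv-right x x≉0) (ring! (x ∷ y ∷ inv x x≉0 ∷ []))

  *-nonzero : ∀ {x y} → ¬ x ≈ 0# → ¬ y ≈ 0# → ¬ x * y ≈ 0#
  *-nonzero x≉0 y≉0 e = y≉0 (*-cancel-0 x≉0 e)

  inv-nonzero : ∀ {x} (x≉0 : ¬ x ≈ 0#) → ¬ inv x x≉0 ≈ 0#
  inv-nonzero {x} x≉0 e = 1≉0 (trans (sym (inv-right x x≉0)) (trans (*-congˡ e) (zeroʳ x)))

  neg-nonzero : ∀ {x} → ¬ x ≈ 0# → ¬ - x ≈ 0#
  neg-nonzero {x} x≉0 e = x≉0 (lc₁ (- 1#) e (ring! (x ∷ [])))

  diff-zero : ∀ {x y} → x - y ≈ 0# → x ≈ y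
  diff-zero {x} {y} e = lc₁ 1# e (ring! (x ∷ y ∷ []))

  private
    eliminate-pivot : ∀ {a b s} → a * b ≈ 1# → a * - (b * s) + s ≈ 0#
    eliminate-pivot {a} {b} {s} e = lc₁ (- s) e (ring! (a ∷ b ∷ s ∷ []))

    eliminate-row : ∀ {a b s u} → u + - (a * b) * s ≈ 0# → a * - (b * s) + u ≈ 0#
    eliminate-row {a} {b} {s} {u} e = lc₁ 1# e (ring! (a ∷ b ∷ s ∷ u ∷ []))

    distribute : ∀ a x c d → a * x + c * (d * x) ≈ (a + c * d) * x
    distribute a x c d = ring! (a ∷ x ∷ c ∷ d ∷ [])

    two-step : ∀ {a b c} → b ≈ a + 1# → c ≈ b + 1# → 1# + 1# ≈ 0# → c ≈ a
    two-step {a} {b} {c} e f t = lc₃ 1# e 1# f 1# t (ring! (a ∷ b ∷ c ∷ []))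

    no-step : ∀ {a b} → b ≈ a + 1# → b ≈ a → 1# ≈ 0#
    no-step {a} {b} e f = lc₂ 1# f (- 1#) e (ring! (a ∷ b ∷ []))

  -- A homogeneous system with more unknowns than equations, by elimination.
  eliminate : ∀ m (A : Fin m → Fin (suc m) → K) →
                ∃ λ (x : Fin (suc m) → K) → (∃ λ j → ¬ x j ≈ 0#) × (∀ i → sum (λ j → A i j * x j) ≈ 0#)
  eliminate zero A = (λ _ → 1#) , (zero , 1≉0) , λ ()
  eliminate (suc m) A with Finₚ.any? (λ j → ¬? (A zero j ≟ 0#))
  ... | no none = x , (suc (proj₁ nz) , proj₂ nz) , λ
        { zero → trans (sum-cong-≋ (λ j → trans (*-congʳ (row j)) (trans (zeroˡ (x j)) (sym (zeroˡ 0#)))))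
                       (trans (sym (*-distribˡ-sum {suc (suc m)} 0# (λ _ → 0#))) (zeroˡ _))
        ; (suc i) → trans (+-cong (zeroʳ (A (suc i) zero)) (eqs i)) (+-identityˡ 0#) }
    where
    rest = eliminate m (λ i k → A (suc i) (suc k))
    nz = proj₁ (proj₂ rest)
    eqs = proj₂ (proj₂ rest)
    x : Fin (suc (suc m)) → K
    x zero = 0#
    x (suc k) = proj₁ rest k
    row : ∀ j → A zero j ≈ 0#
    row j = Dec.decidable-stable (A zero j ≟ 0#) (λ n → none (j , n))
  ... | yes (j , pivot) = x , nonzero , λ { zero → first ; (suc i) → other i }
    where
    b = inv (A zero j) pivot
    A′ : Fin m → Fin (suc m) → K
    A′ i k = A (suc i) (punchIn j k) + (- (A (suc i) j * b)) * A zero (punchIn j k)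
    rest = eliminate m A′
    x′ = proj₁ rest
    S = sum (λ k → A zero (punchIn j k) * x′ k)
    v = - (b * S)
    x = insertAt x′ j v
    nonzero : ∃ λ k → ¬ x k ≈ 0#
    nonzero with k , n ← proj₁ (proj₂ rest) =
      punchIn j k , λ e → n (trans (reflexive (≡.sym (insertAt-punchIn x′ j v k))) e)
    split : ∀ r → sum (λ k → A r k * x k) ≈ A r j * v + sum (λ k → A r (punchIn j k) * x′ k)
    split r = trans (sum-remove {i = j} (λ k → A r k * x k))
      (+-cong {A r j * x j} {A r j * v} (*-congˡ (reflexive (insertAt-lookup x′ j v)))
              (sum-cong-≋ (λ k → *-congˡ {A r (punchIn j k)} (reflexive (insertAt-punchIn x′ j v k)))))
    first : sum (λ k → A zero k * x k) ≈ 0#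
    first = trans (split zero) (eliminate-pivot (inv-right (A zero j) pivot))
    other : ∀ i → sum (λ k → A (suc i) k * x k) ≈ 0#
    other i = trans (split (suc i)) (eliminate-row {A (suc i) j} {b} {S} {U} eq)
      where
      U = sum (λ k → A (suc i) (punchIn j k) * x′ k)
      c = - (A (suc i) j * b)
      eq : U + c * S ≈ 0#
      eq = begin
        U + c * S ≈⟨ +-congˡ (*-distribˡ-sum c (λ k → A zero (punchIn j k) * x′ k)) ⟩
        U + sum (λ k → c * (A zero (punchIn j k) * x′ k))
          ≈⟨ sym (∑-distrib-+ (λ k → A (suc i) (punchIn j k) * x′ k) (λ k → c * (A zero (punchIn j k) * x′ k))) ⟩
        sum (λ k → A (suc i) (punchIn j k) * x′ k + c * (A zero (punchIn j k) * x′ k))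
          ≈⟨ sum-cong-≋ (λ k → distribute (A (suc i) (punchIn j k)) (x′ k) c (A zero (punchIn j k))) ⟩
        sum (λ k → A′ i k * x′ k) ≈⟨ proj₂ (proj₂ rest) i ⟩
        0# ∎

  abstract
    homogeneous : ∀ m (A : Fin m → Fin (suc m) → K) →
                  ∃ λ (x : Fin (suc m) → K) → (∃ λ j → ¬ x j ≈ 0#) × (∀ i → sum (λ j → A i j * x j) ≈ 0#)
    homogeneous = eliminate

  -- Translation by 1 would be a fixed-point-free involution.
  two-nonzero : ¬ (2 ∣ q) → ¬ 1# + 1# ≈ 0#
  two-nonzero odd 2≈0 = odd (fixpointfree-involution (λ t → ix (el t + 1#))
    (λ t → ≡.trans (ix-cong (two-step (el-ix _) refl 2≈0)) (ix-el t))
    (λ t e → 1≉0 (no-step (el-ix (el t + 1#)) (reflexive (≡.cong el e)))))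

module Vectors (R : CommutativeRing 0ℓ 0ℓ) (q : ℕ) (isField : IsFiniteField R q) (h : Fin 5 → CommutativeRing.Carrier R) where
  open CommutativeRing R renaming (Carrier to K) hiding (zero)
  open RingTactic R
  open FiniteField R q isField
  open Geometry R q h
  open SemiringSum semiring using (sum; sum-remove; sum-cong-≋; *-distribˡ-sum; ∑-distrib-+; ∑-comm)

  infixl 6 _⊕′_
  _⊕′_ = _⊕_

  ≈v-refl : ∀ {u} → u ≈v u
  ≈v-refl i = refl

  ≈v-sym : ∀ {u v} → u ≈v v → v ≈v u
  ≈v-sym e i = sym (e i)

  ≈v-trans : ∀ {u v w} → u ≈v v → v ≈v w → u ≈v w
  ≈v-trans e f i = trans (e i) (f i)

  infix 4 _≟v_
  _≟v_ : ∀ u v → Dec (u ≈v v)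
  u ≟v v = Finₚ.all? (λ i → u i ≟ v i)

  support : ∀ {v} → NonZero v → ∃ λ j → ¬ v j ≈ 0#
  support {v} v≉0 with Finₚ.any? (λ j → ¬? (v j ≟ 0#))
  ... | yes p = p
  ... | no ¬p = ⊥-elim (v≉0 (λ j → Dec.decidable-stable (v j ≟ 0#) (λ n → ¬p (j , n))))

  infix 8 _∙_

  abstract
    _∙_ : Vec5 → Vec5 → K
    _∙_ = dot

    ∙-dot : ∀ g v → g ∙ v ≈ dot g v
    ∙-dot g v = refl

    dot-⊕ : ∀ g u v → g ∙ (u ⊕ v) ≈ g ∙ u + g ∙ v
    dot-⊕ g u v = lemma (g zero) (g (suc zero)) (g (suc (suc zero))) (g (suc (suc (suc zero)))) (g (suc (suc (suc (suc zero)))))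
                        (u zero) (u (suc zero)) (u (suc (suc zero))) (u (suc (suc (suc zero)))) (u (suc (suc (suc (suc zero)))))
                        (v zero) (v (suc zero)) (v (suc (suc zero))) (v (suc (suc (suc zero)))) (v (suc (suc (suc (suc zero)))))
      where
      lemma : ∀ g₀ g₁ g₂ g₃ g₄ u₀ u₁ u₂ u₃ u₄ v₀ v₁ v₂ v₃ v₄ →
        g₀ * (u₀ + v₀) + g₁ * (u₁ + v₁) + g₂ * (u₂ + v₂) + g₃ * (u₃ + v₃) + g₄ * (u₄ + v₄) ≈
        (g₀ * u₀ + g₁ * u₁ + g₂ * u₂ + g₃ * u₃ + g₄ * u₄) + (g₀ * v₀ + g₁ * v₁ + g₂ * v₂ + g₃ * v₃ + g₄ * v₄)
      lemma g₀ g₁ g₂ g₃ g₄ u₀ u₁ u₂ u₃ u₄ v₀ v₁ v₂ v₃ v₄ =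
        ring! (g₀ ∷ g₁ ∷ g₂ ∷ g₃ ∷ g₄ ∷ u₀ ∷ u₁ ∷ u₂ ∷ u₃ ∷ u₄ ∷ v₀ ∷ v₁ ∷ v₂ ∷ v₃ ∷ v₄ ∷ [])

    dot-· : ∀ g a v → g ∙ (a · v) ≈ a * g ∙ v
    dot-· g a v = lemma (g zero) (g (suc zero)) (g (suc (suc zero))) (g (suc (suc (suc zero)))) (g (suc (suc (suc (suc zero)))))
                        (v zero) (v (suc zero)) (v (suc (suc zero))) (v (suc (suc (suc zero)))) (v (suc (suc (suc (suc zero)))))
      where
      lemma : ∀ g₀ g₁ g₂ g₃ g₄ v₀ v₁ v₂ v₃ v₄ →
        g₀ * (a * v₀) + g₁ * (a * v₁) + g₂ * (a * v₂) + g₃ * (a * v₃) + g₄ * (a * v₄) ≈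
        a * (g₀ * v₀ + g₁ * v₁ + g₂ * v₂ + g₃ * v₃ + g₄ * v₄)
      lemma g₀ g₁ g₂ g₃ g₄ v₀ v₁ v₂ v₃ v₄ =
        ring! (g₀ ∷ g₁ ∷ g₂ ∷ g₃ ∷ g₄ ∷ v₀ ∷ v₁ ∷ v₂ ∷ v₃ ∷ v₄ ∷ a ∷ [])

    dot-cong : ∀ g {u v} → u ≈v v → g ∙ u ≈ g ∙ v
    dot-cong g e = +-cong (+-cong (+-cong (+-cong (*-congˡ (e _)) (*-congˡ (e _))) (*-congˡ (e _))) (*-congˡ (e _))) (*-congˡ (e _))

    dot-comm : ∀ g v → g ∙ v ≈ v ∙ g
    dot-comm g v = +-cong (+-cong (+-cong (+-cong (*-comm _ _) (*-comm _ _)) (*-comm _ _)) (*-comm _ _)) (*-comm _ _)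

    dot-sum : ∀ g v → g ∙ v ≈ sum (λ i → g i * v i)
    dot-sum g v = lemma (g zero * v zero) (g (suc zero) * v (suc zero)) (g (suc (suc zero)) * v (suc (suc zero))) _ _
      where
      lemma : ∀ a b c d e → a + b + c + d + e ≈ a + (b + (c + (d + (e + 0#))))
      lemma a b c d e = ring! (a ∷ b ∷ c ∷ d ∷ e ∷ [])

  Inf : Vec5 → Set
  Inf v = h ∙ v ≈ 0#

  dot-left : ∀ g a f v → (g ⊕ (a · f)) ∙ v ≈ g ∙ v + a * f ∙ v
  dot-left g a f v = trans (dot-comm _ v) (trans (dot-⊕ v g (a · f))
    (+-cong (dot-comm v g) (trans (dot-· v a f) (*-congˡ (dot-comm v f)))))

  dot-left-zero : ∀ g → g ≈v 0v → ∀ v → g ∙ v ≈ 0#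
  dot-left-zero g z v = trans (dot-comm g v) (trans (dot-cong v {g} {0# · 0v} (λ i → trans (z i) (sym (zeroˡ _))))
    (trans (dot-· v 0# 0v) (zeroˡ _)))

  dot-comb₂ : ∀ g a u b v → g ∙ ((a · u) ⊕ (b · v)) ≈ a * g ∙ u + b * g ∙ v
  dot-comb₂ g a u b v = trans (dot-⊕ g (a · u) (b · v)) (+-cong (dot-· g a u) (dot-· g b v))

  dot-comb₃ : ∀ g a u b v c w → g ∙ (((a · u) ⊕ (b · v)) ⊕ (c · w)) ≈ a * g ∙ u + b * g ∙ v + c * g ∙ w
  dot-comb₃ g a u b v c w = trans (dot-⊕ g ((a · u) ⊕ (b · v)) (c · w)) (+-cong (dot-comb₂ g a u b v) (dot-· g c w))

  record IsSubspace (S : Vec5 → Set) : Set where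
    field
      resp  : ∀ {u v} → u ≈v v → S u → S v
      add   : ∀ {u v} → S u → S v → S (u ⊕ v)
      scale : ∀ {v} a → S v → S (a · v)

    span₂ : ∀ {x u v} → S u → S v → InSpan2 x u v → S x
    span₂ su sv (a , b , e) = resp (≈v-sym e) (add (scale a su) (scale b sv))

    span₃ : ∀ {x u v w} → S u → S v → S w → InSpan3 x u v w → S x
    span₃ su sv sw (a , b , c , e) = resp (≈v-sym e) (add (add (scale a su) (scale b sv)) (scale c sw))

    difference-in : ∀ {u v} → S u → S v → S (u ⊕ ((- 1#) · v))
    difference-in su sv = add su (scale (- 1#) sv)

    translate : ∀ {u v} t → S u → S v → S (u ⊕ (t · v))
    translate t su sv = add su (scale t sv)

  infix 4 _∈_
  record _∈_ (v : Vec5) (π : Plane) : Set where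
    constructor member
    field
      span : InSpan3 v (Plane.p₁ π) (Plane.p₂ π) (Plane.p₃ π)
  open _∈_ public

  plane-subspace : ∀ π → IsSubspace (_∈ π)
  plane-subspace π = record
    { resp = λ { e (member (a , b , c , f)) → member (a , b , c , ≈v-trans (≈v-sym e) f) }
    ; add = λ { (member (a , b , c , e)) (member (a′ , b′ , c′ , e′)) → member (a + a′ , b + b′ , c + c′ , λ i →
        trans (+-cong (e i) (e′ i)) (ring! (a ∷ b ∷ c ∷ a′ ∷ b′ ∷ c′ ∷ p₁ i ∷ p₂ i ∷ p₃ i ∷ []))) }
    ; scale = λ { t (member (a , b , c , e)) → member (t * a , t * b , t * c , λ i →
        trans (*-congˡ (e i)) (ring! (t ∷ a ∷ b ∷ c ∷ p₁ i ∷ p₂ i ∷ p₃ i ∷ []))) }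
    }
    where open Plane π

  kernel-subspace : ∀ g → IsSubspace (λ v → g ∙ v ≈ 0#)
  kernel-subspace g = record
    { resp = λ e p → trans (sym (dot-cong g e)) p
    ; add = λ {u} {v} p q′ → trans (dot-⊕ g u v) (trans (+-cong p q′) (+-identityˡ 0#))
    ; scale = λ {v} a p → trans (dot-· g a v) (trans (*-congˡ p) (zeroʳ a))
    }

  module InPlane π = IsSubspace (plane-subspace π)
  module Kernel g = IsSubspace (kernel-subspace g)

  infix 4 _∈?_
  _∈?_ : ∀ v π → Dec (v ∈ π)
  v ∈? π = Dec.map′ member span (search-K (λ e (b , c , f) → b , c , λ i → trans (f i) (+-congʳ (+-congʳ (*-congʳ e))))
    (λ a → search-K (λ e (c , f) → c , λ i → trans (f i) (+-congʳ (+-congˡ (*-congʳ e))))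
    (λ b → search-K (λ e f i → trans (f i) (+-congˡ (*-congʳ e)))
    (λ c → v ≟v _))))

  comb : ∀ {n} → (Fin n → K) → (Fin n → Vec5) → Vec5
  comb x v i = sum (λ k → x k * v k i)

  Dependent : ∀ {n} → (Fin n → Vec5) → Set
  Dependent {n} v = ∃ λ (x : Fin n → K) → (∃ λ j → ¬ x j ≈ 0#) × comb x v ≈v 0v

  six-dependent : (v : Fin 6 → Vec5) → Dependent v
  six-dependent v with x , nz , eqs ← homogeneous 5 (λ i k → v k i) =
    x , nz , λ i → trans (sum-cong-≋ (λ k → *-comm (x k) (v k i))) (eqs i)

  annihilator : (v : Fin 4 → Vec5) → ∃ λ g → NonZero g × (∀ k → g ∙ (v k) ≈ 0#)
  annihilator v with g , (j , n) , eqs ← homogeneous 4 v =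
    g , (λ z → n (z j)) , λ k → trans (dot-sum g (v k)) (trans (sum-cong-≋ (λ i → *-comm (g i) (v k i))) (eqs k))

  dot-comb : ∀ {n} g x (v : Fin n → Vec5) → (∀ k → g ∙ (v k) ≈ 0#) → g ∙ (comb x v) ≈ 0#
  dot-comb {zero} g x v z = trans (dot-cong g {comb x v} {0# · 0v} (λ i → sym (zeroˡ 0#))) (trans (dot-· g 0# 0v) (zeroˡ _))
  dot-comb {suc n} g x v z = trans (dot-⊕ g (x zero · v zero) (comb (x ∘ suc) (v ∘ suc)))
    (trans (+-cong (trans (dot-· g (x zero) (v zero)) (trans (*-congˡ (z zero)) (zeroʳ _))) (dot-comb g (x ∘ suc) (v ∘ suc) (z ∘ suc)))
           (+-identityˡ 0#))

  -- If g j ≉ 0, a vector of ker g whose other coordinates vanish is zero, so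
  -- four of the five coordinate equations suffice.
  kernel-dependent : ∀ {g} → NonZero g → (v : Fin 5 → Vec5) → (∀ k → g ∙ (v k) ≈ 0#) → Dependent v
  kernel-dependent {g} g≉0 v z with j , gj≉0 ← support g≉0
    with x , nz , eqs ← homogeneous 4 (λ i k → v k (punchIn j i)) = x , nz , vanish
    where
    w = comb x v
    other : ∀ i → w (punchIn j i) ≈ 0#
    other i = trans (sum-cong-≋ (λ k → *-comm (x k) (v k (punchIn j i)))) (eqs i)
    pivot : w j ≈ 0#
    pivot = *-cancel-0 gj≉0 (begin
      g j * w j                                               ≈⟨ sym (+-identityʳ _) ⟩
      g j * w j + 0#                                          ≈⟨ +-congˡ (sym (zeros (g ∘ punchIn j))) ⟩
      g j * w j + sum (λ i → g (punchIn j i) * 0#)            ≈⟨ +-congˡ (sum-cong-≋ (λ i → *-congˡ {g (punchIn j i)} (sym (other i)))) ⟩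
      g j * w j + sum (λ i → g (punchIn j i) * w (punchIn j i)) ≈⟨ sym (sum-remove {i = j} (λ i → g i * w i)) ⟩
      sum (λ i → g i * w i)                                   ≈⟨ sym (dot-sum g w) ⟩
      g ∙ w                                                 ≈⟨ dot-comb g x v z ⟩
      0# ∎)
      where
      open SetoidReasoning setoid
      zeros : ∀ {n} (a : Fin n → K) → sum (λ i → a i * 0#) ≈ 0#
      zeros {zero} a = refl
      zeros {suc n} a = trans (+-cong (zeroʳ _) (zeros (a ∘ suc))) (+-identityˡ 0#)
    vanish : ∀ i → w i ≈ 0#
    vanish i with j Fin.≟ i
    ... | yes ≡.refl = pivot
    ... | no j≢i = trans (reflexive (≡.cong w (≡.sym (Finₚ.punchIn-punchOut j≢i)))) (other (punchOut j≢i))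

  dot-comb-sum : ∀ {n} g x (v : Fin n → Vec5) → g ∙ comb x v ≈ sum (λ k → x k * g ∙ v k)
  dot-comb-sum {zero} g x v = dot-comb g x v λ ()
  dot-comb-sum {suc n} g x v = trans (dot-⊕ g (x zero · v zero) (comb (x ∘ suc) (v ∘ suc)))
    (+-cong (dot-· g (x zero) (v zero)) (dot-comb-sum g (x ∘ suc) (v ∘ suc)))

  sum-zero : ∀ {n} (x : Fin n → K) → (∀ k → x k ≈ 0#) → sum x ≈ 0#
  sum-zero {zero} x z = refl
  sum-zero {suc n} x z = trans (+-cong (z zero) (sum-zero (x ∘ suc) (z ∘ suc))) (+-identityˡ 0#)

  -- A functional vanishing on four of five dependent vectors can be chosen so that the
  -- fifth is a combination of them.
  dependent-annihilator : (v : Fin 5 → Vec5) → Dependent v → ∃ λ g → NonZero g × (∀ k → g ∙ v k ≈ 0#)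
  dependent-annihilator v (x , (j , xj) , e) = g , proj₁ (proj₂ ann) , kills
    where
    ann : ∃ λ g → NonZero g × (∀ k → g ∙ v (punchIn j k) ≈ 0#)
    ann = annihilator (v ∘ punchIn j)
    g : Vec5
    g = proj₁ ann
    pivot : g ∙ v j ≈ 0#
    pivot = *-cancel-0 xj (trans (sym (+-identityʳ _)) (trans (+-congˡ (sym (sum-zero _ (λ k →
        trans (*-congˡ (proj₂ (proj₂ ann) k)) (zeroʳ (x (punchIn j k)))))))
      (trans (sym (sum-remove {i = j} (λ k → x k * g ∙ v k))) (trans (sym (dot-comb-sum g x v))
        (trans (dot-cong g {v = 0# · 0v} (λ i → trans (e i) (sym (zeroˡ 0#)))) (trans (dot-· g 0# 0v) (zeroˡ _)))))))
    kills : ∀ k → g ∙ v k ≈ 0#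
    kills k = decide (j Fin.≟ k)
      where
      decide : Dec (j ≡ k) → g ∙ v k ≈ 0#
      decide (yes ≡.refl) = pivot
      decide (no j≢k) = ≡.subst (λ k → g ∙ v k ≈ 0#) (Finₚ.punchIn-punchOut j≢k) (proj₂ (proj₂ ann) (punchOut j≢k))

  plane-dependent : ∀ π (v : Fin 4 → Vec5) → (∀ k → v k ∈ π) → Dependent v
  plane-dependent π v inπ = x , proj₁ (proj₂ solution) , λ i →
      trans (sum-cong-≋ (λ k → *-congˡ {x k} (proj₂ (proj₂ (proj₂ (span (inπ k)))) i)))
            (expand (x zero) (x (suc zero)) (x (suc (suc zero))) (x (suc (suc (suc zero)))) _ _ _ _ _ _ _ _ _ _ _ _ (p₁ i) (p₂ i) (p₃ i)
               (eqs zero) (eqs (suc zero)) (eqs (suc (suc zero))))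
    where
    open Plane π
    coordinates : Fin 3 → Fin 4 → K
    coordinates zero k = proj₁ (span (inπ k))
    coordinates (suc zero) k = proj₁ (proj₂ (span (inπ k)))
    coordinates (suc (suc zero)) k = proj₁ (proj₂ (proj₂ (span (inπ k))))
    solution = homogeneous 3 coordinates
    x = proj₁ solution
    eqs = proj₂ (proj₂ solution)
    row : ∀ x₀ x₁ x₂ x₃ a₀ a₁ a₂ a₃ → K
    row x₀ x₁ x₂ x₃ a₀ a₁ a₂ a₃ = a₀ * x₀ + (a₁ * x₁ + (a₂ * x₂ + (a₃ * x₃ + 0#)))
    expand : ∀ x₀ x₁ x₂ x₃ a₀ a₁ a₂ a₃ b₀ b₁ b₂ b₃ c₀ c₁ c₂ c₃ u v w →
      row x₀ x₁ x₂ x₃ a₀ a₁ a₂ a₃ ≈ 0# → row x₀ x₁ x₂ x₃ b₀ b₁ b₂ b₃ ≈ 0# → row x₀ x₁ x₂ x₃ c₀ c₁ c₂ c₃ ≈ 0# →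
      x₀ * (a₀ * u + b₀ * v + c₀ * w) + (x₁ * (a₁ * u + b₁ * v + c₁ * w) + (x₂ * (a₂ * u + b₂ * v + c₂ * w) +
        (x₃ * (a₃ * u + b₃ * v + c₃ * w) + 0#))) ≈ 0#
    expand x₀ x₁ x₂ x₃ a₀ a₁ a₂ a₃ b₀ b₁ b₂ b₃ c₀ c₁ c₂ c₃ u v w ea eb ec =
      trans (collect x₀ x₁ x₂ x₃ a₀ a₁ a₂ a₃ b₀ b₁ b₂ b₃ c₀ c₁ c₂ c₃ u v w)
            (trans (+-cong (+-cong (*-congʳ ea) (*-congʳ eb)) (*-congʳ ec)) (ring! (u ∷ v ∷ w ∷ [])))
      where
      term : ∀ x a b c u v w r s t rest →
             x * (a * u + b * v + c * w) + (r * u + s * v + t * w) ≈ (a * x + r) * u + (b * x + s) * v + (c * x + t) * w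
      term x a b c u v w r s t rest = ring! (x ∷ a ∷ b ∷ c ∷ u ∷ v ∷ w ∷ r ∷ s ∷ t ∷ [])
      collect : ∀ x₀ x₁ x₂ x₃ a₀ a₁ a₂ a₃ b₀ b₁ b₂ b₃ c₀ c₁ c₂ c₃ u v w →
        x₀ * (a₀ * u + b₀ * v + c₀ * w) + (x₁ * (a₁ * u + b₁ * v + c₁ * w) + (x₂ * (a₂ * u + b₂ * v + c₂ * w) +
        (x₃ * (a₃ * u + b₃ * v + c₃ * w) + 0#))) ≈
        row x₀ x₁ x₂ x₃ a₀ a₁ a₂ a₃ * u + row x₀ x₁ x₂ x₃ b₀ b₁ b₂ b₃ * v + row x₀ x₁ x₂ x₃ c₀ c₁ c₂ c₃ * w
      collect x₀ x₁ x₂ x₃ a₀ a₁ a₂ a₃ b₀ b₁ b₂ b₃ c₀ c₁ c₂ c₃ u v w =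
        trans (+-congˡ (trans (+-congˡ (trans (+-congˡ (trans (+-congˡ (ring! (u ∷ v ∷ w ∷ [])))
          (term x₃ a₃ b₃ c₃ u v w 0# 0# 0# 0#))) (term x₂ a₂ b₂ c₂ u v w _ _ _ 0#))) (term x₁ a₁ b₁ c₁ u v w _ _ _ 0#)))
          (term x₀ a₀ b₀ c₀ u v w _ _ _ 0#)

  lookup-all : ∀ {n} (P : Vec5 → Set) (vs : Vec Vec5 n) → All P vs → ∀ k → P (lookup vs k)
  lookup-all P (v ∷ vs) (p ∷ ps) zero = p
  lookup-all P (v ∷ vs) (p ∷ ps) (suc k) = lookup-all P vs ps k

module Incidence (R : CommutativeRing 0ℓ 0ℓ) (q : ℕ) (isField : IsFiniteField R q) (h : Fin 5 → CommutativeRing.Carrier R) where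
  open CommutativeRing R renaming (Carrier to K) hiding (zero)
  open RingTactic R
  open FiniteField R q isField
  open Geometry R q h
  open Vectors R q isField h

  -- Affine points are normalised to h · x = 1, so that their differences lie in Σ∞.
  Normal : Vec5 → Set
  Normal y = h ∙ y ≈ 1#

  infix 4 _≗_ _≗̸_
  record _≗_ (π ρ : Plane) : Set where
    constructor same
    field
      to   : ∀ {w} → w ∈ π → w ∈ ρ
      from : ∀ {w} → w ∈ ρ → w ∈ π
  open _≗_ public

  _≗̸_ : Plane → Plane → Set
  π ≗̸ ρ = ¬ (π ≗ ρ)

  ≗-refl : ∀ {π} → π ≗ π
  ≗-refl = same id id

  ≗-sym : ∀ {π ρ} → π ≗ ρ → ρ ≗ π
  ≗-sym e = same (from e) (to e)

  ≗-trans : ∀ {π ρ σ} → π ≗ ρ → ρ ≗ σ → π ≗ σ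
  ≗-trans e f = same (to f ∘ to e) (from e ∘ from f)

  record OnAxis (y N z : Vec5) : Set where
    constructor _,_
    field
      parameter : K
      equation  : z ≈v (y ⊕ (parameter · N))

  onAxis? : ∀ y N z → Dec (OnAxis y N z)
  onAxis? y N z = Dec.map′ (λ (t , e) → t , e) (λ (t , e) → t , e) (search-K (λ e f i → trans (f i) (+-congˡ (*-congʳ e))) (λ t → z ≟v _))

  record Multiple (N M : Vec5) : Set where
    constructor _,_
    field
      factor   : K
      equation : M ≈v (factor · N)

  multiple? : ∀ N M → Dec (Multiple N M)
  multiple? N M = Dec.map′ (λ (t , e) → t , e) (λ (t , e) → t , e) (search-K (λ e f i → trans (f i) (*-congʳ e)) (λ t → M ≟v _))

  multiple-sym : ∀ {N M} → NonZero M → Multiple N M → Multiple M N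
  multiple-sym {N} {M} M≉0 (k , e) with k ≟ 0#
  ... | yes k≈0 = ⊥-elim (M≉0 λ i → trans (e i) (trans (*-congʳ k≈0) (zeroˡ _)))
  ... | no k≉0 = inv k k≉0 , λ i → lc₂ (- inv k k≉0) (e i) (- N i) (inv-right k k≉0)
                   (lemma (N i) (M i) k (inv k k≉0))
    where
    lemma : ∀ n m k j → n + (- j * (k * n) + - n * 1#) ≈ j * m + (- j * m + - n * (k * j))
    lemma n m k j = ring! (n ∷ m ∷ k ∷ j ∷ [])

  multiple-trans : ∀ {N M L} → Multiple N M → Multiple M L → Multiple N L
  multiple-trans {N} {M} {L} (k , e) (l , f) = l * k , λ i → lc₂ 1# (f i) l (e i) (ring! (k ∷ l ∷ N i ∷ M i ∷ L i ∷ []))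

  dot-axis : ∀ g {y N} t → g ∙ N ≈ 0# → g ∙ (y ⊕ (t · N)) ≈ g ∙ y
  dot-axis g {y} {N} t e = trans (dot-⊕ g y (t · N)) (trans (+-congˡ (trans (dot-· g t N) (trans (*-congˡ e) (zeroʳ t)))) (+-identityʳ _))

  difference-inf : ∀ {y z} → Normal y → Normal z → Inf (z ⊕ ((- 1#) · y))
  difference-inf {y} {z} hy hz = trans (dot-⊕ h z ((- 1#) · y))
    (lc₃ 1# (dot-· h (- 1#) y) 1# hz (- 1#) hy (lemma _ _ _))
    where
    lemma : ∀ a b c → (a + b) + (1# * (- 1# * c) + (1# * 1# + - 1# * 1#)) ≈ 0# + (1# * b + (1# * a + - 1# * c))
    lemma a b c = ring! (a ∷ b ∷ c ∷ [])

  difference-axis : ∀ {y z} → OnAxis y (z ⊕ ((- 1#) · y)) z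
  difference-axis {y} {z} = 1# , λ i → ring! (y i ∷ z i ∷ [])

  axis-self : ∀ {y N} → OnAxis y N y
  axis-self {y} {N} = 0# , λ i → ring! (y i ∷ N i ∷ [])

  axis-shift : ∀ {y N} t → OnAxis y N (y ⊕ (t · N))
  axis-shift t = t , ≈v-refl

  axis-sym : ∀ {y N z} → OnAxis y N z → OnAxis z N y
  axis-sym {y} {N} {z} (t , e) = - t , λ i → lc₁ (- 1#) (e i) (ring! (y i ∷ z i ∷ N i ∷ t ∷ []))

  axis-trans : ∀ {y N z w} → OnAxis y N z → OnAxis z N w → OnAxis y N w
  axis-trans {y} {N} {z} {w} (t , e) (s , f) = t + s , λ i →
    lc₂ 1# (e i) 1# (f i) (ring! (y i ∷ z i ∷ w i ∷ N i ∷ t ∷ s ∷ []))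

  axis-resp : ∀ {y N z w} → z ≈v w → OnAxis y N z → OnAxis y N w
  axis-resp e (t , f) = t , ≈v-trans (≈v-sym e) f

  axis-multiple : ∀ {y N M z} → Multiple N M → OnAxis y M z → OnAxis y N z
  axis-multiple {y} {N} {M} {z} (k , e) (t , f) = t * k , λ i →
    lc₂ t (e i) 1# (f i) (ring! (y i ∷ z i ∷ N i ∷ M i ∷ t ∷ k ∷ []))

  not-axis-nonzero : ∀ {y N z} → ¬ OnAxis y N z → NonZero (z ⊕ ((- 1#) · y))
  not-axis-nonzero {y} {N} {z} ¬on e = ¬on (0# , λ i → lc₁ 1# (e i) (ring! (y i ∷ z i ∷ N i ∷ [])))

  -- The line joining two points of an axis has the direction of that axis.
  axis-direction : ∀ {y N z} → OnAxis y N z → Multiple N (z ⊕ ((- 1#) · y))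
  axis-direction {y} {N} {z} (t , e) = t , λ i → lc₁ 1# (e i) (ring! (y i ∷ z i ∷ N i ∷ t ∷ []))

  multiple-axis : ∀ {y N z} → Multiple N (z ⊕ ((- 1#) · y)) → OnAxis y N z
  multiple-axis {y} {N} {z} (t , e) = t , λ i → lc₁ 1# (e i) (ring! (y i ∷ z i ∷ N i ∷ t ∷ []))

  difference-zero : ∀ {y z} → (z ⊕ ((- 1#) · y)) ≈v 0v → y ≈v z
  difference-zero {y} {z} e i = lc₁ (- 1#) (e i) (ring! (y i ∷ z i ∷ []))

  axis-inj : ∀ {y N s t} → NonZero N → (y ⊕ (s · N)) ≈v (y ⊕ (t · N)) → s ≈ t
  axis-inj {y} {N} {s} {t} N≉0 e with j , Nj ← support N≉0 =
    diff-zero (*-cancel-0 Nj (lc₁ 1# (e j) (ring! (y j ∷ N j ∷ s ∷ t ∷ []))))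

  independent₂ : ∀ {N M} → NonZero N → ¬ Multiple N M → Independent2 N M
  independent₂ {N} {M} N≉0 ¬mult a b e with b ≟ 0#
  ... | yes b≈0 with j , Nj ← support N≉0 =
        *-cancel-0 Nj (lc₂ 1# (e j) (- M j) b≈0 (ring! (a ∷ b ∷ N j ∷ M j ∷ []))) , b≈0
  ... | no b≉0 = ⊥-elim (¬mult (- (inv b b≉0 * a) , λ i →
        lc₂ (inv b b≉0) (e i) (- M i) (inv-right b b≉0) (lemma (N i) (M i) a b (inv b b≉0))))
    where
    lemma : ∀ n m a b j → m + (j * 0# + - m * 1#) ≈ (- (j * a)) * n + (j * (a * n + b * m) + - m * (b * j))
    lemma n m a b j = ring! (n ∷ m ∷ a ∷ b ∷ j ∷ [])

  independent₂-nonzero : ∀ {N M} → Independent2 N M → NonZero N × NonZero M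
  independent₂-nonzero {N} {M} ind =
    (λ z → 1≉0 (proj₁ (ind 1# 0# λ i → lc₁ 1# (z i) (ring! (N i ∷ M i ∷ []))))) ,
    (λ z → 1≉0 (proj₂ (ind 0# 1# λ i → lc₁ 1# (z i) (ring! (N i ∷ M i ∷ [])))))

  independent₂-not-multiple : ∀ {N M} → Independent2 N M → ¬ Multiple N M
  independent₂-not-multiple {N} {M} ind (k , e) =
    neg-nonzero 1≉0 (proj₂ (ind k (- 1#) λ i → lc₁ (- 1#) (e i) (ring! (k ∷ N i ∷ M i ∷ []))))

  independent-frame : ∀ {y N M} → Normal y → Inf N → Inf M → Independent2 N M → Independent3 y N M
  independent-frame {y} {N} {M} hy hN hM ind a b c e = a≈0 , ind b c λ i →
      lc₂ 1# (e i) (- y i) a≈0 (lemma (y i) (N i) (M i))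
    where
    a≈0 : a ≈ 0#
    a≈0 = begin-a (trans (sym (dot-comb₃ h a y b N c M)) (trans (dot-cong h e) (kernel-zero)))
      where
      kernel-zero : h ∙ 0v ≈ 0#
      kernel-zero = trans (dot-cong h {0v} {0# · 0v} (λ i → sym (zeroˡ 0#))) (trans (dot-· h 0# 0v) (zeroˡ _))
      begin-a : a * h ∙ y + b * h ∙ N + c * h ∙ M ≈ 0# → a ≈ 0#
      begin-a f = scalars hy hN hM f
        where
        scalars : ∀ {u v w} → u ≈ 1# → v ≈ 0# → w ≈ 0# → a * u + b * v + c * w ≈ 0# → a ≈ 0#
        scalars {u} {v} {w} eu ev ew f = lc₄ (- a) eu (- b) ev (- c) ew 1# f (ring! (a ∷ b ∷ c ∷ u ∷ v ∷ w ∷ []))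
    lemma : ∀ y n m → (b * n + c * m) + (1# * 0# + - y * 0#) ≈ 0# + (1# * (a * y + b * n + c * m) + - y * a)
    lemma y n m = ring! (a ∷ b ∷ c ∷ y ∷ n ∷ m ∷ [])

  independent-axis : ∀ {y z N} → Normal y → Normal z → Inf N → NonZero N → ¬ OnAxis y N z → Independent3 y z N
  independent-axis {y} {z} {N} hy hz hN N≉0 ¬on a b c e =
      lc₂ 1# (proj₁ sol) (- 1#) (proj₂ (proj₂ sol)) (ring! (a ∷ b ∷ [])) , proj₂ (proj₂ sol) , proj₁ (proj₂ sol)
    where
    sol = independent-frame hy hN (difference-inf hy hz) (independent₂ N≉0 (¬on ∘ multiple-axis {y} {N} {z})) (a + b) c b
            (λ i → lc₁ 1# (e i) (lemma (y i) (z i) (N i)))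
      where
      lemma : ∀ y z n → ((a + b) * y + c * n + b * (z + - 1# * y)) + 1# * 0# ≈ 0# + 1# * (a * y + b * z + c * n)
      lemma y z n = ring! (a ∷ b ∷ c ∷ y ∷ z ∷ n ∷ [])

  private
    solve-first : ∀ {x₀ x₁ x₂ x₃ w a b c j} → x₀ * j ≈ 1# → x₀ * w + (x₁ * a + (x₂ * b + (x₃ * c + 0#))) ≈ 0# →
                  w ≈ - (j * x₁) * a + - (j * x₂) * b + - (j * x₃) * c
    solve-first {x₀} {x₁} {x₂} {x₃} {w} {a} {b} {c} {j} e f =
      lc₂ (- w) e j f (ring! (x₀ ∷ x₁ ∷ x₂ ∷ x₃ ∷ w ∷ a ∷ b ∷ c ∷ j ∷ []))

    drop-first : ∀ {x₀ x₁ x₂ x₃ w a b c} → x₀ ≈ 0# → x₀ * w + (x₁ * a + (x₂ * b + (x₃ * c + 0#))) ≈ 0# →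
                 x₁ * a + x₂ * b + x₃ * c ≈ 0#
    drop-first {x₀} {x₁} {x₂} {x₃} {w} {a} {b} {c} e f = lc₂ (- w) e 1# f (ring! (x₀ ∷ x₁ ∷ x₂ ∷ x₃ ∷ w ∷ a ∷ b ∷ c ∷ []))

  solve-dependency : ∀ {w a b c} → Independent3 a b c →
    (x : Fin 4 → K) → (∃ λ j → ¬ x j ≈ 0#) → comb x (lookup (w ∷ a ∷ b ∷ c ∷ [])) ≈v 0v → InSpan3 w a b c
  solve-dependency {w} {a} {b} {c} ind x (j , xj) e = by-cases (x zero ≟ 0#)
    where
    by-cases : Dec (x zero ≈ 0#) → InSpan3 w a b c
    by-cases (no x₀) = - (inv _ x₀ * x (suc zero)) , - (inv _ x₀ * x (suc (suc zero))) , - (inv _ x₀ * x (suc (suc (suc zero)))) , λ i →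
        solve-first (inv-right _ x₀) (e i)
    by-cases (yes x₀≈0) = ⊥-elim (xj (all-zero j))
      where
      zs = ind (x (suc zero)) (x (suc (suc zero))) (x (suc (suc (suc zero)))) (λ i → drop-first x₀≈0 (e i))
      all-zero : ∀ j → x j ≈ 0#
      all-zero zero = x₀≈0
      all-zero (suc zero) = proj₁ zs
      all-zero (suc (suc zero)) = proj₁ (proj₂ zs)
      all-zero (suc (suc (suc zero))) = proj₂ (proj₂ zs)

  spanning : ∀ π {a b c w} → a ∈ π → b ∈ π → c ∈ π → Independent3 a b c → w ∈ π → InSpan3 w a b c
  spanning π {a} {b} {c} {w} a∈ b∈ c∈ ind w∈ = solve-dependency ind (proj₁ d) (proj₁ (proj₂ d)) (proj₂ (proj₂ d))
    where
    d : Dependent (lookup (w ∷ a ∷ b ∷ c ∷ []))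
    d = plane-dependent π (lookup (w ∷ a ∷ b ∷ c ∷ [])) (lookup-all (_∈ π) (w ∷ a ∷ b ∷ c ∷ []) (w∈ ∷ a∈ ∷ b∈ ∷ c∈ ∷ []))

  -- A subspace containing three independent vectors of a plane contains the plane.
  plane-in-subspace : ∀ {S} → IsSubspace S → ∀ π {a b c} → a ∈ π → b ∈ π → c ∈ π → Independent3 a b c →
                      S a → S b → S c → ∀ {w} → w ∈ π → S w
  plane-in-subspace sub π a∈ b∈ c∈ ind sa sb sc w∈ = IsSubspace.span₃ sub sa sb sc (spanning π a∈ b∈ c∈ ind w∈)

  three-common : ∀ {π ρ a b c} → Independent3 a b c → a ∈ π → b ∈ π → c ∈ π → a ∈ ρ → b ∈ ρ → c ∈ ρ → π ≗ ρ
  three-common {π} {ρ} {a} {b} {c} ind aπ bπ cπ aρ bρ cρ = same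
    (plane-in-subspace (plane-subspace ρ) π {a} {b} {c} aπ bπ cπ ind aρ bρ cρ)
    (plane-in-subspace (plane-subspace π) ρ {a} {b} {c} aρ bρ cρ ind aπ bπ cπ)

  common-axis : ∀ {π ρ y N z} → π ≗̸ ρ → Normal y → Normal z → Inf N → NonZero N →
                y ∈ π → N ∈ π → z ∈ π → y ∈ ρ → N ∈ ρ → z ∈ ρ → OnAxis y N z
  common-axis {y = y} {N} {z} π≠ρ hy hz hN N≉0 yπ Nπ zπ yρ Nρ zρ =
    Dec.decidable-stable (onAxis? y N z) λ ¬on →
      π≠ρ (three-common {a = y} {z} {N} (independent-axis hy hz hN N≉0 ¬on) yπ zπ Nπ yρ zρ Nρ)

  common-direction : ∀ {π ρ y N M} → π ≗̸ ρ → Normal y → Inf N → NonZero N → Inf M →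
                     y ∈ π → N ∈ π → M ∈ π → y ∈ ρ → N ∈ ρ → M ∈ ρ → Multiple N M
  common-direction {y = y} {N} {M} π≠ρ hy hN N≉0 hM yπ Nπ Mπ yρ Nρ Mρ =
    Dec.decidable-stable (multiple? N M) λ ¬mult →
      π≠ρ (three-common {a = y} {N} {M} (independent-frame hy hN hM (independent₂ {N} {M} N≉0 ¬mult)) yπ Nπ Mπ yρ Nρ Mρ)

  normal-coefficient : ∀ {w y N M a b c} → Normal w → Normal y → Inf N → Inf M →
                       w ≈v (((a · y) ⊕ (b · N)) ⊕ (c · M)) → a ≈ 1#
  normal-coefficient {w} {y} {N} {M} {a} {b} {c} hw hy hN hM e =
    scalars hy hN hM (trans (sym hw) (trans (dot-cong h e) (dot-comb₃ h a y b N c M)))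
    where
    scalars : ∀ {u v w} → u ≈ 1# → v ≈ 0# → w ≈ 0# → 1# ≈ a * u + b * v + c * w → a ≈ 1#
    scalars {u} {v} {w} eu ev ew f = lc₄ (- a) eu (- b) ev (- c) ew (- 1#) f (ring! (a ∷ b ∷ c ∷ u ∷ v ∷ w ∷ []))

  inf-coefficient : ∀ {w y N M a b c} → Inf w → Normal y → Inf N → Inf M →
                    w ≈v (((a · y) ⊕ (b · N)) ⊕ (c · M)) → a ≈ 0#
  inf-coefficient {w} {y} {N} {M} {a} {b} {c} hw hy hN hM e =
    scalars hy hN hM (trans (sym hw) (trans (dot-cong h e) (dot-comb₃ h a y b N c M)))
    where
    scalars : ∀ {u v w} → u ≈ 1# → v ≈ 0# → w ≈ 0# → 0# ≈ a * u + b * v + c * w → a ≈ 0#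
    scalars {u} {v} {w} eu ev ew f = lc₄ (- a) eu (- b) ev (- c) ew (- 1#) f (ring! (a ∷ b ∷ c ∷ u ∷ v ∷ w ∷ []))

  frame-coordinates : ∀ π {y N M w} → Normal y → Inf N → Inf M → Independent2 N M → y ∈ π → N ∈ π → M ∈ π →
                      Normal w → w ∈ π → ∃₂ λ s t → w ≈v ((y ⊕ (s · N)) ⊕ (t · M))
  frame-coordinates π {y} {N} {M} {w} hy hN hM ind y∈ N∈ M∈ hw w∈ =
    conclude (spanning π {y} {N} {M} {w} y∈ N∈ M∈ (independent-frame hy hN hM ind) w∈)
    where
    conclude : InSpan3 w y N M → ∃₂ λ s t → w ≈v ((y ⊕ (s · N)) ⊕ (t · M))
    conclude (a , s , t , e) = s , t , λ i →
      lc₂ 1# (e i) (y i) (normal-coefficient {w} {y} {N} {M} {a} {s} {t} hw hy hN hM e)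
        (ring! (a ∷ s ∷ t ∷ y i ∷ N i ∷ M i ∷ w i ∷ []))

  frame-direction : ∀ π {y N M w} → Normal y → Inf N → Inf M → Independent2 N M → y ∈ π → N ∈ π → M ∈ π →
                    Inf w → w ∈ π → InSpan2 w N M
  frame-direction π {y} {N} {M} {w} hy hN hM ind y∈ N∈ M∈ hw w∈ =
    conclude (spanning π {y} {N} {M} {w} y∈ N∈ M∈ (independent-frame hy hN hM ind) w∈)
    where
    conclude : InSpan3 w y N M → InSpan2 w N M
    conclude (a , s , t , e) = s , t , λ i →
      lc₂ 1# (e i) (y i) (inf-coefficient {w} {y} {N} {M} {a} {s} {t} hw hy hN hM e)
        (ring! (a ∷ s ∷ t ∷ y i ∷ N i ∷ M i ∷ w i ∷ []))

module Configuration (R : CommutativeRing 0ℓ 0ℓ) (q : ℕ) (7≤q : 7 ℕ.≤ q) (isField : IsFiniteField R q)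
  (h : Fin 5 → CommutativeRing.Carrier R) (C : Fin (q ℕ.* q) → Geometry.Vec5 R q h) (CPlane : Geometry.Plane R q h → Set)
  (hypotheses : Geometry.Config.Hypotheses R q h C CPlane) where
  open CommutativeRing R renaming (Carrier to K) hiding (zero)
  open RingTactic R
  open FiniteField R q isField
  open Geometry R q h
  open Config C CPlane
  open Vectors R q isField h
  open Incidence R q isField h
  open Hypotheses hypotheses

  Index : Set
  Index = Fin (q ℕ.* q)

  weight : ∀ i → ¬ h ∙ C i ≈ 0#
  weight i e = C-affine i (trans (sym (∙-dot h (C i))) e)

  abstract
    c : Index → Vec5
    c i = inv (h ∙ C i) (weight i) · C i

    c-def : ∀ i → c i ≈v (inv (h ∙ C i) (weight i) · C i)
    c-def i = ≈v-refl

  c-normal : ∀ i → Normal (c i)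
  c-normal i = trans (dot-cong h (c-def i)) (trans (dot-· h _ (C i)) (trans (*-comm _ _) (inv-right _ (weight i))))

  C-multiple : ∀ i → C i ≈v ((h ∙ C i) · c i)
  C-multiple i k = lc₂ (- C i k) (inv-right _ (weight i)) (- (h ∙ C i)) (c-def i k) (ring! (C i k ∷ c i k ∷ h ∙ C i ∷ inv (h ∙ C i) (weight i) ∷ []))

  normal-nonzero : ∀ {y} → Normal y → NonZero y
  normal-nonzero {y} hy e = 1≉0 (trans (sym hy) (trans (dot-cong h {y} {0# · 0v} (λ i → trans (e i) (sym (zeroˡ 0#))))
    (trans (dot-· h 0# 0v) (zeroˡ _))))

  onPlane-c : ∀ {π i} → InPlaneC π i → c i ∈ π
  onPlane-c {π} {i} (_ , s) = InPlane.resp π (≈v-sym (c-def i)) (InPlane.scale π {C i} _ (member s))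

  c-onPlane : ∀ {π i} → c i ∈ π → InPlaneC π i
  c-onPlane {π} {i} m = C-nonzero i , span (InPlane.resp π {(h ∙ C i) · c i} {C i} (≈v-sym (C-multiple i)) (InPlane.scale π {c i} (h ∙ C i) m))

  zero-in : ∀ π {v} → v ≈v 0v → v ∈ π
  zero-in π {v} e = member (0# , 0# , 0# , λ i → trans (e i) (ring! (Plane.p₁ π i ∷ Plane.p₂ π i ∷ Plane.p₃ π i ∷ [])))

  samePlane : ∀ {π ρ} → π ≗ ρ → SamePlane π ρ
  samePlane e x nz = (λ (_ , m) → nz , span (to e (member m))) , (λ (_ , m) → nz , span (from e (member m)))

  fromSamePlane : ∀ {π ρ} → SamePlane π ρ → π ≗ ρ
  fromSamePlane {π} {ρ} s = same (move (λ x nz → proj₁ (s x nz))) (move (λ x nz → proj₂ (s x nz)))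
    where
    move : ∀ {σ τ} → (∀ x → NonZero x → OnPlane σ x → OnPlane τ x) → ∀ {w} → w ∈ σ → w ∈ τ
    move {σ} {τ} f {w} m with w ≟v 0v
    ... | yes z = zero-in τ z
    ... | no nz = member (proj₂ (f w nz (nz , span m)))

  c-injective : ∀ {i j} → c i ≈v c j → i ≡ j
  c-injective {i} {j} e = C-distinct i j (h ∙ C i * inv (h ∙ C j) (weight j) , *-nonzero (weight i) (inv-nonzero (weight j)) ,
    λ k → lc₃ 1# (C-multiple i k) (h ∙ C i) (e k) (h ∙ C i) (c-def j k) (ring! (C i k ∷ c i k ∷ c j k ∷ C j k ∷ h ∙ C i ∷ inv (h ∙ C j) (weight j) ∷ [])))

  -- The points of 𝒞 in a 𝒞-plane.
  module _ {π} (cπ : CPlane π) where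
    abstract
      pts : Fin q → Index
      pts = proj₁ (proj₁ (A1-arc π cπ))

      pts-injective : ∀ {k l} → pts k ≡ pts l → k ≡ l
      pts-injective = proj₁ (proj₂ (proj₁ (A1-arc π cπ)))

      pts-in : ∀ k → c (pts k) ∈ π
      pts-in k = onPlane-c {π} (proj₂ (proj₂ (proj₂ (proj₁ (A1-arc π cπ))) (pts k)) (k , ≡.refl))

      pts-all : ∀ {i} → c i ∈ π → ∃ λ k → pts k ≡ i
      pts-all {i} m = proj₁ (proj₂ (proj₂ (proj₁ (A1-arc π cπ))) i) (c-onPlane m)

    no-three : ∀ {i j k N} → i ≢ j → i ≢ k → j ≢ k → c i ∈ π → c j ∈ π → c k ∈ π → OnAxis (c i) N (c j) → OnAxis (c i) N (c k) → ⊥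
    no-three {i} {j} {k} {N} i≢j i≢k j≢k mi mj mk (s , e) (t , f) =
      proj₂ (A1-arc π cπ) i j k i≢j i≢k j≢k (c-onPlane mi) (c-onPlane mj) (c-onPlane mk)
        ((t - s) * wi , - t * wj , s * wk , (λ (_ , e₂ , e₃) → t≉0 (neg-zero (cancel-weight j {(- t)} e₂))) , λ l →
           lc₂ (- t) (weighted e l) s (weighted f l) (ring! (C i l ∷ C j l ∷ C k l ∷ wi ∷ wj ∷ wk ∷ s ∷ t ∷ N l ∷ [])))
      where
      wi = inv (h ∙ C i) (weight i)
      wj = inv (h ∙ C j) (weight j)
      wk = inv (h ∙ C k) (weight k)
      weighted : ∀ {j s} → c j ≈v (c i ⊕ (s · N)) → ∀ l → inv (h ∙ C j) (weight j) * C j l ≈ wi * C i l + s * N l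
      weighted {j} e l = trans (sym (c-def j l)) (trans (e l) (+-congʳ (c-def i l)))
      cancel-weight : ∀ j {x} → x * inv (h ∙ C j) (weight j) ≈ 0# → x ≈ 0#
      cancel-weight j {x} e = *-cancel-0 (inv-nonzero (weight j)) (trans (*-comm _ _) e)
      neg-zero : ∀ {x} → - x ≈ 0# → x ≈ 0#
      neg-zero {x} e = lc₁ (- 1#) e (ring! (x ∷ []))
      t≉0 : ¬ t ≈ 0#
      t≉0 z = i≢k (c-injective λ l → lc₂ (- 1#) (f l) (- N l) z (lemma (c i l) (c k l) (N l)))
        where
        lemma : ∀ x y n → x + (- 1# * (x + t * n) + - n * 0#) ≈ y + (- 1# * y + - n * t)
        lemma x y n = ring! (x ∷ y ∷ n ∷ t ∷ [])

  infix 4 _≗?_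

  meet-two : ∀ {π ρ} → CPlane π → CPlane ρ → ∀ {i j} → i ≢ j → c i ∈ π → c j ∈ π → c i ∈ ρ → c j ∈ ρ → π ≗ ρ
  meet-two {π} {ρ} cπ cρ {i} {j} i≢j iπ jπ iρ jρ with A2 i j i≢j
  ... | σ , _ , _ , _ , unique = ≗-trans {ρ = σ} (fromSamePlane {π} {σ} (unique π cπ (c-onPlane iπ) (c-onPlane jπ)))
                                        (≗-sym (fromSamePlane {ρ} {σ} (unique ρ cρ (c-onPlane iρ) (c-onPlane jρ))))

  meet-once : ∀ {π ρ} → CPlane π → CPlane ρ → π ≗̸ ρ → ∀ {i j} → c i ∈ π → c j ∈ π → c i ∈ ρ → c j ∈ ρ → i ≡ j
  meet-once cπ cρ π≠ρ {i} {j} iπ jπ iρ jρ = Dec.decidable-stable (i Fin.≟ j) λ i≢j → π≠ρ (meet-two cπ cρ i≢j iπ jπ iρ jρ)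

  abstract
    0≢ : Fin q
    0≢ = Fin.fromℕ< (ℕₚ.≤-trans (ℕ.s≤s ℕ.z≤n) 7≤q)

    1≢ : Fin q
    1≢ = Fin.fromℕ< (ℕₚ.≤-trans (ℕ.s≤s (ℕ.s≤s ℕ.z≤n)) 7≤q)

    2≢ : Fin q
    2≢ = Fin.fromℕ< (ℕₚ.≤-trans (ℕ.s≤s (ℕ.s≤s (ℕ.s≤s ℕ.z≤n))) 7≤q)

    0≢1 : 0≢ ≢ 1≢
    0≢1 e with () ← ≡.trans (≡.sym (Finₚ.toℕ-fromℕ< _)) (≡.trans (≡.cong Fin.toℕ e) (Finₚ.toℕ-fromℕ< _))

    0≢2 : 0≢ ≢ 2≢
    0≢2 e with () ← ≡.trans (≡.sym (Finₚ.toℕ-fromℕ< _)) (≡.trans (≡.cong Fin.toℕ e) (Finₚ.toℕ-fromℕ< _))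

    1≢2 : 1≢ ≢ 2≢
    1≢2 e with () ← ≡.trans (≡.sym (Finₚ.toℕ-fromℕ< _)) (≡.trans (≡.cong Fin.toℕ e) (Finₚ.toℕ-fromℕ< _))

  _≗?_ : ∀ {π ρ} → CPlane π → CPlane ρ → Dec (π ≗ ρ)
  _≗?_ {π} {ρ} cπ cρ = Dec.map′ (λ (m , n) → meet-two cπ cρ (0≢1 ∘ pts-injective cπ) (pts-in cπ 0≢) (pts-in cπ 1≢) m n)
    (λ e → to e (pts-in cπ 0≢) , to e (pts-in cπ 1≢)) ((c (pts cπ 0≢) ∈? ρ) ×-dec (c (pts cπ 1≢) ∈? ρ))

  abstract
    outside : ∀ {π} → CPlane π → ∃ λ r → ¬ c r ∈ π
    outside {π} cπ with avoid (↔-id Index) (↔-id (Fin q)) (λ i k → pts cπ k ≡ i) (λ i k → pts cπ k Fin.≟ i)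
                          (λ k e f → ≡.trans (≡.sym e) f) (ℕₚ.m<m*n q q {{ℕ.>-nonZero (ℕₚ.≤-trans (ℕ.s≤s ℕ.z≤n) 7≤q)}} (ℕₚ.≤-trans (ℕ.s≤s (ℕ.s≤s ℕ.z≤n)) 7≤q))
    ... | r , free = r , λ m → free (proj₁ (pts-all cπ m)) (proj₂ (pts-all cπ m))

  record Joining (i j : Index) : Set where
    constructor joined
    field
      plane : Plane
      isC   : CPlane plane
      left  : c i ∈ plane
      right : c j ∈ plane

  abstract
    join : ∀ {i j} → i ≢ j → Joining i j
    join {i} {j} i≢j with A2 i j i≢j
    ... | σ , cσ , mi , mj , _ = joined σ cσ (onPlane-c mi) (onPlane-c mj)

  Disjoint : Plane → Plane → Set
  Disjoint π ρ = ∀ i → c i ∈ π → ¬ c i ∈ ρ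

  disjoint-sym : ∀ {π ρ} → Disjoint π ρ → Disjoint ρ π
  disjoint-sym d i mρ mπ = d i mπ mρ

  disjoint-resp : ∀ {π ρ σ} → ρ ≗ σ → Disjoint π ρ → Disjoint π σ
  disjoint-resp e d i mπ mσ = d i mπ (from e mσ)

  abstract
    meet? : ∀ π ρ → (∃ λ i → c i ∈ π × c i ∈ ρ) ⊎ Disjoint π ρ
    meet? π ρ = decide (Finₚ.any? (λ i → (c i ∈? π) ×-dec (c i ∈? ρ)))
      where
      decide : Dec (∃ λ i → c i ∈ π × c i ∈ ρ) → (∃ λ i → c i ∈ π × c i ∈ ρ) ⊎ Disjoint π ρ
      decide (yes m) = inj₁ m
      decide (no ¬m) = inj₂ λ i mπ mρ → ¬m (i , mπ , mρ)

  -- Counting the points on n different 𝒞-planes through c r.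
  pencil-bound : ∀ {n} (F : Fin n → Plane) → (∀ k → CPlane (F k)) → ∀ r → (∀ k → c r ∈ F k) →
                 (∀ {k l} → F k ≗ F l → k ≡ l) → n ℕ.* q ℕ.≤ q ℕ.* q ℕ.+ n
  pencil-bound {n} F cF r r∈ distinct = cover Finₚ.*↔× Finₚ.+↔⊎ B total unique
    where
    B : Fin n × Fin q → Index ⊎ Fin n → Set
    B (k , t) (inj₁ i) = pts (cF k) t ≡ i × i ≢ r
    B (k , t) (inj₂ l) = pts (cF k) t ≡ r × k ≡ l
    total : ∀ x → ∃ (B x)
    total (k , t) with pts (cF k) t Fin.≟ r
    ... | yes e = inj₂ k , e , ≡.refl
    ... | no n = inj₁ _ , ≡.refl , n
    same-plane : ∀ {k l t s i} → pts (cF k) t ≡ i → pts (cF l) s ≡ i → k ≡ l → (k , t) ≡ (l , s)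
    same-plane {k} e f ≡.refl = ≡.cong (k ,_) (pts-injective (cF k) (≡.trans e (≡.sym f)))
    unique : ∀ {x x′} y → B x y → B x′ y → x ≡ x′
    unique {k , t} {l , s} (inj₁ i) (e , i≢r) (f , _) = same-plane e f (distinct
      (meet-two (cF k) (cF l) i≢r (≡.subst (λ j → c j ∈ F k) e (pts-in (cF k) t)) (r∈ k)
                                  (≡.subst (λ j → c j ∈ F l) f (pts-in (cF l) s)) (r∈ l)))
    unique {k , t} {l , s} (inj₂ m) (e , k≡m) (f , l≡m) = same-plane e f (≡.trans k≡m (≡.sym l≡m))

  -- Through a point there is at most one 𝒞-plane missing π, since q others join it to π.
  playfair : ∀ {π μ ν} → CPlane π → CPlane μ → CPlane ν → ∀ {r} → c r ∈ μ → c r ∈ ν →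
             Disjoint μ π → Disjoint ν π → μ ≗ ν
  playfair {π} {μ} {ν} cπ cμ cν {r} rμ rν dμ dν = Dec.decidable-stable (cμ ≗? cν) λ μ≠ν → absurd μ≠ν
    where
    r≢ : ∀ k → r ≢ pts cπ k
    r≢ k ≡.refl = dμ r rμ (pts-in cπ k)
    J : ∀ k → Joining r (pts cπ k)
    J k = join (r≢ k)
    open Joining
    F : Fin (2 ℕ.+ q) → Plane
    F zero = μ
    F (suc zero) = ν
    F (suc (suc k)) = plane (J k)
    cF : ∀ k → CPlane (F k)
    cF zero = cμ
    cF (suc zero) = cν
    cF (suc (suc k)) = isC (J k)
    r∈ : ∀ k → c r ∈ F k
    r∈ zero = rμ
    r∈ (suc zero) = rν
    r∈ (suc (suc k)) = left (J k)
    module _ (μ≠ν : μ ≗̸ ν) where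
      distinct : ∀ {k l} → F k ≗ F l → k ≡ l
      distinct {zero} {zero} e = ≡.refl
      distinct {zero} {suc zero} e = ⊥-elim (μ≠ν e)
      distinct {zero} {suc (suc l)} e = ⊥-elim (dμ _ (from e (right (J l))) (pts-in cπ l))
      distinct {suc zero} {zero} e = ⊥-elim (μ≠ν (≗-sym e))
      distinct {suc zero} {suc zero} e = ≡.refl
      distinct {suc zero} {suc (suc l)} e = ⊥-elim (dν _ (from e (right (J l))) (pts-in cπ l))
      distinct {suc (suc k)} {zero} e = ⊥-elim (dμ _ (to e (right (J k))) (pts-in cπ k))
      distinct {suc (suc k)} {suc zero} e = ⊥-elim (dν _ (to e (right (J k))) (pts-in cπ k))
      distinct {suc (suc k)} {suc (suc l)} e = ≡.cong (λ x → suc (suc x)) (Dec.decidable-stable (k Fin.≟ l) λ k≢l →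
        dμ r rμ (to (meet-two (isC (J k)) cπ {pts cπ k} {pts cπ l} (k≢l ∘ pts-injective cπ)
                   (right (J k)) (from e (right (J l))) (pts-in cπ k) (pts-in cπ l)) (left (J k))))
      absurd : ⊥
      absurd = ℕₚ.<⇒≱ small (pencil-bound F cF r r∈ distinct)
        where
        small : q ℕ.* q ℕ.+ (2 ℕ.+ q) ℕ.< (2 ℕ.+ q) ℕ.* q
        small = ℕₚ.<-≤-trans (ℕₚ.+-monoʳ-< (q ℕ.* q) (ℕₚ.+-monoˡ-< q (ℕₚ.≤-trans (ℕ.s≤s (ℕ.s≤s (ℕ.s≤s ℕ.z≤n))) 7≤q)))
          (ℕₚ.≤-reflexive (≡.trans (ℕₚ.+-comm (q ℕ.* q) (q ℕ.+ q)) (ℕₚ.+-assoc q q (q ℕ.* q))))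

  -- The 𝒞-planes equal to π or missing π are told apart by their points on a
  -- 𝒞-plane τ crossing π; so there are at most q of them.
  parallel-cover : ∀ {π} → CPlane π → ∀ {n m X Y} → Fin n ↔ X → Fin m ↔ Y → (P : X → Plane → Set) (B : X → Y → Set) →
    (∀ {x ρ} → P x ρ → CPlane ρ × (ρ ≗ π ⊎ Disjoint ρ π)) →
    (∀ {x x′ ρ ρ′} → P x ρ → P x′ ρ′ → ρ ≗ ρ′ → x ≡ x′) →
    (∀ {x x′} y → B x y → B x′ y → x ≡ x′) →
    (∀ x → ∃ (P x) ⊎ ∃ (B x)) → n ℕ.≤ q ℕ.+ m
  parallel-cover {π} cπ {X = X} {Y} eX eY P B P-parallel P-distinct B-unique classify =
    cover eX ((↔-id (Fin q) ⊎-↔ eY) ↔-∘ Finₚ.+↔⊎) L total unique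
    where
    p₀ = pts cπ 0≢
    r = proj₁ (outside cπ)
    r∉π = proj₂ (outside cπ)
    p₀≢r : p₀ ≢ r
    p₀≢r e = r∉π (≡.subst (λ i → c i ∈ π) e (pts-in cπ 0≢))
    open Joining (join p₀≢r) renaming (plane to τ; isC to cτ)
    L : X → Fin q ⊎ Y → Set
    L x (inj₁ t) = ∃ λ ρ → P x ρ × c (pts cτ t) ∈ ρ
    L x (inj₂ y) = B x y
    total : ∀ x → ∃ (L x)
    total x with classify x
    ... | inj₂ (y , b) = inj₂ y , b
    ... | inj₁ (ρ , p) with meet? ρ τ
    ... | inj₁ (i , iρ , iτ) = inj₁ (proj₁ (pts-all cτ iτ)) , ρ , p , ≡.subst (λ j → c j ∈ ρ) (≡.sym (proj₂ (pts-all cτ iτ))) iρ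
    ... | inj₂ dρτ with P-parallel p
    ... | cρ , inj₁ ρ≗π = ⊥-elim (dρτ p₀ (from ρ≗π (pts-in cπ 0≢)) left)
    ... | cρ , inj₂ dρπ = ⊥-elim (r∉π (from (playfair cρ cπ cτ (pts-in cπ 0≢) left (disjoint-sym dρπ) (disjoint-sym dρτ)) right))
    unique : ∀ {x x′} l → L x l → L x′ l → x ≡ x′
    unique (inj₂ y) b b′ = B-unique y b b′
    unique (inj₁ t) (ρ , p , m) (ρ′ , p′ , m′) with P-parallel p | P-parallel p′
    ... | cρ , inj₁ e | cρ′ , inj₁ e′ = P-distinct p p′ (≗-trans e (≗-sym e′))
    ... | cρ , inj₁ e | cρ′ , inj₂ d′ = ⊥-elim (d′ _ m′ (to e m))
    ... | cρ , inj₂ d | cρ′ , inj₁ e′ = ⊥-elim (d _ m (to e′ m′))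
    ... | cρ , inj₂ d | cρ′ , inj₂ d′ = P-distinct p p′ (playfair cπ cρ cρ′ m m′ d d′)

  NonPoint : Vec5 → Set
  NonPoint y = ∀ i → ¬ y ≈v c i

  normal-onPlane : ∀ {π y} → Normal y → y ∈ π → OnPlane π y
  normal-onPlane hy m = normal-nonzero hy , span m

  normal-multiple : ∀ {y i} → Normal y → y ∼ C i → y ≈v c i
  normal-multiple {y} {i} hy (a , _ , e) k = lc₃ 1# (e k) a (C-multiple i k) (c i k) aw≈1 (lemma a (h ∙ C i) (y k) (C i k) (c i k))
    where
    aw≈1 : a * h ∙ C i ≈ 1#
    aw≈1 = trans (sym (dot-· h a (C i))) (trans (sym (dot-cong h e)) hy)
    lemma : ∀ a w y x z → y + (1# * (a * x) + (a * (w * z) + z * 1#)) ≈ z + (1# * y + (a * x + z * (a * w)))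
    lemma a w y x z = ring! (a ∷ w ∷ y ∷ x ∷ z ∷ [])

  affine-normal : ∀ {y} → Normal y → Affine y
  affine-normal {y} hy e = 1≉0 (trans (sym hy) (trans (∙-dot h y) e))

  -- A point off 𝒞 lies on at most one 𝒞-plane other than π.
  nonpoint-unique : ∀ {π ρ σ y} → Normal y → NonPoint y → CPlane π → CPlane ρ → CPlane σ →
                    y ∈ π → y ∈ ρ → y ∈ σ → π ≗̸ ρ → π ≗̸ σ → ρ ≗ σ
  nonpoint-unique {π} {ρ} {σ} {y} hy np cπ cρ cσ yπ yρ yσ π≠ρ π≠σ with A3 y (normal-nonzero hy) (affine-normal hy)
  ... | inj₁ (i , e) = ⊥-elim (np i (normal-multiple {i = i} hy e))
  ... | inj₂ (inj₁ none) = ⊥-elim (none π cπ (normal-onPlane hy yπ))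
  ... | inj₂ (inj₂ (π₁ , π₂ , _ , _ , _ , _ , _ , only)) = choose (which cπ yπ) (which cρ yρ) (which cσ yσ)
    where
    which : ∀ {κ} → CPlane κ → y ∈ κ → κ ≗ π₁ ⊎ κ ≗ π₂
    which {κ} cκ m with only κ cκ (normal-onPlane hy m)
    ... | inj₁ s = inj₁ (fromSamePlane {κ} {π₁} s)
    ... | inj₂ s = inj₂ (fromSamePlane {κ} {π₂} s)
    choose : π ≗ π₁ ⊎ π ≗ π₂ → ρ ≗ π₁ ⊎ ρ ≗ π₂ → σ ≗ π₁ ⊎ σ ≗ π₂ → ρ ≗ σ
    choose (inj₁ a) (inj₁ b) _ = ⊥-elim (π≠ρ (≗-trans a (≗-sym b)))
    choose (inj₁ a) (inj₂ b) (inj₁ d) = ⊥-elim (π≠σ (≗-trans a (≗-sym d)))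
    choose (inj₁ a) (inj₂ b) (inj₂ d) = ≗-trans b (≗-sym d)
    choose (inj₂ a) (inj₁ b) (inj₁ d) = ≗-trans b (≗-sym d)
    choose (inj₂ a) (inj₁ b) (inj₂ d) = ⊥-elim (π≠σ (≗-trans a (≗-sym d)))
    choose (inj₂ a) (inj₂ b) _ = ⊥-elim (π≠ρ (≗-trans a (≗-sym b)))

  -- The line of π through y with direction M lies in a second 𝒞-plane.
  record Special (π : Plane) (y M : Vec5) : Set where
    field
      other     : Plane
      other-C   : CPlane other
      distinct  : π ≗̸ other
      point-in  : y ∈ other
      dir-in    : M ∈ other
  open Special public

  special-axis : ∀ {π y M z} → OnAxis y M z → Special π y M → Special π z M
  special-axis {π} {y} {M} {z} (t , e) s = record
    { other = other s; other-C = other-C s; distinct = distinct s; dir-in = dir-in s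
    ; point-in = InPlane.resp (other s) {y ⊕ (t · M)} {z} (≈v-sym e) (InPlane.translate (other s) {y} {M} t (point-in s) (dir-in s)) }

  special-multiple : ∀ {π y M N} → Multiple M N → Special π y M → Special π y N
  special-multiple {π} {y} {M} {N} (t , e) s = record
    { other = other s; other-C = other-C s; distinct = distinct s; point-in = point-in s
    ; dir-in = InPlane.resp (other s) {t · M} {N} (≈v-sym e) (InPlane.scale (other s) {M} t (dir-in s)) }

  special-once : ∀ {π y M i j} → CPlane π → Special π y M → c i ∈ π → c j ∈ π → OnAxis y M (c i) → OnAxis y M (c j) → i ≡ j
  special-once {i = i} {j} cπ s iπ jπ iM jM =
    meet-once cπ (other-C s) (distinct s) iπ jπ (point-in (special-axis iM s)) (point-in (special-axis jM s))

  axis-in : ∀ {π y M z} → OnAxis y M z → y ∈ π → M ∈ π → z ∈ π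
  axis-in {π} {y} {M} {z} (t , e) yπ Mπ = InPlane.resp π {y ⊕ (t · M)} {z} (≈v-sym e) (InPlane.translate π {y} {M} t yπ Mπ)

  axis-normal : ∀ {y M z} → OnAxis y M z → Normal y → Inf M → Normal z
  axis-normal {y} {M} {z} (t , e) hy hM = trans (dot-cong h e) (trans (dot-axis h {y} {M} t hM) hy)

  data Status (π : Plane) (y : Vec5) : Set where
    point   : ∀ i → y ≈v c i → Status π y
    special : NonPoint y → ∀ M → Inf M → NonZero M → M ∈ π → Special π y M → Status π y
    lonely  : ∀ ρ → CPlane ρ → π ≗̸ ρ → y ∈ ρ → Disjoint ρ π → (∀ z → Normal z → z ∈ π → z ∈ ρ → z ≈v y) → Status π y

  search-plane : ∀ π {P : Vec5 → Set} → (∀ {u v} → u ≈v v → P u → P v) → (∀ v → Dec (P v)) → Dec (∃ λ v → v ∈ π × P v)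
  search-plane π {P} resp P? = Dec.map′
    (λ (a , b , c , p) → _ , member (a , b , c , ≈v-refl) , p)
    (λ { (v , member (a , b , c , e) , p) → a , b , c , resp e p })
    (search-K (λ e (b , c , p) → b , c , resp (λ i → +-congʳ (+-congʳ (*-congʳ e))) p)
    (λ a → search-K (λ e (c , p) → c , resp (λ i → +-congʳ (+-congˡ (*-congʳ e))) p)
    (λ b → search-K (λ e p → resp (λ i → +-congˡ (*-congʳ e)) p)
    (λ c → P? _))))

  status-of : ∀ {π y} → CPlane π → Normal y → y ∈ π → Status π y
  status-of {π} {y} cπ hy yπ = by-point (Finₚ.any? (λ i → y ≟v c i))
    where
    by-point : Dec (∃ λ i → y ≈v c i) → Status π y
    by-point (yes (i , e)) = point i e
    by-point (no ¬point) = by-planes (A3 y (normal-nonzero hy) (affine-normal hy))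
      where
      alone : ∀ ρ → ¬ (∃ λ z → z ∈ π × Normal z × z ∈ ρ × ¬ z ≈v y) → ∀ z → Normal z → z ∈ π → z ∈ ρ → z ≈v y
      alone ρ none z hz zπ zρ = Dec.decidable-stable (z ≟v y) λ z≠y → none (z , zπ , hz , zρ , z≠y)
      with-plane : ∀ {ρ} → CPlane ρ → π ≗̸ ρ → y ∈ ρ → Dec (∃ λ z → z ∈ π × Normal z × z ∈ ρ × ¬ z ≈v y) → Status π y
      with-plane {ρ} cρ π≠ρ yρ (yes (z , zπ , hz , zρ , z≠y)) = special (λ i e → ¬point (i , e)) (z ⊕ ((- 1#) · y)) (difference-inf hy hz)
        (λ e → z≠y (≈v-sym (difference-zero {y} {z} e))) (InPlane.difference-in π zπ yπ)
        (record { other = ρ; other-C = cρ; distinct = π≠ρ; point-in = yρ; dir-in = InPlane.difference-in ρ zρ yρ })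
      with-plane {ρ} cρ π≠ρ yρ (no none) = lonely ρ cρ π≠ρ yρ (λ i iρ iπ → ¬point (i , ≈v-sym (alone ρ none (c i) (c-normal i) iπ iρ))) (alone ρ none)
      second-point : ∀ ρ → Dec (∃ λ z → z ∈ π × Normal z × z ∈ ρ × ¬ z ≈v y)
      second-point ρ = search-plane π {λ z → Normal z × z ∈ ρ × ¬ z ≈v y}
        (λ {u} {v} e (hz , zρ , z≠y) → trans (sym (dot-cong h e)) hz , InPlane.resp ρ e zρ , λ f → z≠y (≈v-trans e f))
        (λ z → (h ∙ z ≟ 1#) ×-dec ((z ∈? ρ) ×-dec ¬? (z ≟v y)))
      by-planes : _ → Status π y
      by-planes (inj₁ (i , e)) = point i (normal-multiple {i = i} hy e)
      by-planes (inj₂ (inj₁ none)) = ⊥-elim (none π cπ (normal-onPlane hy yπ))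
      by-planes (inj₂ (inj₂ (π₁ , π₂ , c₁ , c₂ , π₁≠π₂ , m₁ , m₂ , only))) = other-than (only π cπ (normal-onPlane hy yπ))
        where
        other-than : SamePlane π π₁ ⊎ SamePlane π π₂ → Status π y
        other-than (inj₁ s) = with-plane c₂ (λ e → π₁≠π₂ (samePlane (≗-trans (≗-sym (fromSamePlane {π} {π₁} s)) e))) (member (proj₂ m₂)) (second-point π₂)
        other-than (inj₂ s) = with-plane c₁ (λ e → π₁≠π₂ (samePlane (≗-trans (≗-sym e) (fromSamePlane {π} {π₂} s)))) (member (proj₂ m₁)) (second-point π₁)

  abstract
    status : ∀ {π y} → CPlane π → Normal y → y ∈ π → Status π y
    status = status-of

  record Lonely (π : Plane) (y : Vec5) (ρ : Plane) : Set where
    constructor lonely-plane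
    field
      isC      : CPlane ρ
      contains : y ∈ ρ
      misses   : Disjoint ρ π
      alone    : ∀ z → Normal z → z ∈ π → z ∈ ρ → z ≈v y

  IsSpecial : ∀ {π y} → Status π y → Set
  IsSpecial (special _ _ _ _ _ _) = ⊤
  IsSpecial _ = ⊥

  isSpecial? : ∀ {π y} (s : Status π y) → Dec (IsSpecial s)
  isSpecial? (point i x) = no λ ()
  isSpecial? (special _ _ _ _ _ _) = yes _
  isSpecial? (lonely _ _ _ _ _ _) = no λ ()

  -- Special lines of π with different directions meet in a point of 𝒞, since
  -- other points lie on only two 𝒞-planes.
  special-meet : ∀ {π y M y′ M′} → CPlane π → Normal y → Inf M → NonZero M → y ∈ π → M ∈ π → Special π y M →
                 Normal y′ → Inf M′ → y′ ∈ π → M′ ∈ π → Special π y′ M′ → ¬ Multiple M M′ →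
                 ∃ λ i → c i ∈ π × OnAxis y M (c i) × OnAxis y′ M′ (c i)
  special-meet {π} {y} {M} {y′} {M′} cπ hy hM M≉0 yπ Mπ s hy′ hM′ y′π M′π s′ ¬mult =
      meeting (proj₁ coords) (proj₁ (proj₂ coords)) (proj₂ (proj₂ coords))
    where
    ind : Independent2 M M′
    ind = independent₂ {M} {M′} M≉0 ¬mult
    coords : ∃₂ λ a b → y′ ≈v ((y ⊕ (a · M)) ⊕ (b · M′))
    coords = frame-coordinates π {y} {M} {M′} {y′} hy hM hM′ ind yπ Mπ M′π hy′ y′π
    meeting : ∀ a b → y′ ≈v ((y ⊕ (a · M)) ⊕ (b · M′)) → ∃ λ i → c i ∈ π × OnAxis y M (c i) × OnAxis y′ M′ (c i)
    meeting a b e = by-status (status cπ hz zπ)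
      where
      z : Vec5
      z = y ⊕ (a · M)
      zM : OnAxis y M z
      zM = a , ≈v-refl
      hz : Normal z
      hz = axis-normal zM hy hM
      zπ : z ∈ π
      zπ = axis-in zM yπ Mπ
      zM′ : OnAxis y′ M′ z
      zM′ = - b , λ k → lc₁ (- 1#) (e k) (lemma (y k) (y′ k) (M k) (M′ k))
        where
        lemma : ∀ y y′ m m′ → (y + a * m) + - 1# * ((y + a * m) + b * m′) ≈ (y′ + - b * m′) + - 1# * y′
        lemma y y′ m m′ = ring! (y ∷ y′ ∷ m ∷ m′ ∷ a ∷ b ∷ [])
      sz : Special π z M
      sz = special-axis zM s
      sz′ : Special π z M′
      sz′ = special-axis zM′ s′
      nonpoint-absurd : ¬ NonPoint z
      nonpoint-absurd np = distinct sz (three-common {a = z} {M} {M′} (independent-frame hz hM hM′ ind) zπ Mπ M′π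
          (point-in sz) (dir-in sz) (from σ≗σ′ (dir-in sz′)))
        where
        σ≗σ′ : other sz ≗ other sz′
        σ≗σ′ = nonpoint-unique hz np cπ (other-C sz) (other-C sz′) zπ (point-in sz) (point-in sz′) (distinct sz) (distinct sz′)
      by-status : Status π z → ∃ λ i → c i ∈ π × OnAxis y M (c i) × OnAxis y′ M′ (c i)
      by-status (point i f) = i , InPlane.resp π f zπ , axis-resp f zM , axis-resp f zM′
      by-status (special np _ _ _ _ _) = ⊥-elim (nonpoint-absurd np)
      by-status (lonely ρ cρ π≠ρ zρ dρ alone) = ⊥-elim (nonpoint-absurd λ i f → dρ i (InPlane.resp ρ f zρ) (InPlane.resp π f zπ))

  infix 6 _↦_
  _↦_ : Vec5 → Vec5 → Vec5
  y ↦ z = z ⊕ ((- 1#) · y)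

  -- Points of the lines joining c i to c j and to c k.
  module TwoSecants {π} (cπ : CPlane π) {i j k} (i≢j : i ≢ j) (i≢k : i ≢ k) (j≢k : j ≢ k)
                    (iπ : c i ∈ π) (jπ : c j ∈ π) (kπ : c k ∈ π) where
    Position : Set
    Position = Fin q ⊎ Fin q

    end : Position → Index
    end (inj₁ _) = j
    end (inj₂ _) = k

    parameter : Position → K
    parameter (inj₁ t) = el t
    parameter (inj₂ t) = el t

    end-in : ∀ x → c (end x) ∈ π
    end-in (inj₁ _) = jπ
    end-in (inj₂ _) = kπ

    i≢end : ∀ x → i ≢ end x
    i≢end (inj₁ _) = i≢j
    i≢end (inj₂ _) = i≢k

    at : Position → Vec5
    at x = c i ⊕ (parameter x · (c i ↦ c (end x)))

    at-axis : ∀ x → OnAxis (c i) (c i ↦ c (end x)) (at x)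
    at-axis x = parameter x , ≈v-refl

    secant-inf : ∀ l → Inf (c i ↦ c l)
    secant-inf l = difference-inf (c-normal i) (c-normal l)

    at-normal : ∀ x → Normal (at x)
    at-normal x = axis-normal (at-axis x) (c-normal i) (secant-inf (end x))

    at-in : ∀ x → at x ∈ π
    at-in x = axis-in (at-axis x) iπ (InPlane.difference-in π (end-in x) iπ)

    secant-nonzero : ∀ x → NonZero (c i ↦ c (end x))
    secant-nonzero x e = i≢end x (c-injective (difference-zero {c i} {c (end x)} e))

    at-first : ∀ x → parameter x ≈ 0# → at x ≈v c i
    at-first x e l = lc₁ ((c i ↦ c (end x)) l) e (lemma (c i l) ((c i ↦ c (end x)) l) (parameter x))
      where
      lemma : ∀ u v p → u + p * v + v * 0# ≈ u + v * p
      lemma u v p = ring! (u ∷ v ∷ p ∷ [])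

    at-last : ∀ x → parameter x ≈ 1# → at x ≈v c (end x)
    at-last x e l = lc₁ ((c i ↦ c (end x)) l) e (lemma (c i l) (c (end x) l) (parameter x))
      where
      lemma : ∀ u v p → u + p * (v + - 1# * u) + (v + - 1# * u) * 1# ≈ v + (v + - 1# * u) * p
      lemma u v p = ring! (u ∷ v ∷ p ∷ [])

    at-point : ∀ x l → at x ≈v c l → parameter x ≈ 0# ⊎ parameter x ≈ 1#
    at-point x l e with l Fin.≟ i | l Fin.≟ end x
    ... | yes ≡.refl | _ = inj₁ (axis-inj {c i} {c i ↦ c (end x)} (secant-nonzero x)
            (≈v-trans e λ m → ring! (c i m ∷ c (end x) m ∷ [])))
    ... | _ | yes ≡.refl = inj₂ (axis-inj {c i} {c i ↦ c (end x)} (secant-nonzero x)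
            (≈v-trans e λ m → ring! (c i m ∷ c (end x) m ∷ [])))
    ... | no l≢i | no l≢end = ⊥-elim (no-three cπ (i≢end x) (λ f → l≢i (≡.sym f)) (λ f → l≢end (≡.sym f)) iπ (end-in x)
            (InPlane.resp π e (at-in x)) difference-axis (axis-resp e (at-axis x)))

    on-secant : ∀ x → ¬ parameter x ≈ 0# → OnAxis (c i) (at x ↦ c i) (c (end x))
    on-secant x p≉0 = - inv _ p≉0 , λ l → lc₁ (c i l - c (end x) l) (inv-right _ p≉0)
      (lemma (c i l) (c (end x) l) (parameter x) (inv _ p≉0))
      where
      lemma : ∀ u v p j → v + (u - v) * 1# ≈ u + - j * (u + - 1# * (u + p * (v + - 1# * u))) + (u - v) * (p * j)
      lemma u v p j = ring! (u ∷ v ∷ p ∷ j ∷ [])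

    at-injective : ∀ x x′ → at x ≈v at x′ → ¬ parameter x ≈ 0# → ¬ parameter x′ ≈ 0# → x ≡ x′
    at-injective (inj₁ s) (inj₁ t) e _ _ = ≡.cong inj₁ (el-injective (axis-inj {c i} {c i ↦ c j} (secant-nonzero (inj₁ s)) e))
    at-injective (inj₂ s) (inj₂ t) e _ _ = ≡.cong inj₂ (el-injective (axis-inj {c i} {c i ↦ c k} (secant-nonzero (inj₂ s)) e))
    at-injective (inj₁ s) (inj₂ t) e s≉0 t≉0 = ⊥-elim (no-three cπ i≢j i≢k j≢k iπ jπ kπ
      (on-secant (inj₁ s) s≉0) (axis-multiple {M = at (inj₂ t) ↦ c i} (1# , λ l → lc₁ 1# (e l) (lemma (c i l) (at (inj₁ s) l) (at (inj₂ t) l))) (on-secant (inj₂ t) t≉0)))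
      where
      lemma : ∀ u a b → (u + - 1# * b) + 1# * b ≈ 1# * (u + - 1# * a) + 1# * a
      lemma u a b = ring! (u ∷ a ∷ b ∷ [])
    at-injective (inj₂ s) (inj₁ t) e s≉0 t≉0 = ≡.sym (at-injective (inj₁ t) (inj₂ s) (≈v-sym e) t≉0 s≉0)

    -- Few points of the two secants are in 𝒞, are excluded by E, or are lonely.
    find-special : (E : Vec5 → Set) → (∀ y → Dec (E y)) → (∀ s t → E (at (inj₁ s)) → E (at (inj₁ t)) → s ≡ t) →
                   (∀ s t → E (at (inj₂ s)) → E (at (inj₂ t)) → s ≡ t) →
                   ∃ λ x → ¬ E (at x) × NonPoint (at x) × ∃ λ M → Inf M × NonZero M × M ∈ π × Special π (at x) M
    find-special E E? E₁ E₂ = conclude (search {X = Position} Finₚ.+↔⊎ {Good} (λ x → isSpecial? (st x) ×-dec ¬? (E? (at x))))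
      where
      st : ∀ x → Status π (at x)
      st x = status cπ (at-normal x) (at-in x)
      Good : Position → Set
      Good x = IsSpecial (st x) × ¬ E (at x)
      Excluded : Position → (Fin 3 ⊎ Fin 3) → Set
      reason : Position → Fin 3 → Set
      reason x zero = parameter x ≈ 0#
      reason x (suc zero) = parameter x ≈ 1#
      reason x (suc (suc zero)) = E (at x)
      Excluded (inj₁ s) (inj₁ r) = reason (inj₁ s) r
      Excluded (inj₂ s) (inj₂ r) = reason (inj₂ s) r
      Excluded (inj₁ s) (inj₂ _) = ⊥
      Excluded (inj₂ s) (inj₁ _) = ⊥
      exclude : ∀ x r → reason x r → ∃ (Excluded x)
      exclude (inj₁ s) r p = inj₁ r , p
      exclude (inj₂ s) r p = inj₂ r , p
      excluded-unique : ∀ {x x′} y → Excluded x y → Excluded x′ y → x ≡ x′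
      excluded-unique {inj₁ s} {inj₁ t} (inj₁ zero) a b = ≡.cong inj₁ (el-injective (trans a (sym b)))
      excluded-unique {inj₁ s} {inj₁ t} (inj₁ (suc zero)) a b = ≡.cong inj₁ (el-injective (trans a (sym b)))
      excluded-unique {inj₁ s} {inj₁ t} (inj₁ (suc (suc zero))) a b = ≡.cong inj₁ (E₁ s t a b)
      excluded-unique {inj₂ s} {inj₂ t} (inj₂ zero) a b = ≡.cong inj₂ (el-injective (trans a (sym b)))
      excluded-unique {inj₂ s} {inj₂ t} (inj₂ (suc zero)) a b = ≡.cong inj₂ (el-injective (trans a (sym b)))
      excluded-unique {inj₂ s} {inj₂ t} (inj₂ (suc (suc zero))) a b = ≡.cong inj₂ (E₂ s t a b)
      P : Position → Plane → Set
      P x ρ = Lonely π (at x) ρ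
      nonzero-parameter : ∀ {x ρ} → P x ρ → ¬ parameter x ≈ 0#
      nonzero-parameter {x} p e = Lonely.misses p i (InPlane.resp _ (at-first x e) (Lonely.contains p)) iπ
      distinct-planes : ∀ {x x′ ρ ρ′} → P x ρ → P x′ ρ′ → ρ ≗ ρ′ → x ≡ x′
      distinct-planes {x} {x′} p p′ e = at-injective x x′
        (Lonely.alone p′ (at x) (at-normal x) (at-in x) (to e (Lonely.contains p))) (nonzero-parameter {x} p) (nonzero-parameter {x′} p′)
      by-status : ∀ x (s : Status π (at x)) → ¬ (IsSpecial s × ¬ E (at x)) → ∃ (P x) ⊎ ∃ (Excluded x)
      by-status x (point l e) _ = inj₂ (end-point (at-point x l e))
        where
        end-point : parameter x ≈ 0# ⊎ parameter x ≈ 1# → ∃ (Excluded x)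
        end-point (inj₁ z) = exclude x zero z
        end-point (inj₂ o) = exclude x (suc zero) o
      by-status x (special _ _ _ _ _ _) ng = inj₂ (exclude x (suc (suc zero)) (Dec.decidable-stable (E? (at x)) λ ¬E → ng (_ , ¬E)))
      by-status x (lonely ρ cρ _ xρ dρ alone) _ = inj₁ (ρ , lonely-plane cρ xρ dρ alone)
      classify : ¬ ∃ Good → ∀ x → ∃ (P x) ⊎ ∃ (Excluded x)
      classify none x = by-status x (st x) (λ g → none (x , g))
      extract : ∀ {x} (s : Status π (at x)) → IsSpecial s → NonPoint (at x) × ∃ λ M → Inf M × NonZero M × M ∈ π × Special π (at x) M
      extract (special np M hM nz Mπ s) _ = np , M , hM , nz , Mπ , s
      conclude : Dec (∃ Good) → ∃ λ x → ¬ E (at x) × NonPoint (at x) × ∃ λ M → Inf M × NonZero M × M ∈ π × Special π (at x) M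
      conclude (yes (x , s , ¬E)) = x , ¬E , extract (st x) s
      conclude (no none) = ⊥-elim (ℕₚ.<⇒≱ (ℕₚ.+-monoʳ-< q 7≤q)
        (parallel-cover cπ {X = Position} {Y = Fin 3 ⊎ Fin 3} Finₚ.+↔⊎ Finₚ.+↔⊎ P Excluded (λ p → Lonely.isC p , inj₂ (Lonely.misses p))
          distinct-planes excluded-unique (classify none)))

  axis-two : ∀ {y M u d s t} → ¬ s ≈ t → OnAxis y M (u ⊕ (s · d)) → OnAxis y M (u ⊕ (t · d)) → ∀ r → OnAxis y M (u ⊕ (r · d))
  axis-two {y} {M} {u} {d} {s} {t} s≉t (a , e) (b , f) r =
    a + (r - s) * inv (s - t) n * (a - b) , λ l → lc₃ (1# + (r - s) * inv (s - t) n) (e l) (- ((r - s) * inv (s - t) n)) (f l)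
      (- ((r - s) * d l)) (inv-right (s - t) n) (lemma (y l) (M l) (u l) (d l) (inv (s - t) n))
    where
    n : ¬ s - t ≈ 0#
    n z = s≉t (diff-zero z)
    lemma : ∀ y m u d j → (u + r * d) + ((1# + (r - s) * j) * (y + a * m) + (- ((r - s) * j) * (y + b * m) + - ((r - s) * d) * 1#)) ≈
      (y + (a + (r - s) * j * (a - b)) * m) + ((1# + (r - s) * j) * (u + s * d) + (- ((r - s) * j) * (u + t * d) + - ((r - s) * d) * ((s - t) * j)))
    lemma y m u d j = ring! (y ∷ m ∷ u ∷ d ∷ j ∷ r ∷ s ∷ t ∷ a ∷ b ∷ [])

  record Axis (π : Plane) (N : Vec5) : Set where
    field
      N-inf     : Inf N
      N-nonzero : NonZero N
      N-in      : N ∈ π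
      only      : ∀ {y M} → Normal y → Inf M → NonZero M → y ∈ π → M ∈ π → Special π y M → Multiple N M

  -- Two special lines with the same direction force every special line to have
  -- that direction: another one would meet both in points of 𝒞.
  axis-from-two : ∀ {π y y′ N} → CPlane π → Normal y → Normal y′ → Inf N → NonZero N → y ∈ π → y′ ∈ π → N ∈ π →
                  Special π y N → Special π y′ N → ¬ OnAxis y N y′ → Axis π N
  axis-from-two {π} {y} {y′} {N} cπ hy hy′ hN N≉0 yπ y′π Nπ s s′ off = record
    { N-inf = hN ; N-nonzero = N≉0 ; N-in = Nπ ; only = only′ }
    where
    only′ : ∀ {z M} → Normal z → Inf M → NonZero M → z ∈ π → M ∈ π → Special π z M → Multiple N M
    only′ {z} {M} hz hM M≉0 zπ Mπ sz = Dec.decidable-stable (multiple? N M) absurd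
      where
      absurd : ¬ ¬ Multiple N M
      absurd ¬mult = twice (special-meet cπ hy hN N≉0 yπ Nπ s hz hM zπ Mπ sz ¬mult)
                           (special-meet cπ hy′ hN N≉0 y′π Nπ s′ hz hM zπ Mπ sz ¬mult)
        where
        twice : (∃ λ i → c i ∈ π × OnAxis y N (c i) × OnAxis z M (c i)) → (∃ λ i → c i ∈ π × OnAxis y′ N (c i) × OnAxis z M (c i)) → ⊥
        twice (i , iπ , iy , iz) (j , jπ , jy , jz) =
          off (axis-trans (≡.subst (λ l → OnAxis y N (c l)) (special-once cπ sz iπ jπ iz jz) iy) (axis-sym jy))

  some-special : ∀ {π} → CPlane π → ∃ λ y → Normal y × y ∈ π × ∃ λ M → Inf M × NonZero M × M ∈ π × Special π y M
  some-special {π} cπ = let x , _ , _ , M , hM , nz , Mπ , s = find-special (λ _ → ⊥) (λ _ → no λ ()) (λ _ _ ()) (λ _ _ ())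
                        in at x , at-normal x , at-in x , M , hM , nz , Mπ , s
    where
    open TwoSecants cπ (0≢1 ∘ pts-injective cπ) (0≢2 ∘ pts-injective cπ) (1≢2 ∘ pts-injective cπ)
           (pts-in cπ 0≢) (pts-in cπ 1≢) (pts-in cπ 2≢)

  -- If a special line ℓ = y + K M meets 𝒞 at most in c i, then a special line through a
  -- further point of the secants c i c j, c i c k either is parallel to ℓ
  -- or meets ℓ in c i, but then it is a secant.
  module SecondSpecial {π y M} (cπ : CPlane π) (hy : Normal y) (hM : Inf M) (M≉0 : NonZero M) (yπ : y ∈ π) (Mπ : M ∈ π) (s : Special π y M)
    {i j k} (i≢j : i ≢ j) (i≢k : i ≢ k) (j≢k : j ≢ k) (iπ : c i ∈ π) (jπ : c j ∈ π) (kπ : c k ∈ π)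
    (only-i : ∀ {l} → c l ∈ π → OnAxis y M (c l) → l ≡ i) where
    open TwoSecants cπ i≢j i≢k j≢k iπ jπ kπ

    secant-once : ∀ x t t′ → OnAxis y M (c i ⊕ (el t · (c i ↦ c (end x)))) → OnAxis y M (c i ⊕ (el t′ · (c i ↦ c (end x)))) → t ≡ t′
    secant-once x t t′ a b = Dec.decidable-stable (t Fin.≟ t′) λ t≢t′ →
      i≢end x (≡.sym (only-i (end-in x) (axis-resp (λ l → ring! (c i l ∷ c (end x) l ∷ []))
        (axis-two (λ e → t≢t′ (el-injective e)) a b 1#))))

    axis : ∃ (Axis π)
    axis = second (find-special (OnAxis y M) (onAxis? y M) (λ a b → secant-once (inj₁ a) a b) (λ a b → secant-once (inj₂ a) a b))
      where
      second : (∃ λ x → ¬ OnAxis y M (at x) × NonPoint (at x) × ∃ λ M′ → Inf M′ × NonZero M′ × M′ ∈ π × Special π (at x) M′) → ∃ (Axis π)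
      second (x , off , np , M′ , hM′ , M′≉0 , M′π , s′) = decide (multiple? M M′)
        where
        meets : ¬ ∃ λ l → c l ∈ π × OnAxis y M (c l) × OnAxis (at x) M′ (c l)
        meets (l , lπ , ly , lx) = i≢end x (special-once cπ s′ iπ (end-in x) meets-i
            (axis-trans meets-i (axis-multiple (axis-direction meets-i) (on-secant x λ e → np i (at-first x e)))))
          where
          meets-i : OnAxis (at x) M′ (c i)
          meets-i = ≡.subst (λ l → OnAxis (at x) M′ (c l)) (only-i lπ ly) lx
        decide : Dec (Multiple M M′) → ∃ (Axis π)
        decide (yes mult) = M , axis-from-two cπ hy (at-normal x) hM M≉0 yπ (at-in x) Mπ s (special-multiple (multiple-sym M′≉0 mult) s′) off
        decide (no ¬mult) = ⊥-elim (meets (special-meet cπ hy hM M≉0 yπ Mπ s (at-normal x) hM′ (at-in x) M′π s′ ¬mult))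

  two-others : ∀ t → ∃₂ λ u v → t ≢ u × t ≢ v × u ≢ v
  two-others t with t Fin.≟ 0≢ | t Fin.≟ 1≢
  ... | yes ≡.refl | _ = 1≢ , 2≢ , 0≢1 , 0≢2 , 1≢2
  ... | no a | yes ≡.refl = 0≢ , 2≢ , a , 1≢2 , 0≢2
  ... | no a | no b = 0≢ , 1≢ , a , b , 0≢1

  find-axis : ∀ {π} → CPlane π → ∃ (Axis π)
  find-axis {π} cπ = from-special (some-special cπ)
    where
    from-special : (∃ λ y → Normal y × y ∈ π × ∃ λ M → Inf M × NonZero M × M ∈ π × Special π y M) → ∃ (Axis π)
    from-special (y , hy , yπ , M , hM , M≉0 , Mπ , s) = decide (Finₚ.any? (λ t → onAxis? y M (c (pts cπ t))))
      where
      decide : Dec (∃ λ t → OnAxis y M (c (pts cπ t))) → ∃ (Axis π)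
      decide (yes (t , on)) = SecondSpecial.axis cπ hy hM M≉0 yπ Mπ s (proj₁ t≢ ∘ pts-injective cπ) (proj₁ (proj₂ t≢) ∘ pts-injective cπ) (proj₂ (proj₂ t≢) ∘ pts-injective cπ)
            (pts-in cπ t) (pts-in cπ u) (pts-in cπ v) (λ lπ l → special-once cπ s lπ (pts-in cπ t) l on)
        where
        u = proj₁ (two-others t)
        v = proj₁ (proj₂ (two-others t))
        t≢ = proj₂ (proj₂ (two-others t))
      decide (no none) = SecondSpecial.axis cπ hy hM M≉0 yπ Mπ s (0≢1 ∘ pts-injective cπ) (0≢2 ∘ pts-injective cπ) (1≢2 ∘ pts-injective cπ)
            (pts-in cπ 0≢) (pts-in cπ 1≢) (pts-in cπ 2≢)
            (λ lπ l → ⊥-elim (none (proj₁ (pts-all cπ lπ) , ≡.subst (λ l → OnAxis y M (c l)) (≡.sym (proj₂ (pts-all cπ lπ))) l)))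

  abstract
    axis-exists : ∀ {π} → CPlane π → ∃ (Axis π)
    axis-exists = find-axis

  open Joining
  open Axis

  index₀ index₁ : Index
  index₀ = combine 0≢ 0≢
  index₁ = combine 0≢ 1≢

  index₀≢index₁ : index₀ ≢ index₁
  index₀≢index₁ e = 0≢1 (Finₚ.combine-injectiveʳ 0≢ 0≢ 0≢ 1≢ e)

  abstract
    outside-two : ∀ {π ρ} → CPlane π → CPlane ρ → ∃ λ r → ¬ c r ∈ π × ¬ c r ∈ ρ
    outside-two {π} {ρ} cπ cρ = conclude (avoid (↔-id Index) (Finₚ.+↔⊎ {q} {q}) B B? unique
        (ℕₚ.≤-trans (ℕₚ.≤-reflexive (≡.cong suc (≡.cong (q ℕ.+_) (≡.sym (ℕₚ.+-identityʳ q)))))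
          (ℕₚ.*-monoˡ-< q {{ℕ.>-nonZero (ℕₚ.≤-trans (ℕ.s≤s ℕ.z≤n) 7≤q)}} (ℕₚ.≤-trans (ℕ.s≤s (ℕ.s≤s (ℕ.s≤s ℕ.z≤n))) 7≤q))))
      where
      B : Index → Fin q ⊎ Fin q → Set
      B i (inj₁ t) = pts cπ t ≡ i
      B i (inj₂ t) = pts cρ t ≡ i
      B? : ∀ i y → Dec (B i y)
      B? i (inj₁ t) = pts cπ t Fin.≟ i
      B? i (inj₂ t) = pts cρ t Fin.≟ i
      unique : ∀ {i j} y → B i y → B j y → i ≡ j
      unique (inj₁ t) e f = ≡.trans (≡.sym e) f
      unique (inj₂ t) e f = ≡.trans (≡.sym e) f
      conclude : (∃ λ i → ∀ y → ¬ B i y) → ∃ λ r → ¬ c r ∈ π × ¬ c r ∈ ρ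
      conclude (r , free) = r , (λ m → free (inj₁ _) (proj₂ (pts-all cπ m))) , (λ m → free (inj₂ _) (proj₂ (pts-all cρ m)))

  two-special : ∀ {π ρ y M} → CPlane ρ → π ≗̸ ρ → y ∈ ρ → M ∈ ρ → Special π y M
  two-special {ρ = ρ} cρ π≠ρ yρ Mρ = record { other = ρ ; other-C = cρ ; distinct = π≠ρ ; point-in = yρ ; dir-in = Mρ }

  multiple-in : ∀ {π N M} → Multiple N M → N ∈ π → M ∈ π
  multiple-in {π} (k , e) m = InPlane.resp π (≈v-sym e) (InPlane.scale π k m)

  axis-shared : ∀ {π ρ N y M} → Axis π N → CPlane ρ → π ≗̸ ρ → Normal y → Inf M → NonZero M →
                y ∈ π → M ∈ π → y ∈ ρ → M ∈ ρ → N ∈ ρ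
  axis-shared a cρ π≠ρ hy hM M≉0 yπ Mπ yρ Mρ =
    multiple-in (multiple-sym M≉0 (only a hy hM M≉0 yπ Mπ (two-special cρ π≠ρ yρ Mρ))) Mρ

  -- A line has points off 𝒞, which lie on at most two 𝒞-planes.
  triple-axis : ∀ {π ρ σ y N} → CPlane π → CPlane ρ → CPlane σ → π ≗̸ ρ → π ≗̸ σ → ρ ≗̸ σ → Normal y → Inf N → NonZero N →
                y ∈ π → y ∈ ρ → y ∈ σ → N ∈ π → N ∈ ρ → N ∈ σ → ⊥
  triple-axis {π} {ρ} {σ} {y} {N} cπ cρ cσ π≠ρ π≠σ ρ≠σ hy hN N≉0 yπ yρ yσ Nπ Nρ Nσ = decide (Finₚ.any? (λ i → y ≟v c i))
    where
    next : OnAxis y N (y ⊕ (1# · N))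
    next = axis-shift 1#
    decide : ¬ Dec (∃ λ i → y ≈v c i)
    decide (no np) = ρ≠σ (nonpoint-unique hy (λ i e → np (i , e)) cπ cρ cσ yπ yρ yσ π≠ρ π≠σ)
    decide (yes (i , e)) = ρ≠σ (nonpoint-unique (axis-normal next hy hN) np cπ cρ cσ
        (axis-in next yπ Nπ) (axis-in next yρ Nρ) (axis-in next yσ Nσ) π≠ρ π≠σ)
      where
      np : NonPoint (y ⊕ (1# · N))
      np j f = π≠ρ (meet-two cπ cρ i≢j (InPlane.resp π e yπ) (InPlane.resp π f (axis-in next yπ Nπ))
                                       (InPlane.resp ρ e yρ) (InPlane.resp ρ f (axis-in next yρ Nρ)))
        where
        i≢j : i ≢ j
        i≢j ≡.refl = N≉0 λ k → lc₂ 1# (f k) (- 1#) (e k) (ring! (y k ∷ N k ∷ c i k ∷ []))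

  points-independent : ∀ {π i j k} → CPlane π → i ≢ j → i ≢ k → j ≢ k → c i ∈ π → c j ∈ π → c k ∈ π →
                       Independent2 (c i ↦ c j) (c i ↦ c k)
  points-independent {π} {i} {j} {k} cπ i≢j i≢k j≢k iπ jπ kπ =
    independent₂ (λ e → i≢j (c-injective (difference-zero {c i} {c j} e)))
      (λ m → no-three cπ i≢j i≢k j≢k iπ jπ kπ difference-axis (axis-multiple m difference-axis))

  record Frame (π : Plane) : Set where
    field
      o u v : Vec5
      o-normal : Normal o
      u-inf : Inf u
      v-inf : Inf v
      o-in : o ∈ π
      u-in : u ∈ π
      v-in : v ∈ π
      uv : Independent2 u v

  frame : ∀ {π} → CPlane π → Frame π
  frame {π} cπ = record
    { o = c (pts cπ 0≢) ; u = c (pts cπ 0≢) ↦ c (pts cπ 1≢) ; v = c (pts cπ 0≢) ↦ c (pts cπ 2≢)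
    ; o-normal = c-normal _ ; u-inf = difference-inf (c-normal _) (c-normal _) ; v-inf = difference-inf (c-normal _) (c-normal _)
    ; o-in = pts-in cπ 0≢ ; u-in = InPlane.difference-in π (pts-in cπ 1≢) (pts-in cπ 0≢)
    ; v-in = InPlane.difference-in π (pts-in cπ 2≢) (pts-in cπ 0≢)
    ; uv = points-independent cπ (0≢1 ∘ pts-injective cπ) (0≢2 ∘ pts-injective cπ) (1≢2 ∘ pts-injective cπ)
             (pts-in cπ 0≢) (pts-in cπ 1≢) (pts-in cπ 2≢) }

  InSolid : Vec5 → Plane → Set
  InSolid g π = ∀ {w} → w ∈ π → g ∙ w ≈ 0#

  dependency-direction : ∀ {p u v u′ v′} → Normal p → Inf u → Inf v → Inf u′ → Inf v′ →
    Independent2 u v → Independent2 u′ v′ → (x : Fin 5 → K) → (∃ λ j → ¬ x j ≈ 0#) →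
    comb x (lookup (p ∷ u ∷ v ∷ u′ ∷ v′ ∷ [])) ≈v 0v → ∃ λ M → Inf M × NonZero M × InSpan2 M u v × InSpan2 M u′ v′
  dependency-direction {p} {u} {v} {u′} {v′} hp hu hv hu′ hv′ ind ind′ x (j , xj) e =
      M , M-inf , M-nonzero , (x₁ , x₂ , ≈v-refl) , (- x₃ , - x₄ , λ i → second x₀≈0 (e i))
    where
    x₀ = x zero
    x₁ = x (suc zero)
    x₂ = x (suc (suc zero))
    x₃ = x (suc (suc (suc zero)))
    x₄ = x (suc (suc (suc (suc zero))))
    M : Vec5
    M = (x₁ · u) ⊕ (x₂ · v)
    M-inf : Inf M
    M-inf = Kernel.add h (Kernel.scale h x₁ hu) (Kernel.scale h x₂ hv)
    M′ : Vec5
    M′ = (x₃ · u′) ⊕ (x₄ · v′)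
    M′-inf : Inf M′
    M′-inf = Kernel.add h (Kernel.scale h x₃ hu′) (Kernel.scale h x₄ hv′)
    regroup : ∀ {a b c d f p u v u′ v′} → a * p + (b * u + (c * v + (d * u′ + (f * v′ + 0#)))) ≈ 0# →
              a * p + 1# * (b * u + c * v) + 1# * (d * u′ + f * v′) ≈ 0#
    regroup {a} {b} {c} {d} {f} {p} {u} {v} {u′} {v′} e =
      lc₁ 1# e (ring! (a ∷ b ∷ c ∷ d ∷ f ∷ p ∷ u ∷ v ∷ u′ ∷ v′ ∷ []))
    height : ∀ {a b c d} → b ≈ 1# → c ≈ 0# → d ≈ 0# → a * b + 1# * c + 1# * d ≈ 0# → a ≈ 0#
    height {a} {b} {c} {d} eb ec ed f = lc₄ (- a) eb (- 1#) ec (- 1#) ed 1# f (ring! (a ∷ b ∷ c ∷ d ∷ []))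
    x₀≈0 : x₀ ≈ 0#
    x₀≈0 = height hp M-inf M′-inf (trans (sym (dot-comb₃ h x₀ p 1# M 1# M′))
      (trans (dot-cong h {v = 0# · p} (λ i → trans (regroup (e i)) (sym (zeroˡ _)))) (trans (dot-· h 0# p) (zeroˡ _))))
    second : ∀ {a b c d f p u v u′ v′} → a ≈ 0# → a * p + (b * u + (c * v + (d * u′ + (f * v′ + 0#)))) ≈ 0# →
             b * u + c * v ≈ - d * u′ + - f * v′
    second {a} {b} {c} {d} {f} {p} {u} {v} {u′} {v′} z e =
      lc₂ 1# e (- p) z (ring! (a ∷ b ∷ c ∷ d ∷ f ∷ p ∷ u ∷ v ∷ u′ ∷ v′ ∷ []))
    M-nonzero : NonZero M
    M-nonzero z = xj (all-zero j)
      where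
      first-zero : x₁ ≈ 0# × x₂ ≈ 0#
      first-zero = ind x₁ x₂ z
      last-zero : - x₃ ≈ 0# × - x₄ ≈ 0#
      last-zero = ind′ (- x₃) (- x₄) (λ i → trans (sym (second x₀≈0 (e i))) (z i))
      un-neg : ∀ {a} → - a ≈ 0# → a ≈ 0#
      un-neg {a} f = lc₁ (- 1#) f (ring! (a ∷ []))
      all-zero : ∀ j → x j ≈ 0#
      all-zero zero = x₀≈0
      all-zero (suc zero) = proj₁ first-zero
      all-zero (suc (suc zero)) = proj₂ first-zero
      all-zero (suc (suc (suc zero))) = un-neg (proj₁ last-zero)
      all-zero (suc (suc (suc (suc zero)))) = un-neg (proj₂ last-zero)

  -- Two 𝒞-planes in a solid have a common direction.
  solid-direction : ∀ {g μ ν} → NonZero g → CPlane μ → CPlane ν → InSolid g μ → InSolid g ν →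
                    ∃ λ M → Inf M × NonZero M × M ∈ μ × M ∈ ν
  solid-direction {g} {μ} {ν} g≉0 cμ cν gμ gν = conclude
      (dependency-direction F.o-normal F.u-inf F.v-inf G.u-inf G.v-inf F.uv G.uv (proj₁ d) (proj₁ (proj₂ d)) (proj₂ (proj₂ d)))
    where
    module F = Frame (frame cμ)
    module G = Frame (frame cν)
    vs : Vec Vec5 5
    vs = F.o ∷ F.u ∷ F.v ∷ G.u ∷ G.v ∷ []
    d : Dependent (lookup vs)
    d = kernel-dependent g≉0 (lookup vs) (lookup-all (λ v → g ∙ v ≈ 0#) vs (gμ F.o-in ∷ gμ F.u-in ∷ gμ F.v-in ∷ gν G.u-in ∷ gν G.v-in ∷ []))
    conclude : (∃ λ M → Inf M × NonZero M × InSpan2 M F.u F.v × InSpan2 M G.u G.v) → ∃ λ M → Inf M × NonZero M × M ∈ μ × M ∈ ν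
    conclude (M , hM , M≉0 , s , s′) = M , hM , M≉0 ,
      IsSubspace.span₂ (plane-subspace μ) F.u-in F.v-in s , IsSubspace.span₂ (plane-subspace ν) G.u-in G.v-in s′

  not-all-in-solid : ∀ {g} → NonZero g → ¬ (∀ i → g ∙ c i ≈ 0#)
  not-all-in-solid {g} g≉0 all = triple-axis cπ₁ cπ₂ cπ₃ π₁≠π₂ π₁≠π₃ π₂≠π₃ (c-normal index₀) (N-inf a) (N-nonzero a)
      (left J₁) (left J₂) (left J₃) (N-in a) (shared cπ₂ π₁≠π₂ (left J₂)) (shared cπ₃ π₁≠π₃ (left J₃))
    where
    J₁ : Joining index₀ index₁
    J₁ = join index₀≢index₁
    cπ₁ = isC J₁
    r₂ = outside cπ₁
    J₂ : Joining index₀ (proj₁ r₂)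
    J₂ = join (λ e → proj₂ r₂ (≡.subst (λ i → c i ∈ plane J₁) e (left J₁)))
    cπ₂ = isC J₂
    r₃ = outside-two cπ₁ cπ₂
    J₃ : Joining index₀ (proj₁ r₃)
    J₃ = join (λ e → proj₁ (proj₂ r₃) (≡.subst (λ i → c i ∈ plane J₁) e (left J₁)))
    cπ₃ = isC J₃
    π₁≠π₂ : plane J₁ ≗̸ plane J₂
    π₁≠π₂ e = proj₂ r₂ (from e (right J₂))
    π₁≠π₃ : plane J₁ ≗̸ plane J₃
    π₁≠π₃ e = proj₁ (proj₂ r₃) (from e (right J₃))
    π₂≠π₃ : plane J₂ ≗̸ plane J₃
    π₂≠π₃ e = proj₂ (proj₂ r₃) (from e (right J₃))
    N = proj₁ (axis-exists cπ₁)
    a : Axis (plane J₁) N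
    a = proj₂ (axis-exists cπ₁)
    in-solid : ∀ {π} → CPlane π → InSolid g π
    in-solid {π} cπ = plane-in-subspace (kernel-subspace g) π (Frame.o-in F) (Frame.u-in F) (Frame.v-in F)
        (independent-frame (Frame.o-normal F) (Frame.u-inf F) (Frame.v-inf F) (Frame.uv F))
        (all _) (Kernel.difference-in g (all _) (all _)) (Kernel.difference-in g (all _) (all _))
      where
      F : Frame π
      F = frame cπ
    shared : ∀ {ρ} → CPlane ρ → plane J₁ ≗̸ ρ → c index₀ ∈ ρ → N ∈ ρ
    shared {ρ} cρ π≠ρ m = from-direction (solid-direction g≉0 cπ₁ cρ (in-solid cπ₁) (in-solid cρ))
      where
      from-direction : (∃ λ M → Inf M × NonZero M × M ∈ plane J₁ × M ∈ ρ) → N ∈ ρ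
      from-direction (M , hM , M≉0 , Mπ , Mρ) = axis-shared a cρ π≠ρ (c-normal index₀) hM M≉0 (left J₁) Mπ m Mρ

  off-solid : ∀ {g} → NonZero g → ∃ λ r → ¬ g ∙ c r ≈ 0#
  off-solid {g} g≉0 = decide (Finₚ.any? (λ r → ¬? (g ∙ c r ≟ 0#)))
    where
    decide : Dec (∃ λ r → ¬ g ∙ c r ≈ 0#) → ∃ λ r → ¬ g ∙ c r ≈ 0#
    decide (yes p) = p
    decide (no none) = ⊥-elim (not-all-in-solid g≉0 λ i → Dec.decidable-stable (g ∙ c i ≟ 0#) λ n → none (i , n))

  solid-of-three : ∀ {π g i j k} → CPlane π → i ≢ j → i ≢ k → j ≢ k → c i ∈ π → c j ∈ π → c k ∈ π →
                   g ∙ c i ≈ 0# → g ∙ c j ≈ 0# → g ∙ c k ≈ 0# → InSolid g π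
  solid-of-three {π} {g} {i} {j} {k} cπ i≢j i≢k j≢k iπ jπ kπ gi gj gk =
    plane-in-subspace (kernel-subspace g) π iπ (InPlane.difference-in π jπ iπ) (InPlane.difference-in π kπ iπ)
      (independent-frame (c-normal i) (difference-inf (c-normal i) (c-normal j)) (difference-inf (c-normal i) (c-normal k))
        (points-independent cπ i≢j i≢k j≢k iπ jπ kπ))
      gi (Kernel.difference-in g gj gi) (Kernel.difference-in g gk gi)

  disjoint? : ∀ π ρ → Dec (Disjoint π ρ)
  disjoint? π ρ = decide (meet? π ρ)
    where
    decide : (∃ λ i → c i ∈ π × c i ∈ ρ) ⊎ Disjoint π ρ → Dec (Disjoint π ρ)
    decide (inj₁ (i , iπ , iρ)) = no λ d → d i iπ iρ
    decide (inj₂ d) = yes d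

  intersect : ∀ π ρ → ¬ Disjoint π ρ → ∃ λ i → c i ∈ π × c i ∈ ρ
  intersect π ρ nd = decide (meet? π ρ)
    where
    decide : (∃ λ i → c i ∈ π × c i ∈ ρ) ⊎ Disjoint π ρ → ∃ λ i → c i ∈ π × c i ∈ ρ
    decide (inj₁ m) = m
    decide (inj₂ d) = ⊥-elim (nd d)

  -- A 𝒞-plane through a point r off the solid meets it in at most two points of 𝒞,
  -- but if q ≥ 6 some 𝒞-plane through r meets all of μ₁, μ₂, μ₃ in different points.
  module ThreeInSolid {g μ₁ μ₂ μ₃} (g≉0 : NonZero g) (c₁ : CPlane μ₁) (c₂ : CPlane μ₂) (c₃ : CPlane μ₃)
    (μ₁≠μ₂ : μ₁ ≗̸ μ₂) (μ₁≠μ₃ : μ₁ ≗̸ μ₃) (μ₂≠μ₃ : μ₂ ≗̸ μ₃) (g₁ : InSolid g μ₁) (g₂ : InSolid g μ₂) (g₃ : InSolid g μ₃) where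
    r : Index
    r = proj₁ (off-solid g≉0)
    r-off : ¬ g ∙ c r ≈ 0#
    r-off = proj₂ (off-solid g≉0)
    r≢ : ∀ k → r ≢ pts c₁ k
    r≢ k e = r-off (≡.subst (λ i → g ∙ c i ≈ 0#) (≡.sym e) (g₁ (pts-in c₁ k)))
    J : ∀ k → Joining r (pts c₁ k)
    J k = join (r≢ k)
    J-injective : ∀ {k l} → plane (J k) ≗ plane (J l) → k ≡ l
    J-injective {k} {l} e = Dec.decidable-stable (k Fin.≟ l) λ k≢l →
      r-off (g₁ (to (meet-two (isC (J k)) c₁ {pts c₁ k} {pts c₁ l} (k≢l ∘ pts-injective c₁)
                       (right (J k)) (from e (right (J l))) (pts-in c₁ k) (pts-in c₁ l)) (left (J k))))
    Bad : Fin q → Fin 5 → Set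
    Bad k zero = c (pts c₁ k) ∈ μ₂
    Bad k (suc zero) = c (pts c₁ k) ∈ μ₃
    Bad k (suc (suc zero)) = Disjoint (plane (J k)) μ₂
    Bad k (suc (suc (suc zero))) = Disjoint (plane (J k)) μ₃
    Bad k (suc (suc (suc (suc zero)))) = ∃ λ i → c i ∈ plane (J k) × c i ∈ μ₂ × c i ∈ μ₃
    Bad? : ∀ k b → Dec (Bad k b)
    Bad? k zero = c (pts c₁ k) ∈? μ₂
    Bad? k (suc zero) = c (pts c₁ k) ∈? μ₃
    Bad? k (suc (suc zero)) = disjoint? (plane (J k)) μ₂
    Bad? k (suc (suc (suc zero))) = disjoint? (plane (J k)) μ₃
    Bad? k (suc (suc (suc (suc zero)))) = Finₚ.any? (λ i → (c i ∈? plane (J k)) ×-dec ((c i ∈? μ₂) ×-dec (c i ∈? μ₃)))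
    unique : ∀ {k l} b → Bad k b → Bad l b → k ≡ l
    unique {k} {l} zero a b = pts-injective c₁ (meet-once c₁ c₂ μ₁≠μ₂ (pts-in c₁ k) (pts-in c₁ l) a b)
    unique {k} {l} (suc zero) a b = pts-injective c₁ (meet-once c₁ c₃ μ₁≠μ₃ (pts-in c₁ k) (pts-in c₁ l) a b)
    unique {k} {l} (suc (suc zero)) a b = J-injective (playfair c₂ (isC (J k)) (isC (J l)) (left (J k)) (left (J l)) a b)
    unique {k} {l} (suc (suc (suc zero))) a b = J-injective (playfair c₃ (isC (J k)) (isC (J l)) (left (J k)) (left (J l)) a b)
    unique {k} {l} (suc (suc (suc (suc zero)))) (i , iJ , i₂ , i₃) (j , jJ , j₂ , j₃) =
      J-injective (meet-two (isC (J k)) (isC (J l)) {r} {i} r≢i (left (J k)) iJ (left (J l))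
        (≡.subst (λ x → c x ∈ plane (J l)) (meet-once c₂ c₃ μ₂≠μ₃ j₂ i₂ j₃ i₃) jJ))
      where
      r≢i : r ≢ i
      r≢i e = r-off (≡.subst (λ x → g ∙ c x ≈ 0#) (≡.sym e) (g₂ i₂))
    absurd : ⊥
    absurd = conclude (avoid (↔-id (Fin q)) (↔-id (Fin 5)) Bad Bad? unique (ℕₚ.≤-trans (ℕₚ.n≤1+n 6) 7≤q))
      where
      conclude : ¬ ∃ λ k → ∀ b → ¬ Bad k b
      conclude (k , good) = meets (intersect (plane (J k)) μ₂ (good (suc (suc zero)))) (intersect (plane (J k)) μ₃ (good (suc (suc (suc zero)))))
        where
        meets : (∃ λ i → c i ∈ plane (J k) × c i ∈ μ₂) → (∃ λ i → c i ∈ plane (J k) × c i ∈ μ₃) → ⊥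
        meets (i , iJ , i₂) (j , jJ , j₃) = r-off (solid-of-three {i = pts c₁ k} {i} {j} (isC (J k))
          (λ e → good zero (≡.subst (λ x → c x ∈ μ₂) (≡.sym e) i₂))
          (λ e → good (suc zero) (≡.subst (λ x → c x ∈ μ₃) (≡.sym e) j₃))
          (λ e → good (suc (suc (suc (suc zero)))) (i , iJ , i₂ , ≡.subst (λ x → c x ∈ μ₃) (≡.sym e) j₃))
          (right (J k)) iJ jJ (g₁ (pts-in c₁ k)) (g₂ i₂) (g₃ j₃) (left (J k)))

  -- Three 𝒞-planes with a common direction whose pairwise intersections contain affine
  -- points lie in a solid or have a common line.
  no-triangle : ∀ {π ρ κ N y₁ y₂ y₃} → CPlane π → CPlane ρ → CPlane κ → π ≗̸ ρ → π ≗̸ κ → ρ ≗̸ κ →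
                Inf N → NonZero N → N ∈ π → N ∈ ρ → N ∈ κ → Normal y₁ → Normal y₂ → Normal y₃ →
                y₁ ∈ π → y₁ ∈ ρ → y₂ ∈ π → y₂ ∈ κ → y₃ ∈ ρ → y₃ ∈ κ → ⊥
  no-triangle {π} {ρ} {κ} {N} {y₁} {y₂} {y₃} cπ cρ cκ π≠ρ π≠κ ρ≠κ hN N≉0 Nπ Nρ Nκ h₁ h₂ h₃ y₁π y₁ρ y₂π y₂κ y₃ρ y₃κ =
    ThreeInSolid.absurd (proj₁ (proj₂ ann)) cπ cρ cκ π≠ρ π≠κ ρ≠κ
      (plane-in-subspace ker π y₁π y₂π Nπ (independent-axis h₁ h₂ hN N≉0 off₁₂) z₁ z₂ zN)
      (plane-in-subspace ker ρ y₁ρ y₃ρ Nρ (independent-axis h₁ h₃ hN N≉0 off₁₃) z₁ z₃ zN)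
      (plane-in-subspace ker κ y₂κ y₃κ Nκ (independent-axis h₂ h₃ hN N≉0 off₂₃) z₂ z₃ zN)
    where
    off₁₂ : ¬ OnAxis y₁ N y₂
    off₁₂ a = triple-axis cπ cρ cκ π≠ρ π≠κ ρ≠κ h₁ hN N≉0 y₁π y₁ρ (axis-in (axis-sym a) y₂κ Nκ) Nπ Nρ Nκ
    off₁₃ : ¬ OnAxis y₁ N y₃
    off₁₃ a = triple-axis cπ cρ cκ π≠ρ π≠κ ρ≠κ h₁ hN N≉0 y₁π y₁ρ (axis-in (axis-sym a) y₃κ Nκ) Nπ Nρ Nκ
    off₂₃ : ¬ OnAxis y₂ N y₃
    off₂₃ a = triple-axis cπ cρ cκ π≠ρ π≠κ ρ≠κ h₂ hN N≉0 y₂π (axis-in (axis-sym a) y₃ρ Nρ) y₂κ Nπ Nρ Nκ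
    vs : Vec Vec5 4
    vs = y₁ ∷ y₂ ∷ y₃ ∷ N ∷ []
    ann : ∃ λ g → NonZero g × (∀ k → g ∙ lookup vs k ≈ 0#)
    ann = annihilator (lookup vs)
    ker : IsSubspace (λ v → proj₁ ann ∙ v ≈ 0#)
    ker = kernel-subspace (proj₁ ann)
    z₁ : proj₁ ann ∙ y₁ ≈ 0#
    z₁ = proj₂ (proj₂ ann) zero
    z₂ : proj₁ ann ∙ y₂ ≈ 0#
    z₂ = proj₂ (proj₂ ann) (suc zero)
    z₃ : proj₁ ann ∙ y₃ ≈ 0#
    z₃ = proj₂ (proj₂ ann) (suc (suc zero))
    zN : proj₁ ann ∙ N ≈ 0#
    zN = proj₂ (proj₂ ann) (suc (suc (suc zero)))

  open Axis
  open Joining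

  axis-transport : ∀ {π N M} → Axis π N → Inf M → NonZero M → Multiple N M → Axis π M
  axis-transport a hM M≉0 mult = record
    { N-inf = hM ; N-nonzero = M≉0 ; N-in = multiple-in mult (N-in a)
    ; only = λ hy hL L≉0 yπ Lπ s → multiple-trans (multiple-sym M≉0 mult) (only a hy hL L≉0 yπ Lπ s) }

  special-sym : ∀ {π y N} → CPlane π → y ∈ π → N ∈ π → (s : Special π y N) → Special (other s) y N
  special-sym cπ yπ Nπ s = two-special cπ (λ e → distinct s (≗-sym e)) yπ Nπ

  axis-of-other : ∀ {π y N} → CPlane π → Axis π N → Normal y → y ∈ π → (s : Special π y N) → Axis (other s) N
  axis-of-other {π} {y} {N} cπ a hy yπ s = transport (axis-exists (other-C s))
    where
    transport : ∃ (Axis (other s)) → Axis (other s) N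
    transport (M , b) = axis-transport b (N-inf a) (N-nonzero a)
      (only b hy (N-inf a) (N-nonzero a) (point-in s) (dir-in s) (special-sym cπ yπ (N-in a) s))

  step : Vec5 → Vec5 → Fin q → Vec5
  step y N t = y ⊕ (el t · N)

  step-axis : ∀ {y N} t → OnAxis y N (step y N t)
  step-axis t = el t , ≈v-refl

  axis-step : ∀ {y N z} → OnAxis y N z → ∃ λ t → z ≈v step y N t
  axis-step {y} {N} {z} (s , e) = ix s , λ i → trans (e i) (+-congˡ (*-congʳ (sym (el-ix s))))

  step-injective : ∀ {y N s t} → NonZero N → step y N s ≈v step y N t → s ≡ t
  step-injective N≉0 e = el-injective (axis-inj N≉0 e)

  record NonSpecial (π : Plane) (N y : Vec5) : Set where
    field
      base-normal : Normal y
      base-in     : y ∈ π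
      each        : ∀ t → (∃ λ i → step y N t ≈v c i) ⊎ ∃ (Lonely π (step y N t))
  open NonSpecial

  line-status : ∀ {π N y} → CPlane π → Axis π N → Normal y → y ∈ π → Special π y N ⊎ NonSpecial π N y
  line-status {π} {N} {y} cπ a hy yπ = decide (Finₚ.any? (λ t → isSpecial? (st t)))
    where
    st : ∀ t → Status π (step y N t)
    st t = status cπ (axis-normal (step-axis t) hy (N-inf a)) (axis-in (step-axis t) yπ (N-in a))
    extract : ∀ t (s : Status π (step y N t)) → IsSpecial s → Special π y N
    extract t (special _ M hM M≉0 Mπ s) _ = special-axis (axis-sym (step-axis t)) (special-multiple (multiple-sym M≉0
      (only a (axis-normal (step-axis t) hy (N-inf a)) hM M≉0 (axis-in (step-axis t) yπ (N-in a)) Mπ s)) s)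
    each′ : ∀ t (s : Status π (step y N t)) → ¬ IsSpecial s → (∃ λ i → step y N t ≈v c i) ⊎ ∃ (Lonely π (step y N t))
    each′ t (point i e) _ = inj₁ (i , e)
    each′ t (special _ _ _ _ _ _) n = ⊥-elim (n _)
    each′ t (lonely ρ cρ _ m d alone) _ = inj₂ (ρ , lonely-plane cρ m d alone)
    decide : Dec (∃ λ t → IsSpecial (st t)) → Special π y N ⊎ NonSpecial π N y
    decide (yes (t , s)) = inj₁ (extract t (st t) s)
    decide (no none) = inj₂ (record { base-normal = hy ; base-in = yπ ; each = λ t → each′ t (st t) λ s → none (t , s) })

  points-on-axis : ∀ {π N y} → CPlane π → NonZero N → y ∈ π → N ∈ π →
                   ∃₂ λ t₁ t₂ → ∀ t i → step y N t ≈v c i → t ≡ t₁ ⊎ t ≡ t₂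
  points-on-axis {π} {N} {y} cπ N≉0 yπ Nπ = first (Finₚ.any? hit?)
    where
    Hit : Fin q → Set
    Hit t = ∃ λ i → step y N t ≈v c i
    hit? : ∀ t → Dec (Hit t)
    hit? t = Finₚ.any? (λ i → step y N t ≟v c i)
    hit-in : ∀ {t i} → step y N t ≈v c i → c i ∈ π
    hit-in {t} e = InPlane.resp π e (axis-in (step-axis t) yπ Nπ)
    different : ∀ {s t i j} → s ≢ t → step y N s ≈v c i → step y N t ≈v c j → i ≢ j
    different s≢t e f ≡.refl = s≢t (step-injective {y} {N} N≉0 (≈v-trans e (≈v-sym f)))
    aligned : ∀ {s t i j} → step y N s ≈v c i → step y N t ≈v c j → OnAxis (c i) N (c j)
    aligned {s} {t} e f = axis-trans (axis-sym (axis-resp e (step-axis s))) (axis-resp f (step-axis t))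
    first : Dec (∃ Hit) → ∃₂ λ t₁ t₂ → ∀ t i → step y N t ≈v c i → t ≡ t₁ ⊎ t ≡ t₂
    first (no none) = 0≢ , 0≢ , λ t i e → ⊥-elim (none (t , i , e))
    first (yes (t₁ , i₁ , e₁)) = second (Finₚ.any? (λ t → ¬? (t Fin.≟ t₁) ×-dec hit? t))
      where
      second : Dec (∃ λ t → t ≢ t₁ × Hit t) → ∃₂ λ t₁ t₂ → ∀ t i → step y N t ≈v c i → t ≡ t₁ ⊎ t ≡ t₂
      second (no none) = t₁ , t₁ , λ t i e → inj₁ (Dec.decidable-stable (t Fin.≟ t₁) λ n → none (t , n , i , e))
      second (yes (t₂ , t₂≢t₁ , i₂ , e₂)) = t₁ , t₂ , third
        where
        third : ∀ t i → step y N t ≈v c i → t ≡ t₁ ⊎ t ≡ t₂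
        third t i e = either (t Fin.≟ t₁) (t Fin.≟ t₂)
          where
          either : Dec (t ≡ t₁) → Dec (t ≡ t₂) → t ≡ t₁ ⊎ t ≡ t₂
          either (yes p) _ = inj₁ p
          either _ (yes p) = inj₂ p
          either (no p) (no p′) = ⊥-elim (no-three cπ (different (λ f → t₂≢t₁ (≡.sym f)) e₁ e₂) (different (λ f → p (≡.sym f)) e₁ e)
            (different (λ f → p′ (≡.sym f)) e₂ e) (hit-in e₁) (hit-in e₂) (hit-in e) (aligned e₁ e₂) (aligned e₁ e))

  lonely-injective : ∀ {π N y y′ ρ ρ′ s t} → Normal y → y ∈ π → Inf N → N ∈ π →
                     Lonely π (step y N s) ρ → Lonely π (step y′ N t) ρ′ → ρ ≗ ρ′ → step y N s ≈v step y′ N t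
  lonely-injective {s = s} hy yπ hN Nπ p p′ e =
    Lonely.alone p′ _ (axis-normal (step-axis s) hy hN) (axis-in (step-axis s) yπ Nπ) (to e (Lonely.contains p))

  nonspecial-unique : ∀ {π N y y′} → CPlane π → Axis π N → NonSpecial π N y → NonSpecial π N y′ → OnAxis y N y′
  nonspecial-unique {π} {N} {y} {y′} cπ a n n′ = Dec.decidable-stable (onAxis? y N y′) λ off →
      ℕₚ.<⇒≱ (ℕₚ.+-monoʳ-< q (ℕₚ.≤-trans (ℕₚ.m≤n+m 5 2) 7≤q))
        (parallel-cover cπ {X = Fin q ⊎ Fin q} {Y = Fin 2 ⊎ Fin 2} Finₚ.+↔⊎ Finₚ.+↔⊎ P B
          (λ {x} p → P-isC x p , inj₂ (P-misses x p)) (λ {x} {x′} p p′ e → P-distinct off x x′ p p′ e) (λ {x} {x′} → unique x x′) classify)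
    where
    hits : ∀ {y} → NonSpecial π N y → ∃₂ λ t₁ t₂ → ∀ t i → step y N t ≈v c i → t ≡ t₁ ⊎ t ≡ t₂
    hits n = points-on-axis cπ (N-nonzero a) (base-in n) (N-in a)
    P : Fin q ⊎ Fin q → Plane → Set
    P (inj₁ t) = Lonely π (step y N t)
    P (inj₂ t) = Lonely π (step y′ N t)
    P-isC : ∀ x {ρ} → P x ρ → CPlane ρ
    P-isC (inj₁ t) = Lonely.isC
    P-isC (inj₂ t) = Lonely.isC
    P-misses : ∀ x {ρ} → P x ρ → Disjoint ρ π
    P-misses (inj₁ t) = Lonely.misses
    P-misses (inj₂ t) = Lonely.misses
    Is : ∀ {y} → NonSpecial π N y → Fin q → Fin 2 → Set
    Is n t zero = t ≡ proj₁ (hits n)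
    Is n t (suc zero) = t ≡ proj₁ (proj₂ (hits n))
    B : Fin q ⊎ Fin q → Fin 2 ⊎ Fin 2 → Set
    B (inj₁ t) (inj₁ b) = Is n t b
    B (inj₂ t) (inj₂ b) = Is n′ t b
    B (inj₁ _) (inj₂ _) = ⊥
    B (inj₂ _) (inj₁ _) = ⊥
    Is-unique : ∀ {y} (n : NonSpecial π N y) b {s t} → Is n s b → Is n t b → s ≡ t
    Is-unique n zero e f = ≡.trans e (≡.sym f)
    Is-unique n (suc zero) e f = ≡.trans e (≡.sym f)
    unique : ∀ x x′ b → B x b → B x′ b → x ≡ x′
    unique (inj₁ s) (inj₁ t) (inj₁ b) e f = ≡.cong inj₁ (Is-unique n b e f)
    unique (inj₂ s) (inj₂ t) (inj₂ b) e f = ≡.cong inj₂ (Is-unique n′ b e f)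
    unique (inj₁ s) _ (inj₂ b) () _
    unique (inj₂ s) _ (inj₁ b) () _
    unique (inj₁ s) (inj₂ t) (inj₁ b) _ ()
    unique (inj₂ s) (inj₁ t) (inj₂ b) _ ()
    hit : ∀ {y} (n : NonSpecial π N y) {t i} → step y N t ≈v c i → ∃ (Is n t)
    hit n {t} {i} e = choose (proj₂ (proj₂ (hits n)) t i e)
      where
      choose : t ≡ proj₁ (hits n) ⊎ t ≡ proj₁ (proj₂ (hits n)) → ∃ (Is n t)
      choose (inj₁ f) = zero , f
      choose (inj₂ f) = suc zero , f
    classify : ∀ x → ∃ (P x) ⊎ ∃ (B x)
    classify (inj₁ t) = sort (each n t)
      where
      sort : (∃ λ i → step y N t ≈v c i) ⊎ ∃ (Lonely π (step y N t)) → ∃ (P (inj₁ t)) ⊎ ∃ (B (inj₁ t))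
      sort (inj₁ (i , e)) = inj₂ (inj₁ (proj₁ (hit n e)) , proj₂ (hit n e))
      sort (inj₂ l) = inj₁ l
    classify (inj₂ t) = sort (each n′ t)
      where
      sort : (∃ λ i → step y′ N t ≈v c i) ⊎ ∃ (Lonely π (step y′ N t)) → ∃ (P (inj₂ t)) ⊎ ∃ (B (inj₂ t))
      sort (inj₁ (i , e)) = inj₂ (inj₂ (proj₁ (hit n′ e)) , proj₂ (hit n′ e))
      sort (inj₂ l) = inj₁ l
    module _ (off : ¬ OnAxis y N y′) where
      crossing : ∀ {s t} → ¬ step y N s ≈v step y′ N t
      crossing {s} {t} e = off (axis-trans (axis-resp e (step-axis s)) (axis-sym (step-axis t)))
      P-distinct : ∀ x x′ {ρ ρ′} → P x ρ → P x′ ρ′ → ρ ≗ ρ′ → x ≡ x′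
      P-distinct (inj₁ s) (inj₁ t) p p′ e = ≡.cong inj₁ (step-injective {y} {N} (N-nonzero a)
        (lonely-injective (base-normal n) (base-in n) (N-inf a) (N-in a) p p′ e))
      P-distinct (inj₂ s) (inj₂ t) p p′ e = ≡.cong inj₂ (step-injective {y′} {N} (N-nonzero a)
        (lonely-injective (base-normal n′) (base-in n′) (N-inf a) (N-in a) p p′ e))
      P-distinct (inj₁ s) (inj₂ t) p p′ e = ⊥-elim (crossing {s} {t} (lonely-injective (base-normal n) (base-in n) (N-inf a) (N-in a) p p′ e))
      P-distinct (inj₂ s) (inj₁ t) p p′ e = ⊥-elim (crossing {t} {s} (lonely-injective (base-normal n) (base-in n) (N-inf a) (N-in a) p′ p (≗-sym e)))

  abstract
    line-frame : ∀ {π N} → CPlane π → Inf N → NonZero N → ∃ λ n → Inf n × n ∈ π × Independent2 N n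
    line-frame {π} {N} cπ hN N≉0 = decide (multiple? N F.u) (multiple? N F.v)
      where
      module F = Frame (frame cπ)
      decide : Dec (Multiple N F.u) → Dec (Multiple N F.v) → ∃ λ n → Inf n × n ∈ π × Independent2 N n
      decide (no ¬m) _ = F.u , F.u-inf , F.u-in , independent₂ N≉0 ¬m
      decide (yes _) (no ¬m) = F.v , F.v-inf , F.v-in , independent₂ N≉0 ¬m
      decide (yes m) (yes m′) = ⊥-elim (independent₂-not-multiple F.uv
        (multiple-trans (multiple-sym (proj₁ (independent₂-nonzero F.uv)) m) m′))

  module Lines {π N} (cπ : CPlane π) (a : Axis π N) {o} (ho : Normal o) (oπ : o ∈ π) where
    private
      transversal = line-frame cπ (N-inf a) (N-nonzero a)
    n : Vec5
    n = proj₁ transversal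
    n-inf : Inf n
    n-inf = proj₁ (proj₂ transversal)
    n-in : n ∈ π
    n-in = proj₁ (proj₂ (proj₂ transversal))
    ind : Independent2 N n
    ind = proj₂ (proj₂ (proj₂ transversal))
    line : Fin q → Vec5
    line = step o n
    line-normal : ∀ t → Normal (line t)
    line-normal t = axis-normal (step-axis t) ho n-inf
    line-in : ∀ t → line t ∈ π
    line-in t = axis-in (step-axis t) oπ n-in
    line-injective : ∀ {s t} → OnAxis (line s) N (line t) → s ≡ t
    line-injective {s} {t} (k , e) = el-injective (diff-zero (proj₂ zeros))
      where
      zeros : k ≈ 0# × el s - el t ≈ 0#
      zeros = ind k (el s - el t) (λ i → lc₁ (- 1#) (e i) (ring! (o i ∷ N i ∷ n i ∷ el s ∷ el t ∷ k ∷ [])))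
    line-of : ∀ {w} → Normal w → w ∈ π → ∃ λ t → OnAxis (line t) N w
    line-of {w} hw wπ = convert (frame-coordinates π ho (N-inf a) n-inf ind oπ (N-in a) n-in hw wπ)
      where
      convert : (∃₂ λ s t → w ≈v ((o ⊕ (s · N)) ⊕ (t · n))) → ∃ λ t → OnAxis (line t) N w
      convert (s , t , e) = ix t , (s , λ i → lc₂ 1# (e i) (- n i) (el-ix t) (ring! (w i ∷ o i ∷ N i ∷ n i ∷ s ∷ t ∷ el (ix t) ∷ [])))

  -- If every line in direction N is special, each contains at most one of the q
  -- points of π ∩ 𝒞, hence exactly one.
  special-meets : ∀ {π N} → CPlane π → Axis π N → (∀ {y} → Normal y → y ∈ π → Special π y N) →
                  ∀ {y} → Normal y → y ∈ π → ∃ λ i → c i ∈ π × OnAxis y N (c i)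
  special-meets {π} {N} cπ a spec {y} hy yπ = conclude (injective⇒surjective f injective (ix 0#))
    where
    open Lines cπ a hy yπ
    where-is : ∀ k → ∃ λ t → OnAxis (line t) N (c (pts cπ k))
    where-is k = line-of (c-normal _) (pts-in cπ k)
    f : Fin q → Fin q
    f k = proj₁ (where-is k)
    injective : Injective _≡_ _≡_ f
    injective {k} {l} e = pts-injective cπ (special-once cπ (spec (line-normal (f k)) (line-in (f k))) (pts-in cπ k) (pts-in cπ l)
      (proj₂ (where-is k)) (≡.subst (λ t → OnAxis (line t) N (c (pts cπ l))) (≡.sym e) (proj₂ (where-is l))))
    base : OnAxis y N (line (ix 0#))
    base = axis-resp (λ i → sym (trans (+-congˡ (trans (*-congʳ (el-ix 0#)) (zeroˡ _))) (+-identityʳ _))) axis-self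
    conclude : (∃ λ k → f k ≡ ix 0#) → ∃ λ i → c i ∈ π × OnAxis y N (c i)
    conclude (k , hits) = pts cπ k , pts-in cπ k ,
      axis-trans base (≡.subst (λ t → OnAxis (line t) N (c (pts cπ k))) hits (proj₂ (where-is k)))

  -- Consequences of a line in direction N all of whose points outside 𝒞 are lonely.
  module Exceptional {π N y₀} (cπ : CPlane π) (a : Axis π N) (n₀ : NonSpecial π N y₀) where
    special-off : ∀ {y} → Normal y → y ∈ π → ¬ OnAxis y₀ N y → Special π y N
    special-off {y} hy yπ off = decide (line-status cπ a hy yπ)
      where
      decide : Special π y N ⊎ NonSpecial π N y → Special π y N
      decide (inj₁ s) = s
      decide (inj₂ n) = ⊥-elim (off (nonspecial-unique cπ a n₀ n))

    others-disjoint : ∀ {y y′ z} → Normal y → Normal y′ → y ∈ π → y′ ∈ π → ¬ OnAxis y N y′ → (s : Special π y N) (s′ : Special π y′ N) →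
                      Normal z → z ∈ other s → z ∈ other s′ → ⊥
    others-disjoint {y} {y′} hy hy′ yπ y′π off s s′ hz zs zs′ =
      no-triangle cπ (other-C s) (other-C s′) (distinct s) (distinct s′) different (N-inf a) (N-nonzero a) (N-in a) (dir-in s) (dir-in s′)
        hy hy′ hz yπ (point-in s) y′π (point-in s′) zs zs′
      where
      different : other s ≗̸ other s′
      different e = distinct s (three-common {a = y} {y′} {N} (independent-axis hy hy′ (N-inf a) (N-nonzero a) off)
        yπ y′π (N-in a) (point-in s) (from e (point-in s′)) (dir-in s))

    point-off : ∃ λ i → c i ∈ π × ¬ OnAxis y₀ N (c i)
    point-off = decide (onAxis? y₀ N (c (pts cπ 0≢))) (onAxis? y₀ N (c (pts cπ 1≢))) (onAxis? y₀ N (c (pts cπ 2≢)))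
      where
      decide : Dec (OnAxis y₀ N (c (pts cπ 0≢))) → Dec (OnAxis y₀ N (c (pts cπ 1≢))) → Dec (OnAxis y₀ N (c (pts cπ 2≢))) →
               ∃ λ i → c i ∈ π × ¬ OnAxis y₀ N (c i)
      decide (no f) _ _ = _ , pts-in cπ 0≢ , f
      decide _ (no f) _ = _ , pts-in cπ 1≢ , f
      decide _ _ (no f) = _ , pts-in cπ 2≢ , f
      decide (yes e) (yes f) (yes g) = ⊥-elim (no-three cπ (0≢1 ∘ pts-injective cπ) (0≢2 ∘ pts-injective cπ) (1≢2 ∘ pts-injective cπ)
        (pts-in cπ 0≢) (pts-in cπ 1≢) (pts-in cπ 2≢) (axis-trans (axis-sym e) f) (axis-trans (axis-sym e) g))

    has-point : ∀ {y} → Normal y → y ∈ π → ¬ OnAxis y₀ N y → ∃ λ i → c i ∈ π × OnAxis y N (c i)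
    has-point {y} hy yπ off = decide (Finₚ.any? (λ i → (c i ∈? π) ×-dec onAxis? y N (c i)))
      where
      decide : Dec (∃ λ i → c i ∈ π × OnAxis y N (c i)) → ∃ λ i → c i ∈ π × OnAxis y N (c i)
      decide (yes p) = p
      decide (no none) = ⊥-elim (distinct sp (playfair (other-C s) cπ (other-C sp) pπ (point-in sp) π-misses sp-misses))
        where
        s : Special π y N
        s = special-off hy yπ off
        p = proj₁ point-off
        pπ : c p ∈ π
        pπ = proj₁ (proj₂ point-off)
        sp : Special π (c p) N
        sp = special-off (c-normal p) pπ (proj₂ (proj₂ point-off))
        π-misses : Disjoint π (other s)
        π-misses i iπ is = none (i , iπ , common-axis (distinct s) hy (c-normal i) (N-inf a) (N-nonzero a) yπ (N-in a) iπ (point-in s) (dir-in s) is)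
        sp-misses : Disjoint (other sp) (other s)
        sp-misses i isp is = others-disjoint hy (c-normal p) yπ pπ (λ on → none (p , pπ , on)) s sp (c-normal i) is isp

    open Lines cπ a (base-normal n₀) (base-in n₀)

    line-off : ∀ {t} → ¬ el t ≈ 0# → ¬ OnAxis y₀ N (line t)
    line-off {t} t≉0 (k , e) = t≉0 (lc₁ (- 1#) (proj₂ zeros) (ring! (el t ∷ [])))
      where
      zeros : k ≈ 0# × - el t ≈ 0#
      zeros = ind k (- el t) (λ i → lc₁ (- 1#) (e i) (ring! (y₀ i ∷ N i ∷ n i ∷ el t ∷ k ∷ [])))

    -- The other q - 1 lines have a point each, so this one has at most one.
    at-most-one : ∀ {i j} → c i ∈ π → c j ∈ π → OnAxis y₀ N (c i) → OnAxis y₀ N (c j) → i ≡ j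
    at-most-one {i} {j} iπ jπ iN jN = conclude (injective⇒surjective f f-injective (proj₁ (pts-all cπ jπ)))
      where
      K-zero? : ∀ t → Dec (el t ≈ 0#)
      K-zero? t = el t ≟ 0#
      choice : ∀ t → Dec (el t ≈ 0#) → ∃ λ l → c l ∈ π × OnAxis (line t) N (c l)
      choice t (yes z) = i , iπ , axis-trans (axis-sym (axis-resp (λ k → lc₁ (- n k) z (ring! (y₀ k ∷ n k ∷ el t ∷ []))) axis-self)) iN
      choice t (no z) = has-point (line-normal t) (line-in t) (line-off z)
      chosen : ∀ t → ∃ λ l → c l ∈ π × OnAxis (line t) N (c l)
      chosen t = choice t (K-zero? t)
      f : Fin q → Fin q
      f t = proj₁ (pts-all cπ (proj₁ (proj₂ (chosen t))))
      f-line : ∀ t → OnAxis (line t) N (c (pts cπ (f t)))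
      f-line t = ≡.subst (λ l → OnAxis (line t) N (c l)) (≡.sym (proj₂ (pts-all cπ (proj₁ (proj₂ (chosen t)))))) (proj₂ (proj₂ (chosen t)))
      f-injective : Injective _≡_ _≡_ f
      f-injective {s} {t} e = line-injective (axis-trans (f-line s) (axis-sym (≡.subst (λ k → OnAxis (line t) N (c (pts cπ k))) (≡.sym e) (f-line t))))
      conclude : (∃ λ t → f t ≡ proj₁ (pts-all cπ jπ)) → i ≡ j
      conclude (t , e) = decide (el t ≟ 0#) ≡.refl
        where
        is-j : pts cπ (f t) ≡ j
        is-j = ≡.trans (≡.cong (pts cπ) e) (proj₂ (pts-all cπ jπ))
        decide : ∀ d → d ≡ K-zero? t → i ≡ j
        decide (no z) _ = ⊥-elim (line-off z (axis-trans jN (axis-sym (≡.subst (λ l → OnAxis (line t) N (c l)) is-j (f-line t)))))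
        decide (yes z) d≡ = ≡.trans (≡.cong (λ d → proj₁ (choice t d)) d≡) (≡.trans (≡.sym (proj₂ (pts-all cπ (proj₁ (proj₂ (chosen t)))))) is-j)

    -- Every 𝒞-plane missing π in 𝒞 shares an affine point with π: otherwise it, π and the
    -- planes of the lonely points would be too many.
    no-parallel : ∀ {ρ} → CPlane ρ → Disjoint ρ π → (∀ z → Normal z → z ∈ π → ¬ z ∈ ρ) → ⊥
    no-parallel {ρ} cρ dρ apart = ℕₚ.<⇒≱ (ℕₚ.+-monoʳ-< q (ℕₚ.n<1+n 1))
        (parallel-cover cπ {X = Fin q ⊎ Fin 2} {Y = Fin 1} Finₚ.+↔⊎ (↔-id (Fin 1)) P B (λ {x} → parallel x)
          (λ {x} {x′} → P-distinct x x′) (λ {x} {x′} → unique x x′) classify)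
      where
      P : Fin q ⊎ Fin 2 → Plane → Set
      P (inj₁ t) κ = Lonely π (step y₀ N t) κ
      P (inj₂ zero) κ = CPlane κ × κ ≗ π
      P (inj₂ (suc zero)) κ = CPlane κ × κ ≗ ρ
      B : Fin q ⊎ Fin 2 → Fin 1 → Set
      B (inj₁ t) _ = ∃ λ i → step y₀ N t ≈v c i
      B (inj₂ _) _ = ⊥
      parallel : ∀ x {κ} → P x κ → CPlane κ × (κ ≗ π ⊎ Disjoint κ π)
      parallel (inj₁ t) p = Lonely.isC p , inj₂ (Lonely.misses p)
      parallel (inj₂ zero) (cκ , e) = cκ , inj₁ e
      parallel (inj₂ (suc zero)) (cκ , e) = cκ , inj₂ λ i iκ → dρ i (to e iκ)
      step-normal : ∀ t → Normal (step y₀ N t)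
      step-normal t = axis-normal (step-axis t) (base-normal n₀) (N-inf a)
      step-in : ∀ t → step y₀ N t ∈ π
      step-in t = axis-in (step-axis t) (base-in n₀) (N-in a)
      P-distinct : ∀ x x′ {κ κ′} → P x κ → P x′ κ′ → κ ≗ κ′ → x ≡ x′
      P-distinct (inj₁ s) (inj₁ t) p p′ e = ≡.cong inj₁ (step-injective {y₀} {N} (N-nonzero a)
        (lonely-injective (base-normal n₀) (base-in n₀) (N-inf a) (N-in a) p p′ e))
      P-distinct (inj₁ s) (inj₂ zero) p (_ , f) e = ⊥-elim (Lonely.misses p _ (from e (from f (pts-in cπ 0≢))) (pts-in cπ 0≢))
      P-distinct (inj₂ zero) (inj₁ t) (_ , f) p e = ⊥-elim (Lonely.misses p _ (to e (from f (pts-in cπ 0≢))) (pts-in cπ 0≢))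
      P-distinct (inj₁ s) (inj₂ (suc zero)) p (_ , f) e = ⊥-elim (apart _ (step-normal s) (step-in s) (to f (to e (Lonely.contains p))))
      P-distinct (inj₂ (suc zero)) (inj₁ t) (_ , f) p e = ⊥-elim (apart _ (step-normal t) (step-in t) (to f (from e (Lonely.contains p))))
      P-distinct (inj₂ zero) (inj₂ zero) _ _ _ = ≡.refl
      P-distinct (inj₂ (suc zero)) (inj₂ (suc zero)) _ _ _ = ≡.refl
      P-distinct (inj₂ zero) (inj₂ (suc zero)) (_ , f) (_ , f′) e = ⊥-elim (dρ _ (to f′ (to e (from f (pts-in cπ 0≢)))) (pts-in cπ 0≢))
      P-distinct (inj₂ (suc zero)) (inj₂ zero) (_ , f) (_ , f′) e = ⊥-elim (dρ _ (to f (from e (from f′ (pts-in cπ 0≢)))) (pts-in cπ 0≢))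
      unique : ∀ x x′ b → B x b → B x′ b → x ≡ x′
      unique (inj₁ s) (inj₁ t) _ (i , e) (j , f) = ≡.cong inj₁ (step-injective {y₀} {N} (N-nonzero a)
        (≈v-trans e (≈v-trans (λ k → reflexive (≡.cong (λ l → c l k) i≡j)) (≈v-sym f))))
        where
        i≡j : i ≡ j
        i≡j = at-most-one (InPlane.resp π e (step-in s)) (InPlane.resp π f (step-in t)) (axis-resp e (step-axis s)) (axis-resp f (step-axis t))
      classify : ∀ x → ∃ (P x) ⊎ ∃ (B x)
      classify (inj₁ t) = sort (each n₀ t)
        where
        sort : (∃ λ i → step y₀ N t ≈v c i) ⊎ ∃ (Lonely π (step y₀ N t)) → ∃ (P (inj₁ t)) ⊎ ∃ (B (inj₁ t))
        sort (inj₁ p) = inj₂ (zero , p)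
        sort (inj₂ l) = inj₁ l
      classify (inj₂ zero) = inj₁ (π , cπ , ≗-refl)
      classify (inj₂ (suc zero)) = inj₁ (ρ , cρ , ≗-refl)

  exceptional-absurd : ∀ {π N y₀} → CPlane π → Axis π N → NonSpecial π N y₀ → ⊥
  exceptional-absurd {π} {N} {y₀} cπ a n₀ = go (two-others (ix 0#))
    where
    open Lines cπ a (base-normal n₀) (base-in n₀)
    open Exceptional cπ a n₀
    nonzero : ∀ {t} → ix 0# ≢ t → ¬ el t ≈ 0#
    nonzero n e = n (≡.trans (ix-cong (sym e)) (ix-el _))
    go : (∃₂ λ u v → ix 0# ≢ u × ix 0# ≢ v × u ≢ v) → ⊥
    go (u , v , u≉ , v≉ , u≢v) = through (outside-point (c (pts cρ₁ 0≢) ∈? π) (c (pts cρ₁ 1≢) ∈? π))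
      where
      s₁ : Special π (line u) N
      s₁ = special-off (line-normal u) (line-in u) (line-off (nonzero u≉))
      s₂ : Special π (line v) N
      s₂ = special-off (line-normal v) (line-in v) (line-off (nonzero v≉))
      ρ₁ = other s₁
      cρ₁ = other-C s₁
      ρ₂ = other s₂
      apart : ∀ z → Normal z → z ∈ ρ₁ → ¬ z ∈ ρ₂
      apart z hz z₁ z₂ = others-disjoint (line-normal u) (line-normal v) (line-in u) (line-in v) (u≢v ∘ line-injective) s₁ s₂ hz z₁ z₂
      a₁ : Axis ρ₁ N
      a₁ = axis-of-other cπ a (line-normal u) (line-in u) s₁
      outside-point : Dec (c (pts cρ₁ 0≢) ∈ π) → Dec (c (pts cρ₁ 1≢) ∈ π) → ∃ λ r → c r ∈ ρ₁ × ¬ c r ∈ π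
      outside-point (no p) _ = _ , pts-in cρ₁ 0≢ , p
      outside-point _ (no p) = _ , pts-in cρ₁ 1≢ , p
      outside-point (yes p) (yes p′) = ⊥-elim (distinct s₁
        (meet-two cπ cρ₁ (0≢1 ∘ pts-injective cρ₁) p p′ (pts-in cρ₁ 0≢) (pts-in cρ₁ 1≢)))
      through : ¬ ∃ λ r → c r ∈ ρ₁ × ¬ c r ∈ π
      through (r , rρ₁ , r∉π) = by-status (line-status cρ₁ a₁ (c-normal r) rρ₁)
        where
        by-status : ¬ (Special ρ₁ (c r) N ⊎ NonSpecial ρ₁ N (c r))
        by-status (inj₂ n) = Exceptional.no-parallel cρ₁ a₁ n (other-C s₂) (λ i i₂ i₁ → apart _ (c-normal i) i₁ i₂) apart
        by-status (inj₁ s) = no-parallel (other-C s) (λ i iκ iπ → κ-apart _ (c-normal i) iπ iκ) κ-apart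
          where
          κ-apart : ∀ z → Normal z → z ∈ π → ¬ z ∈ other s
          κ-apart z hz zπ zκ = no-triangle cπ cρ₁ (other-C s) (distinct s₁) (λ e → r∉π (from e (point-in s))) (distinct s)
            (N-inf a) (N-nonzero a) (N-in a) (dir-in s₁) (dir-in s) (line-normal u) hz (c-normal r)
            (line-in u) (point-in s₁) zπ zκ rρ₁ (point-in s)

  -- Every line of π in the direction of its axis lies in a second 𝒞-plane and
  -- contains exactly one point of 𝒞.
  record Regular (π : Plane) (N : Vec5) : Set where
    field
      axis : Axis π N
      all-special : ∀ {y} → Normal y → y ∈ π → Special π y N
      has-point : ∀ {y} → Normal y → y ∈ π → ∃ λ i → c i ∈ π × OnAxis y N (c i)

  axis-regular : ∀ {π N} → CPlane π → Axis π N → Regular π N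
  axis-regular {π} {N} cπ a = record { axis = a ; all-special = spec ; has-point = special-meets cπ a spec }
    where
    spec : ∀ {y} → Normal y → y ∈ π → Special π y N
    spec {y} hy yπ = decide (line-status cπ a hy yπ)
      where
      decide : Special π y N ⊎ NonSpecial π N y → Special π y N
      decide (inj₁ s) = s
      decide (inj₂ n) = ⊥-elim (exceptional-absurd cπ a n)

  open Axis
  open Joining
  open Regular

  axis-once : ∀ {π N i j} → CPlane π → Regular π N → c i ∈ π → c j ∈ π → OnAxis (c i) N (c j) → i ≡ j
  axis-once {i = i} cπ reg iπ jπ on = special-once cπ (all-special reg (c-normal i) iπ) iπ jπ axis-self on

  different-planes : ∀ {π ρ i j} → CPlane π → CPlane ρ → π ≗̸ ρ → c i ∈ π → c i ∈ ρ → c j ∈ π → i ≢ j → ¬ c j ∈ ρ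
  different-planes cπ cρ π≠ρ iπ iρ jπ i≢j jρ = i≢j (meet-once cπ cρ π≠ρ iπ jπ iρ jρ)

  other-point : ∀ {π} → CPlane π → ∀ i → ∃ λ j → i ≢ j × c j ∈ π
  other-point {π} cπ i = decide (i Fin.≟ pts cπ 0≢)
    where
    decide : Dec (i ≡ pts cπ 0≢) → ∃ λ j → i ≢ j × c j ∈ π
    decide (no n) = pts cπ 0≢ , n , pts-in cπ 0≢
    decide (yes ≡.refl) = pts cπ 1≢ , (λ e → 0≢1 (pts-injective cπ e)) , pts-in cπ 1≢

  -- The second 𝒞-planes through the lines of π in direction N partition 𝒞.
  module Class {π N} (cπ : CPlane π) (reg : Regular π N) where
    private
      a = axis reg
    through : ∀ k → Special π (c (pts cπ k)) N
    through k = all-special reg (c-normal _) (pts-in cπ k)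

    twin : Fin q → Plane
    twin k = other (through k)

    twin-C : ∀ k → CPlane (twin k)
    twin-C k = other-C (through k)

    twin-once : ∀ {i k l} → c i ∈ twin k → c i ∈ twin l → k ≡ l
    twin-once {i} {k} {l} ik il = Dec.decidable-stable (k Fin.≟ l) λ k≢l →
      no-triangle cπ (twin-C k) (twin-C l) (distinct (through k)) (distinct (through l))
        (λ e → distinct (through k) (meet-two cπ (twin-C k) (k≢l ∘ pts-injective cπ) (pts-in cπ k) (pts-in cπ l)
                                      (point-in (through k)) (from e (point-in (through l)))))
        (N-inf a) (N-nonzero a) (N-in a) (dir-in (through k)) (dir-in (through l)) (c-normal _) (c-normal _) (c-normal i)
        (pts-in cπ k) (point-in (through k)) (pts-in cπ l) (point-in (through l)) ik il

    private
      f : Index → Index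
      f x = pts (twin-C (proj₁ (remQuot {q} q x))) (proj₂ (remQuot {q} q x))

      f-injective : Injective _≡_ _≡_ f
      f-injective {x} {y} e = ≡.trans (≡.sym (Finₚ.combine-remQuot {q} q x))
          (≡.trans (pair (proj₁ (remQuot {q} q x)) (proj₁ (remQuot {q} q y)) e
            (twin-once (pts-in (twin-C _) _) (≡.subst (λ i → c i ∈ twin (proj₁ (remQuot {q} q y))) (≡.sym e) (pts-in (twin-C _) _))))
            (Finₚ.combine-remQuot {q} q y))
        where
        pair : ∀ k l {s t} → pts (twin-C k) s ≡ pts (twin-C l) t → k ≡ l → combine k s ≡ combine l t
        pair k .k e ≡.refl = ≡.cong (combine k) (pts-injective (twin-C k) e)

    abstract
      class-index : ∀ j → ∃ λ k → c j ∈ twin k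
      class-index j = conclude (injective⇒surjective f f-injective j)
        where
        conclude : (∃ λ x → f x ≡ j) → ∃ λ k → c j ∈ twin k
        conclude (x , e) = _ , ≡.subst (λ i → c i ∈ twin (proj₁ (remQuot {q} q x))) e (pts-in (twin-C _) _)

    col : Index → Plane
    col j = twin (proj₁ (class-index j))

    col-C : ∀ j → CPlane (col j)
    col-C j = twin-C (proj₁ (class-index j))

    col-in : ∀ j → c j ∈ col j
    col-in j = proj₂ (class-index j)

    col-N : ∀ j → N ∈ col j
    col-N j = dir-in (through (proj₁ (class-index j)))

    col-regular : ∀ j → Regular (col j) N
    col-regular j = axis-regular (col-C j) (axis-of-other cπ a (c-normal _) (pts-in cπ _) (through (proj₁ (class-index j))))

    col-same : ∀ {i j} → c i ∈ col j → col i ≗ col j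
    col-same {i} {j} m = ≡.subst (λ k → twin k ≗ col j) (twin-once {i} m (col-in i)) ≗-refl

    col-distinct : ∀ j → π ≗̸ col j
    col-distinct j = distinct (through (proj₁ (class-index j)))

    col-meets : ∀ j → ∃ λ i → c i ∈ π × c i ∈ col j
    col-meets j = _ , pts-in cπ _ , point-in (through (proj₁ (class-index j)))

  record IsClass (N : Vec5) (A : Index → Plane) : Set where
    field
      isC     : ∀ j → CPlane (A j)
      contains : ∀ j → c j ∈ A j
      regular : ∀ j → Regular (A j) N
      same-class : ∀ {i j} → c i ∈ A j → A i ≗ A j

    dir : ∀ j → N ∈ A j
    dir j = N-in (axis (regular j))

    shared : ∀ {i j k} → c k ∈ A i → c k ∈ A j → A i ≗ A j
    shared m m′ = ≗-trans (≗-sym (same-class m)) (same-class m′)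

  -- Two transversal classes of 𝒞-planes with the same axis direction.
  record Grid (N : Vec5) : Set where
    field
      A B : Index → Plane
      A-class : IsClass N A
      B-class : IsClass N B
      A≠B   : ∀ i j → A i ≗̸ B j
      meet  : ∀ i j → ∃ λ k → c k ∈ A i × c k ∈ B j

  flip-grid : ∀ {N} → Grid N → Grid N
  flip-grid G = record { A = B ; B = A ; A-class = B-class ; B-class = A-class ; A≠B = λ i j e → A≠B j i (≗-sym e)
                       ; meet = λ i j → let k , m , m′ = meet j i in k , m′ , m }
    where open Grid G

  module MakeGrid {π N p} (cπ : CPlane π) (reg : Regular π N) (pπ : c p ∈ π) where
    private
      a = axis reg
    s : Special π (c p) N
    s = all-special reg (c-normal p) pπ

    ρ : Plane
    ρ = other s

    cρ : CPlane ρ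
    cρ = other-C s

    ρ-regular : Regular ρ N
    ρ-regular = axis-regular cρ (axis-of-other cπ a (c-normal p) pπ s)

    private
      module A = Class cρ ρ-regular
      module B = Class cπ reg

    π-col : A.col p ≗ π
    π-col = Dec.decidable-stable (A.col-C p ≗? cπ) λ n → triple-axis cπ cρ (A.col-C p) (distinct s) (λ e → n (≗-sym e))
      (A.col-distinct p) (c-normal p) (N-inf a) (N-nonzero a) pπ (point-in s) (A.col-in p) (N-in a) (dir-in s) (A.col-N p)

    A-class : IsClass N A.col
    A-class = record { isC = A.col-C ; contains = A.col-in ; regular = A.col-regular ; same-class = A.col-same }

    B-class : IsClass N B.col
    B-class = record { isC = B.col-C ; contains = B.col-in ; regular = B.col-regular ; same-class = B.col-same }

    A≠B : ∀ i j → A.col i ≗̸ B.col j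
    A≠B i j e = no-triangle cπ cρ (B.col-C j) (distinct s) (B.col-distinct j) (λ f → A.col-distinct i (≗-trans f (≗-sym e)))
      (N-inf a) (N-nonzero a) (N-in a) (dir-in s) (B.col-N j) (c-normal p) (c-normal _) (c-normal _)
      pπ (point-in s) (proj₁ (proj₂ (B.col-meets j))) (proj₂ (proj₂ (B.col-meets j)))
      (proj₁ (proj₂ (A.col-meets i))) (to e (proj₂ (proj₂ (A.col-meets i))))

    meet : ∀ i j → ∃ λ k → c k ∈ A.col i × c k ∈ B.col j
    meet i j = intersect (A.col i) (B.col j) λ d → by-point (B.col-meets j) d
      where
      by-point : (∃ λ x → c x ∈ π × c x ∈ B.col j) → ¬ Disjoint (A.col i) (B.col j)
      by-point (x , xπ , xB) d = B.col-distinct j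
          (playfair (A.col-C i) cπ (B.col-C j) xπ xB π-misses (disjoint-sym d))
        where
        π-misses : Disjoint π (A.col i)
        π-misses k kπ kA = d x (from (≗-trans (≗-sym (IsClass.shared A-class (from π-col kπ) kA)) π-col) xπ) xB

    grid : Grid N
    grid = record { A = A.col ; B = B.col ; A-class = A-class ; B-class = B-class ; A≠B = A≠B ; meet = meet }

    grid-A : Grid.A grid p ≗ π
    grid-A = π-col

  -- A solid through two A-planes contains the points at infinity of all of them:
  -- otherwise it contains a B-plane as well.
  module ClassFunctional {N} (G : Grid N) (p : Index) where
    open Grid G
    private
      module A = IsClass A-class
      module B = IsClass B-class

    N-inf′ : Inf N
    N-inf′ = N-inf (axis (A.regular p))

    N-nonzero′ : NonZero N
    N-nonzero′ = N-nonzero (axis (A.regular p))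

    AB-once : ∀ {i j k l} → c k ∈ A i → c k ∈ B j → c l ∈ A i → c l ∈ B j → k ≡ l
    AB-once {i} {j} kA kB lA lB = meet-once (A.isC i) (B.isC j) (A≠B i j) kA lA kB lB

    q₁ : Index
    q₁ = proj₁ (other-point (B.isC p) p)

    q₁-not : A p ≗̸ A q₁
    q₁-not e = proj₁ (proj₂ (other-point (B.isC p) p))
      (AB-once (A.contains p) (B.contains p) (from e (A.contains q₁)) (proj₂ (proj₂ (other-point (B.isC p) p))))

    abstract
      transversal : ∀ j → ∃ λ n → Inf n × n ∈ A j × Independent2 N n
      transversal j = line-frame (A.isC j) N-inf′ N-nonzero′

    n₀ n₁ : Vec5
    n₀ = proj₁ (transversal p)
    n₁ = proj₁ (transversal q₁)

    vs : Vec Vec5 4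
    vs = c p ∷ N ∷ n₀ ∷ n₁ ∷ []

    ann : ∃ λ g → NonZero g × (∀ k → g ∙ lookup vs k ≈ 0#)
    ann = annihilator (lookup vs)

    g : Vec5
    g = proj₁ ann

    g-nonzero : NonZero g
    g-nonzero = proj₁ (proj₂ ann)

    g-p : g ∙ c p ≈ 0#
    g-p = proj₂ (proj₂ ann) zero

    g-N : g ∙ N ≈ 0#
    g-N = proj₂ (proj₂ ann) (suc zero)

    g-n₀ : g ∙ n₀ ≈ 0#
    g-n₀ = proj₂ (proj₂ ann) (suc (suc zero))

    g-n₁ : g ∙ n₁ ≈ 0#
    g-n₁ = proj₂ (proj₂ ann) (suc (suc (suc zero)))

    solid-from : ∀ {f j i} → f ∙ N ≈ 0# → f ∙ proj₁ (transversal j) ≈ 0# → c i ∈ A j → f ∙ c i ≈ 0# → InSolid f (A j)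
    solid-from {f} {j} {i} fN fn iA fi = plane-in-subspace (kernel-subspace f) (A j) iA (A.dir j) (proj₁ (proj₂ (proj₂ (transversal j))))
      (independent-frame (c-normal i) N-inf′ (proj₁ (proj₂ (transversal j))) (proj₂ (proj₂ (proj₂ (transversal j))))) fi fN fn

    g-base : InSolid g (A p)
    g-base = solid-from g-N g-n₀ (A.contains p) g-p

    B-solid : ∀ {f x i} → f ∙ N ≈ 0# → c i ∈ B x → i ≢ x → f ∙ c i ≈ 0# → f ∙ c x ≈ 0# → InSolid f (B x)
    B-solid {f} {x} {i} fN iB i≢x fi fx = plane-in-subspace (kernel-subspace f) (B x) iB (B.contains x) (B.dir x)
      (independent-axis (c-normal i) (c-normal x) N-inf′ N-nonzero′ (λ on → i≢x (axis-once (B.isC x) (B.regular x) iB (B.contains x) on))) fi fx fN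

    no-solid-three : ∀ {f i j x} → NonZero f → A i ≗̸ A j → InSolid f (A i) → InSolid f (A j) → InSolid f (B x) → ⊥
    no-solid-three {f} {i} {j} {x} f≉0 n fi fj fB = ThreeInSolid.absurd f≉0 (A.isC i) (A.isC j) (B.isC x) n (A≠B i x) (A≠B j x) fi fj fB

    point-absurd : ∀ {j x} → A p ≗̸ A j → c x ∈ A j → ¬ g ∙ c x ≈ 0#
    point-absurd {j} {x} n xA gx = go (meet p x)
      where
      go : ¬ ∃ λ i → c i ∈ A p × c i ∈ B x
      go (i , iA , iB) = finish (meet q₁ x)
        where
        i≢x : i ≢ x
        i≢x ≡.refl = n (A.shared iA xA)
        B-in : InSolid g (B x)
        B-in = B-solid g-N iB i≢x (g-base iA) gx
        finish : ¬ ∃ λ k → c k ∈ A q₁ × c k ∈ B x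
        finish (k , kA , kB) = no-solid-three g-nonzero q₁-not g-base (solid-from g-N g-n₁ kA (B-in kB)) B-in

    g-direction : ∀ {j w} → Inf w → w ∈ A j → g ∙ w ≈ 0#
    g-direction {j} {w} hw wA = decide (A.isC p ≗? A.isC j)
      where
      decide : Dec (A p ≗ A j) → g ∙ w ≈ 0#
      decide (yes e) = g-base (from e wA)
      decide (no n) = Dec.decidable-stable (g ∙ w ≟ 0#) nonzero-absurd
        where
        nonzero-absurd : ¬ ¬ g ∙ w ≈ 0#
        nonzero-absurd gw = go (has-point (A.regular j) y-normal y-in)
          where
          t : K
          t = - (g ∙ c j * inv (g ∙ w) gw)
          y : Vec5
          y = c j ⊕ (t · w)
          y-normal : Normal y
          y-normal = trans (dot-axis h t hw) (c-normal j)
          y-in : y ∈ A j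
          y-in = InPlane.translate (A j) t (A.contains j) wA
          g-y : g ∙ y ≈ 0#
          g-y = trans (dot-comb₂′ t) (lc₁ (- (g ∙ c j)) (inv-right (g ∙ w) gw) (ring! (g ∙ c j ∷ g ∙ w ∷ inv (g ∙ w) gw ∷ [])))
            where
            dot-comb₂′ : ∀ t → g ∙ (c j ⊕ (t · w)) ≈ g ∙ c j + t * g ∙ w
            dot-comb₂′ t = trans (dot-⊕ g (c j) (t · w)) (+-congˡ (dot-· g t w))
          go : ¬ ∃ λ x → c x ∈ A j × OnAxis y N (c x)
          go (x , xA , (s , e)) = point-absurd n xA (trans (dot-cong g e) (trans (dot-axis g s g-N) g-y))

    g-const : ∀ {i j} → c i ∈ A j → g ∙ c i ≈ g ∙ c j
    g-const {i} {j} m = sym (lc₁ 1# zero-diff (ring! (g ∙ c i ∷ g ∙ c j ∷ [])))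
      where
      zero-diff : 0# ≈ g ∙ c i + - 1# * g ∙ c j
      zero-diff = sym (trans (sym (trans (dot-⊕ g (c i) ((- 1#) · c j)) (+-congˡ (dot-· g (- 1#) (c j)))))
        (g-direction {j} (difference-inf (c-normal j) (c-normal i)) (InPlane.difference-in (A j) m (A.contains j))))

    g-separates : ∀ {i j} → g ∙ c i ≈ g ∙ c j → c i ∈ A j
    g-separates {i} {j} e = Dec.decidable-stable (c i ∈? A j) λ i∉ → absurd i∉ (meet j i)
      where
      f : Vec5
      f = g ⊕ ((- (g ∙ c j)) · h)
      f-value : ∀ w → f ∙ w ≈ g ∙ w + - (g ∙ c j) * h ∙ w
      f-value w = trans (dot-left g _ h w) refl
      f-inf : ∀ {k w} → Inf w → w ∈ A k → f ∙ w ≈ 0#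
      f-inf {k} {w} hw wA = trans (f-value w) (lc₂ 1# (g-direction {k} hw wA) (- (g ∙ c j)) hw (ring! (g ∙ w ∷ g ∙ c j ∷ h ∙ w ∷ [])))
      f-point : ∀ k → g ∙ c k ≈ g ∙ c j → f ∙ c k ≈ 0#
      f-point k e = trans (f-value (c k)) (lc₂ 1# e (- (g ∙ c j)) (c-normal k) (ring! (g ∙ c k ∷ g ∙ c j ∷ h ∙ c k ∷ [])))
      f-solid : ∀ k → g ∙ c k ≈ g ∙ c j → InSolid f (A k)
      f-solid k e = solid-from (f-inf {k} N-inf′ (A.dir k)) (f-inf {k} (proj₁ (proj₂ (transversal k))) (proj₁ (proj₂ (proj₂ (transversal k)))))
        (A.contains k) (f-point k e)
      f-nonzero : NonZero f
      f-nonzero z = g-nonzero λ l → lc₂ 1# (z l) (h l) gj (ring! (g l ∷ h l ∷ g ∙ c j ∷ []))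
        where
        fp : f ∙ c p ≈ 0#
        fp = trans (dot-left-zero f z (c p)) refl
        gj : g ∙ c j ≈ 0#
        gj = lc₄ (- 1#) fp (1#) (f-value (c p)) 1# g-p (- (g ∙ c j)) (c-normal p) (ring! (f ∙ c p ∷ g ∙ c p ∷ g ∙ c j ∷ h ∙ c p ∷ []))
      absurd : ¬ c i ∈ A j → ¬ ∃ λ k → c k ∈ A j × c k ∈ B i
      absurd i∉ (k , kA , kB) = no-solid-three f-nonzero (λ s → i∉ (to s (A.contains i))) (f-solid i e) (f-solid j refl)
        (B-solid (f-inf {j} N-inf′ (A.dir j)) kB (λ { ≡.refl → i∉ kA }) (f-solid j refl kA) (f-point i e))

  open Axis
  open Joining
  open Regular

  -- Different 𝒞-planes do not share a line of Σ∞: they would lie in a solid, and so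
  -- would a 𝒞-plane meeting both.
  line-at-infinity : ∀ {π ρ u v} → CPlane π → CPlane ρ → π ≗̸ ρ → Inf u → Inf v → Independent2 u v →
                     u ∈ π → v ∈ π → u ∈ ρ → v ∈ ρ → ⊥
  line-at-infinity {π} {ρ} {u} {v} cπ cρ π≠ρ hu hv uv uπ vπ uρ vρ = finish (intersect κ ρ λ d →
      distinct s (playfair cρ cπ cκ rπ (point-in s) apart d))
    where
    r = pts cπ 0≢
    rπ : c r ∈ π
    rπ = pts-in cπ 0≢
    r′ = pts cρ 0≢
    r′ρ : c r′ ∈ ρ
    r′ρ = pts-in cρ 0≢
    N = proj₁ (axis-exists cπ)
    a : Axis π N
    a = proj₂ (axis-exists cπ)
    s : Special π (c r) N
    s = all-special (axis-regular cπ a) (c-normal r) rπ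
    κ = other s
    cκ = other-C s
    κ-regular : Regular κ N
    κ-regular = axis-regular cκ (axis-of-other cπ a (c-normal r) rπ s)
    apart : Disjoint π ρ
    apart i iπ iρ = π≠ρ (three-common {a = c i} {u} {v} (independent-frame (c-normal i) hu hv uv) iπ uπ vπ iρ uρ vρ)
    vs : Vec Vec5 4
    vs = c r ∷ c r′ ∷ u ∷ v ∷ []
    ann : ∃ λ g → NonZero g × (∀ k → g ∙ lookup vs k ≈ 0#)
    ann = annihilator (lookup vs)
    g = proj₁ ann
    solid-π : InSolid g π
    solid-π = plane-in-subspace (kernel-subspace g) π rπ uπ vπ (independent-frame (c-normal r) hu hv uv)
      (proj₂ (proj₂ ann) zero) (proj₂ (proj₂ ann) (suc (suc zero))) (proj₂ (proj₂ ann) (suc (suc (suc zero))))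
    solid-ρ : InSolid g ρ
    solid-ρ = plane-in-subspace (kernel-subspace g) ρ r′ρ uρ vρ (independent-frame (c-normal r′) hu hv uv)
      (proj₂ (proj₂ ann) (suc zero)) (proj₂ (proj₂ ann) (suc (suc zero))) (proj₂ (proj₂ ann) (suc (suc (suc zero))))
    finish : ¬ ∃ λ i → c i ∈ κ × c i ∈ ρ
    finish (i , iκ , iρ) = ThreeInSolid.absurd (proj₁ (proj₂ ann)) cπ cρ cκ π≠ρ (distinct s) (λ e → apart r rπ (from e (point-in s)))
        solid-π solid-ρ (plane-in-subspace (kernel-subspace g) κ (point-in s) iκ (dir-in s)
          (independent-axis (c-normal r) (c-normal i) (N-inf a) (N-nonzero a) (λ on → r≢i (axis-once cκ κ-regular (point-in s) iκ on)))
          (solid-π rπ) (solid-ρ iρ) (solid-π (N-in a)))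
      where
      r≢i : r ≢ i
      r≢i e = apart r rπ (≡.subst (λ j → c j ∈ ρ) (≡.sym e) iρ)

  module Coordinates {N} (G : Grid N) (p : Index) where
    open Grid G
    private
      module A = IsClass A-class
      module B = IsClass B-class
      module X = ClassFunctional G p
      module Y = ClassFunctional (flip-grid G) p

    abstract
      gx gy : Vec5
      gx = X.g
      gy = Y.g

      gx-N : gx ∙ N ≈ 0#
      gx-N = X.g-N

      gy-N : gy ∙ N ≈ 0#
      gy-N = Y.g-N

      gx-const : ∀ {i j} → c i ∈ A j → gx ∙ c i ≈ gx ∙ c j
      gx-const = X.g-const

      gy-const : ∀ {i j} → c i ∈ B j → gy ∙ c i ≈ gy ∙ c j
      gy-const = Y.g-const

      gx-separates : ∀ {i j} → gx ∙ c i ≈ gx ∙ c j → c i ∈ A j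
      gx-separates = X.g-separates

      gy-separates : ∀ {i j} → gy ∙ c i ≈ gy ∙ c j → c i ∈ B j
      gy-separates = Y.g-separates

    N-inf′ : Inf N
    N-inf′ = N-inf (axis (A.regular p))

    N-nonzero′ : NonZero N
    N-nonzero′ = N-nonzero (axis (A.regular p))

    coordinates-injective : ∀ {i j} → gx ∙ c i ≈ gx ∙ c j → gy ∙ c i ≈ gy ∙ c j → i ≡ j
    coordinates-injective {i} {j} ex ey =
      meet-once (A.isC j) (B.isC j) (A≠B j j) (gx-separates ex) (A.contains j) (gy-separates ey) (B.contains j)

    private
      code : Index → Index
      code i = combine (ix (gx ∙ c i)) (ix (gy ∙ c i))

      code-injective : Injective _≡_ _≡_ code
      code-injective {i} {j} e = coordinates-injective (ix-injective (proj₁ parts)) (ix-injective (proj₂ parts))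
        where parts = Finₚ.combine-injective (ix (gx ∙ c i)) (ix (gy ∙ c i)) (ix (gx ∙ c j)) (ix (gy ∙ c j)) e

      decode : ∀ x y → ∃ λ i → code i ≡ combine (ix x) (ix y)
      decode x y = injective⇒surjective code code-injective (combine (ix x) (ix y))

      decode-parts : ∀ x y → ix (gx ∙ c (proj₁ (decode x y))) ≡ ix x × ix (gy ∙ c (proj₁ (decode x y))) ≡ ix y
      decode-parts x y = Finₚ.combine-injective (ix (gx ∙ c i)) (ix (gy ∙ c i)) (ix x) (ix y) (proj₂ (decode x y))
        where i = proj₁ (decode x y)

    abstract
      at : K → K → Index
      at x y = proj₁ (decode x y)

      at-x : ∀ x y → gx ∙ c (at x y) ≈ x
      at-x x y = ix-injective (proj₁ (decode-parts x y))

      at-y : ∀ x y → gy ∙ c (at x y) ≈ y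
      at-y x y = ix-injective (proj₂ (decode-parts x y))

    at-unique : ∀ {i x y} → gx ∙ c i ≈ x → gy ∙ c i ≈ y → at x y ≡ i
    at-unique {i} {x} {y} ex ey = coordinates-injective (trans (at-x x y) (sym ex)) (trans (at-y x y) (sym ey))

    at-cong : ∀ {x y x′ y′} → x ≈ x′ → y ≈ y′ → at x y ≡ at x′ y′
    at-cong {x} {y} {x′} {y′} ex ey = at-unique (trans (at-x x′ y′) (sym ex)) (trans (at-y x′ y′) (sym ey))

    at-injective : ∀ {x y x′ y′} → at x y ≡ at x′ y′ → x ≈ x′ × y ≈ y′
    at-injective {x} {y} {x′} {y′} e =
      trans (sym (at-x x y)) (trans (reflexive (≡.cong (λ i → gx ∙ c i) e)) (at-x x′ y′)) ,
      trans (sym (at-y x y)) (trans (reflexive (≡.cong (λ i → gy ∙ c i) e)) (at-y x′ y′))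

    F : K → K → Vec5
    F x y = c (at x y)

    F-cong : ∀ {x y x′ y′} → x ≈ x′ → y ≈ y′ → F x y ≈v F x′ y′
    F-cong ex ey i = reflexive (≡.cong (λ j → c j i) (at-cong ex ey))

    F-in : ∀ {x y x′ y′ π} → x ≈ x′ → y ≈ y′ → F x y ∈ π → F x′ y′ ∈ π
    F-in {π = π} ex ey m = ≡.subst (λ i → c i ∈ π) (at-cong ex ey) m

    F-normal : ∀ x y → Normal (F x y)
    F-normal x y = c-normal (at x y)

    -- Along lines of direction (d₁ , d₂) the points of 𝒞 are affinely interpolated modulo M.
    Straight : Vec5 → K → K → Set
    Straight M d₁ d₂ = ∀ x y t → ∃ λ φ →
      F (x + t * d₁) (y + t * d₂) ≈v ((((1# - t) · F x y) ⊕ (t · F (x + d₁) (y + d₂))) ⊕ (φ · M))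

    module _ {M A′} (A′-class : IsClass M A′) (d₁ d₂ : K) (γ : Vec5) (δ : K) (δ≉0 : ¬ δ ≈ 0#) (γM : γ ∙ M ≈ 0#)
      (γF : ∀ x y t → γ ∙ F (x + t * d₁) (y + t * d₂) ≈ γ ∙ F x y + t * δ)
      (inA : ∀ x y t → F (x + t * d₁) (y + t * d₂) ∈ A′ (at x y)) where
      private
        module A′ = IsClass A′-class

      straight : Straight M d₁ d₂
      straight x y t = conclude (spanning π {a} {b} {M} {w} a∈ b∈ (A′.dir (at x y)) ind (inA x y t))
        where
        π = A′ (at x y)
        a = F x y
        b = F (x + d₁) (y + d₂)
        w = F (x + t * d₁) (y + t * d₂)
        a∈ : a ∈ π
        a∈ = A′.contains (at x y)
        b∈ : b ∈ π
        b∈ = F-in (+-congˡ (*-identityˡ d₁)) (+-congˡ (*-identityˡ d₂)) (inA x y 1#)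
        ax : Axis π M
        ax = axis (A′.regular (at x y))
        γb : γ ∙ b ≈ γ ∙ a + δ
        γb = trans (dot-cong γ (F-cong (+-congˡ (sym (*-identityˡ d₁))) (+-congˡ (sym (*-identityˡ d₂)))))
          (trans (γF x y 1#) (+-congˡ (*-identityˡ δ)))
        a≢b : at x y ≢ at (x + d₁) (y + d₂)
        a≢b e = δ≉0 (lc₂ (- 1#) γb 1# (reflexive (≡.cong (λ i → γ ∙ c i) (≡.sym e))) (ring! (γ ∙ a ∷ γ ∙ b ∷ δ ∷ [])))
        ind : Independent3 a b M
        ind = independent-axis (F-normal x y) (F-normal (x + d₁) (y + d₂)) (N-inf ax) (N-nonzero ax)
          (λ on → a≢b (axis-once (A′.isC (at x y)) (A′.regular (at x y)) a∈ b∈ on))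
        conclude : InSpan3 w a b M → ∃ λ φ → w ≈v ((((1# - t) · a) ⊕ (t · b)) ⊕ (φ · M))
        conclude (α , β , φ , e) = φ , λ i → lc₃ 1# (e i) (b i) β≈t (a i) α≈ (ring! (w i ∷ a i ∷ b i ∷ M i ∷ α ∷ β ∷ φ ∷ t ∷ []))
          where
          heights : ∀ {u v w z} → z ≈ 1# → u ≈ 1# → v ≈ 1# → w ≈ 0# → z ≈ α * u + β * v + φ * w → α + β ≈ 1#
          heights {u} {v} {w} {z} ez eu ev ew f = lc₂ (- α) eu 1# (lc₄ (- β) ev (- φ) ew (- 1#) f 1# ez lemma) (ring! (α ∷ β ∷ u ∷ []))
            where
            lemma : (α * u + β) + (- β * 1# + (- φ * 0# + (- 1# * (α * u + β * v + φ * w) + 1# * 1#))) ≈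
                    1# + (- β * v + (- φ * w + (- 1# * z + 1# * z)))
            lemma = ring! (α ∷ β ∷ φ ∷ u ∷ v ∷ w ∷ z ∷ [])
          sum-one : α + β ≈ 1#
          sum-one = heights (F-normal (x + t * d₁) (y + t * d₂)) (F-normal x y) (F-normal (x + d₁) (y + d₂)) (N-inf ax)
            (trans (dot-cong h e) (dot-comb₃ h α a β b φ M))
          slopes : ∀ {u v w z} → z ≈ u + t * δ → v ≈ u + δ → w ≈ 0# → z ≈ α * u + β * v + φ * w → δ * (β - t) ≈ 0#
          slopes {u} {v} {w} {z} ez ev ew f = lc₂ (- u) sum-one 1# (lc₄ (- β) ev (- φ) ew (- 1#) f 1# ez lemma) (ring! (α ∷ β ∷ u ∷ δ ∷ t ∷ []))
            where
            lemma : (α * u + β * u + β * δ) + (- β * (u + δ) + (- φ * 0# + (- 1# * (α * u + β * v + φ * w) + 1# * (u + t * δ)))) ≈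
                    (u + t * δ) + (- β * v + (- φ * w + (- 1# * z + 1# * z)))
            lemma = ring! (α ∷ β ∷ φ ∷ u ∷ v ∷ w ∷ z ∷ δ ∷ t ∷ [])
          β≈t : β ≈ t
          β≈t = diff-zero (*-cancel-0 δ≉0 (slopes (γF x y t) γb γM (trans (dot-cong γ e) (dot-comb₃ γ α a β b φ M))))
          α≈ : α ≈ 1# - t
          α≈ = lc₂ 1# sum-one (- 1#) β≈t (ring! (α ∷ β ∷ t ∷ []))

    same-x : ∀ {x y y′} → F x y′ ∈ A (at x y)
    same-x {x} {y} {y′} = gx-separates (trans (at-x x y′) (sym (at-x x y)))

    same-y : ∀ {x y x′} → F x′ y ∈ B (at x y)
    same-y {x} {y} {x′} = gy-separates (trans (at-y x′ y) (sym (at-y x y)))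

    straight-x : Straight N 1# 0#
    straight-x = straight B-class 1# 0# gx 1# 1≉0 gx-N
      (λ x y t → trans (at-x _ _) (trans (ring! (x ∷ t ∷ [])) (+-congʳ (sym (at-x x y)))))
      (λ x y t → F-in refl (ring! (y ∷ t ∷ [])) same-y)

    straight-y : Straight N 0# 1#
    straight-y = straight A-class 0# 1# gy 1# 1≉0 gy-N
      (λ x y t → trans (at-y _ _) (trans (ring! (y ∷ t ∷ [])) (+-congʳ (sym (at-y x y)))))
      (λ x y t → F-in (ring! (x ∷ t ∷ [])) refl same-x)

    bilinear : K → K → K → K → K → K → Vec5
    bilinear d₁ d₂ d₁′ d₂′ s t = ((F 0# 0# ⊕ (s · (F d₁ d₂ ⊕ ((- 1#) · F 0# 0#)))) ⊕ (t · (F d₁′ d₂′ ⊕ ((- 1#) · F 0# 0#))))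
      ⊕ ((s * t) · ((F (d₁ + d₁′) (d₂ + d₂′) ⊕ ((- 1#) · F d₁ d₂)) ⊕ (F 0# 0# ⊕ ((- 1#) · F d₁′ d₂′))))

    interpolation : ∀ {M d₁ d₂ d₁′ d₂′} → Straight M d₁ d₂ → Straight M d₁′ d₂′ → ∀ s t → ∃ λ φ →
      F (s * d₁ + t * d₁′) (s * d₂ + t * d₂′) ≈v (bilinear d₁ d₂ d₁′ d₂′ s t ⊕ (φ · M))
    interpolation {M} {d₁} {d₂} {d₁′} {d₂′} S S′ s t = conclude (S′ (s * d₁) (s * d₂) t) (S 0# 0# s) (S d₁′ d₂′ s)
      where
      conclude : (∃ λ φ → F (s * d₁ + t * d₁′) (s * d₂ + t * d₂′) ≈v ((((1# - t) · F (s * d₁) (s * d₂)) ⊕ (t · F (s * d₁ + d₁′) (s * d₂ + d₂′))) ⊕ (φ · M))) →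
                 (∃ λ φ → F (0# + s * d₁) (0# + s * d₂) ≈v ((((1# - s) · F 0# 0#) ⊕ (s · F (0# + d₁) (0# + d₂))) ⊕ (φ · M))) →
                 (∃ λ φ → F (d₁′ + s * d₁) (d₂′ + s * d₂) ≈v ((((1# - s) · F d₁′ d₂′) ⊕ (s · F (d₁′ + d₁) (d₂′ + d₂))) ⊕ (φ · M))) →
                 ∃ λ φ → F (s * d₁ + t * d₁′) (s * d₂ + t * d₂′) ≈v (bilinear d₁ d₂ d₁′ d₂′ s t ⊕ (φ · M))
      conclude (φ₁ , e₁) (φ₂ , e₂) (φ₃ , e₃) = φ₁ + (1# - t) * φ₂ + t * φ₃ , λ i →
        trans (e₁ i) (trans (+-congʳ (+-cong (*-congˡ (first i)) (*-congˡ (second i))))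
          (lemma (F 0# 0# i) (F d₁ d₂ i) (F d₁′ d₂′ i) (F (d₁ + d₁′) (d₂ + d₂′) i) (M i)))
        where
        first : ∀ i → F (s * d₁) (s * d₂) i ≈ (1# - s) * F 0# 0# i + s * F d₁ d₂ i + φ₂ * M i
        first i = trans (F-cong (sym (+-identityˡ _)) (sym (+-identityˡ _)) i)
          (trans (e₂ i) (+-congʳ (+-congˡ (*-congˡ (F-cong (+-identityˡ _) (+-identityˡ _) i)))))
        second : ∀ i → F (s * d₁ + d₁′) (s * d₂ + d₂′) i ≈ (1# - s) * F d₁′ d₂′ i + s * F (d₁ + d₁′) (d₂ + d₂′) i + φ₃ * M i
        second i = trans (F-cong (+-comm _ _) (+-comm _ _) i)
          (trans (e₃ i) (+-congʳ (+-congˡ (*-congˡ (F-cong (+-comm _ _) (+-comm _ _) i)))))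
        lemma : ∀ o a b ab m → (1# - t) * ((1# - s) * o + s * a + φ₂ * m) + t * ((1# - s) * b + s * ab + φ₃ * m) + φ₁ * m ≈
          o + s * (a + - 1# * o) + t * (b + - 1# * o) + s * t * ((ab + - 1# * a) + (o + - 1# * b)) + (φ₁ + (1# - t) * φ₂ + t * φ₃) * m
        lemma o a b ab m = ring! (o ∷ a ∷ b ∷ ab ∷ m ∷ s ∷ t ∷ φ₁ ∷ φ₂ ∷ φ₃ ∷ [])

module Surfaces (R : CommutativeRing 0ℓ 0ℓ) (q : ℕ) (7≤q : 7 ℕ.≤ q) (isField : IsFiniteField R q)
  (h : Fin 5 → CommutativeRing.Carrier R) (C : Fin (q ℕ.* q) → Geometry.Vec5 R q h) (CPlane : Geometry.Plane R q h → Set)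
  (hypotheses : Geometry.Config.Hypotheses R q h C CPlane) where
  open CommutativeRing R renaming (Carrier to K) hiding (zero)
  open RingTactic R
  open FiniteField R q isField
  open Geometry R q h
  open Config C CPlane
  open Vectors R q isField h
  open Incidence R q isField h
  open Hypotheses hypotheses
  open Configuration R q 7≤q isField h C CPlane hypotheses

  open Axis
  open Regular

  dot-comb₅ : ∀ g P s E t E′ r E″ φ M →
    g ∙ ((((P ⊕ (s · E)) ⊕ (t · E′)) ⊕ (r · E″)) ⊕ (φ · M)) ≈ g ∙ P + s * g ∙ E + t * g ∙ E′ + r * g ∙ E″ + φ * g ∙ M
  dot-comb₅ g P s E t E′ r E″ φ M = append (append (append (append refl)))
    where
    append : ∀ {u a v x} → g ∙ u ≈ x → g ∙ (u ⊕ (a · v)) ≈ x + a * g ∙ v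
    append {u} {a} {v} e = trans (dot-⊕ g u (a · v)) (+-cong e (dot-· g a v))

  module Lines₂ {N} (G : Grid N) (p : Index) where
    open Grid G public
    open Coordinates G p public
    private
      module A = IsClass A-class
      module B = IsClass B-class

    P E₁ E₂ E₃ : Vec5
    P = F 0# 0#
    E₁ = F 1# 0# ⊕ ((- 1#) · P)
    E₂ = F 0# 1# ⊕ ((- 1#) · P)
    E₃ = (F (1# + 0#) (0# + 1#) ⊕ ((- 1#) · F 1# 0#)) ⊕ (P ⊕ ((- 1#) · F 0# 1#))

    surface : ∀ x y → ∃ λ φ → F x y ≈v ((((P ⊕ (x · E₁)) ⊕ (y · E₂)) ⊕ ((x * y) · E₃)) ⊕ (φ · N))
    surface x y = conclude (interpolation straight-x straight-y x y)
      where
      conclude : (∃ λ φ → F (x * 1# + y * 0#) (x * 0# + y * 1#) ≈v (bilinear 1# 0# 0# 1# x y ⊕ (φ · N))) →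
                 ∃ λ φ → F x y ≈v ((((P ⊕ (x · E₁)) ⊕ (y · E₂)) ⊕ ((x * y) · E₃)) ⊕ (φ · N))
      conclude (φ , e) = φ , ≈v-trans (F-cong (ring! (x ∷ y ∷ [])) (ring! (x ∷ y ∷ []))) e

    surface-value : ∀ {g} → g ∙ N ≈ 0# → ∀ x y → g ∙ F x y ≈ g ∙ P + x * g ∙ E₁ + y * g ∙ E₂ + x * y * g ∙ E₃
    surface-value {g} gN x y = trans (dot-cong g (proj₂ (surface x y)))
      (trans (dot-comb₅ g P x E₁ y E₂ (x * y) E₃ (proj₁ (surface x y)) N) (trans (+-congˡ (trans (*-congˡ gN) (zeroʳ _))) (+-identityʳ _)))

    F-index : ∀ i → c i ≈v F (gx ∙ c i) (gy ∙ c i)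
    F-index i k = reflexive (≡.cong (λ j → c j k) (≡.sym (at-unique refl refl)))

    not-all-F : ∀ {g} → NonZero g → ¬ (∀ x y → g ∙ F x y ≈ 0#)
    not-all-F {g} g≉0 all = not-all-in-solid g≉0 λ i → trans (dot-cong g (F-index i)) (all _ _)

    record LineOf (κ : Plane) : Set where
      field
        a b c′ : K
        b≉0 : ¬ b ≈ 0#
        c≉0 : ¬ c′ ≈ 0#
        equation : ∀ {x y} → F x y ∈ κ → a + b * x + c′ * y ≈ 0#
        on-line  : ∀ {x y} → a + b * x + c′ * y ≈ 0# → F x y ∈ κ

    -- A hyperplane through N and κ gives an equation a + bx + cy + dxy = 0 for κ; as κ
    -- meets every A-plane and every B-plane exactly once, d = 0 and b , c ≠ 0.
    module _ {κ} (cκ : CPlane κ) (N∉κ : ¬ N ∈ κ) where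
      private
        module Fr = Frame (frame cκ)
        vs : Vec Vec5 4
        vs = Fr.o ∷ Fr.u ∷ Fr.v ∷ N ∷ []
        ann : ∃ λ g → NonZero g × (∀ k → g ∙ lookup vs k ≈ 0#)
        ann = annihilator (lookup vs)
        χ : Vec5
        χ = proj₁ ann
        χ-nonzero : NonZero χ
        χ-nonzero = proj₁ (proj₂ ann)
        χN : χ ∙ N ≈ 0#
        χN = proj₂ (proj₂ ann) (suc (suc (suc zero)))
        χ-solid : InSolid χ κ
        χ-solid = plane-in-subspace (kernel-subspace χ) κ Fr.o-in Fr.u-in Fr.v-in (independent-frame Fr.o-normal Fr.u-inf Fr.v-inf Fr.uv)
          (proj₂ (proj₂ ann) zero) (proj₂ (proj₂ ann) (suc zero)) (proj₂ (proj₂ ann) (suc (suc zero)))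
        a b c′ d : K
        a = χ ∙ P
        b = χ ∙ E₁
        c′ = χ ∙ E₂
        d = χ ∙ E₃
        value : ∀ {x y} → F x y ∈ κ → a + x * b + y * c′ + x * y * d ≈ 0#
        value {x} {y} m = trans (sym (surface-value {χ} χN x y)) (χ-solid m)
        κ≠ : ∀ {D} → IsClass N D → ∀ j → κ ≗̸ D j
        κ≠ D-class j e = N∉κ (from e (IsClass.dir D-class j))
        crosses : ∀ {D} → IsClass N D → ∀ j → ∃ λ k → c k ∈ κ × c k ∈ D j
        crosses {D} D-class j = intersect κ (D j) λ d → κ≠ D-class r (playfair (isC j) cκ (isC r) rκ (contains r) d
            (λ k kr kj → d r rκ (to (shared kr kj) (contains r))))
          where
          open IsClass D-class
          r = pts cκ 0≢
          rκ : c r ∈ κ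
          rκ = pts-in cκ 0≢
        at-x-of : ∀ x → ∃ λ y → F x y ∈ κ
        at-x-of x = convert (crosses A-class (at x 0#))
          where
          convert : (∃ λ k → c k ∈ κ × c k ∈ A (at x 0#)) → ∃ λ y → F x y ∈ κ
          convert (k , kκ , kA) = gy ∙ c k , ≡.subst (λ j → c j ∈ κ) (≡.sym (at-unique (trans (gx-const kA) (at-x x 0#)) refl)) kκ
        at-y-of : ∀ y → ∃ λ x → F x y ∈ κ
        at-y-of y = convert (crosses B-class (at 0# y))
          where
          convert : (∃ λ k → c k ∈ κ × c k ∈ B (at 0# y)) → ∃ λ x → F x y ∈ κ
          convert (k , kκ , kB) = gx ∙ c k , ≡.subst (λ j → c j ∈ κ) (≡.sym (at-unique refl (trans (gy-const kB) (at-y 0# y)))) kκ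
        same-column : ∀ {x y y′} → F x y ∈ κ → F x y′ ∈ κ → y ≈ y′
        same-column {x} {y} m m′ = proj₂ (at-injective
          (meet-once cκ (A.isC (at x y)) (κ≠ A-class _) m m′ (A.contains _) same-x))
        same-row : ∀ {x x′ y} → F x y ∈ κ → F x′ y ∈ κ → x ≈ x′
        same-row {x} {x′} {y} m m′ = proj₁ (at-injective
          (meet-once cκ (B.isC (at x y)) (κ≠ B-class _) m m′ (B.contains _) same-y))
        d≈0 : d ≈ 0#
        d≈0 = Dec.decidable-stable (d ≟ 0#) λ d≉0 → absurd d≉0
          where
          absurd : ¬ d ≈ 0# → ⊥
          absurd d≉0 = go (two-others (ix x₀)) (at-x-of x₀)
            where
            j = inv d d≉0
            x₀ : K
            x₀ = - (c′ * j)
            away : ∀ {t} → ix x₀ ≢ t → ¬ el t - x₀ ≈ 0#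
            away n e = n (≡.trans (ix-cong (sym (diff-zero e))) (ix-el _))
            at-x₀ : ∀ {y} → F x₀ y ∈ κ → a + x₀ * b ≈ 0#
            at-x₀ {y} m = lc₂ 1# (value m) (c′ * y) (inv-right d d≉0) (lemma a b c′ d j y)
              where
              lemma : ∀ a b c d j y → (a + - (c * j) * b) + (1# * 0# + c * y * 1#) ≈
                0# + (1# * (a + - (c * j) * b + y * c + - (c * j) * y * d) + c * y * (d * j))
              lemma a b c d j y = ring! (a ∷ b ∷ c ∷ d ∷ j ∷ y ∷ [])
            slope : ∀ {y₀ t y} → F x₀ y₀ ∈ κ → ix x₀ ≢ t → F (el t) y ∈ κ → b + d * y ≈ 0#
            slope {y₀} {t} {y} m n m′ = *-cancel-0 (away n)
              (lc₃ 1# (value m′) (- 1#) (at-x₀ m) (c′ * y) (inv-right d d≉0) (lemma a b c′ d j y (el t)))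
              where
              lemma : ∀ a b c d j y t → (t - - (c * j)) * (b + d * y) + (1# * 0# + (- 1# * 0# + c * y * 1#)) ≈
                0# + (1# * (a + t * b + y * c + t * y * d) + (- 1# * (a + - (c * j) * b) + c * y * (d * j)))
              lemma a b c d j y t = ring! (a ∷ b ∷ c ∷ d ∷ j ∷ y ∷ t ∷ [])
            go : (∃₂ λ u v → ix x₀ ≢ u × ix x₀ ≢ v × u ≢ v) → ¬ ∃ λ y → F x₀ y ∈ κ
            go (u , v , nu , nv , u≢v) (y₀ , m₀) = u≢v (el-injective (same-row (proj₂ (at-x-of (el u)))
                (F-in refl (sym y≈) (proj₂ (at-x-of (el v))))))
              where
              yu = proj₁ (at-x-of (el u))
              yv = proj₁ (at-x-of (el v))
              y≈ : yu ≈ yv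
              y≈ = diff-zero (*-cancel-0 d≉0 (lc₂ 1# (slope m₀ nu (proj₂ (at-x-of (el u)))) (- 1#) (slope m₀ nv (proj₂ (at-x-of (el v))))
                (lemma b d yu yv)))
                where
                lemma : ∀ b d u v → d * (u - v) + (1# * 0# + - 1# * 0#) ≈ 0# + (1# * (b + d * u) + - 1# * (b + d * v))
                lemma b d u v = ring! (b ∷ d ∷ u ∷ v ∷ [])
        linear : ∀ {x y} → F x y ∈ κ → a + b * x + c′ * y ≈ 0#
        linear {x} {y} m = lc₂ 1# (value m) (- (x * y)) d≈0 (lemma a b c′ d x y)
          where
          lemma : ∀ a b c d x y → (a + b * x + c * y) + (1# * 0# + - (x * y) * 0#) ≈ 0# + (1# * (a + x * b + y * c + x * y * d) + - (x * y) * d)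
          lemma a b c d x y = ring! (a ∷ b ∷ c ∷ d ∷ x ∷ y ∷ [])
        not-zero : ¬ (b ≈ 0# × c′ ≈ 0#)
        not-zero (b≈0 , c≈0) = not-all-F χ-nonzero λ x y → trans (surface-value {χ} χN x y)
          (lc₄ 1# a≈0 x b≈0 y c≈0 (x * y) d≈0 (lemma a b c′ d x y))
          where
          a≈0 : a ≈ 0#
          a≈0 = lc₃ 1# (linear (proj₂ (at-x-of 0#))) (- 0#) b≈0 (- proj₁ (at-x-of 0#)) c≈0 (lemma a b c′ (proj₁ (at-x-of 0#)))
            where
            lemma : ∀ a b c y → a + (1# * 0# + (- 0# * 0# + - y * 0#)) ≈ 0# + (1# * (a + b * 0# + c * y) + (- 0# * b + - y * c))
            lemma a b c y = ring! (a ∷ b ∷ c ∷ y ∷ [])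
          lemma : ∀ a b c d x y → (a + x * b + y * c + x * y * d) + (1# * 0# + (x * 0# + (y * 0# + x * y * 0#))) ≈
                  0# + (1# * a + (x * b + (y * c + x * y * d)))
          lemma a b c d x y = ring! (a ∷ b ∷ c ∷ d ∷ x ∷ y ∷ [])
        b≉0′ : ¬ b ≈ 0#
        b≉0′ b≈0 = 1≉0 (sym (same-row (proj₂ (at-x-of 0#)) (F-in refl (sym y≈) (proj₂ (at-x-of 1#)))))
          where
          y₀ = proj₁ (at-x-of 0#)
          y₁ = proj₁ (at-x-of 1#)
          y≈ : y₀ ≈ y₁
          y≈ = diff-zero (*-cancel-0 (λ c≈0 → not-zero (b≈0 , c≈0))
            (lc₃ 1# (linear (proj₂ (at-x-of 0#))) (- 1#) (linear (proj₂ (at-x-of 1#))) 1# b≈0 (lemma a b c′ y₀ y₁)))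
            where
            lemma : ∀ a b c y z → c * (y - z) + (1# * 0# + (- 1# * 0# + 1# * 0#)) ≈
              0# + (1# * (a + b * 0# + c * y) + (- 1# * (a + b * 1# + c * z) + 1# * b))
            lemma a b c y z = ring! (a ∷ b ∷ c ∷ y ∷ z ∷ [])
        c≉0′ : ¬ c′ ≈ 0#
        c≉0′ c≈0 = 1≉0 (sym (same-column (proj₂ (at-y-of 0#)) (F-in (sym x≈) refl (proj₂ (at-y-of 1#)))))
          where
          x₀ = proj₁ (at-y-of 0#)
          x₁ = proj₁ (at-y-of 1#)
          x≈ : x₀ ≈ x₁
          x≈ = diff-zero (*-cancel-0 b≉0′
            (lc₃ 1# (linear (proj₂ (at-y-of 0#))) (- 1#) (linear (proj₂ (at-y-of 1#))) 1# c≈0 (lemma a b c′ x₀ x₁)))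
            where
            lemma : ∀ a b c y z → b * (y - z) + (1# * 0# + (- 1# * 0# + 1# * 0#)) ≈
              0# + (1# * (a + b * y + c * 0#) + (- 1# * (a + b * z + c * 1#) + 1# * c))
            lemma a b c y z = ring! (a ∷ b ∷ c ∷ y ∷ z ∷ [])
        converse : ∀ {x y} → a + b * x + c′ * y ≈ 0# → F x y ∈ κ
        converse {x} {y} e = F-in refl (sym y≈) (proj₂ (at-x-of x))
          where
          y≈ : y ≈ proj₁ (at-x-of x)
          y≈ = diff-zero (*-cancel-0 c≉0′ (lc₂ 1# e (- 1#) (linear (proj₂ (at-x-of x))) (lemma a b c′ x y (proj₁ (at-x-of x)))))
            where
            lemma : ∀ a b c x y z → c * (y - z) + (1# * 0# + - 1# * 0#) ≈ 0# + (1# * (a + b * x + c * y) + - 1# * (a + b * x + c * z))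
            lemma a b c x y z = ring! (a ∷ b ∷ c ∷ x ∷ y ∷ z ∷ [])

      abstract
        line-of-plane : LineOf κ
        line-of-plane = record { a = a ; b = b ; c′ = c′ ; b≉0 = b≉0′ ; c≉0 = c≉0′ ; equation = linear ; on-line = converse }

  open Axis
  open Regular

  record Surface : Set where
    field
      P e₁ e₂ f N : Vec5
      α γ : K
      N-inf : Inf N
      at : K → K → Index
      at-cong : ∀ {x y x′ y′} → x ≈ x′ → y ≈ y′ → at x y ≡ at x′ y′
      at-injective : ∀ {x y x′ y′} → at x y ≡ at x′ y′ → x ≈ x′ × y ≈ y′
      at-onto : ∀ i → ∃₂ λ x y → at x y ≡ i
      formula : ∀ x y → c (at x y) ≈v ((((P ⊕ (x · e₁)) ⊕ (y · e₂)) ⊕ ((x * y) · f)) ⊕ ((α * (x * x) + γ * (y * y)) · N))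

  unit : Fin 5 → Vec5
  unit zero zero = 1#
  unit (suc zero) (suc zero) = 1#
  unit (suc (suc zero)) (suc (suc zero)) = 1#
  unit (suc (suc (suc zero))) (suc (suc (suc zero))) = 1#
  unit (suc (suc (suc (suc zero)))) (suc (suc (suc (suc zero)))) = 1#
  unit _ _ = 0#

  unit-dot : ∀ j v → unit j ∙ v ≈ v j
  unit-dot j v = trans (∙-dot (unit j) v) (lemma j (v zero) (v (suc zero)) (v (suc (suc zero))) (v (suc (suc (suc zero)))) (v (suc (suc (suc (suc zero))))) ≡.refl ≡.refl ≡.refl ≡.refl ≡.refl)
    where
    lemma : ∀ j a b c d e → a ≡ v zero → b ≡ v (suc zero) → c ≡ v (suc (suc zero)) → d ≡ v (suc (suc (suc zero))) → e ≡ v (suc (suc (suc (suc zero)))) →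
      unit j zero * a + unit j (suc zero) * b + unit j (suc (suc zero)) * c + unit j (suc (suc (suc zero))) * d + unit j (suc (suc (suc (suc zero)))) * e ≈ v j
    lemma zero a b c d e ≡.refl _ _ _ _ = ring! (a ∷ b ∷ c ∷ d ∷ e ∷ [])
    lemma (suc zero) a b c d e _ ≡.refl _ _ _ = ring! (a ∷ b ∷ c ∷ d ∷ e ∷ [])
    lemma (suc (suc zero)) a b c d e _ _ ≡.refl _ _ = ring! (a ∷ b ∷ c ∷ d ∷ e ∷ [])
    lemma (suc (suc (suc zero))) a b c d e _ _ _ ≡.refl _ = ring! (a ∷ b ∷ c ∷ d ∷ e ∷ [])
    lemma (suc (suc (suc (suc zero)))) a b c d e _ _ _ _ ≡.refl = ring! (a ∷ b ∷ c ∷ d ∷ e ∷ [])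

  find-dual : ∀ {N M} → NonZero M → ¬ Multiple M N → ∃ λ η → η ∙ N ≈ 1# × η ∙ M ≈ 0#
  find-dual {N} {M} M≉0 ¬mult = conclude (support M≉0)
    where
    conclude : (∃ λ i → ¬ M i ≈ 0#) → ∃ λ η → η ∙ N ≈ 1# × η ∙ M ≈ 0#
    conclude (i , Mi) = second (support W-nonzero)
      where
      m = inv (M i) Mi
      W : Vec5
      W = N ⊕ ((- (N i * m)) · M)
      W-nonzero : NonZero W
      W-nonzero z = ¬mult (N i * m , λ k → lc₁ 1# (z k) (ring! (N k ∷ M k ∷ N i ∷ m ∷ [])))
      second : (∃ λ j → ¬ W j ≈ 0#) → ∃ λ η → η ∙ N ≈ 1# × η ∙ M ≈ 0#
      second (j , Wj) = η , on-N , on-M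
        where
        w = inv (W j) Wj
        ξ η : Vec5
        ξ = unit j ⊕ ((- (M j * m)) · unit i)
        η = ξ ⊕ ((w - 1#) · ξ)
        ξ-value : ∀ v → ξ ∙ v ≈ v j + - (M j * m) * v i
        ξ-value v = trans (dot-left (unit j) _ (unit i) v) (+-cong (unit-dot j v) (*-congˡ (unit-dot i v)))
        η-value : ∀ v → η ∙ v ≈ w * (v j + - (M j * m) * v i)
        η-value v = trans (dot-left ξ (w - 1#) ξ v) (trans (+-cong (ξ-value v) (*-congˡ (ξ-value v)))
          (lemma w (v j + - (M j * m) * v i)))
          where
          lemma : ∀ w x → x + (w - 1#) * x ≈ w * x
          lemma w x = ring! (w ∷ x ∷ [])
        on-N : η ∙ N ≈ 1#
        on-N = trans (η-value N) (lc₁ 1# (inv-right (W j) Wj) (lemma w (N j) (M j) m (N i)))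
          where
          lemma : ∀ w a b m d → w * (a + - (b * m) * d) + 1# * 1# ≈ 1# + 1# * ((a + - (d * m) * b) * w)
          lemma w a b m d = ring! (w ∷ a ∷ b ∷ m ∷ d ∷ [])
        on-M : η ∙ M ≈ 0#
        on-M = trans (η-value M) (lc₁ (- (w * M j)) (inv-right (M i) Mi) (lemma w (M j) m (M i)))
          where
          lemma : ∀ w b m d → w * (b + - (b * m) * d) + - (w * b) * 1# ≈ 0# + - (w * b) * (d * m)
          lemma w b m d = ring! (w ∷ b ∷ m ∷ d ∷ [])

  abstract
    dual : ∀ {N M} → NonZero M → ¬ Multiple M N → ∃ λ η → η ∙ N ≈ 1# × η ∙ M ≈ 0#
    dual = find-dual

  module TwoGrids {N} (G : Grid N) (p : Index) where
    open Lines₂ G p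
    private
      module A = IsClass A-class
      module B = IsClass B-class

    record Slope (κ : Plane) (k a : K) : Set where
      field
        equation : ∀ {x y} → F x y ∈ κ → x + k * y ≈ a
        on-line  : ∀ {x y} → x + k * y ≈ a → F x y ∈ κ

    find-slope : ∀ {κ} → CPlane κ → ¬ N ∈ κ → ∃₂ λ k a → Slope κ k a
    find-slope {κ} cκ N∉ = L.c′ * j , - (L.a * j) , record
        { equation = λ {x} {y} m → lc₂ j (L.equation m) (- x) (inv-right L.b L.b≉0) (ring! (x ∷ y ∷ L.a ∷ L.b ∷ L.c′ ∷ j ∷ []))
        ; on-line = λ {x} {y} e → L.on-line (lc₂ L.b e (- (L.a + L.c′ * y)) (inv-right L.b L.b≉0) (ring! (x ∷ y ∷ L.a ∷ L.b ∷ L.c′ ∷ j ∷ []))) }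
      where
      module L = LineOf (line-of-plane cκ N∉)
      j = inv L.b L.b≉0

    abstract
      slope : ∀ {κ} → CPlane κ → ¬ N ∈ κ → ∃₂ λ k a → Slope κ k a
      slope = find-slope

    open Slope

    -- The members of a class whose direction is not N are the lines of one parallel class.
    module Parallels {M D} (D-class : IsClass M D) (free : ∀ j → ¬ N ∈ D j) where
      private
        module D = IsClass D-class
        o = at 0# 0#
        line : ∀ j → ∃₂ λ k a → Slope (D j) k a
        line j = slope (D.isC j) (free j)
      k : K
      k = proj₁ (line o)
      base : Slope (D o) k (proj₁ (proj₂ (line o)))
      base = proj₂ (proj₂ (line o))
      level-zero : proj₁ (proj₂ (line o)) ≈ 0#
      level-zero = trans (sym (equation base (D.contains o))) (ring! (k ∷ []))
      through-o : ∀ {x y} → x + k * y ≈ 0# → F x y ∈ D o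
      through-o e = on-line base (trans e (sym level-zero))
      on-o : ∀ {x y} → F x y ∈ D o → x + k * y ≈ 0#
      on-o m = trans (equation base m) level-zero
      same-slope : ∀ j {k′ a′} → Slope (D j) k′ a′ → k′ ≈ k
      same-slope j {k′} {a′} S = Dec.decidable-stable (k′ ≟ k) λ n → absurd n
        where
        absurd : ¬ ¬ k′ ≈ k
        absurd n = n (lc₂ (- 1#) (in-D k (- 1#) (ring! (k ∷ []))) 1# (in-D 0# 0# (ring! (k ∷ []))) (ring! (k ∷ k′ ∷ a′ ∷ [])))
          where
          diff : ¬ k′ - k ≈ 0#
          diff e = n (diff-zero e)
          y : K
          y = a′ * inv (k′ - k) diff
          common : F (- (k * y)) y ∈ D j
          common = on-line S (lc₁ a′ (inv-right (k′ - k) diff) (lemma k k′ a′ (inv (k′ - k) diff)))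
            where
            lemma : ∀ k k′ a j → (- (k * (a * j)) + k′ * (a * j)) + a * 1# ≈ a + a * ((k′ - k) * j)
            lemma k k′ a j = ring! (k ∷ k′ ∷ a ∷ j ∷ [])
          same-plane : D o ≗ D j
          same-plane = D.shared (through-o (ring! (k ∷ a′ ∷ inv (k′ - k) diff ∷ []))) common
          in-D : ∀ u v → u + k * v ≈ 0# → u + k′ * v ≈ a′
          in-D u v e = equation S (to same-plane (through-o e))
      parallel : ∀ x y t → F (x + t * k) (y + t * - 1#) ∈ D (at x y)
      parallel x y t = on-line S (lc₂ 1# (equation S (D.contains (at x y))) (- t) (same-slope (at x y) S)
          (lemma x y t k (proj₁ (line (at x y))) (proj₁ (proj₂ (line (at x y))))))
        where
        S = proj₂ (proj₂ (line (at x y)))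
        lemma : ∀ x y t k k′ a → ((x + t * k) + k′ * (y + t * - 1#)) + (1# * a + - t * k) ≈ a + (1# * (x + k′ * y) + - t * k′)
        lemma x y t k k′ a = ring! (x ∷ y ∷ t ∷ k ∷ k′ ∷ a ∷ [])
      direction : gx ∙ M + k * gy ∙ M ≈ 0#
      direction = trans (sym (dot-left gx k gy M)) (solid (D.dir o))
        where
        ψ : Vec5
        ψ = gx ⊕ (k · gy)
        ψ-point : ∀ {i} → c i ∈ D o → ψ ∙ c i ≈ 0#
        ψ-point {i} m = trans (dot-left gx k gy (c i)) (on-o (≡.subst (λ j → c j ∈ D o) (≡.sym (at-unique refl refl)) m))
        solid : InSolid ψ (D o)
        solid = solid-of-three (D.isC o) (0≢1 ∘ pts-injective (D.isC o)) (0≢2 ∘ pts-injective (D.isC o)) (1≢2 ∘ pts-injective (D.isC o))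
          (pts-in (D.isC o) 0≢) (pts-in (D.isC o) 1≢) (pts-in (D.isC o) 2≢)
          (ψ-point (pts-in (D.isC o) 0≢)) (ψ-point (pts-in (D.isC o) 1≢)) (ψ-point (pts-in (D.isC o) 2≢))

    module Second {M} (G′ : Grid M) (not-multiple : ¬ Multiple M N) where
      private
        module G″ = Grid G′
        a′ = axis (IsClass.regular G″.A-class p)

      free : ∀ {D} → IsClass M D → ∀ j → ¬ N ∈ D j
      free {D} D-class j N∈ = decide (D.isC j ≗? A.isC j)
        where
        module D = IsClass D-class
        via : ∀ {ρ} → CPlane ρ → D j ≗̸ ρ → c j ∈ ρ → N ∈ ρ → ⊥
        via cρ n jρ Nρ = not-multiple (only (axis (D.regular j)) (c-normal j) N-inf′ N-nonzero′ (D.contains j) N∈ (two-special cρ n jρ Nρ))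
        decide : ¬ Dec (D j ≗ A j)
        decide (yes e) = via (B.isC j) (λ e′ → A≠B j j (≗-trans (≗-sym e) e′)) (B.contains j) (B.dir j)
        decide (no n) = via (A.isC j) n (A.contains j) (A.dir j)

      module U = Parallels G″.A-class (free G″.A-class)
      module V = Parallels G″.B-class (free G″.B-class)

      slopes-differ : ¬ U.k - V.k ≈ 0#
      slopes-differ e = G″.A≠B o o (meet-two (IsClass.isC G″.A-class o) (IsClass.isC G″.B-class o) o≢
          (IsClass.contains G″.A-class o) (U.through-o (ring! (U.k ∷ []))) (IsClass.contains G″.B-class o)
          (V.through-o (lc₁ 1# e (ring! (U.k ∷ V.k ∷ [])))))
        where
        o = at 0# 0#
        o≢ : o ≢ at U.k (- 1#)
        o≢ f = neg-nonzero 1≉0 (sym (proj₂ (at-injective f)))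

      gyM : gy ∙ M ≈ 0#
      gyM = *-cancel-0 slopes-differ (lc₂ 1# U.direction (- 1#) V.direction (ring! (U.k ∷ V.k ∷ gx ∙ M ∷ gy ∙ M ∷ [])))

      straight-along : ∀ {D} (D-class : IsClass M D) k → (∀ x y t → F (x + t * k) (y + t * - 1#) ∈ D (at x y)) → Straight M k (- 1#)
      straight-along D-class k par = straight D-class k (- 1#) gy (- 1#) (neg-nonzero 1≉0) gyM
        (λ x y t → trans (at-y _ _) (+-congʳ (sym (at-y x y)))) par

      j : K
      j = inv (U.k - V.k) slopes-differ

      s t : K → K → K
      s x y = j * (x + V.k * y)
      t x y = - (j * (x + U.k * y))

      E₁′ E₂′ E₃′ : Vec5
      E₁′ = F U.k (- 1#) ⊕ ((- 1#) · P)
      E₂′ = F V.k (- 1#) ⊕ ((- 1#) · P)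
      E₃′ = (F (U.k + V.k) (- 1# + - 1#) ⊕ ((- 1#) · F U.k (- 1#))) ⊕ (P ⊕ ((- 1#) · F V.k (- 1#)))

      surface′ : ∀ x y → ∃ λ φ → F x y ≈v ((((P ⊕ (s x y · E₁′)) ⊕ (t x y · E₂′)) ⊕ ((s x y * t x y) · E₃′)) ⊕ (φ · M))
      surface′ x y = conclude (interpolation (straight-along G″.A-class U.k U.parallel) (straight-along G″.B-class V.k V.parallel) (s x y) (t x y))
        where
        ex : s x y * U.k + t x y * V.k ≈ x
        ex = lc₁ x (inv-right _ slopes-differ) (lemma j x y U.k V.k)
          where
          lemma : ∀ j x y u v → (j * (x + v * y) * u + - (j * (x + u * y)) * v) + x * 1# ≈ x + x * ((u - v) * j)
          lemma j x y u v = ring! (j ∷ x ∷ y ∷ u ∷ v ∷ [])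
        ey : s x y * - 1# + t x y * - 1# ≈ y
        ey = lc₁ y (inv-right _ slopes-differ) (lemma j x y U.k V.k)
          where
          lemma : ∀ j x y u v → (j * (x + v * y) * - 1# + - (j * (x + u * y)) * - 1#) + y * 1# ≈ y + y * ((u - v) * j)
          lemma j x y u v = ring! (j ∷ x ∷ y ∷ u ∷ v ∷ [])
        conclude : (∃ λ φ → F (s x y * U.k + t x y * V.k) (s x y * - 1# + t x y * - 1#) ≈v
                      (bilinear U.k (- 1#) V.k (- 1#) (s x y) (t x y) ⊕ (φ · M))) →
                   ∃ λ φ → F x y ≈v ((((P ⊕ (s x y · E₁′)) ⊕ (t x y · E₂′)) ⊕ ((s x y * t x y) · E₃′)) ⊕ (φ · M))
        conclude (φ , e) = φ , ≈v-trans (F-cong (sym ex) (sym ey)) e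

      -- Comparing the two interpolations along a functional with η · N = 1, η · M = 0.
      private
        ηd = dual {N} {M} (N-nonzero a′) not-multiple
      η : Vec5
      η = proj₁ ηd
      λ₁ λ₂ α β γ : K
      λ₁ = j * η ∙ E₁′ - j * η ∙ E₂′ - η ∙ E₁
      λ₂ = j * V.k * η ∙ E₁′ - j * U.k * η ∙ E₂′ - η ∙ E₂
      α = - (j * j * η ∙ E₃′)
      β = - (j * j * (U.k + V.k) * η ∙ E₃′) - η ∙ E₃
      γ = - (j * j * (U.k * V.k) * η ∙ E₃′)

      φ-value : ∀ x y → proj₁ (surface x y) ≈ λ₁ * x + λ₂ * y + α * (x * x) + β * (x * y) + γ * (y * y)
      φ-value x y = compare (trans (dot-cong η (proj₂ (surface x y))) (dot-comb₅ η P x E₁ y E₂ (x * y) E₃ φ N))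
          (trans (dot-cong η (proj₂ (surface′ x y))) (dot-comb₅ η P (s x y) E₁′ (t x y) E₂′ (s x y * t x y) E₃′ (proj₁ (surface′ x y)) M))
        where
        φ = proj₁ (surface x y)
        ψ = proj₁ (surface′ x y)
        compare : ∀ {v} → v ≈ η ∙ P + x * η ∙ E₁ + y * η ∙ E₂ + x * y * η ∙ E₃ + φ * η ∙ N →
          v ≈ η ∙ P + s x y * η ∙ E₁′ + t x y * η ∙ E₂′ + s x y * t x y * η ∙ E₃′ + ψ * η ∙ M →
          φ ≈ λ₁ * x + λ₂ * y + α * (x * x) + β * (x * y) + γ * (y * y)
        compare {v} e₁ e₂ = trans (lc₄ (- 1#) e₁ 1# e₂ (- φ) (proj₁ (proj₂ ηd)) ψ (proj₂ (proj₂ ηd))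
            (isolate (η ∙ P) (x * η ∙ E₁) (y * η ∙ E₂) (x * y * η ∙ E₃) (s x y * η ∙ E₁′) (t x y * η ∙ E₂′) (s x y * t x y * η ∙ E₃′) (η ∙ N) (η ∙ M) φ ψ v))
          (expand x y (η ∙ E₁) (η ∙ E₂) (η ∙ E₃) (η ∙ E₁′) (η ∙ E₂′) (η ∙ E₃′) j U.k V.k)
          where
          isolate : ∀ p a b d a′ b′ d′ n m φ ψ v →
            φ + (- 1# * (p + a + b + d + φ * n) + (1# * (p + a′ + b′ + d′ + ψ * m) + (- φ * 1# + ψ * 0#))) ≈
            (a′ + b′ + d′ - (a + b + d)) + (- 1# * v + (1# * v + (- φ * n + ψ * m)))
          isolate p a b d a′ b′ d′ n m φ ψ v = ring! (p ∷ a ∷ b ∷ d ∷ a′ ∷ b′ ∷ d′ ∷ n ∷ m ∷ φ ∷ ψ ∷ v ∷ [])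
          expand : ∀ x y a b d a′ b′ d′ j u w →
            j * (x + w * y) * a′ + - (j * (x + u * y)) * b′ + j * (x + w * y) * - (j * (x + u * y)) * d′ - (x * a + y * b + x * y * d) ≈
            (j * a′ - j * b′ - a) * x + (j * w * a′ - j * u * b′ - b) * y + - (j * j * d′) * (x * x) +
              (- (j * j * (u + w) * d′) - d) * (x * y) + - (j * j * (u * w) * d′) * (y * y)
          expand x y a b d a′ b′ d′ j u w = ring! (x ∷ y ∷ a ∷ b ∷ d ∷ a′ ∷ b′ ∷ d′ ∷ j ∷ u ∷ w ∷ [])

      quadric : Surface
      quadric = record
        { P = P ; e₁ = E₁ ⊕ (λ₁ · N) ; e₂ = E₂ ⊕ (λ₂ · N) ; f = E₃ ⊕ (β · N) ; N = N ; α = α ; γ = γ ; N-inf = N-inf′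
        ; at = at ; at-cong = at-cong ; at-injective = at-injective
        ; at-onto = λ i → gx ∙ c i , gy ∙ c i , at-unique refl refl
        ; formula = λ x y i → trans (proj₂ (surface x y) i) (trans (+-congˡ (*-congʳ (φ-value x y)))
            (lemma x y (P i) (E₁ i) (E₂ i) (E₃ i) (N i) λ₁ λ₂ α β γ)) }
        where
        lemma : ∀ x y p a b d n l₁ l₂ α β γ → p + x * a + y * b + x * y * d + (l₁ * x + l₂ * y + α * (x * x) + β * (x * y) + γ * (y * y)) * n ≈
                p + x * (a + l₁ * n) + y * (b + l₂ * n) + x * y * (d + β * n) + (α * (x * x) + γ * (y * y)) * n
        lemma x y p a b d n l₁ l₂ α β γ = ring! (x ∷ y ∷ p ∷ a ∷ b ∷ d ∷ n ∷ l₁ ∷ l₂ ∷ α ∷ β ∷ γ ∷ [])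

    abstract
      surface-exists : Surface
      surface-exists = Second.quadric (MakeGrid.grid cτ (axis-regular cτ aτ) (Joining.left J)) (λ m → N∉τ (multiple-in m (N-in aτ)))
        where
        o≢ : at 0# 0# ≢ at 1# 1#
        o≢ e = 1≉0 (sym (proj₁ (at-injective e)))
        J : Joining (at 0# 0#) (at 1# 1#)
        J = join o≢
        τ : Plane
        τ = Joining.plane J
        cτ : CPlane τ
        cτ = Joining.isC J
        aτ : Axis τ (proj₁ (axis-exists cτ))
        aτ = proj₂ (axis-exists cτ)
        τ≠A : τ ≗̸ A (at 0# 0#)
        τ≠A e = 1≉0 (trans (sym (at-x 1# 1#)) (trans (gx-const (to e (Joining.right J))) (at-x 0# 0#)))
        τ≠B : τ ≗̸ B (at 0# 0#)
        τ≠B e = 1≉0 (trans (sym (at-y 1# 1#)) (trans (gy-const (to e (Joining.right J))) (at-y 0# 0#)))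
        N∉τ : ¬ N ∈ τ
        N∉τ N∈ = triple-axis cτ (A.isC _) (B.isC _) τ≠A τ≠B (A≠B _ _) (c-normal _) N-inf′ N-nonzero′
          (Joining.left J) (A.contains _) (B.contains _) N∈ (A.dir _) (B.dir _)

  abstract
    the-surface : Surface
    the-surface = TwoGrids.surface-exists (MakeGrid.grid cπ (axis-regular cπ (proj₂ (axis-exists cπ))) (Joining.left J)) index₀
      where
      J : Joining index₀ index₁
      J = join index₀≢index₁
      cπ : CPlane (Joining.plane J)
      cπ = Joining.isC J

module Quadrics (R : CommutativeRing 0ℓ 0ℓ) (q : ℕ) (7≤q : 7 ℕ.≤ q) (isField : IsFiniteField R q)
  (2≉0 : ¬ CommutativeRing._≈_ R (CommutativeRing._+_ R (CommutativeRing.1# R) (CommutativeRing.1# R)) (CommutativeRing.0# R))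
  (h : Fin 5 → CommutativeRing.Carrier R) (C : Fin (q ℕ.* q) → Geometry.Vec5 R q h) (CPlane : Geometry.Plane R q h → Set)
  (hypotheses : Geometry.Config.Hypotheses R q h C CPlane) where
  open CommutativeRing R renaming (Carrier to K) hiding (zero)
  open RingTactic R
  open FiniteField R q isField
  open Geometry R q h
  open Config C CPlane
  open Vectors R q isField h
  open Incidence R q isField h
  open Hypotheses hypotheses
  open Configuration R q 7≤q isField h C CPlane hypotheses
  open Surfaces R q 7≤q isField h C CPlane hypotheses

  open Surface the-surface public

  -- The vector x e₁ + y e₂ + z f + w N of Σ∞, for the surface
  -- 𝒞 = { P + x e₁ + y e₂ + x y f + (α x² + γ y²) N }.
  ⟨_,_,_,_⟩ : K → K → K → K → Vec5
  ⟨ x , y , z , w ⟩ = (((x · e₁) ⊕ (y · e₂)) ⊕ (z · f)) ⊕ (w · N)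

  F : K → K → Vec5
  F x y = c (at x y)

  F-formula : ∀ x y i → F x y i ≈ P i + ⟨ x , y , x * y , α * (x * x) + γ * (y * y) ⟩ i
  F-formula x y i = trans (formula x y i) (lemma (P i) (e₁ i) (e₂ i) (f i) (N i) x y (α * (x * x) + γ * (y * y)))
    where
    lemma : ∀ p a b d n x y w → p + x * a + y * b + x * y * d + w * n ≈ p + (x * a + y * b + x * y * d + w * n)
    lemma p a b d n x y w = ring! (p ∷ a ∷ b ∷ d ∷ n ∷ x ∷ y ∷ w ∷ [])

  F-value : ∀ g x y → g ∙ F x y ≈ g ∙ P + x * g ∙ e₁ + y * g ∙ e₂ + x * y * g ∙ f + (α * (x * x) + γ * (y * y)) * g ∙ N
  F-value g x y = trans (dot-cong g (formula x y)) (dot-comb₅ g P x e₁ y e₂ (x * y) f (α * (x * x) + γ * (y * y)) N)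

  P-normal : Normal P
  P-normal = lc₂ (- 1#) (F-value h 0# 0#) 1# (c-normal (at 0# 0#)) (lemma α γ (h ∙ F 0# 0#) (h ∙ P) (h ∙ e₁) (h ∙ e₂) (h ∙ f) (h ∙ N))
    where
    lemma : ∀ α γ u p a b d n →
      p + (- 1# * (p + 0# * a + 0# * b + 0# * 0# * d + (α * (0# * 0#) + γ * (0# * 0#)) * n) + 1# * 1#) ≈ 1# + (- 1# * u + 1# * u)
    lemma α γ u p a b d n = ring! (α ∷ γ ∷ u ∷ p ∷ a ∷ b ∷ d ∷ n ∷ [])

  height : ∀ x y → x * h ∙ e₁ + y * h ∙ e₂ + x * y * h ∙ f ≈ 0#
  height x y = lc₄ (- 1#) (F-value h x y) 1# (c-normal (at x y)) (- 1#) P-normal (- (α * (x * x) + γ * (y * y))) N-inf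
    (lemma x y (α * (x * x) + γ * (y * y)) (h ∙ F x y) (h ∙ P) (h ∙ e₁) (h ∙ e₂) (h ∙ f) (h ∙ N))
    where
    lemma : ∀ x y w u p a b d n → (x * a + y * b + x * y * d) + (- 1# * (p + x * a + y * b + x * y * d + w * n) + (1# * 1# + (- 1# * 1# + - w * 0#))) ≈
      0# + (- 1# * u + (1# * u + (- 1# * p + - w * n)))
    lemma x y w u p a b d n = ring! (x ∷ y ∷ w ∷ u ∷ p ∷ a ∷ b ∷ d ∷ n ∷ [])

  e₁-inf : Inf e₁
  e₁-inf = trans (ring! (h ∙ e₁ ∷ h ∙ e₂ ∷ h ∙ f ∷ [])) (height 1# 0#)

  e₂-inf : Inf e₂
  e₂-inf = trans (ring! (h ∙ e₁ ∷ h ∙ e₂ ∷ h ∙ f ∷ [])) (height 0# 1#)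

  f-inf : Inf f
  f-inf = lc₃ 1# (height 1# 1#) (- 1#) e₁-inf (- 1#) e₂-inf (ring! (h ∙ e₁ ∷ h ∙ e₂ ∷ h ∙ f ∷ []))

  dot-⟨⟩ : ∀ g x y z w → g ∙ ⟨ x , y , z , w ⟩ ≈ x * g ∙ e₁ + y * g ∙ e₂ + z * g ∙ f + w * g ∙ N
  dot-⟨⟩ g x y z w = trans (dot-⊕ g _ (w · N)) (+-cong (dot-comb₃ g x e₁ y e₂ z f) (dot-· g w N))

  ⟨⟩-inf : ∀ x y z w → Inf ⟨ x , y , z , w ⟩
  ⟨⟩-inf x y z w = trans (dot-⟨⟩ h x y z w) (trans (+-cong (+-cong (+-cong (*-congˡ e₁-inf) (*-congˡ e₂-inf)) (*-congˡ f-inf)) (*-congˡ N-inf))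
    (ring! (x ∷ y ∷ z ∷ w ∷ [])))

  basis : Vec Vec5 5
  basis = P ∷ e₁ ∷ e₂ ∷ f ∷ N ∷ []

  basis-independent : ¬ Dependent (lookup basis)
  basis-independent d = conclude (dependent-annihilator (lookup basis) d)
    where
    conclude : ¬ ∃ λ g → NonZero g × (∀ k → g ∙ lookup basis k ≈ 0#)
    conclude (g , g≉0 , z) = not-all-in-solid g≉0 λ i → on-point i (at-onto i)
      where
      on-point : ∀ i → (∃₂ λ x y → at x y ≡ i) → g ∙ c i ≈ 0#
      on-point i (x , y , ≡.refl) = trans (F-value g x y) (trans (+-cong (+-cong (+-cong (+-cong (z zero) (*-congˡ (z (suc zero))))
        (*-congˡ (z (suc (suc zero))))) (*-congˡ (z (suc (suc (suc zero)))))) (*-congˡ (z (suc (suc (suc (suc zero)))))))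
        (lemma x y (α * (x * x) + γ * (y * y))))
        where
        lemma : ∀ x y w → 0# + x * 0# + y * 0# + x * y * 0# + w * 0# ≈ 0#
        lemma x y w = ring! (x ∷ y ∷ w ∷ [])

  ⟨⟩-zero : ∀ {x y z w} → ⟨ x , y , z , w ⟩ ≈v 0v → x ≈ 0# × y ≈ 0# × z ≈ 0# × w ≈ 0#
  ⟨⟩-zero {x} {y} {z} {w} e = vanish (suc zero) , vanish (suc (suc zero)) , vanish (suc (suc (suc zero))) , vanish (suc (suc (suc (suc zero))))
    where
    coefficients : Vec K 5
    coefficients = 0# ∷ x ∷ y ∷ z ∷ w ∷ []
    vanish : ∀ j → lookup coefficients j ≈ 0#
    vanish j = Dec.decidable-stable (lookup coefficients j ≟ 0#) λ n →
      basis-independent (lookup coefficients , (j , n) , λ i → lc₁ 1# (e i) (lemma (P i) (e₁ i) (e₂ i) (f i) (N i)))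
      where
      lemma : ∀ p a b d n → 0# * p + (x * a + (y * b + (z * d + (w * n + 0#)))) + 1# * 0# ≈ 0# + 1# * (x * a + y * b + z * d + w * n)
      lemma p a b d n = ring! (p ∷ a ∷ b ∷ d ∷ n ∷ x ∷ y ∷ z ∷ w ∷ [])

  ⟨⟩-injective : ∀ {x y z w x′ y′ z′ w′} → ⟨ x , y , z , w ⟩ ≈v ⟨ x′ , y′ , z′ , w′ ⟩ → x ≈ x′ × y ≈ y′ × z ≈ z′ × w ≈ w′
  ⟨⟩-injective {x} {y} {z} {w} {x′} {y′} {z′} {w′} e = diff-zero (proj₁ zs) , diff-zero (proj₁ (proj₂ zs)) ,
      diff-zero (proj₁ (proj₂ (proj₂ zs))) , diff-zero (proj₂ (proj₂ (proj₂ zs)))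
    where
    lemma : ∀ a b d n → (x - x′) * a + (y - y′) * b + (z - z′) * d + (w - w′) * n + 1# * (x′ * a + y′ * b + z′ * d + w′ * n) ≈
            0# + 1# * (x * a + y * b + z * d + w * n)
    lemma a b d n = ring! (a ∷ b ∷ d ∷ n ∷ x ∷ y ∷ z ∷ w ∷ x′ ∷ y′ ∷ z′ ∷ w′ ∷ [])
    zs : x - x′ ≈ 0# × y - y′ ≈ 0# × z - z′ ≈ 0# × w - w′ ≈ 0#
    zs = ⟨⟩-zero λ i → lc₁ 1# (e i) (lemma (e₁ i) (e₂ i) (f i) (N i))

  coordinates : ∀ {w} → Inf w → ∃₂ λ x y → ∃₂ λ z v → w ≈v ⟨ x , y , z , v ⟩
  coordinates {w} hw = conclude (six-dependent (lookup (w ∷ basis)))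
    where
    conclude : Dependent (lookup (w ∷ basis)) → ∃₂ λ x y → ∃₂ λ z v → w ≈v ⟨ x , y , z , v ⟩
    conclude (x , (j , xj) , e) = by-cases (x zero ≟ 0#)
      where
      x₁ = x (suc zero)
      x₂ = x (suc (suc zero))
      x₃ = x (suc (suc (suc zero)))
      x₄ = x (suc (suc (suc (suc zero))))
      x₅ = x (suc (suc (suc (suc (suc zero)))))
      by-cases : Dec (x zero ≈ 0#) → ∃₂ λ x y → ∃₂ λ z v → w ≈v ⟨ x , y , z , v ⟩
      by-cases (yes z) = ⊥-elim (basis-independent (x ∘ suc , nonzero j xj , λ i → lc₂ 1# (e i) (- w i) z (lemma (w i) (P i) (e₁ i) (e₂ i) (f i) (N i) (x zero) x₁ x₂ x₃ x₄ x₅)))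
        where
        nonzero : ∀ j → ¬ x j ≈ 0# → ∃ λ k → ¬ x (suc k) ≈ 0#
        nonzero zero n = ⊥-elim (n z)
        nonzero (suc k) n = k , n
        lemma : ∀ w p a b d n x₀ x₁ x₂ x₃ x₄ x₅ → (x₁ * p + (x₂ * a + (x₃ * b + (x₄ * d + (x₅ * n + 0#))))) + (1# * 0# + - w * 0#) ≈
          0# + (1# * (x₀ * w + (x₁ * p + (x₂ * a + (x₃ * b + (x₄ * d + (x₅ * n + 0#)))))) + - w * x₀)
        lemma w p a b d n x₀ x₁ x₂ x₃ x₄ x₅ = ring! (w ∷ p ∷ a ∷ b ∷ d ∷ n ∷ x₀ ∷ x₁ ∷ x₂ ∷ x₃ ∷ x₄ ∷ x₅ ∷ [])
      by-cases (no n) = - (j₀ * x₂) , - (j₀ * x₃) , - (j₀ * x₄) , - (j₀ * x₅) , λ i →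
          lc₃ j₀ (e i) (- w i) (inv-right (x zero) n) (- (j₀ * P i)) p-zero (lemma (w i) (P i) (e₁ i) (e₂ i) (f i) (N i) (x zero) x₁ x₂ x₃ x₄ x₅ j₀)
        where
        j₀ = inv (x zero) n
        p-zero : x₁ ≈ 0#
        p-zero = scalars (trans (sym (dot-comb₃ h (x zero) w x₁ P 1# ⟨ x₂ , x₃ , x₄ , x₅ ⟩)) (trans (dot-cong h {v = 0# · P} combined)
            (trans (dot-· h 0# P) (zeroˡ _)))) hw P-normal (⟨⟩-inf x₂ x₃ x₄ x₅)
          where
          combined : (((x zero · w) ⊕ (x₁ · P)) ⊕ (1# · ⟨ x₂ , x₃ , x₄ , x₅ ⟩)) ≈v (0# · P)
          combined i = lc₁ 1# (e i) (lemma′ (w i) (P i) (e₁ i) (e₂ i) (f i) (N i) (x zero) x₁ x₂ x₃ x₄ x₅)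
            where
            lemma′ : ∀ w p a b d n x₀ x₁ x₂ x₃ x₄ x₅ → (x₀ * w + x₁ * p + 1# * (x₂ * a + x₃ * b + x₄ * d + x₅ * n)) + 1# * 0# ≈
              0# * p + 1# * (x₀ * w + (x₁ * p + (x₂ * a + (x₃ * b + (x₄ * d + (x₅ * n + 0#))))))
            lemma′ w p a b d n x₀ x₁ x₂ x₃ x₄ x₅ = ring! (w ∷ p ∷ a ∷ b ∷ d ∷ n ∷ x₀ ∷ x₁ ∷ x₂ ∷ x₃ ∷ x₄ ∷ x₅ ∷ [])
          scalars : ∀ {a b u v w} → a * u + b * v + 1# * w ≈ 0# → u ≈ 0# → v ≈ 1# → w ≈ 0# → b ≈ 0#
          scalars {a} {b} {u} {v} {w} s eu ev ew = lc₄ 1# s (- a) eu (- b) ev (- 1#) ew (ring! (a ∷ b ∷ u ∷ v ∷ w ∷ []))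
        lemma : ∀ w p a b d n x₀ x₁ x₂ x₃ x₄ x₅ j → w + (j * 0# + (- w * 1# + - (j * p) * 0#)) ≈
          (- (j * x₂) * a + - (j * x₃) * b + - (j * x₄) * d + - (j * x₅) * n) +
          (j * (x₀ * w + (x₁ * p + (x₂ * a + (x₃ * b + (x₄ * d + (x₅ * n + 0#)))))) + (- w * (x₀ * j) + - (j * p) * x₁))
        lemma w p a b d n x₀ x₁ x₂ x₃ x₄ x₅ j = ring! (w ∷ p ∷ a ∷ b ∷ d ∷ n ∷ x₀ ∷ x₁ ∷ x₂ ∷ x₃ ∷ x₄ ∷ x₅ ∷ j ∷ [])

  -- Directions of the tangents and of the axes: F (p + t d) = F p + t tangent p d + t² apex d.
  tangent : K → K → K → K → Vec5
  tangent x y a b = ⟨ a , b , x * b + y * a , two * (α * (x * a) + γ * (y * b)) ⟩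

  apex : K → K → Vec5
  apex a b = ⟨ 0# , 0# , a * b , α * (a * a) + γ * (b * b) ⟩

  F-along : ∀ x y a b t → F (x + t * a) (y + t * b) ≈v ((F x y ⊕ (t · tangent x y a b)) ⊕ ((t * t) · apex a b))
  F-along x y a b t i = lc₂ 1# (F-formula (x + t * a) (y + t * b) i) (- 1#) (F-formula x y i)
      (lemma (F (x + t * a) (y + t * b) i) (F x y i) (P i) (e₁ i) (e₂ i) (f i) (N i) x y a b t α γ)
    where
    lemma : ∀ l o p u v d n x y a b t α γ →
      l + (1# * (p + ((x + t * a) * u + (y + t * b) * v + (x + t * a) * (y + t * b) * d +
            (α * ((x + t * a) * (x + t * a)) + γ * ((y + t * b) * (y + t * b))) * n)) +
           - 1# * (p + (x * u + y * v + x * y * d + (α * (x * x) + γ * (y * y)) * n))) ≈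
      (o + t * (a * u + b * v + (x * b + y * a) * d + ((1# + 1#) * (α * (x * a) + γ * (y * b))) * n) +
        t * t * (0# * u + 0# * v + a * b * d + (α * (a * a) + γ * (b * b)) * n)) +
      (1# * l + - 1# * o)
    lemma l o p u v d n x y a b t α γ = ring! (l ∷ o ∷ p ∷ u ∷ v ∷ d ∷ n ∷ x ∷ y ∷ a ∷ b ∷ t ∷ α ∷ γ ∷ [])

  Nontrivial : K → K → Set
  Nontrivial a b = ¬ (a ≈ 0# × b ≈ 0#)

  zero-vector : ∀ {x y z w} → x ≈ 0# → y ≈ 0# → z ≈ 0# → w ≈ 0# → ⟨ x , y , z , w ⟩ ≈v 0v
  zero-vector {x} {y} {z} {w} ex ey ez ew i = lc₄ (e₁ i) ex (e₂ i) ey (f i) ez (N i) ew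
    (lemma (e₁ i) (e₂ i) (f i) (N i))
    where
    lemma : ∀ a b d n → (x * a + y * b + z * d + w * n) + (a * 0# + (b * 0# + (d * 0# + n * 0#))) ≈ 0# + (a * x + (b * y + (d * z + n * w)))
    lemma a b d n = ring! (a ∷ b ∷ d ∷ n ∷ x ∷ y ∷ z ∷ w ∷ [])

  ⟨⟩-cong : ∀ {x y z w x′ y′ z′ w′} → x ≈ x′ → y ≈ y′ → z ≈ z′ → w ≈ w′ → ⟨ x , y , z , w ⟩ ≈v ⟨ x′ , y′ , z′ , w′ ⟩
  ⟨⟩-cong ex ey ez ew i = +-cong (+-cong (+-cong (*-congʳ ex) (*-congʳ ey)) (*-congʳ ez)) (*-congʳ ew)

  ⟨⟩-scale : ∀ k x y z w → (k · ⟨ x , y , z , w ⟩) ≈v ⟨ k * x , k * y , k * z , k * w ⟩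
  ⟨⟩-scale k x y z w i = lemma (e₁ i) (e₂ i) (f i) (N i)
    where
    lemma : ∀ a b d n → k * (x * a + y * b + z * d + w * n) ≈ k * x * a + k * y * b + k * z * d + k * w * n
    lemma a b d n = ring! (a ∷ b ∷ d ∷ n ∷ x ∷ y ∷ z ∷ w ∷ k ∷ [])

  ⟨⟩-sum : ∀ x y z w x′ y′ z′ w′ → (⟨ x , y , z , w ⟩ ⊕ ⟨ x′ , y′ , z′ , w′ ⟩) ≈v ⟨ x + x′ , y + y′ , z + z′ , w + w′ ⟩
  ⟨⟩-sum x y z w x′ y′ z′ w′ i = lemma (e₁ i) (e₂ i) (f i) (N i)
    where
    lemma : ∀ a b d n → (x * a + y * b + z * d + w * n) + (x′ * a + y′ * b + z′ * d + w′ * n) ≈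
            (x + x′) * a + (y + y′) * b + (z + z′) * d + (w + w′) * n
    lemma a b d n = ring! (a ∷ b ∷ d ∷ n ∷ x ∷ y ∷ z ∷ w ∷ x′ ∷ y′ ∷ z′ ∷ w′ ∷ [])

  nontrivial-cancel : ∀ {a b k} → Nontrivial a b → k * a ≈ 0# → k * b ≈ 0# → k ≈ 0#
  nontrivial-cancel {a} {b} {k} nt ea eb = Dec.decidable-stable (k ≟ 0#) λ n → nt (*-cancel-0 n ea , *-cancel-0 n eb)

  along-injective : ∀ {x y a b s t} → Nontrivial a b → at (x + s * a) (y + s * b) ≡ at (x + t * a) (y + t * b) → s ≈ t
  along-injective {x} {y} {a} {b} {s} {t} nt e = diff-zero (nontrivial-cancel nt
    (lc₁ 1# (proj₁ (at-injective e)) (ring! (x ∷ a ∷ s ∷ t ∷ []))) (lc₁ 1# (proj₂ (at-injective e)) (ring! (y ∷ b ∷ s ∷ t ∷ []))))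

  -- Otherwise 𝒞 would contain collinear points F 0 , F (a , b) , F (- a , - b).
  apex-nontrivial : ∀ {a b} → Nontrivial a b → Nontrivial (a * b) (α * (a * a) + γ * (b * b))
  apex-nontrivial {a} {b} nt (e , e′) = no-three (Joining.isC J) (points-differ 1≉0′) (points-differ n≉0) (points-differ 1≉n)
      (Joining.left J) (Joining.right J) k-in difference-axis on-axis
    where
    point-at : K → Index
    point-at t = at (0# + t * a) (0# + t * b)
    points-differ : ∀ {s t} → ¬ s ≈ t → point-at s ≢ point-at t
    points-differ s≉t f = s≉t (along-injective nt f)
    1≉0′ : ¬ 0# ≈ 1#
    1≉0′ f = 1≉0 (sym f)
    n≉0 : ¬ 0# ≈ - 1#
    n≉0 f = neg-nonzero 1≉0 (sym f)
    1≉n : ¬ 1# ≈ - 1#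
    1≉n f = 2≉0 (lc₁ 1# f (ring! []))
    J : Joining (point-at 0#) (point-at 1#)
    J = join (points-differ 1≉0′)
    flat : ∀ t → F (0# + t * a) (0# + t * b) ≈v (F 0# 0# ⊕ (t · tangent 0# 0# a b))
    flat t i = trans (F-along 0# 0# a b t i) (trans (+-congˡ (trans (*-congˡ (zero-vector refl refl e e′ i)) (zeroʳ _))) (+-identityʳ _))
    on-axis : OnAxis (c (point-at 0#)) (c (point-at 0#) ↦ c (point-at 1#)) (c (point-at (- 1#)))
    on-axis = - 1# , λ i → lc₃ 1# (flat (- 1#) i) (- (1# + 1#)) (flat 0# i) 1# (flat 1# i)
      (lemma (c (point-at 0#) i) (c (point-at 1#) i) (c (point-at (- 1#)) i) (F 0# 0# i) (tangent 0# 0# a b i))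
      where
      lemma : ∀ u v w o t → w + (1# * (o + - 1# * t) + (- (1# + 1#) * (o + 0# * t) + 1# * (o + 1# * t))) ≈
              (u + - 1# * (v + - 1# * u)) + (1# * w + (- (1# + 1#) * u + 1# * v))
      lemma u v w o t = ring! (u ∷ v ∷ w ∷ o ∷ t ∷ [])
    k-in : c (point-at (- 1#)) ∈ Joining.plane J
    k-in = axis-in on-axis (Joining.left J) (InPlane.difference-in (Joining.plane J) (Joining.right J) (Joining.left J))

  apex-nonzero : ∀ {a b} → Nontrivial a b → NonZero (apex a b)
  apex-nonzero nt e = apex-nontrivial nt (proj₁ (proj₂ (proj₂ (⟨⟩-zero e))) , proj₂ (proj₂ (proj₂ (⟨⟩-zero e))))

  tangent-nonzero : ∀ {x y a b} → Nontrivial a b → NonZero (tangent x y a b)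
  tangent-nonzero nt e = nt (proj₁ (⟨⟩-zero e) , proj₁ (proj₂ (⟨⟩-zero e)))

  tangent-apex : ∀ {x y a b} → Nontrivial a b → Independent2 (tangent x y a b) (apex a b)
  tangent-apex {x} {y} {a} {b} nt = independent₂ (tangent-nonzero nt) λ (k , e) → apex-nonzero nt (≈v-trans e λ i →
      trans (*-congʳ (k-zero k (⟨⟩-injective (≈v-trans e (⟨⟩-scale k a b _ _))))) (zeroˡ _))
    where
    k-zero : ∀ k {u v u′ v′} → 0# ≈ k * a × 0# ≈ k * b × u ≈ u′ × v ≈ v′ → k ≈ 0#
    k-zero k (ea , eb , _) = nontrivial-cancel nt (sym ea) (sym eb)

  F-difference : ∀ x y u v → (F u v ⊕ ((- 1#) · F x y)) ≈v
    ⟨ u - x , v - y , u * v - x * y , (α * (u * u) + γ * (v * v)) - (α * (x * x) + γ * (y * y)) ⟩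
  F-difference x y u v i = lc₂ 1# (F-formula u v i) (- 1#) (F-formula x y i)
      (lemma (F u v i) (F x y i) (P i) (e₁ i) (e₂ i) (f i) (N i) (α * (u * u) + γ * (v * v)) (α * (x * x) + γ * (y * y)))
    where
    lemma : ∀ l o p c₁ c₂ d n q q′ → (l + - 1# * o) +
        (1# * (p + (u * c₁ + v * c₂ + u * v * d + q * n)) + - 1# * (p + (x * c₁ + y * c₂ + x * y * d + q′ * n))) ≈
      ((u - x) * c₁ + (v - y) * c₂ + (u * v - x * y) * d + (q - q′) * n) + (1# * l + - 1# * o)
    lemma l o p c₁ c₂ d n q q′ = ring! (l ∷ o ∷ p ∷ c₁ ∷ c₂ ∷ d ∷ n ∷ q ∷ q′ ∷ u ∷ v ∷ x ∷ y ∷ [])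

  combination : ∀ s t x y a b → ((s · tangent x y a b) ⊕ (t · apex a b)) ≈v
    ⟨ s * a + t * 0# , s * b + t * 0# , s * (x * b + y * a) + t * (a * b) ,
      s * (two * (α * (x * a) + γ * (y * b))) + t * (α * (a * a) + γ * (b * b)) ⟩
  combination s t x y a b i = trans (+-cong (⟨⟩-scale s _ _ _ _ i) (⟨⟩-scale t _ _ _ _ i)) (⟨⟩-sum _ _ _ _ _ _ _ _ i)

  -- The plane of the points F (x + t a , y + t b).
  chord : ∀ x y a b → Nontrivial a b → Plane
  chord x y a b nt = record
    { p₁ = F x y ; p₂ = tangent x y a b ; p₃ = apex a b
    ; indep = independent-frame (c-normal (at x y)) (⟨⟩-inf _ _ _ _) (⟨⟩-inf _ _ _ _) (tangent-apex nt) }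

  module Chord (x y a b : K) (nt : Nontrivial a b) where
    σ : Plane
    σ = chord x y a b nt

    base-in : F x y ∈ σ
    base-in = member (1# , 0# , 0# , λ i → lemma (F x y i) (tangent x y a b i) (apex a b i))
      where
      lemma : ∀ u v w → u ≈ 1# * u + 0# * v + 0# * w
      lemma u v w = ring! (u ∷ v ∷ w ∷ [])

    tangent-in : tangent x y a b ∈ σ
    tangent-in = member (0# , 1# , 0# , λ i → lemma (F x y i) (tangent x y a b i) (apex a b i))
      where
      lemma : ∀ u v w → v ≈ 0# * u + 1# * v + 0# * w
      lemma u v w = ring! (u ∷ v ∷ w ∷ [])

    apex-in : apex a b ∈ σ
    apex-in = member (0# , 0# , 1# , λ i → lemma (F x y i) (tangent x y a b i) (apex a b i))
      where
      lemma : ∀ u v w → w ≈ 0# * u + 0# * v + 1# * w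
      lemma u v w = ring! (u ∷ v ∷ w ∷ [])

    points-in : ∀ t → F (x + t * a) (y + t * b) ∈ σ
    points-in t = InPlane.resp σ (≈v-sym (F-along x y a b t)) (InPlane.add σ (InPlane.add σ base-in (InPlane.scale σ t tangent-in)) (InPlane.scale σ (t * t) apex-in))

    isC : CPlane σ
    isC = A1-five σ (g , g-injective , λ k → c-onPlane (points-in (value k)))
      where
      value : Fin 5 → K
      value k = el (Fin.inject≤ k (ℕₚ.≤-trans (ℕₚ.m≤n+m 5 2) 7≤q))
      g : Fin 5 → Index
      g k = at (x + value k * a) (y + value k * b)
      g-injective : Injective _≡_ _≡_ g
      g-injective e = Finₚ.inject≤-injective _ _ _ _ (el-injective (along-injective nt e))

    only-points : ∀ {u v} → F u v ∈ σ → ∃ λ t → u ≈ x + t * a × v ≈ y + t * b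
    only-points {u} {v} m = conclude (frame-coordinates σ (c-normal (at x y)) (⟨⟩-inf _ _ _ _) (⟨⟩-inf _ _ _ _) (tangent-apex nt)
        base-in tangent-in apex-in (c-normal (at u v)) m)
      where
      conclude : (∃₂ λ s t → F u v ≈v ((F x y ⊕ (s · tangent x y a b)) ⊕ (t · apex a b))) → ∃ λ t → u ≈ x + t * a × v ≈ y + t * b
      conclude (s , t , e) = s , shift (proj₁ coefficients) , shift (proj₁ (proj₂ coefficients))
        where
        shift : ∀ {x u r} → u - x ≈ s * r + t * 0# → u ≈ x + s * r
        shift {x} {u} {r} e = lc₁ 1# e (ring! (u ∷ x ∷ s ∷ r ∷ t ∷ []))
        lemma : ∀ l o v w → l ≈ o + s * v + t * w → l + - 1# * o ≈ s * v + t * w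
        lemma l o v w e = lc₁ 1# e (ring! (l ∷ o ∷ v ∷ w ∷ s ∷ t ∷ []))
        coefficients = ⟨⟩-injective (≈v-trans (≈v-sym (F-difference x y u v))
          (≈v-trans (λ i → lemma (F u v i) (F x y i) (tangent x y a b i) (apex a b i) (e i)) (combination s t x y a b)))

  plane-chord : ∀ {κ} → CPlane κ → ∀ x y → F x y ∈ κ → ∃₂ λ a b → Σ (Nontrivial a b) λ nt → κ ≗ chord x y a b nt
  plane-chord {κ} cκ x y m = conclude (other-point cκ (at x y))
    where
    conclude : (∃ λ j → at x y ≢ j × c j ∈ κ) → ∃₂ λ a b → Σ (Nontrivial a b) λ nt → κ ≗ chord x y a b nt
    conclude (j , i≢j , jκ) = from-coordinates (at-onto j)
      where
      from-coordinates : (∃₂ λ u v → at u v ≡ j) → ∃₂ λ a b → Σ (Nontrivial a b) λ nt → κ ≗ chord x y a b nt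
      from-coordinates (u , v , e) = u - x , v - y , nt , meet-two cκ (Ch.isC) i≢j m jκ Ch.base-in
          (≡.subst (λ k → c k ∈ Ch.σ) (≡.trans (at-cong (ring! (u ∷ x ∷ [])) (ring! (v ∷ y ∷ []))) e) (Ch.points-in 1#))
        where
        nt : Nontrivial (u - x) (v - y)
        nt (z , z′) = i≢j (≡.trans (at-cong (sym (diff-zero z)) (sym (diff-zero z′))) e)
        module Ch = Chord x y (u - x) (v - y) nt

  -- If α a² = γ b², the planes of direction (a , b) through F 0 and F (a , - b) have the
  -- same line at infinity.
  anisotropic : ∀ {a b} → Nontrivial a b → ¬ α * (a * a) ≈ γ * (b * b)
  anisotropic {a} {b} nt e = line-at-infinity A.isC B.isC different (⟨⟩-inf _ _ _ _) (⟨⟩-inf _ _ _ _) (tangent-apex {0# } {0#} nt)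
      A.tangent-in A.apex-in (InPlane.resp B.σ same-tangent B.tangent-in) B.apex-in
    where
    module A = Chord 0# 0# a b nt
    module B = Chord a (- b) a b nt
    same-tangent : tangent a (- b) a b ≈v tangent 0# 0# a b
    same-tangent = ⟨⟩-cong refl refl (ring! (a ∷ b ∷ [])) (lc₁ two e (ring! (a ∷ b ∷ α ∷ γ ∷ [])))
    different : A.σ ≗̸ B.σ
    different s = absurd (A.only-points (from s B.base-in))
      where
      absurd : ¬ ∃ λ t → a ≈ 0# + t * a × - b ≈ 0# + t * b
      absurd (t , ea , eb) = apex-nontrivial nt (by-b (a ≟ 0#))
        where
        a≈0-case : a ≈ 0# → a * b ≈ 0# × α * (a * a) + γ * (b * b) ≈ 0#
        a≈0-case z = lc₁ b z (ring! (a ∷ b ∷ [])) , lc₂ ((1# + 1#) * (α * a)) z (- 1#) e (ring! (a ∷ b ∷ α ∷ γ ∷ []))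
        b≈0-case : b ≈ 0# → a * b ≈ 0# × α * (a * a) + γ * (b * b) ≈ 0#
        b≈0-case z = lc₁ a z (ring! (a ∷ b ∷ [])) , lc₂ ((1# + 1#) * (γ * b)) z 1# e (ring! (a ∷ b ∷ α ∷ γ ∷ []))
        by-b : Dec (a ≈ 0#) → a * b ≈ 0# × α * (a * a) + γ * (b * b) ≈ 0#
        by-b (yes z) = a≈0-case z
        by-b (no n) = b≈0-case (*-cancel-0 2≉0 (lc₂ (- b) t≈1 (- 1#) eb (ring! (b ∷ t ∷ []))))
          where
          t≈1 : t ≈ 1#
          t≈1 = diff-zero (*-cancel-0 n (lc₁ (- 1#) ea (ring! (a ∷ t ∷ []))))

  determinant-nonzero : ∀ {a b} → Nontrivial a b → ¬ two * (γ * (b * b) - α * (a * a)) ≈ 0#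
  determinant-nonzero nt e = anisotropic nt (sym (diff-zero (*-cancel-0 2≉0 e)))

  -- The tangents in direction (a , b) at the points of 𝒞 have all slopes.
  tangent-through : ∀ {a b} → Nontrivial a b → ∀ z w → ∃₂ λ x y → tangent x y a b ≈v ⟨ a , b , z , w ⟩
  tangent-through {a} {b} nt z w = (two * (γ * b) * z - a * w) * j , (b * w - two * (α * a) * z) * j ,
      ⟨⟩-cong refl refl (lc₁ z (inv-right _ (determinant-nonzero nt)) (ring! (a ∷ b ∷ z ∷ w ∷ α ∷ γ ∷ j ∷ [])))
                        (lc₁ w (inv-right _ (determinant-nonzero nt)) (ring! (a ∷ b ∷ z ∷ w ∷ α ∷ γ ∷ j ∷ [])))
    where
    j = inv _ (determinant-nonzero nt)

  tangent-unique : ∀ {a b x y x′ y′} → Nontrivial a b → tangent x y a b ≈v tangent x′ y′ a b → x ≈ x′ × y ≈ y′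
  tangent-unique {a} {b} {x} {y} {x′} {y′} nt e =
      diff-zero (*-cancel-0 (determinant-nonzero nt) (lc₂ (two * (γ * b)) ez (- a) ew (ring! (a ∷ b ∷ x ∷ y ∷ x′ ∷ y′ ∷ α ∷ γ ∷ [])))) ,
      diff-zero (*-cancel-0 (determinant-nonzero nt) (lc₂ b ew (- (two * (α * a))) ez (ring! (a ∷ b ∷ x ∷ y ∷ x′ ∷ y′ ∷ α ∷ γ ∷ []))))
    where
    ez : x * b + y * a ≈ x′ * b + y′ * a
    ez = proj₁ (proj₂ (proj₂ (⟨⟩-injective e)))
    ew : two * (α * (x * a) + γ * (y * b)) ≈ two * (α * (x′ * a) + γ * (y′ * b))
    ew = proj₂ (proj₂ (proj₂ (⟨⟩-injective e)))

  direction-coordinates : ∀ x y a b (nt : Nontrivial a b) {Y} → Inf Y → Y ∈ chord x y a b nt → InSpan2 Y (tangent x y a b) (apex a b)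
  direction-coordinates x y a b nt hY m = frame-direction Ch.σ (c-normal (at x y)) (⟨⟩-inf _ _ _ _) (⟨⟩-inf _ _ _ _) (tangent-apex nt)
      Ch.base-in Ch.tangent-in Ch.apex-in hY m
    where
    module Ch = Chord x y a b nt

  evaluate : ∀ {n} → Vec K n → K → K
  evaluate [] t = 0#
  evaluate (x ∷ xs) t = x + t * evaluate xs t

  infixl 6 _+ᵥ_
  infixl 7 _*ᵥ_

  _+ᵥ_ : ∀ {n} → Vec K n → Vec K n → Vec K n
  [] +ᵥ [] = []
  (x ∷ xs) +ᵥ (y ∷ ys) = (x + y) ∷ (xs +ᵥ ys)

  _*ᵥ_ : ∀ {n} → K → Vec K n → Vec K n
  k *ᵥ [] = []
  k *ᵥ (x ∷ xs) = (k * x) ∷ (k *ᵥ xs)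

  evaluate-+ : ∀ {n} (xs ys : Vec K n) t → evaluate (xs +ᵥ ys) t ≈ evaluate xs t + evaluate ys t
  evaluate-+ [] [] t = sym (+-identityˡ 0#)
  evaluate-+ (x ∷ xs) (y ∷ ys) t = trans (+-congˡ (*-congˡ (evaluate-+ xs ys t))) (lemma (evaluate xs t) (evaluate ys t))
    where
    lemma : ∀ u v → x + y + t * (u + v) ≈ (x + t * u) + (y + t * v)
    lemma u v = ring! (x ∷ y ∷ t ∷ u ∷ v ∷ [])

  evaluate-* : ∀ {n} k (xs : Vec K n) t → evaluate (k *ᵥ xs) t ≈ k * evaluate xs t
  evaluate-* k [] t = sym (zeroʳ k)
  evaluate-* k (x ∷ xs) t = trans (+-congˡ (*-congˡ (evaluate-* k xs t))) (lemma (evaluate xs t))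
    where
    lemma : ∀ u → k * x + t * (k * u) ≈ k * (x + t * u)
    lemma u = ring! (k ∷ x ∷ t ∷ u ∷ [])

  product₂ : K → K → K → K → K → K → Vec K 5
  product₂ r s u r′ s′ u′ = r * r′ ∷ (r * s′ + s * r′) ∷ (s * s′ + (r * u′ + u * r′)) ∷ (s * u′ + u * s′) ∷ u * u′ ∷ []

  product₂-value : ∀ r s u r′ s′ u′ t → evaluate (product₂ r s u r′ s′ u′) t ≈ (r + t * s + t * t * u) * (r′ + t * s′ + t * t * u′)
  product₂-value r s u r′ s′ u′ t = ring! (r ∷ s ∷ u ∷ r′ ∷ s′ ∷ u′ ∷ t ∷ [])

  -- deflate s xs is the quotient of a polynomial with tail xs by t - s.
  deflate : ∀ {n} → K → Vec K n → Vec K n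
  deflate s [] = []
  deflate s (x ∷ xs) = evaluate (x ∷ xs) s ∷ deflate s xs

  deflate-value : ∀ {n} s (xs : Vec K n) t → (t - s) * evaluate (deflate s xs) t ≈ t * evaluate xs t - s * evaluate xs s
  deflate-value s [] t = ring! (s ∷ t ∷ [])
  deflate-value s (x ∷ xs) t = step′ (evaluate xs t) (evaluate xs s) (evaluate (deflate s xs) t) (deflate-value s xs t)
    where
    step′ : ∀ u v w → (t - s) * w ≈ t * u - s * v → (t - s) * ((x + s * v) + t * w) ≈ t * (x + t * u) - s * (x + s * v)
    step′ u v w e = lc₁ t e (ring! (s ∷ t ∷ x ∷ u ∷ v ∷ w ∷ []))

  deflate-zero : ∀ {n} s (xs : Vec K n) → (∀ k → lookup (deflate s xs) k ≈ 0#) → evaluate xs s ≈ 0# × (∀ k → lookup xs k ≈ 0#)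
  deflate-zero s [] z = refl , λ ()
  deflate-zero s (x ∷ xs) z = z zero , λ { zero → head-zero x (evaluate xs s) (z zero) (proj₁ rest) ; (suc k) → proj₂ rest k }
    where
    rest = deflate-zero s xs (z ∘ suc)
    head-zero : ∀ x v → x + s * v ≈ 0# → v ≈ 0# → x ≈ 0#
    head-zero x v e e′ = lc₂ 1# e (- s) e′ (ring! (x ∷ v ∷ s ∷ []))

  roots-vanish : ∀ {n} (xs : Vec K n) (t : Fin n → K) → (∀ {i j} → t i ≈ t j → i ≡ j) → (∀ k → evaluate xs (t k) ≈ 0#) → ∀ k → lookup xs k ≈ 0#
  roots-vanish (x ∷ xs) t distinct-roots root = λ { zero → first ; (suc k) → proj₂ tail-zero k }
    where
    s = t zero
    apart : ∀ k → ¬ t (suc k) - s ≈ 0#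
    apart k e with () ← distinct-roots {suc k} {zero} (diff-zero e)
    tail-zero : evaluate xs s ≈ 0# × (∀ k → lookup xs k ≈ 0#)
    tail-zero = deflate-zero s xs (roots-vanish (deflate s xs) (t ∘ suc) (λ e → Finₚ.suc-injective (distinct-roots e)) λ k →
      *-cancel-0 (apart k) (trans (deflate-value s xs (t (suc k))) (cancel-head (evaluate xs (t (suc k))) (evaluate xs s) (t (suc k)) (root (suc k)) (root zero))))
      where
      cancel-head : ∀ u v r → x + r * u ≈ 0# → x + s * v ≈ 0# → r * u - s * v ≈ 0#
      cancel-head u v r e e′ = lc₂ 1# e (- 1#) e′ (ring! (u ∷ v ∷ r ∷ x ∷ s ∷ []))
    first : x ≈ 0#
    first = last (evaluate xs s) (root zero) (proj₁ tail-zero)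
      where
      last : ∀ v → x + s * v ≈ 0# → v ≈ 0# → x ≈ 0#
      last v e e′ = lc₂ 1# e (- s) e′ (ring! (x ∷ v ∷ s ∷ []))

  ∼-sym : ∀ {u v} → u ∼ v → v ∼ u
  ∼-sym {u} {v} (k , k≉0 , e) = inv k k≉0 , inv-nonzero k≉0 , λ i →
    lc₂ (- inv k k≉0) (e i) (- v i) (inv-right k k≉0) (lemma (u i) (v i) k (inv k k≉0))
    where
    lemma : ∀ u v k j → v + (- j * (k * v) + - v * 1#) ≈ j * u + (- j * u + - v * (k * j))
    lemma u v k j = ring! (u ∷ v ∷ k ∷ j ∷ [])

  ∼-trans : ∀ {u v w} → u ∼ v → v ∼ w → u ∼ w
  ∼-trans {u} {v} {w} (k , k≉0 , e) (l , l≉0 , e′) = k * l , *-nonzero k≉0 l≉0 , λ i →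
    lc₂ 1# (e i) k (e′ i) (ring! (u i ∷ v i ∷ w i ∷ k ∷ l ∷ []))

  ≈v-∼ : ∀ {u v} → u ≈v v → u ∼ v
  ≈v-∼ e = 1# , 1≉0 , λ i → trans (e i) (sym (*-identityˡ _))

  C-∼ : ∀ i → C i ∼ c i
  C-∼ i = h ∙ C i , weight i , C-multiple i

  ∼-nonzero : ∀ {u v} → NonZero v → u ∼ v → NonZero u
  ∼-nonzero {u} {v} v≉0 (k , k≉0 , e) z = v≉0 λ i → *-cancel-0 k≉0 (trans (sym (e i)) (z i))

  ∼-inf : ∀ {u v} → Inf v → u ∼ v → Inf u
  ∼-inf {u} {v} hv (k , _ , e) = trans (dot-cong h e) (trans (dot-· h k v) (trans (*-congˡ hv) (zeroʳ k)))

  inf-not-point : ∀ {X} i → Inf X → ¬ X ∼ C i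
  inf-not-point {X} i hX s = 1≉0 (trans (sym (c-normal i)) (∼-inf hX (∼-sym (∼-trans s (C-∼ i)))))

  toAtInf : ∀ {v} → Inf v → AtInf v
  toAtInf {v} e = trans (sym (∙-dot h v)) e

  fromAtInf : ∀ {v} → AtInf v → Inf v
  fromAtInf {v} e = trans (∙-dot h v) e

  apex-inf : ∀ a b → Inf (apex a b)
  apex-inf a b = ⟨⟩-inf _ _ _ _

  -- In the basis F (x , y), tangent, apex of a chord plane, 𝒞 and the apex form the conic
  -- v² = u w.
  module ChordConic (x y a b : K) (nt : Nontrivial a b) {X : Vec5} (X∼ : X ∼ apex a b) where
    open Chord x y a b nt

    in-basis : K → K → K → Vec5
    in-basis u v w = ((u · F x y) ⊕ (v · tangent x y a b)) ⊕ (w · apex a b)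

    conic : TernaryForm
    conic = record { a = 0# ; b = 1# ; c = 0# ; d = 0# ; e = - 1# ; f = 0# }

    nondegenerate : ¬ discriminant conic ≈ 0#
    nondegenerate e = 2≉0 (lc₁ (- 1#) e (ring! []))

    conic-value : ∀ u v w → evalForm conic u v w ≈ v * v - u * w
    conic-value u v w = ring! (u ∷ v ∷ w ∷ [])

    at-parameter : ∀ {j} → c j ∈ σ → ∃ λ t → c j ≈v in-basis 1# t (t * t) × (t ≈ 0# → at x y ≡ j)
    at-parameter {j} m = from-coordinates (at-onto j)
      where
      from-coordinates : (∃₂ λ u v → at u v ≡ j) → ∃ λ t → c j ≈v in-basis 1# t (t * t) × (t ≈ 0# → at x y ≡ j)
      from-coordinates (u , v , ≡.refl) = from-parameter (only-points m)
        where
        from-parameter : (∃ λ t → u ≈ x + t * a × v ≈ y + t * b) → ∃ λ t → c (at u v) ≈v in-basis 1# t (t * t) × (t ≈ 0# → at x y ≡ at u v)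
        from-parameter (t , eu , ev) = t ,
          (λ i → trans (reflexive (≡.cong (λ k → c k i) (at-cong eu ev))) (trans (F-along x y a b t i) (lemma (F x y i) (tangent x y a b i) (apex a b i)))) ,
          λ z → at-cong (sym (trans eu (shift z))) (sym (trans ev (shift z)))
          where
          lemma : ∀ o v w → o + t * v + t * t * w ≈ 1# * o + t * v + t * t * w
          lemma o v w = ring! (o ∷ v ∷ w ∷ t ∷ [])
          shift : ∀ {x r} → t ≈ 0# → x + t * r ≈ x
          shift {x} {r} z = lc₁ r z (ring! (x ∷ r ∷ t ∷ []))

    to-conic : ∀ Z → ArcPlus σ X Z → OnConic σ conic Z
    to-conic Z (inj₁ (j , m , s)) = from-parameter (at-parameter (onPlane-c m))
      where
      from-parameter : (∃ λ t → c j ≈v in-basis 1# t (t * t) × (t ≈ 0# → at x y ≡ j)) → OnConic σ conic Z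
      from-parameter (t , e , _) = 1# , t , t * t , ∼-trans (∼-trans s (C-∼ j)) (≈v-∼ e) , trans (conic-value 1# t (t * t)) (ring! (t ∷ []))
    to-conic Z (inj₂ s) = 0# , 0# , 1# , ∼-trans (∼-trans s X∼) (≈v-∼ λ i → lemma (F x y i) (tangent x y a b i) (apex a b i)) ,
        trans (conic-value 0# 0# 1#) (ring! [])
      where
      lemma : ∀ u v w → w ≈ 0# * u + 0# * v + 1# * w
      lemma u v w = ring! (u ∷ v ∷ w ∷ [])

    from-conic : ∀ Z → NonZero Z → OnConic σ conic Z → ArcPlus σ X Z
    from-conic Z Z≉0 (u , v , w , s , e) = by-cases (u ≟ 0#)
      where
      on : v * v - u * w ≈ 0#
      on = trans (sym (conic-value u v w)) e
      by-cases : Dec (u ≈ 0#) → ArcPlus σ X Z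
      by-cases (no n) = inj₁ (j , c-onPlane (points-in t) , ∼-trans s (∼-trans (u , n , scaled) (∼-sym (C-∼ j))))
        where
        t = v * inv u n
        j = at (x + t * a) (y + t * b)
        scaled : in-basis u v w ≈v (u · c j)
        scaled i = lc₃ (- u) (F-along x y a b t i) (- (v * tangent x y a b i + v * v * inv u n * apex a b i + w * apex a b i)) (inv-right u n)
            (- (inv u n * apex a b i)) on
            (lemma (c j i) (F x y i) (tangent x y a b i) (apex a b i) u v w (inv u n))
          where
          lemma : ∀ l o m p u v w k →
            (u * o + v * m + w * p) + (- u * (o + v * k * m + v * k * (v * k) * p) + (- (v * m + v * v * k * p + w * p) * 1# + - (k * p) * 0#)) ≈
            u * l + (- u * l + (- (v * m + v * v * k * p + w * p) * (u * k) + - (k * p) * (v * v - u * w)))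
          lemma l o m p u v w k = ring! (l ∷ o ∷ m ∷ p ∷ u ∷ v ∷ w ∷ k ∷ [])
      by-cases (yes z) = inj₂ (∼-trans s (∼-trans (w , w≉0 , flat) (∼-sym X∼)))
        where
        v≈0 : v ≈ 0#
        v≈0 = Dec.decidable-stable (v ≟ 0#) λ n → n (*-cancel-0 n (lc₂ 1# on w z (ring! (u ∷ v ∷ w ∷ []))))
        flat : in-basis u v w ≈v (w · apex a b)
        flat i = lc₂ (F x y i) z (tangent x y a b i) v≈0 (lemma (F x y i) (tangent x y a b i) (apex a b i))
          where
          lemma : ∀ o m p → (u * o + v * m + w * p) + (o * 0# + m * 0#) ≈ w * p + (o * u + m * v)
          lemma o m p = ring! (o ∷ m ∷ p ∷ u ∷ v ∷ w ∷ [])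
        w≉0 : ¬ w ≈ 0#
        w≉0 wz = ∼-nonzero {v = in-basis u v w} (∼-nonzero {u = in-basis u v w} Z≉0 (∼-sym s)) (≈v-∼ ≈v-refl)
          (λ i → trans (flat i) (trans (*-congʳ wz) (zeroˡ _)))

    inf-point : IsInfPointOf σ X
    inf-point = ∼-nonzero (apex-nonzero nt) X∼ , (∼-nonzero (apex-nonzero nt) X∼ , span X-in) ,
      (λ i _ → inf-not-point i (∼-inf (apex-inf a b) X∼)) , (conic , nondegenerate , λ Z Z≉0 → to-conic Z , from-conic Z Z≉0)
      where
      X-in : X ∈ σ
      X-in = InPlane.resp σ (≈v-sym (proj₂ (proj₂ X∼))) (InPlane.scale σ (proj₁ X∼) apex-in)

    -- The tangent at F (x , y) has the direction tangent x y a b.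
    tangent-condition : ∀ Z → NonZero Z → InSpan2 Z (C (at x y)) (tangent x y a b) → ArcPlus σ X Z → Z ∼ C (at x y)
    tangent-condition Z Z≉0 (r , s , e) (inj₁ (j , m , κ , k≉0 , e′)) = from-parameter (at-parameter (onPlane-c m))
      where
      wi = h ∙ C (at x y)
      wj = h ∙ C j
      from-parameter : (∃ λ t → c j ≈v in-basis 1# t (t * t) × (t ≈ 0# → at x y ≡ j)) → Z ∼ C (at x y)
      from-parameter (t , e″ , same-index) = ≡.subst (λ i → Z ∼ C i) (≡.sym (same-index t≈0)) (κ , k≉0 , e′)
        where
        k = κ * wj
        apex-coefficient : k * (t * t) ≈ 0#
        apex-coefficient = proj₂ (proj₂ (Plane.indep σ (k - r * wi) (k * t - s) (k * (t * t)) λ i →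
          lc₄ 1# (e i) (- 1#) (e′ i) (- κ) (C-multiple j i) r (C-multiple (at x y) i)
            (compare (Z i) (C (at x y) i) (C j i) (c j i) (F x y i) (tangent x y a b i) (apex a b i) wi wj (e″ i))))
          where
          compare : ∀ z d dj l o m p wi wj → l ≈ 1# * o + t * m + t * t * p →
            ((κ * wj - r * wi) * o + (κ * wj * t - s) * m + κ * wj * (t * t) * p) + (1# * (r * d + s * m) + (- 1# * (κ * dj) + (- κ * (wj * l) + r * (wi * o)))) ≈
            0# + (1# * z + (- 1# * z + (- κ * dj + r * d)))
          compare z d dj l o m p wi wj f = lc₁ (- (κ * wj)) f
            (ring! (z ∷ d ∷ dj ∷ l ∷ o ∷ m ∷ p ∷ wi ∷ wj ∷ t ∷ r ∷ s ∷ κ ∷ []))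
        t≈0 : t ≈ 0#
        t≈0 = Dec.decidable-stable (t ≟ 0#) λ n → n (*-cancel-0 n (*-cancel-0 (*-nonzero k≉0 (weight j)) apex-coefficient))
    tangent-condition Z Z≉0 (r , s , e) (inj₂ Z∼X) = ⊥-elim (absurd (∼-trans Z∼X X∼))
      where
      absurd : ¬ Z ∼ apex a b
      absurd (k , k≉0 , e′) = neg-nonzero k≉0 (proj₂ (proj₂ (Plane.indep σ (r * h ∙ C (at x y)) s (- k) λ i →
          lc₃ (- 1#) (e i) 1# (e′ i) (- r) (C-multiple (at x y) i) (lemma (Z i) (C (at x y) i) (F x y i) (tangent x y a b i) (apex a b i) (h ∙ C (at x y))))))
        where
        lemma : ∀ z d o m p w → (r * w * o + s * m + - k * p) + (- 1# * (r * d + s * m) + (1# * (k * p) + - r * (w * o))) ≈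
          0# + (- 1# * z + (1# * z + - r * d))
        lemma z d o m p w = ring! (z ∷ d ∷ o ∷ m ∷ p ∷ w ∷ r ∷ s ∷ k ∷ [])

  -- The points of a chord plane on any conic through them: along F (x + t a , y + t b) its
  -- form is a polynomial of degree 4 in t with q zeros, whose leading coefficient is the
  -- value at the apex.
  module AnyConic (x y a b : K) (nt : Nontrivial a b) {π : Plane} (cπ : CPlane π) (π≗ : π ≗ chord x y a b nt) {X : Vec5}
    (isInf : IsInfPointOf π X) where
    open Chord x y a b nt
    open Plane π

    Q : TernaryForm
    Q = proj₁ (proj₂ (proj₂ (proj₂ isInf)))

    conic-is : SameSet (ArcPlus π X) (OnConic π Q)
    conic-is = proj₂ (proj₂ (proj₂ (proj₂ (proj₂ isInf))))

    Coordinates : Vec5 → Set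
    Coordinates v = InSpan3 v p₁ p₂ p₃

    base : Coordinates (F x y)
    base = span (from π≗ base-in)
    slope : Coordinates (tangent x y a b)
    slope = span (from π≗ tangent-in)
    apex′ : Coordinates (apex a b)
    apex′ = span (from π≗ apex-in)

    open TernaryForm Q renaming (a to A; b to B; c to C″; d to D; e to E; f to G)

    form : K → K → K → K
    form = evalForm Q

    r₁ = proj₁ base
    r₂ = proj₁ (proj₂ base)
    r₃ = proj₁ (proj₂ (proj₂ base))
    s₁ = proj₁ slope
    s₂ = proj₁ (proj₂ slope)
    s₃ = proj₁ (proj₂ (proj₂ slope))
    u₁ = proj₁ apex′
    u₂ = proj₁ (proj₂ apex′)
    u₃ = proj₁ (proj₂ (proj₂ apex′))

    q₁₁ q₂₂ q₃₃ q₁₂ q₁₃ q₂₃ quartic : Vec K 5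
    q₁₁ = A *ᵥ product₂ r₁ s₁ u₁ r₁ s₁ u₁
    q₂₂ = B *ᵥ product₂ r₂ s₂ u₂ r₂ s₂ u₂
    q₃₃ = C″ *ᵥ product₂ r₃ s₃ u₃ r₃ s₃ u₃
    q₁₂ = D *ᵥ product₂ r₁ s₁ u₁ r₂ s₂ u₂
    q₁₃ = E *ᵥ product₂ r₁ s₁ u₁ r₃ s₃ u₃
    q₂₃ = G *ᵥ product₂ r₂ s₂ u₂ r₃ s₃ u₃
    quartic = q₁₁ +ᵥ q₂₂ +ᵥ q₃₃ +ᵥ q₁₂ +ᵥ q₁₃ +ᵥ q₂₃

    quartic-value : ∀ t → evaluate quartic t ≈ form (r₁ + t * s₁ + t * t * u₁) (r₂ + t * s₂ + t * t * u₂) (r₃ + t * s₃ + t * t * u₃)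
    quartic-value t = sums (q₁₁ +ᵥ q₂₂ +ᵥ q₃₃ +ᵥ q₁₂ +ᵥ q₁₃) q₂₃ (sums (q₁₁ +ᵥ q₂₂ +ᵥ q₃₃ +ᵥ q₁₂) q₁₃ (sums (q₁₁ +ᵥ q₂₂ +ᵥ q₃₃) q₁₂
        (sums (q₁₁ +ᵥ q₂₂) q₃₃ (sums q₁₁ q₂₂ (term A r₁ s₁ u₁ r₁ s₁ u₁) (term B r₂ s₂ u₂ r₂ s₂ u₂)) (term C″ r₃ s₃ u₃ r₃ s₃ u₃))
        (term D r₁ s₁ u₁ r₂ s₂ u₂)) (term E r₁ s₁ u₁ r₃ s₃ u₃)) (term G r₂ s₂ u₂ r₃ s₃ u₃)
      where
      term : ∀ A r s u r′ s′ u′ → evaluate (A *ᵥ product₂ r s u r′ s′ u′) t ≈ A * ((r + t * s + t * t * u) * (r′ + t * s′ + t * t * u′))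
      term A r s u r′ s′ u′ = trans (evaluate-* A (product₂ r s u r′ s′ u′) t) (*-congˡ (product₂-value r s u r′ s′ u′ t))
      sums : ∀ (xs ys : Vec K 5) {u v} → evaluate xs t ≈ u → evaluate ys t ≈ v → evaluate (xs +ᵥ ys) t ≈ u + v
      sums xs ys e e′ = trans (evaluate-+ xs ys t) (+-cong e e′)

    form-homogeneous : ∀ {k x y z x′ y′ z′} → x ≈ k * x′ → y ≈ k * y′ → z ≈ k * z′ → form x′ y′ z′ ≈ 0# → form x y z ≈ 0#
    form-homogeneous {k} ex ey ez e = trans
      (plus (plus (plus (plus (plus (term A ex ex) (term B ey ey)) (term C″ ez ez)) (term D ex ey)) (term E ex ez)) (term G ey ez))
      (trans (*-congˡ e) (zeroʳ (k * k)))
      where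
      plus : ∀ {u v u′ v′} → u ≈ k * k * u′ → v ≈ k * k * v′ → u + v ≈ k * k * (u′ + v′)
      plus p r = trans (+-cong p r) (sym (distribˡ _ _ _))
      term : ∀ A {u v u′ v′} → u ≈ k * u′ → v ≈ k * v′ → A * (u * v) ≈ k * k * (A * (u′ * v′))
      term A {u} {v} {u′} {v′} p r = trans (*-congˡ (*-cong p r)) (lemma A u′ v′)
        where
        lemma : ∀ A u v → A * ((k * u) * (k * v)) ≈ k * k * (A * (u * v))
        lemma A u v = ring! (A ∷ u ∷ v ∷ k ∷ [])

    root : ∀ t → evaluate quartic t ≈ 0#
    root t = trans (quartic-value t) (zero-of on-conic)
      where
      j = at (x + t * a) (y + t * b)
      on-conic : OnConic π Q (c j)
      on-conic = proj₁ (conic-is (c j) (normal-nonzero (c-normal j)))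
        (inj₁ (j , c-onPlane (from π≗ (points-in t)) , ∼-sym (C-∼ j)))
      zero-of : OnConic π Q (c j) → form (r₁ + t * s₁ + t * t * u₁) (r₂ + t * s₂ + t * t * u₂) (r₃ + t * s₃ + t * t * u₃) ≈ 0#
      zero-of (u , v , w , (k , _ , e) , z) = form-homogeneous {k} (diff-zero (proj₁ zs)) (diff-zero (proj₁ (proj₂ zs))) (diff-zero (proj₂ (proj₂ zs))) z
        where
        zs = indep (r₁ + t * s₁ + t * t * u₁ - k * u) (r₂ + t * s₂ + t * t * u₂ - k * v) (r₃ + t * s₃ + t * t * u₃ - k * w) λ i →
          trans (+-cong (+-cong (column r₁ s₁ u₁ u (p₁ i)) (column r₂ s₂ u₂ v (p₂ i))) (column r₃ s₃ u₃ w (p₃ i)))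
            (trans (regroup (r₁ * p₁ i) (r₂ * p₂ i) (r₃ * p₃ i) (s₁ * p₁ i) (s₂ * p₂ i) (s₃ * p₃ i) (u₁ * p₁ i) (u₂ * p₂ i) (u₃ * p₃ i) (k * (u * p₁ i + v * p₂ i + w * p₃ i))
                (u * p₁ i) (v * p₂ i) (w * p₃ i) refl)
              (trans (+-congʳ (trans (+-cong (+-cong (sym (proj₂ (proj₂ (proj₂ base)) i)) (*-congˡ (sym (proj₂ (proj₂ (proj₂ slope)) i))))
                  (*-congˡ (sym (proj₂ (proj₂ (proj₂ apex′)) i)))) (trans (sym (F-along x y a b t i)) (e i)))) (-‿inverseʳ _)))
          where
          column : ∀ r s u x p → (r + t * s + t * t * u - k * x) * p ≈ r * p + t * (s * p) + t * t * (u * p) - k * (x * p)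
          column r s u x p = ring! (r ∷ s ∷ u ∷ x ∷ p ∷ t ∷ k ∷ [])
          regroup : ∀ r r′ r″ s s′ s″ u u′ u″ z x x′ x″ → z ≈ k * (x + x′ + x″) →
            (r + t * s + t * t * u - k * x) + (r′ + t * s′ + t * t * u′ - k * x′) + (r″ + t * s″ + t * t * u″ - k * x″) ≈
            ((r + r′ + r″) + t * (s + s′ + s″) + t * t * (u + u′ + u″)) - z
          regroup r r′ r″ s s′ s″ u u′ u″ z x x′ x″ e = trans (sums r r′ r″ (t * s) (t * s′) (t * s″) (t * t * u) (t * t * u′) (t * t * u″) (k * x) (k * x′) (k * x″))
              (+-cong (+-cong (+-congˡ (factor t s s′ s″)) (factor (t * t) u u′ u″)) (-‿cong (trans (factor k x x′ x″) (sym e))))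
            where
            factor : ∀ t s s′ s″ → t * s + t * s′ + t * s″ ≈ t * (s + s′ + s″)
            factor t s s′ s″ = ring! (t ∷ s ∷ s′ ∷ s″ ∷ [])
            plus : ∀ u u′ u″ v v′ v″ → (u + v) + (u′ + v′) + (u″ + v″) ≈ (u + u′ + u″) + (v + v′ + v″)
            plus u u′ u″ v v′ v″ = ring! (u ∷ u′ ∷ u″ ∷ v ∷ v′ ∷ v″ ∷ [])
            minus : ∀ x x′ x″ → - x + - x′ + - x″ ≈ - (x + x′ + x″)
            minus x x′ x″ = ring! (x ∷ x′ ∷ x″ ∷ [])
            sums : ∀ r r′ r″ s s′ s″ u u′ u″ x x′ x″ → (r + s + u - x) + (r′ + s′ + u′ - x′) + (r″ + s″ + u″ - x″) ≈
              ((r + r′ + r″) + (s + s′ + s″) + (u + u′ + u″)) - (x + x′ + x″)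
            sums r r′ r″ s s′ s″ u u′ u″ x x′ x″ = trans (plus _ _ _ _ _ _)
              (+-cong (trans (plus _ _ _ _ _ _) (+-congʳ (plus _ _ _ _ _ _))) (minus x x′ x″))

    five : Fin 5 → K
    five k = el (Fin.inject≤ k (ℕₚ.≤-trans (ℕₚ.m≤n+m 5 2) 7≤q))

    apex-on-conic : form u₁ u₂ u₃ ≈ 0#
    apex-on-conic = roots-vanish quartic five (λ e → Finₚ.inject≤-injective _ _ _ _ (el-injective e)) (λ k → root (five k)) (suc (suc (suc (suc zero))))

    is-apex : X ∼ apex a b
    is-apex = from-arc (proj₂ (conic-is (apex a b) (apex-nonzero nt)) (u₁ , u₂ , u₃ , ≈v-∼ (proj₂ (proj₂ (proj₂ apex′))) , apex-on-conic))
      where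
      from-arc : ArcPlus π X (apex a b) → X ∼ apex a b
      from-arc (inj₁ (j , _ , s)) = ⊥-elim (inf-not-point j (apex-inf a b) s)
      from-arc (inj₂ s) = ∼-sym s

  -- t_A for A = F (x , y) consists of the tangents at A.
  tA-tangent : ∀ {x y Y} → tA (at x y) Y → ∃₂ λ a b → Y ≈v tangent x y a b
  tA-tangent {x} {y} {Y} (π , cπ , m , (Y≉0 , Y∈) , Y-inf , X , isInf , condition) = from-chord (plane-chord cπ x y (onPlane-c m))
    where
    from-chord : (∃₂ λ a b → Σ (Nontrivial a b) λ nt → π ≗ chord x y a b nt) → ∃₂ λ a b → Y ≈v tangent x y a b
    from-chord (a , b , nt , π≗) = from-coordinates (direction-coordinates x y a b nt (fromAtInf Y-inf) (to π≗ (member Y∈)))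
      where
      open Chord x y a b nt
      X∼ : X ∼ apex a b
      X∼ = AnyConic.is-apex x y a b nt cπ π≗ isInf
      from-coordinates : InSpan2 Y (tangent x y a b) (apex a b) → ∃₂ λ a b → Y ≈v tangent x y a b
      from-coordinates (s , w , e) = s * a , s * b , λ i → trans (e i) (trans (+-congˡ (trans (*-congʳ w≈0) (zeroˡ _)))
          (trans (+-identityʳ _) (trans (⟨⟩-scale s _ _ _ _ i) (⟨⟩-cong refl refl (ring! (x ∷ y ∷ a ∷ b ∷ s ∷ [])) (ring! (x ∷ y ∷ a ∷ b ∷ s ∷ α ∷ γ ∷ [])) i))))
        where
        absurd : ¬ w ≈ 0# → ¬ Dec (s ≈ 0#)
        absurd w≉0 (yes z) = inf-not-point (at x y) (fromAtInf Y-inf)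
            (condition Y Y≉0 (0# , 1# , λ i → lemma (Y i) (C (at x y) i)) (inj₂ (∼-trans (w , w≉0 , flat) (∼-sym X∼))))
          where
          lemma : ∀ u v → u ≈ 0# * v + 1# * u
          lemma u v = ring! (u ∷ v ∷ [])
          flat : Y ≈v (w · apex a b)
          flat i = trans (e i) (trans (+-congʳ (trans (*-congʳ z) (zeroˡ _))) (+-identityˡ _))
        absurd w≉0 (no n) = t≉0 (different (condition (c j) (normal-nonzero (c-normal j)) in-span (inj₁ (j , c-onPlane (from π≗ (points-in t)) , ∼-sym (C-∼ j)))))
          where
          t = w * inv s n
          t≉0 : ¬ t ≈ 0#
          t≉0 = *-nonzero w≉0 (inv-nonzero n)
          j = at (x + t * a) (y + t * b)
          wi = h ∙ C (at x y)
          in-span : InSpan2 (c j) (C (at x y)) Y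
          in-span = inv wi (weight (at x y)) , t * inv s n , λ i →
            trans (F-along x y a b t i) (trans (+-congʳ (+-congʳ (c-def (at x y) i)))
              (lc₂ (- (t * inv s n)) (e i) (- (t * tangent x y a b i)) (inv-right s n)
                (lemma (inv wi (weight (at x y)) * C (at x y) i) (tangent x y a b i) (apex a b i) (Y i) s w (inv s n) )))
            where
            lemma : ∀ o m p z s w k → (o + w * k * m + w * k * (w * k) * p) + (- (w * k * k) * (s * m + w * p) + - (w * k * m) * 1#) ≈
              (o + w * k * k * z) + (- (w * k * k) * z + - (w * k * m) * (s * k))
            lemma o m p z s w k = ring! (o ∷ m ∷ p ∷ z ∷ s ∷ w ∷ k ∷ [])
          different : c j ∼ C (at x y) → t ≈ 0#
          different s∼ = nontrivial-cancel nt (shift (proj₁ same-point)) (shift (proj₂ same-point))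
            where
            same-point : x + t * a ≈ x × y + t * b ≈ y
            same-point = at-injective (c-injective (normal-multiple {i = at x y} (c-normal j) s∼))
            shift : ∀ {x r} → x + t * r ≈ x → t * r ≈ 0#
            shift {x} {r} e = lc₁ 1# e (lemma x (t * r))
              where
              lemma : ∀ x u → u + 1# * x ≈ 0# + 1# * (x + u)
              lemma x u = ring! (x ∷ u ∷ [])
        w≈0 : w ≈ 0#
        w≈0 = Dec.decidable-stable (w ≟ 0#) λ n → absurd n (s ≟ 0#)

  tangent-tA : ∀ {x y a b Y} → Nontrivial a b → Y ≈v tangent x y a b → tA (at x y) Y
  tangent-tA {x} {y} {a} {b} {Y} nt e = σ , isC , c-onPlane base-in , (Y≉0 , span (InPlane.resp σ (≈v-sym e) tangent-in)) ,
      toAtInf (∼-inf (⟨⟩-inf _ _ _ _) (≈v-∼ e)) , apex a b , ChordConic.inf-point x y a b nt (≈v-∼ ≈v-refl) ,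
      λ Z Z≉0 (r , s , f) → ChordConic.tangent-condition x y a b nt (≈v-∼ ≈v-refl) Z Z≉0 (r , s , λ i → trans (f i) (+-congˡ (*-congˡ (e i))))
    where
    open Chord x y a b nt
    Y≉0 : NonZero Y
    Y≉0 = ∼-nonzero (tangent-nonzero nt) (≈v-∼ e)

  t∞-coordinates : ∀ {Y} → NonZero Y → t∞ Y → ∃₂ λ z w → Y ≈v ⟨ 0# , 0# , z , w ⟩
  t∞-coordinates {Y} Y≉0 (inj₁ (π , cπ , isInf)) = from-chord (base-point (pts-in cπ 0≢) (at-onto (pts cπ 0≢)))
    where
    base-point : ∀ {i} → c i ∈ π → (∃₂ λ x y → at x y ≡ i) → ∃₂ λ x y → ∃₂ λ a b → Σ (Nontrivial a b) λ nt → π ≗ chord x y a b nt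
    base-point m (x , y , ≡.refl) = x , y , plane-chord cπ x y m
    from-chord : (∃₂ λ x y → ∃₂ λ a b → Σ (Nontrivial a b) λ nt → π ≗ chord x y a b nt) → ∃₂ λ z w → Y ≈v ⟨ 0# , 0# , z , w ⟩
    from-chord (x , y , a , b , nt , π≗) = from-apex (AnyConic.is-apex x y a b nt cπ π≗ isInf)
      where
      from-apex : Y ∼ apex a b → ∃₂ λ z w → Y ≈v ⟨ 0# , 0# , z , w ⟩
      from-apex (k , _ , e) = _ , _ , ≈v-trans e (≈v-trans (⟨⟩-scale k _ _ _ _) (⟨⟩-cong (zeroʳ k) (zeroʳ k) refl refl))
  t∞-coordinates {Y} Y≉0 (inj₂ (Y-inf , none)) = from-coordinates (coordinates (fromAtInf Y-inf))
    where
    from-coordinates : (∃₂ λ a b → ∃₂ λ z w → Y ≈v ⟨ a , b , z , w ⟩) → ∃₂ λ z w → Y ≈v ⟨ 0# , 0# , z , w ⟩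
    from-coordinates (a , b , z , w , e) = z , w , ≈v-trans e (⟨⟩-cong (proj₁ trivial) (proj₂ trivial) refl refl)
      where
      trivial : a ≈ 0# × b ≈ 0#
      trivial = Dec.decidable-stable ((a ≟ 0#) ×-dec (b ≟ 0#)) λ nt → on-plane nt (tangent-through nt z w)
        where
        on-plane : (nt : Nontrivial a b) → ¬ ∃₂ λ x y → tangent x y a b ≈v ⟨ a , b , z , w ⟩
        on-plane nt (x , y , f) = none (Chord.σ x y a b nt) (Chord.isC x y a b nt)
          (Y≉0 , span (InPlane.resp (Chord.σ x y a b nt) (≈v-trans f (≈v-sym e)) (Chord.tangent-in x y a b nt)))

  coordinates-t∞ : ∀ {Y z w} → NonZero Y → Y ≈v ⟨ 0# , 0# , z , w ⟩ → t∞ Y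
  coordinates-t∞ {Y} {z} {w} Y≉0 e = by-search search-multiple
    where
    resp-apex : ∀ {a b a′ b′} → a ≈ a′ → b ≈ b′ → apex a b ≈v apex a′ b′
    resp-apex p q = ⟨⟩-cong refl refl (*-cong p q) (+-cong (*-congˡ (*-cong p p)) (*-congˡ (*-cong q q)))
    Y-inf : Inf Y
    Y-inf = ∼-inf (⟨⟩-inf 0# 0# z w) (≈v-∼ e)
    search-multiple : Dec (∃₂ λ a b → ∃ λ k → Y ≈v (k · apex a b))
    search-multiple = search-K (λ p (b , k , f) → b , k , ≈v-trans f (λ i → *-congˡ (resp-apex p refl i)))
      (λ a → search-K (λ p (k , f) → k , ≈v-trans f (λ i → *-congˡ (resp-apex refl p i)))
      (λ b → search-K (λ p f → ≈v-trans f (λ i → *-congʳ p)) (λ k → Y ≟v _)))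
    by-search : Dec (∃₂ λ a b → ∃ λ k → Y ≈v (k · apex a b)) → t∞ Y
    by-search (yes (a , b , k , f)) = inj₁ (Chord.σ 0# 0# a b nt , Chord.isC 0# 0# a b nt ,
        ChordConic.inf-point 0# 0# a b nt (k , (λ z → Y≉0 λ i → trans (f i) (trans (*-congʳ z) (zeroˡ _))) , f))
      where
      nt : Nontrivial a b
      nt (za , zb) = Y≉0 λ i → trans (f i) (trans (*-congˡ (zero-vector refl refl (trans (*-congʳ za) (zeroˡ b))
        (lc₂ (α * a) za (γ * b) zb (ring! (a ∷ b ∷ α ∷ γ ∷ []))) i)) (zeroʳ k))
    by-search (no none) = inj₂ (toAtInf Y-inf , λ π cπ (_ , m) → on-plane cπ (member m) (base-point cπ (pts-in cπ 0≢) (at-onto (pts cπ 0≢))))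
      where
      base-point : ∀ {π i} → CPlane π → c i ∈ π → (∃₂ λ x y → at x y ≡ i) → ∃₂ λ x y → ∃₂ λ a b → Σ (Nontrivial a b) λ nt → π ≗ chord x y a b nt
      base-point cπ m (x , y , ≡.refl) = x , y , plane-chord cπ x y m
      on-plane : ∀ {π} → CPlane π → Y ∈ π → ¬ ∃₂ λ x y → ∃₂ λ a b → Σ (Nontrivial a b) λ nt → π ≗ chord x y a b nt
      on-plane cπ m (x , y , a , b , nt , π≗) = from-coordinates (direction-coordinates x y a b nt Y-inf (to π≗ m))
        where
        from-coordinates : ¬ InSpan2 Y (tangent x y a b) (apex a b)
        from-coordinates (s , t , f) = none (a , b , t , λ i → trans (f i) (trans (+-congʳ (trans (*-congʳ s≈0) (zeroˡ _))) (+-identityˡ _)))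
          where
          cs = ⟨⟩-injective (≈v-trans (≈v-sym e) (≈v-trans f (combination s t x y a b)))
          drop : ∀ {r} → 0# ≈ s * r + t * 0# → s * r ≈ 0#
          drop {r} g = lc₁ (- 1#) g (lemma (s * r) t)
            where
            lemma : ∀ x t → x + - 1# * (x + t * 0#) ≈ 0# + - 1# * 0#
            lemma x t = ring! (x ∷ t ∷ [])
          s≈0 : s ≈ 0#
          s≈0 = nontrivial-cancel nt (drop (proj₁ cs)) (drop (proj₁ (proj₂ cs)))

module SpreadLines (R : CommutativeRing 0ℓ 0ℓ) (q : ℕ) (7≤q : 7 ℕ.≤ q) (isField : IsFiniteField R q)
  (2≉0 : ¬ CommutativeRing._≈_ R (CommutativeRing._+_ R (CommutativeRing.1# R) (CommutativeRing.1# R)) (CommutativeRing.0# R))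
  (h : Fin 5 → CommutativeRing.Carrier R) (C : Fin (q ℕ.* q) → Geometry.Vec5 R q h) (CPlane : Geometry.Plane R q h → Set)
  (hypotheses : Geometry.Config.Hypotheses R q h C CPlane)
  (S′ : Geometry.Spread R q h) (arc : Geometry.IsArcBB R q h C CPlane S′) where
  open CommutativeRing R renaming (Carrier to K) hiding (zero)
  open RingTactic R
  open FiniteField R q isField
  open Geometry R q h
  open Config C CPlane
  open Vectors R q isField h
  open Incidence R q isField h
  open Hypotheses hypotheses
  open Configuration R q 7≤q isField h C CPlane hypotheses
  open Surfaces R q 7≤q isField h C CPlane hypotheses
  open Quadrics R q 7≤q isField 2≉0 h C CPlane hypotheses

  open Spread S′ renaming (cover to spread-cover)

  LineIndex : Set
  LineIndex = Fin (suc (q ℕ.* q))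

  record On (k : LineIndex) (v : Vec5) : Set where
    constructor on
    field
      in-line : InSpan2 v (Line.l₁ (line k)) (Line.l₂ (line k))
  open On

  on-subspace : ∀ k → IsSubspace (On k)
  on-subspace k = record
    { resp = λ { e (on (a , b , f)) → on (a , b , ≈v-trans (≈v-sym e) f) }
    ; add = λ { (on (a , b , f)) (on (a′ , b′ , f′)) → on (a + a′ , b + b′ , λ i → trans (+-cong (f i) (f′ i))
        (ring! (a ∷ b ∷ a′ ∷ b′ ∷ l₁ i ∷ l₂ i ∷ []))) }
    ; scale = λ { t (on (a , b , f)) → on (t * a , t * b , λ i → trans (*-congˡ (f i)) (ring! (t ∷ a ∷ b ∷ l₁ i ∷ l₂ i ∷ []))) } }
    where open Line (line k)

  module OnLine′ k = IsSubspace (on-subspace k)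

  on-inf : ∀ {k v} → On k v → Inf v
  on-inf {k} {v} (on s) = decide (v ≟v 0v)
    where
    decide : Dec (v ≈v 0v) → Inf v
    decide (yes z) = trans (dot-cong h {v = 0# · v} (λ i → trans (z i) (sym (zeroˡ _)))) (trans (dot-· h 0# v) (zeroˡ _))
    decide (no n) = fromAtInf (inΣ∞ k v (n , s))

  on-unique : ∀ {k l v} → NonZero v → On k v → On l v → k ≡ l
  on-unique {k} {l} {v} v≉0 (on s) (on t) = Dec.decidable-stable (k Fin.≟ l) λ k≢l → disjoint k l k≢l v (v≉0 , s) (v≉0 , t)

  on-cover : ∀ {v} → NonZero v → Inf v → ∃ λ k → On k v
  on-cover {v} v≉0 hv = convert (spread-cover v v≉0 (toAtInf hv))
    where
    convert : (∃ λ k → OnLine (line k) v) → ∃ λ k → On k v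
    convert (k , _ , s) = k , on s

  on? : ∀ k v → Dec (On k v)
  on? k v = Dec.map′ on in-line (search-K (λ e (b , f) → b , λ i → trans (f i) (+-congʳ (*-congʳ e)))
    (λ a → search-K (λ e f i → trans (f i) (+-congˡ (*-congʳ e))) (λ b → v ≟v _)))

  solve-x : ∀ a b a′ b′ j p q → a * b′ - a′ * b ≈ j → ∀ i → j * i ≈ 1# → (p * b′ - a′ * q) * i * a + (a * q - p * b) * i * a′ ≈ p
  solve-x a b a′ b′ j p q e i f = lc₂ (p * i) e p f (ring! (a ∷ b ∷ a′ ∷ b′ ∷ j ∷ p ∷ q ∷ i ∷ []))

  solve-y : ∀ a b a′ b′ j p q → a * b′ - a′ * b ≈ j → ∀ i → j * i ≈ 1# → (p * b′ - a′ * q) * i * b + (a * q - p * b) * i * b′ ≈ q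
  solve-y a b a′ b′ j p q e i f = lc₂ (q * i) e q f (ring! (a ∷ b ∷ a′ ∷ b′ ∷ j ∷ p ∷ q ∷ i ∷ []))

  line-span : ∀ {k u v w} → Independent2 u v → On k u → On k v → On k w → InSpan2 w u v
  line-span {k} {u} {v} {w} ind (on (a₁ , b₁ , e₁)) (on (a₂ , b₂ , e₂)) (on (a₃ , b₃ , e₃)) = by-cases (a₁ * b₂ - a₂ * b₁ ≟ 0#)
    where
    open Line (line k)
    by-cases : Dec (a₁ * b₂ - a₂ * b₁ ≈ 0#) → InSpan2 w u v
    by-cases (no n) = r , s , λ i → trans (e₃ i) (trans (+-cong (*-congʳ (sym (solve-x a₁ b₁ a₂ b₂ _ a₃ b₃ refl j (inv-right _ n))))
        (*-congʳ (sym (solve-y a₁ b₁ a₂ b₂ _ a₃ b₃ refl j (inv-right _ n))))) (trans (lemma r s (l₁ i) (l₂ i)) (+-cong (*-congˡ (sym (e₁ i))) (*-congˡ (sym (e₂ i))))))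
      where
      j = inv _ n
      r = (a₃ * b₂ - a₂ * b₃) * j
      s = (a₁ * b₃ - a₃ * b₁) * j
      lemma : ∀ r s p q → (r * a₁ + s * a₂) * p + (r * b₁ + s * b₂) * q ≈ r * (a₁ * p + b₁ * q) + s * (a₂ * p + b₂ * q)
      lemma r s p q = ring! (r ∷ s ∷ p ∷ q ∷ a₁ ∷ b₁ ∷ a₂ ∷ b₂ ∷ [])
    by-cases (yes z) = ⊥-elim (proj₁ (independent₂-nonzero ind) u-zero)
      where
      first = ind b₂ (- b₁) λ i → lc₃ b₂ (e₁ i) (- b₁) (e₂ i) (l₁ i) z
        (lemma (u i) (v i) (l₁ i) (l₂ i) a₁ b₁ a₂ b₂)
        where
        lemma : ∀ u v p q a₁ b₁ a₂ b₂ → (b₂ * u + - b₁ * v) + (b₂ * (a₁ * p + b₁ * q) + (- b₁ * (a₂ * p + b₂ * q) + p * 0#)) ≈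
          0# + (b₂ * u + (- b₁ * v + p * (a₁ * b₂ - a₂ * b₁)))
        lemma u v p q a₁ b₁ a₂ b₂ = ring! (u ∷ v ∷ p ∷ q ∷ a₁ ∷ b₁ ∷ a₂ ∷ b₂ ∷ [])
      second = ind a₂ (- a₁) λ i → lc₃ a₂ (e₁ i) (- a₁) (e₂ i) (- l₂ i) z
        (lemma (u i) (v i) (l₁ i) (l₂ i) a₁ b₁ a₂ b₂)
        where
        lemma : ∀ u v p q a₁ b₁ a₂ b₂ → (a₂ * u + - a₁ * v) + (a₂ * (a₁ * p + b₁ * q) + (- a₁ * (a₂ * p + b₂ * q) + - q * 0#)) ≈
          0# + (a₂ * u + (- a₁ * v + - q * (a₁ * b₂ - a₂ * b₁)))
        lemma u v p q a₁ b₁ a₂ b₂ = ring! (u ∷ v ∷ p ∷ q ∷ a₁ ∷ b₁ ∷ a₂ ∷ b₂ ∷ [])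
      u-zero : u ≈v 0v
      u-zero i = lc₃ 1# (e₁ i) (- l₁ i) (proj₂ second) (- l₂ i) (proj₂ first) (ring! (u i ∷ l₁ i ∷ l₂ i ∷ a₁ ∷ b₁ ∷ []))

  -- Three points of 𝒞 in a plane through a spread line contradict the arc property.
  no-three-parallel : ∀ {k i j m} → i ≢ j → i ≢ m → j ≢ m → On k (c i ↦ c j) → On k (c i ↦ c m) → ⊥
  no-three-parallel {k} {i} {j} {m} i≢j i≢m j≢m (on ij) (on im) = arc i j m i≢j i≢m j≢m
      (π , (affine , k , same-at-infinity) , c-onPlane i-in , c-onPlane (through-difference ij) , c-onPlane (through-difference im))
    where
    open Line (line k) renaming (indep to l-indep)
    l₁-inf : Inf l₁
    l₁-inf = on-inf {k} (on (1# , 0# , λ t → ring! (l₁ t ∷ l₂ t ∷ [])))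
    l₂-inf : Inf l₂
    l₂-inf = on-inf {k} (on (0# , 1# , λ t → ring! (l₁ t ∷ l₂ t ∷ [])))
    π : Plane
    π = record { p₁ = c i ; p₂ = l₁ ; p₃ = l₂ ; indep = independent-frame (c-normal i) l₁-inf l₂-inf l-indep }
    i-in : c i ∈ π
    i-in = member (1# , 0# , 0# , λ t → ring! (c i t ∷ l₁ t ∷ l₂ t ∷ []))
    line-in : ∀ {v} → InSpan2 v l₁ l₂ → v ∈ π
    line-in {v} (a , b , e) = member (0# , a , b , λ t → trans (e t) (ring! (c i t ∷ l₁ t ∷ l₂ t ∷ a ∷ b ∷ [])))
    through-difference : ∀ {m} → InSpan2 (c i ↦ c m) l₁ l₂ → c m ∈ π
    through-difference {m} s = InPlane.resp π (λ t → ring! (c i t ∷ c m t ∷ [])) (InPlane.add π i-in (line-in s))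
    affine : AffinePlane π
    affine = c i , (normal-nonzero (c-normal i) , span i-in) , affine-normal (c-normal i)
    same-at-infinity : SameSet (λ x → OnPlane π x × AtInf x) (OnLine (line k))
    same-at-infinity x x≉0 = (λ ((_ , s) , hx) → x≉0 , direction s (fromAtInf hx)) ,
        λ (_ , s) → (x≉0 , span (line-in s)) , toAtInf (on-inf {k} (on s))
      where
      direction : InSpan3 x (c i) l₁ l₂ → Inf x → InSpan2 x l₁ l₂
      direction (r , a , b , e) hx = a , b , λ t → lc₂ 1# (e t) (c i t) (inf-coefficient {x} {c i} {l₁} {l₂} {r} {a} {b} hx (c-normal i) l₁-inf l₂-inf e)
        (ring! (x t ∷ c i t ∷ l₁ t ∷ l₂ t ∷ r ∷ a ∷ b ∷ []))

  chord-difference : ∀ {k} x y a b s t → On k (((t - s) · tangent x y a b) ⊕ ((t * t - s * s) · apex a b)) →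
                     On k (c (at (x + s * a) (y + s * b)) ↦ c (at (x + t * a) (y + t * b)))
  chord-difference {k} x y a b s t m = OnLine′.resp k (λ i → lc₂ (- 1#) (F-along x y a b t i) 1# (F-along x y a b s i)
      (lemma (c (at (x + t * a) (y + t * b)) i) (c (at (x + s * a) (y + s * b)) i) (F x y i) (tangent x y a b i) (apex a b i))) m
    where
    lemma : ∀ u v o m p → ((t - s) * m + (t * t - s * s) * p) + (- 1# * (o + t * m + t * t * p) + 1# * (o + s * m + s * s * p)) ≈
            (u + - 1# * v) + (- 1# * u + 1# * v)
    lemma u v o m p = ring! (u ∷ v ∷ o ∷ m ∷ p ∷ s ∷ t ∷ [])

  combine₂ : ∀ {k x y z w x′ y′ z′ w′} s t → On k ⟨ x , y , z , w ⟩ → On k ⟨ x′ , y′ , z′ , w′ ⟩ →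
             On k ⟨ s * x + t * x′ , s * y + t * y′ , s * z + t * z′ , s * w + t * w′ ⟩
  combine₂ {k} s t m m′ = OnLine′.resp k (λ i → trans (+-cong (⟨⟩-scale s _ _ _ _ i) (⟨⟩-scale t _ _ _ _ i)) (⟨⟩-sum _ _ _ _ _ _ _ _ i))
    (OnLine′.add k (OnLine′.scale k s m) (OnLine′.scale k t m′))

  tangent-combine : ∀ {x y a b a′ b′ p q} r s → r * a + s * a′ ≈ p → r * b + s * b′ ≈ q →
    ⟨ r * a + s * a′ , r * b + s * b′ , r * (x * b + y * a) + s * (x * b′ + y * a′) ,
      r * (two * (α * (x * a) + γ * (y * b))) + s * (two * (α * (x * a′) + γ * (y * b′))) ⟩ ≈v tangent x y p q
  tangent-combine {x} {y} {a} {b} {a′} {b′} r s ea eb = ⟨⟩-cong ea eb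
      (trans (lemma-z x y a b a′ b′) (+-cong (*-congˡ eb) (*-congˡ ea)))
      (trans (lemma-w two (x * a) (x * a′) (y * b) (y * b′)) (*-congˡ (+-cong (*-congˡ (trans (lemma x a a′) (*-congˡ ea))) (*-congˡ (trans (lemma y b b′) (*-congˡ eb))))))
    where
    lemma : ∀ x a a′ → r * (x * a) + s * (x * a′) ≈ x * (r * a + s * a′)
    lemma x a a′ = ring! (r ∷ s ∷ x ∷ a ∷ a′ ∷ [])
    lemma-z : ∀ x y a b a′ b′ → r * (x * b + y * a) + s * (x * b′ + y * a′) ≈ x * (r * b + s * b′) + y * (r * a + s * a′)
    lemma-z x y a b a′ b′ = ring! (r ∷ s ∷ x ∷ y ∷ a ∷ b ∷ a′ ∷ b′ ∷ [])
    lemma-w : ∀ k u u′ v v′ → r * (k * (α * u + γ * v)) + s * (k * (α * u′ + γ * v′)) ≈ k * (α * (r * u + s * u′) + γ * (r * v + s * v′))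
    lemma-w k u u′ v v′ = ring! (r ∷ s ∷ k ∷ u ∷ u′ ∷ v ∷ v′ ∷ α ∷ γ ∷ [])

  tangent-linear : ∀ {k x y a b a′ b′ p q} r s → r * a + s * a′ ≈ p → r * b + s * b′ ≈ q →
    On k (tangent x y a b) → On k (tangent x y a′ b′) → On k (tangent x y p q)
  tangent-linear {k} r s ea eb m m′ = OnLine′.resp k (tangent-combine r s ea eb) (combine₂ r s m m′)

  points-differ : ∀ {x y a b s t} → Nontrivial a b → ¬ s ≈ t → at (x + s * a) (y + s * b) ≢ at (x + t * a) (y + t * b)
  points-differ nt s≉t e = s≉t (along-injective nt e)

  0≉1′ : ¬ 0# ≈ 1#
  0≉1′ e = 1≉0 (sym e)

  1≉-1 : ¬ 1# ≈ - 1#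
  1≉-1 e = 2≉0 (lc₁ 1# e (ring! []))

  no-chord : ∀ {k x y a b} → Nontrivial a b → On k (tangent x y a b) → On k (apex a b) → ⊥
  no-chord {k} {x} {y} {a} {b} nt mt ma = no-three-parallel {k} (points-differ nt 0≉1′) (points-differ nt (λ e → neg-nonzero 1≉0 (sym e))) (points-differ nt 1≉-1)
      (chord-difference x y a b 0# 1# (combine″ 0# 1#)) (chord-difference x y a b 0# (- 1#) (combine″ 0# (- 1#)))
    where
    combine″ : ∀ s t → On k (((t - s) · tangent x y a b) ⊕ ((t * t - s * s) · apex a b))
    combine″ s t = OnLine′.add k (OnLine′.scale k (t - s) mt) (OnLine′.scale k (t * t - s * s) ma)

  Skew : LineIndex → Set
  Skew k = ∀ {z w} → On k ⟨ 0# , 0# , z , w ⟩ → z ≈ 0# × w ≈ 0#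

  -- The chords of 𝒞 in direction (a , b) whose direction at infinity is on line k are those
  -- with midpoint (x , y).
  record Midpoint (k : LineIndex) : Set where
    field
      x y a b : K
      nontrivial : Nontrivial a b
      on-line : On k (tangent x y a b)
  open Midpoint

  det : K → K → K → K → K
  det a b a′ b′ = a * b′ - a′ * b

  module SkewLine {k} (skew : Skew k) where

    midpoint-chord : ∀ (m : Midpoint k) s →
      On k (c (at (x m + s * a m) (y m + s * b m)) ↦ c (at (x m + (- s) * a m) (y m + (- s) * b m)))
    midpoint-chord m s = chord-difference (x m) (y m) (a m) (b m) s (- s)
        (OnLine′.resp k (λ i → lemma (tangent (x m) (y m) (a m) (b m) i) (apex (a m) (b m) i)) (OnLine′.scale k (- s - s) (on-line m)))
      where
      lemma : ∀ t p → (- s - s) * t ≈ (- s - s) * t + (- s * - s - s * s) * p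
      lemma t p = ring! (s ∷ t ∷ p ∷ [])

    Reaches : Midpoint k → Midpoint k → Set
    Reaches m m′ = ∃ λ s → x m′ ≈ x m + s * a m × y m′ ≈ y m + s * b m

    det₂ : Midpoint k → Midpoint k → K
    det₂ m m′ = det (a m) (b m) (a m′) (b m′)

    -- Otherwise the common point of the lines m + K d and m′ + K d′ and its reflections
    -- in the two midpoints would be three points in one plane through line k.
    reaches : ∀ m m′ → ¬ det₂ m m′ ≈ 0# → Reaches m m′ ⊎ Reaches m′ m
    reaches m m′ δ≉0 = by-cases (s ≟ 0#) (s′ ≟ 0#)
      where
      j s s′ : K
      j = inv (det₂ m m′) δ≉0
      s = det (x m′ - x m) (y m′ - y m) (a m′) (b m′) * j
      s′ = det (x m′ - x m) (y m′ - y m) (a m) (b m) * j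
      ex : x m + s * a m ≈ x m′ + s′ * a m′
      ex = lc₁ (x m′ - x m) (inv-right _ δ≉0) (lemma (x m) (x m′) (y m) (y m′) (a m) (b m) (a m′) (b m′) j)
        where
        lemma : ∀ x x′ y y′ a b a′ b′ j → (x + ((x′ - x) * b′ - a′ * (y′ - y)) * j * a) + (x′ - x) * 1# ≈
          (x′ + ((x′ - x) * b - a * (y′ - y)) * j * a′) + (x′ - x) * ((a * b′ - a′ * b) * j)
        lemma x x′ y y′ a b a′ b′ j = ring! (x ∷ x′ ∷ y ∷ y′ ∷ a ∷ b ∷ a′ ∷ b′ ∷ j ∷ [])
      ey : y m + s * b m ≈ y m′ + s′ * b m′
      ey = lc₁ (y m′ - y m) (inv-right _ δ≉0) (lemma (x m) (x m′) (y m) (y m′) (a m) (b m) (a m′) (b m′) j)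
        where
        lemma : ∀ x x′ y y′ a b a′ b′ j → (y + ((x′ - x) * b′ - a′ * (y′ - y)) * j * b) + (y′ - y) * 1# ≈
          (y′ + ((x′ - x) * b - a * (y′ - y)) * j * b′) + (y′ - y) * ((a * b′ - a′ * b) * j)
        lemma x x′ y y′ a b a′ b′ j = ring! (x ∷ x′ ∷ y ∷ y′ ∷ a ∷ b ∷ a′ ∷ b′ ∷ j ∷ [])
      reflect-differs : ∀ {s} → ¬ s ≈ 0# → ¬ s ≈ - s
      reflect-differs {s} n e = n (*-cancel-0 2≉0 (lc₁ 1# e (ring! (s ∷ []))))
      halve : ∀ {u v w z} → u + v ≈ w + z → u + - v ≈ w + - z → v ≈ z
      halve {u} {v} {w} {z} e e′ = diff-zero (*-cancel-0 2≉0 (lc₂ 1# e (- 1#) e′ (ring! (u ∷ v ∷ w ∷ z ∷ []))))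
      by-cases : Dec (s ≈ 0#) → Dec (s′ ≈ 0#) → Reaches m m′ ⊎ Reaches m′ m
      by-cases (yes z) _ = inj₂ (s′ , trans (drop-term z) ex , trans (drop-term z) ey)
        where
        drop-term : ∀ {u r t} → t ≈ 0# → u ≈ u + t * r
        drop-term {u} {r} {t} z = lc₁ (- r) z (ring! (u ∷ r ∷ t ∷ []))
      by-cases _ (yes z) = inj₁ (s , trans (drop-term z) (sym ex) , trans (drop-term z) (sym ey))
        where
        drop-term : ∀ {u r t} → t ≈ 0# → u ≈ u + t * r
        drop-term {u} {r} {t} z = lc₁ (- r) z (ring! (u ∷ r ∷ t ∷ []))
      by-cases (no n) (no n′) = ⊥-elim (no-three-parallel {k}
          (points-differ (nontrivial m) (reflect-differs n))
          (λ e → points-differ (nontrivial m′) (reflect-differs n′) (≡.trans (≡.sym (at-cong ex ey)) e))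
          (λ e → δ≉0 (*-cancel-0 n (collinear (scaled (a m) (a m′) ex (proj₁ (at-injective e))) (scaled (b m) (b m′) ey (proj₂ (at-injective e))))))
          (midpoint-chord m s)
          (≡.subst (λ i → On k (c i ↦ c (at (x m′ + (- s′) * a m′) (y m′ + (- s′) * b m′)))) (≡.sym (at-cong ex ey)) (midpoint-chord m′ s′)))
        where
        scaled : ∀ {u w} p p′ → u + s * p ≈ w + s′ * p′ → u + (- s) * p ≈ w + (- s′) * p′ → s * p ≈ s′ * p′
        scaled {u} {w} p p′ e e′ = halve e (trans (+-congˡ (flip s p)) (trans e′ (+-congˡ (sym (flip s′ p′)))))
          where
          flip : ∀ s p → - (s * p) ≈ - s * p
          flip s p = ring! (s ∷ p ∷ [])
        collinear : s * a m ≈ s′ * a m′ → s * b m ≈ s′ * b m′ → s * det₂ m m′ ≈ 0#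
        collinear e e′ = lemma (a m) (b m) (a m′) (b m′) s s′ e e′
          where
          lemma : ∀ a b a′ b′ s s′ → s * a ≈ s′ * a′ → s * b ≈ s′ * b′ → s * (a * b′ - a′ * b) ≈ 0#
          lemma a b a′ b′ s s′ e e′ = lc₂ b′ e (- a′) e′ (ring! (a ∷ b ∷ a′ ∷ b′ ∷ s ∷ s′ ∷ []))

    Center : Set
    Center = ∃₂ λ x y → ∀ a b → On k (tangent x y a b)

    combine-on : ∀ {x y z w x′ y′ z′ w′ x″ y″ z″ w″} r s t → On k ⟨ x , y , z , w ⟩ → On k ⟨ x′ , y′ , z′ , w′ ⟩ → On k ⟨ x″ , y″ , z″ , w″ ⟩ →
      On k ⟨ r * x + s * x′ + t * x″ , r * y + s * y′ + t * y″ , r * z + s * z′ + t * z″ , r * w + s * w′ + t * w″ ⟩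
    combine-on r s t m m′ m″ = OnLine′.resp k (λ i → trans (+-cong (trans (+-cong (⟨⟩-scale r _ _ _ _ i) (⟨⟩-scale s _ _ _ _ i)) (⟨⟩-sum _ _ _ _ _ _ _ _ i)) (⟨⟩-scale t _ _ _ _ i)) (⟨⟩-sum _ _ _ _ _ _ _ _ i))
      (OnLine′.add k (OnLine′.add k (OnLine′.scale k r m) (OnLine′.scale k s m′)) (OnLine′.scale k t m″))

    -- With m′ = m + s d and m″ = m + t d, the relation between d , d′ , d″ makes
    -- t det(d,d′) d″ - s det(d,d″) d′ a zero of the nondegenerate pairing with d.
    reaches-zero : ∀ m m′ m″ → ¬ det₂ m m′ ≈ 0# → ¬ det₂ m″ m′ ≈ 0# → Reaches m m′ → Reaches m m″ → x m″ ≈ x m × y m″ ≈ y m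
    reaches-zero m m′ m″ n n″ (s , ex , ey) (t , ex′ , ey′) = still ex′ , still ey′
      where
      still : ∀ {u v r} → u ≈ v + t * r → u ≈ v
      δ = det₂ m m′
      ε = det₂ m″ m′
      ζ = det₂ m m″
      v₁ v₂ : K
      v₁ = t * δ * a m″ - s * ζ * a m′
      v₂ = t * δ * b m″ - s * ζ * b m′
      combined : On k ⟨ _ , _ , _ , _ ⟩
      combined = combine-on δ (- ε) (- ζ) (on-line m″) (on-line m) (on-line m′)
      zero-x : ∀ a b a′ b′ a″ b″ → (a * b′ - a′ * b) * a″ + - (a″ * b′ - a′ * b″) * a + - (a * b″ - a″ * b) * a′ ≈ 0#
      zero-x a b a′ b′ a″ b″ = ring! (a ∷ b ∷ a′ ∷ b′ ∷ a″ ∷ b″ ∷ [])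
      zero-y : ∀ a b a′ b′ a″ b″ → (a * b′ - a′ * b) * b″ + - (a″ * b′ - a′ * b″) * b + - (a * b″ - a″ * b) * b′ ≈ 0#
      zero-y a b a′ b′ a″ b″ = ring! (a ∷ b ∷ a′ ∷ b′ ∷ a″ ∷ b″ ∷ [])
      a-zero : δ * a m″ + - ε * a m + - ζ * a m′ ≈ 0#
      a-zero = zero-x (a m) (b m) (a m′) (b m′) (a m″) (b m″)
      b-zero : δ * b m″ + - ε * b m + - ζ * b m′ ≈ 0#
      b-zero = zero-y (a m) (b m) (a m′) (b m′) (a m″) (b m″)
      at-infinity : _ × _
      at-infinity = skew (OnLine′.resp k (⟨⟩-cong a-zero b-zero refl refl) combined)
      product : ∀ {u u′ u″ d p p′ p″} δ ε ζ → u′ ≈ u + s * d → u″ ≈ u + t * d → δ * p″ + - ε * p + - ζ * p′ ≈ 0# →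
        δ * (u″ * p″) + - ε * (u * p) + - ζ * (u′ * p′) ≈ (t * δ * p″ - s * ζ * p′) * d
      product {u} {u′} {u″} {d} {p} {p′} {p″} δ ε ζ e′ e″ z = lc₃ (δ * p″) e″ (- ζ * p′) e′ u z (lemma u u′ u″ d p p′ p″ δ ε ζ)
        where
        lemma : ∀ u u′ u″ d p p′ p″ δ ε ζ →
          (δ * (u″ * p″) + - ε * (u * p) + - ζ * (u′ * p′)) + (δ * p″ * (u + t * d) + (- ζ * p′ * (u + s * d) + u * 0#)) ≈
          (t * δ * p″ - s * ζ * p′) * d + (δ * p″ * u″ + (- ζ * p′ * u′ + u * (δ * p″ + - ε * p + - ζ * p′)))
        lemma u u′ u″ d p p′ p″ δ ε ζ = ring! (u ∷ u′ ∷ u″ ∷ d ∷ p ∷ p′ ∷ p″ ∷ δ ∷ ε ∷ ζ ∷ s ∷ t ∷ [])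
      add : ∀ δ ε ζ p p′ p″ r r′ r″ → (δ * p″ + ε * p + ζ * p′) + (δ * r″ + ε * r + ζ * r′) ≈ δ * (p″ + r″) + ε * (p + r) + ζ * (p′ + r′)
      add δ ε ζ p p′ p″ r r′ r″ = ring! (δ ∷ ε ∷ ζ ∷ p ∷ p′ ∷ p″ ∷ r ∷ r′ ∷ r″ ∷ [])
      factor : ∀ k δ ε ζ p p′ p″ → k * (δ * p″ + ε * p + ζ * p′) ≈ δ * (k * p″) + ε * (k * p) + ζ * (k * p′)
      factor k δ ε ζ p p′ p″ = ring! (k ∷ δ ∷ ε ∷ ζ ∷ p ∷ p′ ∷ p″ ∷ [])
      pairing-z : v₁ * b m + v₂ * a m ≈ 0#
      pairing-z = trans (+-cong (sym (product δ ε ζ ey ey′ a-zero)) (sym (product δ ε ζ ex ex′ b-zero)))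
        (trans (+-comm _ _) (trans (add δ (- ε) (- ζ) _ _ _ _ _ _) (proj₁ at-infinity)))
      pairing-w : two * (α * (v₁ * a m) + γ * (v₂ * b m)) ≈ 0#
      pairing-w = trans (*-congˡ (+-cong (trans (*-congˡ (sym (product δ ε ζ ex ex′ a-zero))) (factor α δ (- ε) (- ζ) _ _ _))
          (trans (*-congˡ (sym (product δ ε ζ ey ey′ b-zero))) (factor γ δ (- ε) (- ζ) _ _ _))))
        (trans (*-congˡ (add δ (- ε) (- ζ) _ _ _ _ _ _)) (trans (factor two δ (- ε) (- ζ) _ _ _) (proj₂ at-infinity)))
      v-zero : v₁ ≈ 0# × v₂ ≈ 0#
      v-zero = tangent-unique (nontrivial m) (⟨⟩-cong refl refl (trans pairing-z (sym (zero-z (a m) (b m)))) (trans pairing-w (sym (zero-w (a m) (b m)))))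
        where
        zero-z : ∀ a b → 0# * b + 0# * a ≈ 0#
        zero-z a b = ring! (a ∷ b ∷ [])
        zero-w : ∀ a b → two * (α * (0# * a) + γ * (0# * b)) ≈ 0#
        zero-w a b = ring! (a ∷ b ∷ α ∷ γ ∷ [])
      t≈0 : t ≈ 0#
      t≈0 = *-cancel-0 (*-nonzero n n″) (lemma δ (a m″) (b m″) (a m′) (b m′) ζ (proj₁ v-zero) (proj₂ v-zero))
        where
        lemma : ∀ δ a″ b″ a′ b′ ζ → t * δ * a″ - s * ζ * a′ ≈ 0# → t * δ * b″ - s * ζ * b′ ≈ 0# → δ * (a″ * b′ - a′ * b″) * t ≈ 0#
        lemma δ a″ b″ a′ b′ ζ e e′ = lc₂ b′ e (- a′) e′ (ring! (δ ∷ a″ ∷ b″ ∷ a′ ∷ b′ ∷ ζ ∷ s ∷ t ∷ []))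
      still {u} {v} {r} e = lc₂ 1# e r t≈0 (ring! (u ∷ v ∷ r ∷ t ∷ []))

    center-from : ∀ m m″ → ¬ det₂ m m″ ≈ 0# → x m″ ≈ x m → y m″ ≈ y m → Center
    center-from m m″ n ex ey = x m , y m , λ p q →
        tangent-linear ((p * b m″ - a m″ * q) * j) ((a m * q - p * b m) * j)
          (solve-x (a m) (b m) (a m″) (b m″) _ p q refl j (inv-right _ n)) (solve-y (a m) (b m) (a m″) (b m″) _ p q refl j (inv-right _ n)) (on-line m)
          (OnLine′.resp k (⟨⟩-cong refl refl (+-cong (*-congʳ ex) (*-congʳ ey)) (*-congˡ (+-cong (*-congˡ (*-congʳ ex)) (*-congˡ (*-congʳ ey))))) (on-line m″))
      where
      j = inv _ n

    -- Among four midpoints in different directions some point reaches two others.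
    module FourMidpoints (m : Fin 4 → Midpoint k) (independent : ∀ {i j} → i ≢ j → ¬ det₂ (m i) (m j) ≈ 0#) where
      two-out : ∀ i j l → i ≢ j → i ≢ l → l ≢ j → Reaches (m i) (m j) → Reaches (m i) (m l) → Center
      two-out i j l i≢j i≢l l≢j r r′ = center-from (m i) (m l) (independent i≢l) (proj₁ same-point) (proj₂ same-point)
        where
        same-point : x (m l) ≈ x (m i) × y (m l) ≈ y (m i)
        same-point = reaches-zero (m i) (m j) (m l) (independent i≢j) (independent l≢j) r r′
      two-in : ∀ i j → i ≢ zero → j ≢ zero → i ≢ j → Reaches (m i) (m zero) → Reaches (m j) (m zero) → Center
      two-in i j i≢0 j≢0 i≢j r r′ = orient (reaches (m i) (m j) (independent i≢j))
        where
        orient : Reaches (m i) (m j) ⊎ Reaches (m j) (m i) → Center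
        orient (inj₁ s) = two-out i j zero i≢j i≢0 (j≢0 ∘ ≡.sym) s r
        orient (inj₂ s) = two-out j i zero (i≢j ∘ ≡.sym) j≢0 (i≢0 ∘ ≡.sym) s r′
      Edge : Fin 4 → Set
      Edge i = Reaches (m zero) (m i) ⊎ Reaches (m i) (m zero)
      resolve : Edge (suc zero) → Edge (suc (suc zero)) → Edge (suc (suc (suc zero))) → Center
      resolve (inj₁ r) (inj₁ r′) _ = two-out zero (suc zero) (suc (suc zero)) (λ ()) (λ ()) (λ ()) r r′
      resolve (inj₁ r) (inj₂ _) (inj₁ r′) = two-out zero (suc zero) (suc (suc (suc zero))) (λ ()) (λ ()) (λ ()) r r′
      resolve (inj₂ _) (inj₁ r) (inj₁ r′) = two-out zero (suc (suc zero)) (suc (suc (suc zero))) (λ ()) (λ ()) (λ ()) r r′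
      resolve (inj₂ r) (inj₂ r′) _ = two-in (suc zero) (suc (suc zero)) (λ ()) (λ ()) (λ ()) r r′
      resolve (inj₂ r) (inj₁ _) (inj₂ r′) = two-in (suc zero) (suc (suc (suc zero))) (λ ()) (λ ()) (λ ()) r r′
      resolve (inj₁ _) (inj₂ r) (inj₂ r′) = two-in (suc (suc zero)) (suc (suc (suc zero))) (λ ()) (λ ()) (λ ()) r r′
      center : Center
      center = resolve (reaches (m zero) (m (suc zero)) (independent λ ())) (reaches (m zero) (m (suc (suc zero))) (independent λ ()))
                       (reaches (m zero) (m (suc (suc (suc zero)))) (independent λ ()))

  open On using (in-line)

  l₁-on : ∀ k → On k (Line.l₁ (line k))
  l₁-on k = on (1# , 0# , λ t → ring! (l₁ t ∷ l₂ t ∷ []))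
    where open Line (line k)

  l₂-on : ∀ k → On k (Line.l₂ (line k))
  l₂-on k = on (0# , 1# , λ t → ring! (l₁ t ∷ l₂ t ∷ []))
    where open Line (line k)

  cramer : ∀ {a b a′ b′ s t} → ¬ det a b a′ b′ ≈ 0# → 0# ≈ s * a + t * a′ → 0# ≈ s * b + t * b′ → s ≈ 0# × t ≈ 0#
  cramer {a} {b} {a′} {b′} {s} {t} n e e′ = *-cancel-0 n (lc₂ (- b′) e a′ e′ (lemma-s a b a′ b′ s t)) , *-cancel-0 n (lc₂ b e (- a) e′ (lemma-t a b a′ b′ s t))
    where
    lemma-s : ∀ a b a′ b′ s t → (a * b′ - a′ * b) * s + (- b′ * (s * a + t * a′) + a′ * (s * b + t * b′)) ≈ 0# + (- b′ * 0# + a′ * 0#)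
    lemma-s a b a′ b′ s t = ring! (a ∷ b ∷ a′ ∷ b′ ∷ s ∷ t ∷ [])
    lemma-t : ∀ a b a′ b′ s t → (a * b′ - a′ * b) * t + (b * (s * a + t * a′) + - a * (s * b + t * b′)) ≈ 0# + (b * 0# + - a * 0#)
    lemma-t a b a′ b′ s t = ring! (a ∷ b ∷ a′ ∷ b′ ∷ s ∷ t ∷ [])

  module SkewCenter {k} (skew : Skew k) where
    open SkewLine skew
    open Line (line k)

    flat-zero : ∀ {v x y z w} → On k v → v ≈v ⟨ x , y , z , w ⟩ → x ≈ 0# → y ≈ 0# → v ≈v 0v
    flat-zero {v} {x} {y} {z} {w} m e ex ey = ≈v-trans e (zero-vector ex ey (proj₁ zs) (proj₂ zs))
      where
      zs : z ≈ 0# × w ≈ 0#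
      zs = skew (OnLine′.resp k (≈v-trans e (⟨⟩-cong ex ey refl refl)) m)

    det-nonzero : ∀ {a b z w a′ b′ z′ w′} → l₁ ≈v ⟨ a , b , z , w ⟩ → l₂ ≈v ⟨ a′ , b′ , z′ , w′ ⟩ → ¬ det a b a′ b′ ≈ 0#
    det-nonzero {a} {b} {z} {w} {a′} {b′} {z′} {w′} e e′ δ≈0 = proj₁ (independent₂-nonzero indep) (flat-zero (l₁-on k) e
        (unnegate (proj₂ (dependency a′ (- a) (ring! (a ∷ a′ ∷ [])) (lc₁ (- 1#) δ≈0 (lemma a b a′ b′)))))
        (unnegate (proj₂ (dependency b′ (- b) (lc₁ 1# δ≈0 (lemma′ a b a′ b′)) (ring! (b ∷ b′ ∷ []))))))
      where
      dependency : ∀ s t → s * a + t * a′ ≈ 0# → s * b + t * b′ ≈ 0# → s ≈ 0# × t ≈ 0#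
      dependency s t ea eb = indep s t (flat-zero {x = s * a + t * a′} {y = s * b + t * b′} (OnLine′.add k (OnLine′.scale k s (l₁-on k)) (OnLine′.scale k t (l₂-on k)))
        (λ i → trans (+-cong (trans (*-congˡ (e i)) (⟨⟩-scale s a b z w i)) (trans (*-congˡ (e′ i)) (⟨⟩-scale t a′ b′ z′ w′ i))) (⟨⟩-sum _ _ _ _ _ _ _ _ i)) ea eb)
      unnegate : ∀ {r} → - r ≈ 0# → r ≈ 0#
      unnegate {r} e = lc₁ (- 1#) e (ring! (r ∷ []))
      lemma : ∀ a b a′ b′ → (a′ * b + - a * b′) + - 1# * 0# ≈ 0# + - 1# * (a * b′ - a′ * b)
      lemma a b a′ b′ = ring! (a ∷ b ∷ a′ ∷ b′ ∷ [])
      lemma′ : ∀ a b a′ b′ → (b′ * a + - b * a′) + 1# * 0# ≈ 0# + 1# * (a * b′ - a′ * b)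
      lemma′ a b a′ b′ = ring! (a ∷ b ∷ a′ ∷ b′ ∷ [])

    towards : ∀ p q → ∃₂ λ z w → On k ⟨ p , q , z , w ⟩
    towards p q = from-coordinates (coordinates (on-inf (l₁-on k))) (coordinates (on-inf (l₂-on k)))
      where
      from-coordinates : (∃₂ λ a b → ∃₂ λ z w → l₁ ≈v ⟨ a , b , z , w ⟩) → (∃₂ λ a b → ∃₂ λ z w → l₂ ≈v ⟨ a , b , z , w ⟩) → ∃₂ λ z w → On k ⟨ p , q , z , w ⟩
      from-coordinates (a , b , z , w , e) (a′ , b′ , z′ , w′ , e′) = _ , _ , OnLine′.resp k
          (⟨⟩-cong (solve-x a b a′ b′ _ p q refl j (inv-right _ n)) (solve-y a b a′ b′ _ p q refl j (inv-right _ n)) refl refl)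
          (combine₂ ((p * b′ - a′ * q) * j) ((a * q - p * b) * j) (OnLine′.resp k e (l₁-on k)) (OnLine′.resp k e′ (l₂-on k)))
        where
        n : ¬ det a b a′ b′ ≈ 0#
        n = det-nonzero e e′
        j = inv _ n

    midpoint : ∀ {p q} → Nontrivial p q → Midpoint k
    midpoint {p} {q} nt = record { x = proj₁ base ; y = proj₁ (proj₂ base) ; a = p ; b = q ; nontrivial = nt
                                 ; on-line = OnLine′.resp k (≈v-sym (proj₂ (proj₂ base))) (proj₂ (proj₂ vector)) }
      where
      vector : ∃₂ λ z w → On k ⟨ p , q , z , w ⟩
      vector = towards p q
      base : ∃₂ λ x y → tangent x y p q ≈v ⟨ p , q , proj₁ vector , proj₁ (proj₂ vector) ⟩
      base = tangent-through nt _ _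

    slope : Fin 4 → K
    slope i = el (Fin.inject≤ i (ℕₚ.≤-trans (ℕₚ.m≤m+n 4 3) 7≤q))

    center : Center
    center = FourMidpoints.center (λ i → midpoint (nontrivial-slope i)) independent
      where
      nontrivial-slope : ∀ i → Nontrivial 1# (slope i)
      nontrivial-slope i e = 1≉0 (proj₁ e)
      independent : ∀ {i j} → i ≢ j → ¬ 1# * slope j - 1# * slope i ≈ 0#
      independent {i} {j} i≢j e = i≢j (Finₚ.inject≤-injective _ _ i j (el-injective (diff-zero (lc₁ (- 1#) e (ring! (slope i ∷ slope j ∷ []))))))

    through-point : ∀ {x y a b} → Nontrivial a b → On k (tangent x y a b) → ∀ p q → On k (tangent x y p q)
    through-point {x} {y} {a} {b} nt m p q = from-center center
      where
      from-center : Center → On k (tangent x y p q)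
      from-center (x′ , y′ , all) = OnLine′.resp k (⟨⟩-cong refl refl (+-cong (*-congʳ (sym (proj₁ same-point))) (*-congʳ (sym (proj₂ same-point))))
          (*-congˡ (+-cong (*-congˡ (*-congʳ (sym (proj₁ same-point)))) (*-congˡ (*-congʳ (sym (proj₂ same-point))))))) (all p q)
        where
        gap : (x * b + y * a) + - (x′ * b + y′ * a) ≈ 0# × two * (α * (x * a) + γ * (y * b)) + - (two * (α * (x′ * a) + γ * (y′ * b))) ≈ 0#
        gap = skew (OnLine′.resp k (⟨⟩-cong (lemma a) (lemma b) (lemma′ _ _) (lemma′ _ _)) (combine₂ 1# (- 1#) m (all a b)))
          where
          lemma : ∀ a → 1# * a + - 1# * a ≈ 0#
          lemma a = ring! (a ∷ [])
          lemma′ : ∀ u v → 1# * u + - 1# * v ≈ u + - v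
          lemma′ u v = ring! (u ∷ v ∷ [])
        same-point : x ≈ x′ × y ≈ y′
        same-point = tangent-unique nt (⟨⟩-cong refl refl (diff-zero (proj₁ gap)) (diff-zero (proj₂ gap)))

  skew-or-meets : ∀ k → Skew k ⊎ ∃₂ λ z w → Nontrivial z w × On k ⟨ 0# , 0# , z , w ⟩
  skew-or-meets k = decide search-point
    where
    search-point : Dec (∃₂ λ z w → Nontrivial z w × On k ⟨ 0# , 0# , z , w ⟩)
    search-point = search-K (λ e (w , nt , m) → w , (λ (z≈0 , w≈0) → nt (trans e z≈0 , w≈0)) , OnLine′.resp k (⟨⟩-cong refl refl e refl) m)
      (λ z → search-K (λ e (nt , m) → (λ (z≈0 , w≈0) → nt (z≈0 , trans e w≈0)) , OnLine′.resp k (⟨⟩-cong refl refl refl e) m)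
      (λ w → Dec.¬? ((z ≟ 0#) ×-dec (w ≟ 0#)) ×-dec on? k ⟨ 0# , 0# , z , w ⟩))
    decide : Dec (∃₂ λ z w → Nontrivial z w × On k ⟨ 0# , 0# , z , w ⟩) → Skew k ⊎ ∃₂ λ z w → Nontrivial z w × On k ⟨ 0# , 0# , z , w ⟩
    decide (yes p) = inj₂ p
    decide (no n) = inj₁ λ {z} {w} m → Dec.decidable-stable ((z ≟ 0#) ×-dec (w ≟ 0#)) λ nt → n (z , w , nt , m)

  independent-⟨⟩ : ∀ {a b z w a′ b′ z′ w′} → ¬ det a b a′ b′ ≈ 0# → Independent2 ⟨ a , b , z , w ⟩ ⟨ a′ , b′ , z′ , w′ ⟩
  independent-⟨⟩ {a} {b} {z} {w} {a′} {b′} {z′} {w′} n s t e = cramer n (sym (proj₁ zs)) (sym (proj₁ (proj₂ zs)))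
    where
    zs : s * a + t * a′ ≈ 0# × s * b + t * b′ ≈ 0# × s * z + t * z′ ≈ 0# × s * w + t * w′ ≈ 0#
    zs = ⟨⟩-zero λ i → trans (sym (trans (+-cong (⟨⟩-scale s a b z w i) (⟨⟩-scale t a′ b′ z′ w′ i)) (⟨⟩-sum _ _ _ _ _ _ _ _ i))) (e i)

  span-⟨⟩ : ∀ {k v a b z w a′ b′ z′ w′} → ¬ det a b a′ b′ ≈ 0# → On k ⟨ a , b , z , w ⟩ → On k ⟨ a′ , b′ , z′ , w′ ⟩ → On k v →
    ∃₂ λ s t → v ≈v ⟨ s * a + t * a′ , s * b + t * b′ , s * z + t * z′ , s * w + t * w′ ⟩
  span-⟨⟩ {k} {v} {a} {b} {z} {w} {a′} {b′} {z′} {w′} n m m′ mv = from-span (line-span (independent-⟨⟩ n) m m′ mv)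
    where
    from-span : InSpan2 v ⟨ a , b , z , w ⟩ ⟨ a′ , b′ , z′ , w′ ⟩ → ∃₂ λ s t → v ≈v ⟨ s * a + t * a′ , s * b + t * b′ , s * z + t * z′ , s * w + t * w′ ⟩
    from-span (s , t , e) = s , t , λ i → trans (e i) (trans (+-cong (⟨⟩-scale s a b z w i) (⟨⟩-scale t a′ b′ z′ w′ i)) (⟨⟩-sum _ _ _ _ _ _ _ _ i))

  meeting-det : ∀ {k a b z w a′ b′ z′ w′ z″ w″} → On k ⟨ a , b , z , w ⟩ → On k ⟨ a′ , b′ , z′ , w′ ⟩ → Nontrivial z″ w″ → On k ⟨ 0# , 0# , z″ , w″ ⟩ →
    det a b a′ b′ ≈ 0#
  meeting-det {k} {a} {b} {z} {w} {a′} {b′} {z′} {w′} {z″} {w″} m m′ nt m″ = Dec.decidable-stable (det a b a′ b′ ≟ 0#) λ n → nt (coefficients-zero n (span-⟨⟩ n m m′ m″))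
    where
    coefficients-zero : ¬ det a b a′ b′ ≈ 0# → (∃₂ λ s t → ⟨ 0# , 0# , z″ , w″ ⟩ ≈v ⟨ s * a + t * a′ , s * b + t * b′ , s * z + t * z′ , s * w + t * w′ ⟩) → z″ ≈ 0# × w″ ≈ 0#
    coefficients-zero n (s , t , e) = trans (proj₁ (proj₂ (proj₂ cs))) (small z z′) , trans (proj₂ (proj₂ (proj₂ cs))) (small w w′)
      where
      cs : 0# ≈ s * a + t * a′ × 0# ≈ s * b + t * b′ × z″ ≈ s * z + t * z′ × w″ ≈ s * w + t * w′
      cs = ⟨⟩-injective e
      zeros : s ≈ 0# × t ≈ 0#
      zeros = cramer n (proj₁ cs) (proj₁ (proj₂ cs))
      small : ∀ u v → s * u + t * v ≈ 0#
      small u v = lc₂ u (proj₁ zeros) v (proj₂ zeros) (ring! (s ∷ t ∷ u ∷ v ∷ []))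

  dir₁ dir₂ : Fin (suc q) → K
  dir₁ zero = 0#
  dir₁ (suc t) = 1#
  dir₂ zero = 1#
  dir₂ (suc t) = el t

  dir-nontrivial : ∀ j → Nontrivial (dir₁ j) (dir₂ j)
  dir-nontrivial zero e = 1≉0 (proj₂ e)
  dir-nontrivial (suc t) e = 1≉0 (proj₁ e)

  dir-injective : ∀ i j → det (dir₁ i) (dir₂ i) (dir₁ j) (dir₂ j) ≈ 0# → i ≡ j
  dir-injective zero zero _ = ≡.refl
  dir-injective zero (suc t) e = ⊥-elim (1≉0 (lc₁ (- 1#) e (ring! (el t ∷ []))))
  dir-injective (suc s) zero e = ⊥-elim (1≉0 (lc₁ 1# e (ring! (el s ∷ []))))
  dir-injective (suc s) (suc t) e = ≡.cong suc (el-injective (diff-zero (lc₁ (- 1#) e (ring! (el s ∷ el t ∷ [])))))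

  to-dir : ∀ {a b} → Nontrivial a b → ∃₂ λ j k → k * a ≈ dir₁ j × k * b ≈ dir₂ j
  to-dir {a} {b} nt = by-cases (a ≟ 0#)
    where
    by-cases : Dec (a ≈ 0#) → ∃₂ λ j k → k * a ≈ dir₁ j × k * b ≈ dir₂ j
    by-cases (yes z) = zero , inv b b≉0 , trans (*-congˡ z) (zeroʳ _) , trans (*-comm _ _) (inv-right b b≉0)
      where
      b≉0 : ¬ b ≈ 0#
      b≉0 z′ = nt (z , z′)
    by-cases (no n) = suc (ix (inv a n * b)) , inv a n , trans (*-comm _ _) (inv-right a n) , sym (el-ix _)

  proportional : ∀ {a b a′ b′} → Nontrivial a b → det a b a′ b′ ≈ 0# → ∃ λ t → t * a ≈ a′ × t * b ≈ b′
  proportional {a} {b} {a′} {b′} nt δ≈0 = by-cases (a ≟ 0#)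
    where
    by-cases : Dec (a ≈ 0#) → ∃ λ t → t * a ≈ a′ × t * b ≈ b′
    by-cases (yes z) = b′ * j , lc₂ j δ≈0 a′ (inv-right b b≉0) (lemma a b a′ b′ j) , lc₁ b′ (inv-right b b≉0) (ring! (b ∷ b′ ∷ j ∷ []))
      where
      b≉0 : ¬ b ≈ 0#
      b≉0 z′ = nt (z , z′)
      j = inv b b≉0
      lemma : ∀ a b a′ b′ j → b′ * j * a + (j * 0# + a′ * 1#) ≈ a′ + (j * (a * b′ - a′ * b) + a′ * (b * j))
      lemma a b a′ b′ j = ring! (a ∷ b ∷ a′ ∷ b′ ∷ j ∷ [])
    by-cases (no n) = a′ * j , lc₁ a′ (inv-right a n) (ring! (a ∷ a′ ∷ j ∷ [])) , lc₂ (- j) δ≈0 b′ (inv-right a n) (lemma a b a′ b′ j)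
      where
      j = inv a n
      lemma : ∀ a b a′ b′ j → a′ * j * b + (- j * 0# + b′ * 1#) ≈ b′ + (- j * (a * b′ - a′ * b) + b′ * (a * j))
      lemma a b a′ b′ j = ring! (a ∷ b ∷ a′ ∷ b′ ∷ j ∷ [])

  tangent-difference : ∀ {k x y x′ y′} → On k (tangent x y (x′ - x) (y′ - y)) → On k (tangent x′ y′ (x′ - x) (y′ - y)) → On k (apex (x′ - x) (y′ - y))
  tangent-difference {k} {x} {y} {x′} {y′} m m′ = OnLine′.resp k (⟨⟩-cong (cancelled (x′ - x)) (cancelled (y′ - y))
      (trans (subtract-z x y x′ y′ (x′ - x) (y′ - y)) (half-z (x′ - x) (y′ - y))) (trans (subtract-w two x y x′ y′ (x′ - x) (y′ - y)) (half _)))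
      (combine₂ j (- j) m′ m)
    where
    j = inv _ 2≉0
    cancelled : ∀ a → j * a + - j * a ≈ 0#
    cancelled a = ring! (j ∷ a ∷ [])
    half : ∀ u → j * (two * u) ≈ u
    half u = lc₁ u (inv-right _ 2≉0) (lemma u j)
      where
      lemma : ∀ u j → j * ((1# + 1#) * u) + u * 1# ≈ u + u * ((1# + 1#) * j)
      lemma u j = ring! (u ∷ j ∷ [])
    half-z : ∀ a b → j * (a * b + b * a) ≈ a * b
    half-z a b = trans (lemma a b j) (half (a * b))
      where
      lemma : ∀ a b j → j * (a * b + b * a) ≈ j * ((1# + 1#) * (a * b))
      lemma a b j = ring! (a ∷ b ∷ j ∷ [])
    subtract-z : ∀ x y x′ y′ a b → j * (x′ * b + y′ * a) + - j * (x * b + y * a) ≈ j * ((x′ - x) * b + (y′ - y) * a)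
    subtract-z x y x′ y′ a b = ring! (x ∷ y ∷ x′ ∷ y′ ∷ a ∷ b ∷ j ∷ [])
    subtract-w : ∀ k x y x′ y′ a b → j * (k * (α * (x′ * a) + γ * (y′ * b))) + - j * (k * (α * (x * a) + γ * (y * b))) ≈
      j * (k * (α * ((x′ - x) * a) + γ * ((y′ - y) * b)))
    subtract-w k x y x′ y′ a b = ring! (k ∷ x ∷ y ∷ x′ ∷ y′ ∷ a ∷ b ∷ j ∷ α ∷ γ ∷ [])

  tangent-line : ∀ x y {a b} → Nontrivial a b → ∃ λ k → On k (tangent x y a b)
  tangent-line x y {a} {b} nt = on-cover (tangent-nonzero nt) (⟨⟩-inf a b (x * b + y * a) (two * (α * (x * a) + γ * (y * b))))

  tangent-scale : ∀ {k x y a b} t → On k (tangent x y a b) → On k (tangent x y (t * a) (t * b))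
  tangent-scale t m = tangent-linear t 0# (drop _) (drop _) m m
    where
    drop : ∀ a → t * a + 0# * a ≈ t * a
    drop a = trans (+-congˡ (zeroˡ a)) (+-identityʳ _)

  -- If the spread line through N is not t∞ it meets t∞ in N alone and contains directions
  -- of tangents at two points p and p′.
  module TwoTangents {k₀} (N-on : On k₀ ⟨ 0# , 0# , 0# , 1# ⟩) {a b x y x′ y′} (nt : Nontrivial a b)
    (p-on : On k₀ (tangent x y a b)) (p′-on : On k₀ (tangent x′ y′ a b)) (p≢p′ : Nontrivial (x′ - x) (y′ - y)) where

    meets : ∀ {k x y c d} → On k₀ (tangent x y a b) → Nontrivial c d → On k (tangent x y c d) → ∃₂ λ z w → Nontrivial z w × On k ⟨ 0# , 0# , z , w ⟩
    meets {k} {x} {y} {c} {d} q-on nt′ m = by-cases (skew-or-meets k)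
      where
      by-cases : Skew k ⊎ (∃₂ λ z w → Nontrivial z w × On k ⟨ 0# , 0# , z , w ⟩) → ∃₂ λ z w → Nontrivial z w × On k ⟨ 0# , 0# , z , w ⟩
      by-cases (inj₂ p) = p
      by-cases (inj₁ skew) = ⊥-elim (1≉0 (proj₂ (skew (≡.subst (λ l → On l ⟨ 0# , 0# , 0# , 1# ⟩)
        (on-unique (tangent-nonzero nt) q-on (SkewCenter.through-point skew nt′ m a b)) N-on))))

    record Pencil (j i : Fin (suc q)) : Set where
      field
        index : LineIndex
        on-tangent : On index (tangent x y (dir₁ j) (dir₂ j))
        on-point : On index ⟨ 0# , 0# , dir₁ i , dir₂ i ⟩
    open Pencil

    to-dir-point : ∀ {k z w} → Nontrivial z w → On k ⟨ 0# , 0# , z , w ⟩ → ∃ λ i → On k ⟨ 0# , 0# , dir₁ i , dir₂ i ⟩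
    to-dir-point {k} {z} {w} nt m = from-dir (to-dir nt)
      where
      from-dir : (∃₂ λ j t → t * z ≈ dir₁ j × t * w ≈ dir₂ j) → ∃ λ i → On k ⟨ 0# , 0# , dir₁ i , dir₂ i ⟩
      from-dir (j , t , e , e′) = j , OnLine′.resp k (≈v-trans (⟨⟩-scale t _ _ _ _) (⟨⟩-cong (zeroʳ t) (zeroʳ t) e e′)) (OnLine′.scale k t m)

    pencil : ∀ j → ∃ (Pencil j)
    pencil j = from-line (tangent-line x y (dir-nontrivial j))
      where
      from-line : (∃ λ k → On k (tangent x y (dir₁ j) (dir₂ j))) → ∃ (Pencil j)
      from-line (k , m) = from-point (meets p-on (dir-nontrivial j) m)
        where
        from-point : (∃₂ λ z w → Nontrivial z w × On k ⟨ 0# , 0# , z , w ⟩) → ∃ (Pencil j)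
        from-point (z , w , nt′ , m′) = from-dir (to-dir-point nt′ m′)
          where
          from-dir : (∃ λ i → On k ⟨ 0# , 0# , dir₁ i , dir₂ i ⟩) → ∃ (Pencil j)
          from-dir (i , m″) = i , record { index = k ; on-tangent = m ; on-point = m″ }

    point-nonzero : ∀ i → NonZero ⟨ 0# , 0# , dir₁ i , dir₂ i ⟩
    point-nonzero i e = dir-nontrivial i (proj₂ (proj₂ (⟨⟩-zero e)))

    pencil-injective : ∀ {j j′ i i′} → Pencil j i → Pencil j′ i′ → i ≡ i′ → j ≡ j′
    pencil-injective {j} {j′} {i} P P′ ≡.refl = dir-injective j j′ (meeting-det (on-tangent P)
      (≡.subst (λ l → On l (tangent x y (dir₁ j′) (dir₂ j′))) (on-unique (point-nonzero i) (on-point P′) (on-point P)) (on-tangent P′))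
      (dir-nontrivial i) (on-point P))

    a′ b′ : K
    a′ = x′ - x
    b′ = y′ - y

    -- The q + 1 spread lines through the tangents at p meet t∞ in distinct points, so one of
    -- them is the line through the tangent at p′ in direction p′ - p; it contains a chord plane's
    -- line at infinity.
    absurd : ⊥
    absurd = from-line (tangent-line x′ y′ p≢p′)
      where
      from-line : (∃ λ k → On k (tangent x′ y′ a′ b′)) → ⊥
      from-line (k , m) = from-point (meets p′-on p≢p′ m)
        where
        from-point : (∃₂ λ z w → Nontrivial z w × On k ⟨ 0# , 0# , z , w ⟩) → ⊥
        from-point (z , w , nt′ , m′) = from-dir (to-dir-point nt′ m′)
          where
          from-dir : (∃ λ i → On k ⟨ 0# , 0# , dir₁ i , dir₂ i ⟩) → ⊥
          from-dir (i , m″) = from-pencil (injective⇒surjective (λ j → proj₁ (pencil j)) (pencil-injective (proj₂ (pencil _)) (proj₂ (pencil _))) i)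
            where
            from-pencil : ¬ ∃ λ j → proj₁ (pencil j) ≡ i
            from-pencil (j , e) = finish (proj₂ (pencil j)) e
              where
              finish : ∀ {i′} → Pencil j i′ → i′ ≡ i → ⊥
              finish P ≡.refl = no-chord p≢p′ (proj₁ both) (proj₂ both)
                where
                on-p : On k (tangent x y (dir₁ j) (dir₂ j))
                on-p = ≡.subst (λ l → On l (tangent x y (dir₁ j) (dir₂ j))) (on-unique (point-nonzero i) (on-point P) m″) (on-tangent P)
                parallel : det (dir₁ j) (dir₂ j) a′ b′ ≈ 0#
                parallel = meeting-det on-p m (dir-nontrivial i) m″
                both : On k (tangent x y a′ b′) × On k (apex a′ b′)
                both = tangent-and-apex (proportional (dir-nontrivial j) parallel)
                  where
                  tangent-and-apex : (∃ λ t → t * dir₁ j ≈ a′ × t * dir₂ j ≈ b′) → On k (tangent x y a′ b′) × On k (apex a′ b′)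
                  tangent-and-apex (t , e , e′) = on-p′ , tangent-difference on-p′ m
                    where
                    on-p′ : On k (tangent x y a′ b′)
                    on-p′ = OnLine′.resp k (⟨⟩-cong e e′ (+-cong (*-congˡ e′) (*-congˡ e)) (*-congˡ (+-cong (*-congˡ (*-congˡ e)) (*-congˡ (*-congˡ e′)))))
                      (tangent-scale t on-p)

  t∞-line : ∃ λ k → On k ⟨ 0# , 0# , 0# , 1# ⟩ × On k ⟨ 0# , 0# , 1# , 0# ⟩
  t∞-line = through-N (on-cover (λ e → 1≉0 (proj₂ (proj₂ (proj₂ (⟨⟩-zero e))))) (⟨⟩-inf 0# 0# 0# 1#))
    where
    through-N : (∃ λ k → On k ⟨ 0# , 0# , 0# , 1# ⟩) → ∃ λ k → On k ⟨ 0# , 0# , 0# , 1# ⟩ × On k ⟨ 0# , 0# , 1# , 0# ⟩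
    through-N (k , N-on) = k , N-on , Dec.decidable-stable (on? k ⟨ 0# , 0# , 1# , 0# ⟩) meets-only-N
      where
      open Line (line k)
      meets-only-N : ¬ ¬ On k ⟨ 0# , 0# , 1# , 0# ⟩
      meets-only-N M-off = from-coordinates (coordinates (on-inf (l₁-on k))) (coordinates (on-inf (l₂-on k)))
        where
        nontrivial-absurd : ∀ {v a b z w} → On k v → v ≈v ⟨ a , b , z , w ⟩ → ¬ Nontrivial a b
        nontrivial-absurd {v} {a} {b} {z} {w} m e nt = from-points (tangent-through nt z w) (tangent-through nt z (w + 1#))
          where
          m₀ : On k ⟨ a , b , z , w ⟩
          m₀ = OnLine′.resp k e m
          m₁ : On k ⟨ a , b , z , w + 1# ⟩
          m₁ = OnLine′.resp k (⟨⟩-cong (lemma a) (lemma b) (lemma z) (ring! (w ∷ []))) (combine₂ 1# 1# m₀ N-on)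
            where
            lemma : ∀ a → 1# * a + 1# * 0# ≈ a
            lemma a = ring! (a ∷ [])
          from-points : (∃₂ λ x y → tangent x y a b ≈v ⟨ a , b , z , w ⟩) → (∃₂ λ x y → tangent x y a b ≈v ⟨ a , b , z , w + 1# ⟩) → ⊥
          from-points (x , y , f) (x′ , y′ , f′) = TwoTangents.absurd N-on nt (OnLine′.resp k (≈v-sym f) m₀) (OnLine′.resp k (≈v-sym f′) m₁) different
            where
            different : Nontrivial (x′ - x) (y′ - y)
            different (ex , ey) = 1≉0 (cancel-w (trans (sym (proj₂ (proj₂ (proj₂ (⟨⟩-injective f′)))))
              (trans (*-congˡ (+-cong (*-congˡ (*-congʳ (diff-zero ex))) (*-congˡ (*-congʳ (diff-zero ey))))) (proj₂ (proj₂ (proj₂ (⟨⟩-injective f)))))))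
              where
              cancel-w : w + 1# ≈ w → 1# ≈ 0#
              cancel-w e = lc₁ 1# e (ring! (w ∷ []))
        trivial : ∀ {v a b z w} → On k v → v ≈v ⟨ a , b , z , w ⟩ → a ≈ 0# × b ≈ 0# × z ≈ 0#
        trivial {v} {a} {b} {z} {w} m e = proj₁ ab , proj₂ ab , Dec.decidable-stable (z ≟ 0#) λ n → M-off (OnLine′.resp k
            (⟨⟩-cong (zeros (inv z n) (- (inv z n * w))) (zeros (inv z n) (- (inv z n * w))) (lc₁ 1# (inv-right z n) (leading z w (inv z n))) (cleared w (inv z n)))
            (combine₂ (inv z n) (- (inv z n * w)) (OnLine′.resp k (≈v-trans e (⟨⟩-cong (proj₁ ab) (proj₂ ab) refl refl)) m) N-on))
          where
          ab : a ≈ 0# × b ≈ 0#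
          ab = Dec.decidable-stable ((a ≟ 0#) ×-dec (b ≟ 0#)) (nontrivial-absurd m e)
          zeros : ∀ r s → r * 0# + s * 0# ≈ 0#
          zeros r s = ring! (r ∷ s ∷ [])
          leading : ∀ z w j → (j * z + - (j * w) * 0#) + 1# * 1# ≈ 1# + 1# * (z * j)
          leading z w j = ring! (z ∷ w ∷ j ∷ [])
          cleared : ∀ w j → j * w + - (j * w) * 1# ≈ 0#
          cleared w j = ring! (w ∷ j ∷ [])
        from-coordinates : (∃₂ λ a b → ∃₂ λ z w → l₁ ≈v ⟨ a , b , z , w ⟩) → (∃₂ λ a b → ∃₂ λ z w → l₂ ≈v ⟨ a , b , z , w ⟩) → ⊥
        from-coordinates (a , b , z , w , e) (a′ , b′ , z′ , w′ , e′) = proj₁ (independent₂-nonzero indep)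
            (≈v-trans e (zero-vector (proj₁ zs) (proj₁ (proj₂ zs)) (proj₂ (proj₂ zs)) (lc₁ (- 1#) (proj₂ dependency) (ring! (w ∷ [])))))
          where
          zs : a ≈ 0# × b ≈ 0# × z ≈ 0#
          zs = trivial (l₁-on k) e
          zs′ : a′ ≈ 0# × b′ ≈ 0# × z′ ≈ 0#
          zs′ = trivial (l₂-on k) e′
          dependency : w′ ≈ 0# × - w ≈ 0#
          dependency = indep w′ (- w) λ i → trans (+-cong (trans (*-congˡ (e i)) (⟨⟩-scale w′ a b z w i)) (trans (*-congˡ (e′ i)) (⟨⟩-scale (- w) a′ b′ z′ w′ i)))
              (trans (⟨⟩-sum _ _ _ _ _ _ _ _ i) (zero-vector (zeros (proj₁ zs) (proj₁ zs′)) (zeros (proj₁ (proj₂ zs)) (proj₁ (proj₂ zs′)))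
                (zeros (proj₂ (proj₂ zs)) (proj₂ (proj₂ zs′))) (ring! (w ∷ w′ ∷ [])) i))
            where
            zeros : ∀ {u v} → u ≈ 0# → v ≈ 0# → w′ * u + - w * v ≈ 0#
            zeros {u} {v} eu ev = lc₂ w′ eu (- w) ev (ring! (u ∷ v ∷ w ∷ w′ ∷ []))

  same-tA : ∀ {k x y} → (∀ a b → On k (tangent x y a b)) → SameSet (OnLine (line k)) (tA (at x y))
  same-tA {k} {x} {y} all v v≉0 = (λ (_ , s) → to-tA (span-⟨⟩ (λ e → 1≉0 (lc₁ 1# e (ring! []))) (all 1# 0#) (all 0# 1#) (on s))) , λ m → v≉0 , in-line (from-tA (tA-tangent m))
    where
    from-tA : (∃₂ λ a b → v ≈v tangent x y a b) → On k v
    from-tA (a , b , e) = OnLine′.resp k (≈v-sym e) (all a b)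
    to-tA : (∃₂ λ s t → v ≈v ⟨ s * 1# + t * 0# , s * 0# + t * 1# , s * (x * 0# + y * 1#) + t * (x * 1# + y * 0#) ,
        s * (two * (α * (x * 1#) + γ * (y * 0#))) + t * (two * (α * (x * 0#) + γ * (y * 1#))) ⟩) → tA (at x y) v
    to-tA (s , t , e) = tangent-tA nt v-tangent
      where
      v-tangent : v ≈v tangent x y s t
      v-tangent = ≈v-trans e (tangent-combine s t (ring! (s ∷ t ∷ [])) (ring! (s ∷ t ∷ [])))
      nt : Nontrivial s t
      nt (s≈0 , t≈0) = v≉0 (≈v-trans e (zero-vector vanish vanish vanish vanish))
        where
        vanish : ∀ {u u′} → s * u + t * u′ ≈ 0#
        vanish = trans (+-cong (trans (*-congʳ s≈0) (zeroˡ _)) (trans (*-congʳ t≈0) (zeroˡ _))) (+-identityˡ 0#)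

  spread-equal : SpreadEq𝒮 C CPlane S′
  spread-equal = from-t∞-line t∞-line
    where
    from-t∞-line : (∃ λ k → On k ⟨ 0# , 0# , 0# , 1# ⟩ × On k ⟨ 0# , 0# , 1# , 0# ⟩) → SpreadEq𝒮 C CPlane S′
    from-t∞-line (k₀ , N-on , M-on) = each-in , each-tA , k₀ , same-t∞
      where
      all-on : ∀ z w → On k₀ ⟨ 0# , 0# , z , w ⟩
      all-on z w = OnLine′.resp k₀ (⟨⟩-cong (zeros z w) (zeros z w) (ring! (z ∷ w ∷ [])) (ring! (z ∷ w ∷ []))) (combine₂ z w M-on N-on)
        where
        zeros : ∀ r s → r * 0# + s * 0# ≈ 0#
        zeros r s = ring! (r ∷ s ∷ [])
      M-N-independent : Independent2 ⟨ 0# , 0# , 1# , 0# ⟩ ⟨ 0# , 0# , 0# , 1# ⟩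
      M-N-independent s t e = trans (ring! (s ∷ t ∷ [])) (proj₁ (proj₂ (proj₂ zs))) , trans (ring! (s ∷ t ∷ [])) (proj₂ (proj₂ (proj₂ zs)))
        where
        zs : s * 0# + t * 0# ≈ 0# × s * 0# + t * 0# ≈ 0# × s * 1# + t * 0# ≈ 0# × s * 0# + t * 1# ≈ 0#
        zs = ⟨⟩-zero λ i → trans (sym (trans (+-cong (⟨⟩-scale s _ _ _ _ i) (⟨⟩-scale t _ _ _ _ i)) (⟨⟩-sum _ _ _ _ _ _ _ _ i))) (e i)
      at-infinity : ∀ {v} → On k₀ v → ∃₂ λ z w → v ≈v ⟨ 0# , 0# , z , w ⟩
      at-infinity {v} m = from-span (line-span M-N-independent M-on N-on m)
        where
        from-span : InSpan2 v ⟨ 0# , 0# , 1# , 0# ⟩ ⟨ 0# , 0# , 0# , 1# ⟩ → ∃₂ λ z w → v ≈v ⟨ 0# , 0# , z , w ⟩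
        from-span (s , t , e) = s * 1# + t * 0# , s * 0# + t * 1# , λ i → trans (e i) (trans (+-cong (⟨⟩-scale s _ _ _ _ i) (⟨⟩-scale t _ _ _ _ i))
          (trans (⟨⟩-sum _ _ _ _ _ _ _ _ i) (⟨⟩-cong (ring! (s ∷ t ∷ [])) (ring! (s ∷ t ∷ [])) refl refl i)))
      same-t∞ : SameSet (OnLine (line k₀)) t∞
      same-t∞ v v≉0 = (λ (_ , s) → to-t∞ (at-infinity (on s))) , λ m → v≉0 , in-line (from-t∞ (t∞-coordinates v≉0 m))
        where
        to-t∞ : (∃₂ λ z w → v ≈v ⟨ 0# , 0# , z , w ⟩) → t∞ v
        to-t∞ (z , w , e) = coordinates-t∞ v≉0 e
        from-t∞ : (∃₂ λ z w → v ≈v ⟨ 0# , 0# , z , w ⟩) → On k₀ v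
        from-t∞ (z , w , e) = OnLine′.resp k₀ (≈v-sym e) (all-on z w)
      skew : ∀ {k} → k ≢ k₀ → Skew k
      skew k≢k₀ {z} {w} m = Dec.decidable-stable ((z ≟ 0#) ×-dec (w ≟ 0#)) λ nt →
        k≢k₀ (on-unique (λ e → nt (proj₂ (proj₂ (⟨⟩-zero e)))) m (all-on z w))
      each-in : ∀ k → In𝒮 (OnLine (line k))
      each-in k = by-cases (k Fin.≟ k₀)
        where
        by-cases : Dec (k ≡ k₀) → In𝒮 (OnLine (line k))
        by-cases (yes ≡.refl) = inj₂ same-t∞
        by-cases (no k≢k₀) = from-center (SkewCenter.center (skew k≢k₀))
          where
          from-center : (∃₂ λ x y → ∀ a b → On k (tangent x y a b)) → In𝒮 (OnLine (line k))
          from-center (x , y , all) = inj₁ (at x y , same-tA all)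
      each-tA : ∀ i → ∃ λ k → SameSet (OnLine (line k)) (tA i)
      each-tA i = from-point (at-onto i)
        where
        from-point : (∃₂ λ x y → at x y ≡ i) → ∃ λ k → SameSet (OnLine (line k)) (tA i)
        from-point (x , y , ≡.refl) = from-line (tangent-line x y 1-nontrivial)
          where
          1-nontrivial : Nontrivial 1# 0#
          1-nontrivial e = 1≉0 (proj₁ e)
          from-line : (∃ λ k → On k (tangent x y 1# 0#)) → ∃ λ k → SameSet (OnLine (line k)) (tA (at x y))
          from-line (k , m) = k , same-tA (SkewCenter.through-point (skew k≢k₀) 1-nontrivial m)
            where
            k≢k₀ : k ≢ k₀
            k≢k₀ ≡.refl = not-at-infinity (at-infinity m)
              where
              not-at-infinity : ¬ ∃₂ λ z w → tangent x y 1# 0# ≈v ⟨ 0# , 0# , z , w ⟩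
              not-at-infinity (_ , _ , e) = 1≉0 (proj₁ (⟨⟩-injective e))

open import Data.Nat using (_≤_; _*_)

theorem3p26 : (R : CommutativeRing 0ℓ 0ℓ) (q : ℕ) → IsPrimePower q → ¬ (2 ∣ q) → 7 ≤ q
    → IsFiniteField R q
    → (h : Fin 5 → CommutativeRing.Carrier R) → ¬ (∀ i → CommutativeRing._≈_ R (h i) (CommutativeRing.0# R))
    → (C : Fin (q * q) → Geometry.Vec5 R q h) (CPlane : Geometry.Plane R q h → Set)
    → Geometry.Config.Hypotheses R q h C CPlane
    → (S' : Geometry.Spread R q h)
    → ¬ Geometry.SpreadEq𝒮 R q h C CPlane S'
    → ¬ Geometry.IsArcBB R q h C CPlane S'
theorem3p26 R q _ odd 7≤q isField h _ C CPlane hypotheses S′ differs arc = differs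
  (SpreadLines.spread-equal R q 7≤q isField (FiniteField.two-nonzero R q isField odd) h C CPlane hypotheses S′ arc)
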